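{- Let $\mathcal{O}=\mathbb{Z}[\zeta_7+\zeta_7^{ -1}]$, where $\zeta_7=\exp(2\pi i/7)$. Then the Pythagoras number of $\mathcal{O}$ equals $4$; that is, every element of $\mathcal{O}$ that is a sum of squares of elements of $\mathcal{O}$ is a sum of at most four squares of elements of $\mathcal{O}$, and there exists an element of $\mathcal{O}$ which is a sum of squares in $\mathcal{O}$ but not a sum of three squares in $\mathcal{O}$.
   Context: For a commutative ring $R$, $\sum R^2$ denotes the set of elements of $R$ that are finite sums of squares of elements of $R$; for $\alpha\in\sum R^2$, the length $\ell(\alpha)$ is the least $n$ such that $\alpha$ is a sum of $n$ squares in $R$; the Pythagoras number is $\mathcal{P}(R)=\sup\{\ell(\alpha):\alpha\in\sum R^2\}$. The ring $\mathcal{O}=\mathbb{Z}[\zeta_7+\zeta_7^{ -1}]$ is the ring of integers of the totally real cubic field $\mathbb{Q}(\zeta_7+\zeta_7^{ -1})$ (the unique number field of discriminant $49$). -}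

module Defs where

open import Data.Integer using (ℤ; +_; _+_; _*_; _-_)
open import Data.Nat as ℕ using (ℕ)
open import Data.List using (List; []; _∷_; length)
open import Data.Product using (Σ; ∃; _×_; _,_)
open import Relation.Binary.PropositionalEquality using (_≡_)

-- The ring O = ℤ[θ], θ = ζ₇ + ζ₇⁻¹, presented as ℤ[x]/(x³ + x² − 2x − 1)
-- (the minimal polynomial of θ).  An element a₀ + a₁θ + a₂θ² is
-- represented by its (unique) coordinates in the ℤ-basis 1, θ, θ².
record O : Set where
  constructor ⟨_,_,_⟩
  field
    c₀ c₁ c₂ : ℤ

infixl 6 _⊕_
infixl 7 _⊗_

_⊕_ : O → O → O
⟨ a₀ , a₁ , a₂ ⟩ ⊕ ⟨ b₀ , b₁ , b₂ ⟩ = ⟨ a₀ + b₀ , a₁ + b₁ , a₂ + b₂ ⟩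

0O : O
0O = ⟨ + 0 , + 0 , + 0 ⟩

-- Multiplication using θ³ = 1 + 2θ − θ² and θ⁴ = −1 − θ + 3θ².
_⊗_ : O → O → O
⟨ a₀ , a₁ , a₂ ⟩ ⊗ ⟨ b₀ , b₁ , b₂ ⟩ =
  let e₀ = a₀ * b₀
      e₁ = a₀ * b₁ + a₁ * b₀
      e₂ = a₀ * b₂ + a₁ * b₁ + a₂ * b₀
      e₃ = a₁ * b₂ + a₂ * b₁
      e₄ = a₂ * b₂
  in ⟨ e₀ + e₃ - e₄ , e₁ + (+ 2) * e₃ - e₄ , e₂ - e₃ + (+ 3) * e₄ ⟩

sumSq : List O → O
sumSq []       = 0O
sumSq (x ∷ xs) = x ⊗ x ⊕ sumSq xs

IsSumOfSquares : O → Set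
IsSumOfSquares α = ∃ λ (xs : List O) → α ≡ sumSq xs

IsSumOfAtMost : ℕ → O → Set
IsSumOfAtMost n α = ∃ λ (xs : List O) → (length xs ℕ.≤ n) × (α ≡ sumSq xs)

{-# OPTIONS --safe #-}

-- Let H be the order of Hurwitz quaternions and ℍ = O ⊗ H, with norm form N.  Let α ∈ O be
-- totally positive of odd norm.  If α divides N(s), where s = a + bi + j, then the left ideal
-- ℍα + ℍs is a free H-module of rank three on which Tr (N(v) / α) is a Hermitian form of
-- determinant at most 49, and Hermite reduction over H gives v ≠ 0 with Tr (N(v) / α) ≤ 7.
-- Then N(v) = αm, where m is 2, the square of a unit, or such a square times δ = 2 − θ; since
-- a factor of norm m can be split off v, α is a norm.
--
-- A norm N(h) is a sum of four squares as soon as the residue of h in F₆₄ = ℍ / (1 + i) is 0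
-- or a cube.  No element of norm δ is a cube there, and both other cubic classes ("colours")
-- occur.  If N(g) = N(g′) = δ and h′ = g⁻¹hg′ is integral, then h′ has the norm of h, and its
-- colour can be prescribed unless h is a scalar times a unit modulo δ.  In that case
-- conjugation by elements of norm δ moves h away from the scalars, unless h is a scalar times
-- a unit outright.  The only totally positive elements that escape are δε² with ε a unit, and
-- these are not sums of squares.

module Submission where

open import Algebra.Bundles using (CommutativeRing)
open import Algebra.Consequences.Propositional using (comm∧idˡ⇒id; comm∧invˡ⇒inv)
open import Algebra.Structures using (IsCommutativeRing)
open import Data.Bool using (Bool; true; false; T; _∧_; _∨_; _xor_; not)
open import Data.Bool.ListAction using (any)
open import Data.Bool.Properties using (xor-identityʳ)
open import Data.Empty using (⊥; ⊥-elim)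
open import Data.Fin using (Fin; toℕ; fromℕ<)
import Data.Fin as Fin
import Data.Fin.Properties as Fin
open import Data.Integer using (ℤ; +_; -[1+_]; +≤+; +<+; ∣_∣)
import Data.Integer as ℤ
import Data.Integer.DivMod as ℤ
import Data.Integer.Properties as ℤ
open import Data.Integer.Tactic.RingSolver using (solve-∀)
open import Data.List using (List; []; _∷_; length; map)
open import Data.List.Relation.Unary.All using (All; []; _∷_)
open import Data.Maybe using (nothing)
open import Data.Nat as ℕ using (ℕ; zero; suc; z≤n; s≤s)
import Data.Nat.Coprimality as Coprimality
import Data.Nat.Divisibility as ℕ
import Data.Nat.DivMod as ℕ
open import Data.Nat.GCD using (module Bézout)
open import Data.Nat.Induction using (<-wellFounded)
open import Data.Nat.ListAction using (product)
open import Data.Nat.Primality using (Prime; prime?; prime[2]; ¬prime[1]; prime⇒nonZero; prime⇒irreducible; euclidsLemma)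
open import Data.Nat.Primality.Factorisation using (factorise; module PrimeFactorisation)
import Data.Nat.Properties as ℕ
open import Data.Product using (∃; ∃₂; _×_; _,_; proj₁; proj₂)
open import Data.Sum using (_⊎_; inj₁; inj₂)
open import Data.Vec using (Vec)
open import Induction.WellFounded using (Acc; acc)
open import Level using (0ℓ)
open import Relation.Binary.PropositionalEquality
import Relation.Binary.Reflection
open import Relation.Nullary using (Dec; ¬_; yes; no; does)
open import Relation.Nullary.Decidable using (from-yes)
open import Relation.Nullary.Negation using (contradiction)
import Tactic.RingSolver.Core.AlmostCommutativeRing as ACR
import Tactic.RingSolver.Core.Expression as Expression
import Tactic.RingSolver.Core.Polynomial.Base
import Tactic.RingSolver.Core.Polynomial.Homomorphism
import Tactic.RingSolver.Core.Polynomial.Parameters as Parameters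
import Tactic.RingSolver.Core.Polynomial.Semantics
open import Defs

-- The obstacle is δ: it is totally positive and a norm from ℍ, yet not a sum of squares. Producing
-- norms is therefore not enough, and one has to control how a norm is attained. The cubes appear
-- because multiplication by a power of ω makes the ω coordinate of h even exactly when the residue
-- of h lies in F₈, F₈ω or F₈ω², and the 21 nonzero such residues are the cubes of F₆₄. Division by
-- an integer in H leaves a remainder of norm at most half the square of the divisor. For a ternary
-- form of determinant D this gives a nonzero value t with t³ ≤ 8 D. Here D is at most the
-- discriminant 49 of the field, and 8 · 49 < 8³ bounds the trace by 7. The coefficient 1 of j in s
-- has a purpose: an element of norm α found in this way divides 14 s on the right, so a scalar
-- dividing it divides 14. This is what confines the exceptions to units ε. Total positivity is
-- handled through the integral form Tr (α y²) alone, so no real embedding of the field is ever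
-- used.

record IntegerAlgebra : Set₁ where
  infixl 6 _+_ _-_
  infixl 7 _*_
  infix 8 -_
  field
    Carrier : Set
    _+_ _*_ : Carrier → Carrier → Carrier
    -_      : Carrier → Carrier
    fromℤ   : ℤ → Carrier
    isCommutativeRing : IsCommutativeRing _≡_ _+_ _*_ -_ (fromℤ (+ 0)) (fromℤ (+ 1))
    fromℤ-+ : ∀ a b → fromℤ (a ℤ.+ b) ≡ fromℤ a + fromℤ b
    fromℤ-* : ∀ a b → fromℤ (a ℤ.* b) ≡ fromℤ a * fromℤ b
    fromℤ-neg : ∀ a → fromℤ (ℤ.- a) ≡ - fromℤ a

  0# 1# : Carrier
  0# = fromℤ (+ 0)
  1# = fromℤ (+ 1)

  _-_ : Carrier → Carrier → Carrier
  x - y = x + (- y)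

-- The library's ring solver, with integer coefficients, so that it applies to
-- rings whose operations do not compute.
module IntegerSolver (R : IntegerAlgebra) where
  open IntegerAlgebra R

  private
    ring : ACR.AlmostCommutativeRing 0ℓ 0ℓ
    ring = ACR.fromCommutativeRing
      (record { isCommutativeRing = isCommutativeRing }) (λ _ → nothing)

    isZero : ℤ → Bool
    isZero (+ 0) = true
    isZero _ = false

    isZero-sound : ∀ x → T (isZero x) → 0# ≡ fromℤ x
    isZero-sound (+ 0) _ = refl

    homo : Parameters.Homomorphism 0ℓ 0ℓ 0ℓ 0ℓ
    homo = record
      { from = record
        { rawRing = CommutativeRing.rawRing ℤ.+-*-commutativeRing
        ; isZero = isZero }
      ; to = ring
      ; morphism = record
        { ⟦_⟧ = fromℤ ; +-homo = fromℤ-+ ; *-homo = fromℤ-* ; -‿homo = fromℤ-neg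
        ; 0-homo = refl ; 1-homo = refl }
      ; Zero-C⟶Zero-R = isZero-sound }

  open Expression public using (Expr; Κ; Ι; _⊛_; ⊝_) renaming (_⊕_ to _⊞_; _⊗_ to _⊠_)

  open Expression.Eval (ACR.AlmostCommutativeRing.rawRing ring) fromℤ renaming (⟦_⟧ to evaluate)
  module Base = Tactic.RingSolver.Core.Polynomial.Base (Parameters.Homomorphism.from homo)
  module Semantics = Tactic.RingSolver.Core.Polynomial.Semantics homo
  module Homomorphism = Tactic.RingSolver.Core.Polynomial.Homomorphism homo

  normal : ∀ {n} → Expr ℤ n → Base.Poly n
  normal (Κ x) = Base.κ x
  normal (Ι x) = Base.ι x
  normal (x ⊞ y) = normal x Base.⊞ normal y
  normal (x ⊠ y) = normal x Base.⊠ normal y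
  normal (⊝ x) = Base.⊟ normal x
  normal (x ⊛ i) = normal x Base.⊡ i

  evaluateNormal : ∀ {n} → Expr ℤ n → Vec Carrier n → Carrier
  evaluateNormal e = Semantics.⟦ normal e ⟧

  correct : ∀ {n} (e : Expr ℤ n) ρ → evaluateNormal e ρ ≡ evaluate e ρ
  correct (Κ x) ρ = Homomorphism.κ-hom x ρ
  correct (Ι x) ρ = Homomorphism.ι-hom x ρ
  correct (x ⊞ y) ρ = trans (Homomorphism.⊞-hom (normal x) (normal y) ρ) (cong₂ _+_ (correct x ρ) (correct y ρ))
  correct (x ⊠ y) ρ = trans (Homomorphism.⊠-hom (normal x) (normal y) ρ) (cong₂ _*_ (correct x ρ) (correct y ρ))
  correct (⊝ x) ρ = trans (Homomorphism.⊟-hom (normal x) ρ) (cong -_ (correct x ρ))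
  correct (x ⊛ i) ρ = trans (Homomorphism.⊡-hom (normal x) i ρ) (^-congˡ i (correct x ρ))
    where open import Algebra.Properties.Semiring.Exp.TCOptimised (ACR.AlmostCommutativeRing.semiring ring)

  open Relation.Binary.Reflection (setoid Carrier) Ι evaluate evaluateNormal correct public
    using (solve)

  infix 4 _⊜_
  infixl 6 _⊟_
  _⊟_ : ∀ {n} → Expr ℤ n → Expr ℤ n → Expr ℤ n
  x ⊟ y = x ⊞ (⊝ y)

  _⊜_ : ∀ {n} → Expr ℤ n → Expr ℤ n → Expr ℤ n × Expr ℤ n
  _⊜_ = _,_

-- Quaternion identities over an arbitrary commutative ring.

record Quaternion (A : Set) : Set where
  no-eta-equality
  pattern
  constructor quat
  field
    re im jm om : A

open Quaternion

-- Coordinates refer to the basis 1, i, j, ω = (1 + i + j + k) / 2.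
module Formulas {A : Set} (_+_ _*_ : A → A → A) (-_ : A → A) where
  private
    infixl 6 _∔_ _∸_
    infixl 7 _·_
    _∔_ = _+_
    _·_ = _*_
    _∸_ : A → A → A
    x ∸ y = x ∔ (- y)

  infixl 6 _⊹_
  infixl 7 _⋆_
  infixr 8 _•_

  _⊹_ _⋆_ : Quaternion A → Quaternion A → Quaternion A
  quat a b c d ⊹ quat e f g h = quat (a ∔ e) (b ∔ f) (c ∔ g) (d ∔ h)
  quat a b c d ⋆ quat e f g h = quat
    (a · e ∸ b · f ∸ b · g ∸ b · h ∔ c · f ∸ c · g ∸ d · g ∸ d · h)
    (a · f ∔ b · e ∸ b · g ∔ c · f ∔ c · h ∔ d · f ∸ d · g)
    (a · g ∔ c · e ∸ b · g ∸ b · h ∔ c · f ∔ c · h ∔ d · f)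
    (a · h ∔ d · e ∔ b · g ∔ b · g ∔ b · h ∸ c · f ∸ c · f ∸ c · h ∸ d · f ∔ d · g ∔ d · h)

  _•_ : A → Quaternion A → Quaternion A
  s • quat a b c d = quat (s · a) (s · b) (s · c) (s · d)

  conj neg : Quaternion A → Quaternion A
  conj (quat a b c d) = quat (a ∔ d) (- b) (- c) (- d)
  neg (quat a b c d) = quat (- a) (- b) (- c) (- d)

  norm tr : Quaternion A → A
  norm (quat a b c d) = a · a ∔ b · b ∔ c · c ∔ d · d ∔ d · (a ∔ b ∔ c)
  tr (quat a b c d) = a ∔ a ∔ d

quat-≡ : ∀ {A : Set} {x y : Quaternion A} → re x ≡ re y → im x ≡ im y → jm x ≡ jm y → om x ≡ om y → x ≡ y
quat-≡ {x = quat _ _ _ _} {quat _ _ _ _} refl refl refl refl = refl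

module Quaternions (R : IntegerAlgebra) where
  open IntegerAlgebra R
  open Formulas _+_ _*_ -_ public
  open IntegerSolver R

  private
    -- The formulas are instantiated a second time at solver expressions, so that an identity can be
    -- handed to the solver in quaternion notation, one coordinate at a time.
    module P {n} = Formulas {Expr ℤ n} _⊞_ _⊠_ ⊝_
    module A = IsCommutativeRing isCommutativeRing

  ℍ : Set
  ℍ = Quaternion Carrier

  embed : Carrier → ℍ
  embed s = quat s 0# 0# 0#

  0ℍ 1ℍ : ℍ
  0ℍ = embed 0#
  1ℍ = embed 1#

  ⋆-assoc : ∀ x y z → x ⋆ y ⋆ z ≡ x ⋆ (y ⋆ z)
  ⋆-assoc x y z = quat-≡ (l₁ x y z) (lᵢ x y z) (lⱼ x y z) (lω x y z)
    where
    l₁ : ∀ x y z → re (x ⋆ y ⋆ z) ≡ re (x ⋆ (y ⋆ z))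
    l₁ (quat a b c d) (quat e f g h) (quat k l m n) = solve 12 (λ a b c d e f g h k l m n → re ((quat a b c d) P.⋆ (quat e f g h) P.⋆ (quat k l m n)) ⊜ re ((quat a b c d) P.⋆ ((quat e f g h) P.⋆ (quat k l m n)))) refl a b c d e f g h k l m n
    lᵢ : ∀ x y z → im (x ⋆ y ⋆ z) ≡ im (x ⋆ (y ⋆ z))
    lᵢ (quat a b c d) (quat e f g h) (quat k l m n) = solve 12 (λ a b c d e f g h k l m n → im ((quat a b c d) P.⋆ (quat e f g h) P.⋆ (quat k l m n)) ⊜ im ((quat a b c d) P.⋆ ((quat e f g h) P.⋆ (quat k l m n)))) refl a b c d e f g h k l m n
    lⱼ : ∀ x y z → jm (x ⋆ y ⋆ z) ≡ jm (x ⋆ (y ⋆ z))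
    lⱼ (quat a b c d) (quat e f g h) (quat k l m n) = solve 12 (λ a b c d e f g h k l m n → jm ((quat a b c d) P.⋆ (quat e f g h) P.⋆ (quat k l m n)) ⊜ jm ((quat a b c d) P.⋆ ((quat e f g h) P.⋆ (quat k l m n)))) refl a b c d e f g h k l m n
    lω : ∀ x y z → om (x ⋆ y ⋆ z) ≡ om (x ⋆ (y ⋆ z))
    lω (quat a b c d) (quat e f g h) (quat k l m n) = solve 12 (λ a b c d e f g h k l m n → om ((quat a b c d) P.⋆ (quat e f g h) P.⋆ (quat k l m n)) ⊜ om ((quat a b c d) P.⋆ ((quat e f g h) P.⋆ (quat k l m n)))) refl a b c d e f g h k l m n

  ⋆-distribˡ : ∀ x y z → x ⋆ (y ⊹ z) ≡ x ⋆ y ⊹ x ⋆ z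
  ⋆-distribˡ x y z = quat-≡ (l₁ x y z) (lᵢ x y z) (lⱼ x y z) (lω x y z)
    where
    l₁ : ∀ x y z → re (x ⋆ (y ⊹ z)) ≡ re (x ⋆ y ⊹ x ⋆ z)
    l₁ (quat a b c d) (quat e f g h) (quat k l m n) = solve 12 (λ a b c d e f g h k l m n → re ((quat a b c d) P.⋆ ((quat e f g h) P.⊹ (quat k l m n))) ⊜ re ((quat a b c d) P.⋆ (quat e f g h) P.⊹ (quat a b c d) P.⋆ (quat k l m n))) refl a b c d e f g h k l m n
    lᵢ : ∀ x y z → im (x ⋆ (y ⊹ z)) ≡ im (x ⋆ y ⊹ x ⋆ z)
    lᵢ (quat a b c d) (quat e f g h) (quat k l m n) = solve 12 (λ a b c d e f g h k l m n → im ((quat a b c d) P.⋆ ((quat e f g h) P.⊹ (quat k l m n))) ⊜ im ((quat a b c d) P.⋆ (quat e f g h) P.⊹ (quat a b c d) P.⋆ (quat k l m n))) refl a b c d e f g h k l m n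
    lⱼ : ∀ x y z → jm (x ⋆ (y ⊹ z)) ≡ jm (x ⋆ y ⊹ x ⋆ z)
    lⱼ (quat a b c d) (quat e f g h) (quat k l m n) = solve 12 (λ a b c d e f g h k l m n → jm ((quat a b c d) P.⋆ ((quat e f g h) P.⊹ (quat k l m n))) ⊜ jm ((quat a b c d) P.⋆ (quat e f g h) P.⊹ (quat a b c d) P.⋆ (quat k l m n))) refl a b c d e f g h k l m n
    lω : ∀ x y z → om (x ⋆ (y ⊹ z)) ≡ om (x ⋆ y ⊹ x ⋆ z)
    lω (quat a b c d) (quat e f g h) (quat k l m n) = solve 12 (λ a b c d e f g h k l m n → om ((quat a b c d) P.⋆ ((quat e f g h) P.⊹ (quat k l m n))) ⊜ om ((quat a b c d) P.⋆ (quat e f g h) P.⊹ (quat a b c d) P.⋆ (quat k l m n))) refl a b c d e f g h k l m n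

  ⋆-distribʳ : ∀ x y z → (x ⊹ y) ⋆ z ≡ x ⋆ z ⊹ y ⋆ z
  ⋆-distribʳ x y z = quat-≡ (l₁ x y z) (lᵢ x y z) (lⱼ x y z) (lω x y z)
    where
    l₁ : ∀ x y z → re ((x ⊹ y) ⋆ z) ≡ re (x ⋆ z ⊹ y ⋆ z)
    l₁ (quat a b c d) (quat e f g h) (quat k l m n) = solve 12 (λ a b c d e f g h k l m n → re (((quat a b c d) P.⊹ (quat e f g h)) P.⋆ (quat k l m n)) ⊜ re ((quat a b c d) P.⋆ (quat k l m n) P.⊹ (quat e f g h) P.⋆ (quat k l m n))) refl a b c d e f g h k l m n
    lᵢ : ∀ x y z → im ((x ⊹ y) ⋆ z) ≡ im (x ⋆ z ⊹ y ⋆ z)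
    lᵢ (quat a b c d) (quat e f g h) (quat k l m n) = solve 12 (λ a b c d e f g h k l m n → im (((quat a b c d) P.⊹ (quat e f g h)) P.⋆ (quat k l m n)) ⊜ im ((quat a b c d) P.⋆ (quat k l m n) P.⊹ (quat e f g h) P.⋆ (quat k l m n))) refl a b c d e f g h k l m n
    lⱼ : ∀ x y z → jm ((x ⊹ y) ⋆ z) ≡ jm (x ⋆ z ⊹ y ⋆ z)
    lⱼ (quat a b c d) (quat e f g h) (quat k l m n) = solve 12 (λ a b c d e f g h k l m n → jm (((quat a b c d) P.⊹ (quat e f g h)) P.⋆ (quat k l m n)) ⊜ jm ((quat a b c d) P.⋆ (quat k l m n) P.⊹ (quat e f g h) P.⋆ (quat k l m n))) refl a b c d e f g h k l m n
    lω : ∀ x y z → om ((x ⊹ y) ⋆ z) ≡ om (x ⋆ z ⊹ y ⋆ z)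
    lω (quat a b c d) (quat e f g h) (quat k l m n) = solve 12 (λ a b c d e f g h k l m n → om (((quat a b c d) P.⊹ (quat e f g h)) P.⋆ (quat k l m n)) ⊜ om ((quat a b c d) P.⋆ (quat k l m n) P.⊹ (quat e f g h) P.⋆ (quat k l m n))) refl a b c d e f g h k l m n

  conj-⋆ : ∀ x y → conj (x ⋆ y) ≡ conj y ⋆ conj x
  conj-⋆ x y = quat-≡ (l₁ x y) (lᵢ x y) (lⱼ x y) (lω x y)
    where
    l₁ : ∀ x y → re (conj (x ⋆ y)) ≡ re (conj y ⋆ conj x)
    l₁ (quat a b c d) (quat e f g h) = solve 8 (λ a b c d e f g h → re (P.conj ((quat a b c d) P.⋆ (quat e f g h))) ⊜ re (P.conj (quat e f g h) P.⋆ P.conj (quat a b c d))) refl a b c d e f g h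
    lᵢ : ∀ x y → im (conj (x ⋆ y)) ≡ im (conj y ⋆ conj x)
    lᵢ (quat a b c d) (quat e f g h) = solve 8 (λ a b c d e f g h → im (P.conj ((quat a b c d) P.⋆ (quat e f g h))) ⊜ im (P.conj (quat e f g h) P.⋆ P.conj (quat a b c d))) refl a b c d e f g h
    lⱼ : ∀ x y → jm (conj (x ⋆ y)) ≡ jm (conj y ⋆ conj x)
    lⱼ (quat a b c d) (quat e f g h) = solve 8 (λ a b c d e f g h → jm (P.conj ((quat a b c d) P.⋆ (quat e f g h))) ⊜ jm (P.conj (quat e f g h) P.⋆ P.conj (quat a b c d))) refl a b c d e f g h
    lω : ∀ x y → om (conj (x ⋆ y)) ≡ om (conj y ⋆ conj x)
    lω (quat a b c d) (quat e f g h) = solve 8 (λ a b c d e f g h → om (P.conj ((quat a b c d) P.⋆ (quat e f g h))) ⊜ om (P.conj (quat e f g h) P.⋆ P.conj (quat a b c d))) refl a b c d e f g h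

  •-⋆ : ∀ s x y → (s • x) ⋆ y ≡ s • (x ⋆ y)
  •-⋆ s x y = quat-≡ (l₁ s x y) (lᵢ s x y) (lⱼ s x y) (lω s x y)
    where
    l₁ : ∀ s x y → re ((s • x) ⋆ y) ≡ re (s • (x ⋆ y))
    l₁ s (quat a b c d) (quat e f g h) = solve 9 (λ s a b c d e f g h → re ((s P.• (quat a b c d)) P.⋆ (quat e f g h)) ⊜ re (s P.• ((quat a b c d) P.⋆ (quat e f g h)))) refl s a b c d e f g h
    lᵢ : ∀ s x y → im ((s • x) ⋆ y) ≡ im (s • (x ⋆ y))
    lᵢ s (quat a b c d) (quat e f g h) = solve 9 (λ s a b c d e f g h → im ((s P.• (quat a b c d)) P.⋆ (quat e f g h)) ⊜ im (s P.• ((quat a b c d) P.⋆ (quat e f g h)))) refl s a b c d e f g h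
    lⱼ : ∀ s x y → jm ((s • x) ⋆ y) ≡ jm (s • (x ⋆ y))
    lⱼ s (quat a b c d) (quat e f g h) = solve 9 (λ s a b c d e f g h → jm ((s P.• (quat a b c d)) P.⋆ (quat e f g h)) ⊜ jm (s P.• ((quat a b c d) P.⋆ (quat e f g h)))) refl s a b c d e f g h
    lω : ∀ s x y → om ((s • x) ⋆ y) ≡ om (s • (x ⋆ y))
    lω s (quat a b c d) (quat e f g h) = solve 9 (λ s a b c d e f g h → om ((s P.• (quat a b c d)) P.⋆ (quat e f g h)) ⊜ om (s P.• ((quat a b c d) P.⋆ (quat e f g h)))) refl s a b c d e f g h

  ⋆-• : ∀ s x y → x ⋆ (s • y) ≡ s • (x ⋆ y)
  ⋆-• s x y = quat-≡ (l₁ s x y) (lᵢ s x y) (lⱼ s x y) (lω s x y)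
    where
    l₁ : ∀ s x y → re (x ⋆ (s • y)) ≡ re (s • (x ⋆ y))
    l₁ s (quat a b c d) (quat e f g h) = solve 9 (λ s a b c d e f g h → re ((quat a b c d) P.⋆ (s P.• (quat e f g h))) ⊜ re (s P.• ((quat a b c d) P.⋆ (quat e f g h)))) refl s a b c d e f g h
    lᵢ : ∀ s x y → im (x ⋆ (s • y)) ≡ im (s • (x ⋆ y))
    lᵢ s (quat a b c d) (quat e f g h) = solve 9 (λ s a b c d e f g h → im ((quat a b c d) P.⋆ (s P.• (quat e f g h))) ⊜ im (s P.• ((quat a b c d) P.⋆ (quat e f g h)))) refl s a b c d e f g h
    lⱼ : ∀ s x y → jm (x ⋆ (s • y)) ≡ jm (s • (x ⋆ y))
    lⱼ s (quat a b c d) (quat e f g h) = solve 9 (λ s a b c d e f g h → jm ((quat a b c d) P.⋆ (s P.• (quat e f g h))) ⊜ jm (s P.• ((quat a b c d) P.⋆ (quat e f g h)))) refl s a b c d e f g h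
    lω : ∀ s x y → om (x ⋆ (s • y)) ≡ om (s • (x ⋆ y))
    lω s (quat a b c d) (quat e f g h) = solve 9 (λ s a b c d e f g h → om ((quat a b c d) P.⋆ (s P.• (quat e f g h))) ⊜ om (s P.• ((quat a b c d) P.⋆ (quat e f g h)))) refl s a b c d e f g h

  conj-⊹ : ∀ x y → conj (x ⊹ y) ≡ conj x ⊹ conj y
  conj-⊹ x y = quat-≡ (l₁ x y) (lᵢ x y) (lⱼ x y) (lω x y)
    where
    l₁ : ∀ x y → re (conj (x ⊹ y)) ≡ re (conj x ⊹ conj y)
    l₁ (quat a b c d) (quat e f g h) = solve 8 (λ a b c d e f g h → re (P.conj ((quat a b c d) P.⊹ (quat e f g h))) ⊜ re (P.conj (quat a b c d) P.⊹ P.conj (quat e f g h))) refl a b c d e f g h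
    lᵢ : ∀ x y → im (conj (x ⊹ y)) ≡ im (conj x ⊹ conj y)
    lᵢ (quat a b c d) (quat e f g h) = solve 8 (λ a b c d e f g h → im (P.conj ((quat a b c d) P.⊹ (quat e f g h))) ⊜ im (P.conj (quat a b c d) P.⊹ P.conj (quat e f g h))) refl a b c d e f g h
    lⱼ : ∀ x y → jm (conj (x ⊹ y)) ≡ jm (conj x ⊹ conj y)
    lⱼ (quat a b c d) (quat e f g h) = solve 8 (λ a b c d e f g h → jm (P.conj ((quat a b c d) P.⊹ (quat e f g h))) ⊜ jm (P.conj (quat a b c d) P.⊹ P.conj (quat e f g h))) refl a b c d e f g h
    lω : ∀ x y → om (conj (x ⊹ y)) ≡ om (conj x ⊹ conj y)
    lω (quat a b c d) (quat e f g h) = solve 8 (λ a b c d e f g h → om (P.conj ((quat a b c d) P.⊹ (quat e f g h))) ⊜ om (P.conj (quat a b c d) P.⊹ P.conj (quat e f g h))) refl a b c d e f g h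

  conj-• : ∀ s x → conj (s • x) ≡ s • conj x
  conj-• s x = quat-≡ (l₁ s x) (lᵢ s x) (lⱼ s x) (lω s x)
    where
    l₁ : ∀ s x → re (conj (s • x)) ≡ re (s • conj x)
    l₁ s (quat a b c d) = solve 5 (λ s a b c d → re (P.conj (s P.• (quat a b c d))) ⊜ re (s P.• P.conj (quat a b c d))) refl s a b c d
    lᵢ : ∀ s x → im (conj (s • x)) ≡ im (s • conj x)
    lᵢ s (quat a b c d) = solve 5 (λ s a b c d → im (P.conj (s P.• (quat a b c d))) ⊜ im (s P.• P.conj (quat a b c d))) refl s a b c d
    lⱼ : ∀ s x → jm (conj (s • x)) ≡ jm (s • conj x)
    lⱼ s (quat a b c d) = solve 5 (λ s a b c d → jm (P.conj (s P.• (quat a b c d))) ⊜ jm (s P.• P.conj (quat a b c d))) refl s a b c d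
    lω : ∀ s x → om (conj (s • x)) ≡ om (s • conj x)
    lω s (quat a b c d) = solve 5 (λ s a b c d → om (P.conj (s P.• (quat a b c d))) ⊜ om (s P.• P.conj (quat a b c d))) refl s a b c d

  conj-conj : ∀ x → conj (conj x) ≡ x
  conj-conj x = quat-≡ (l₁ x) (lᵢ x) (lⱼ x) (lω x)
    where
    l₁ : ∀ x → re (conj (conj x)) ≡ re (x)
    l₁ (quat a b c d) = solve 4 (λ a b c d → re (P.conj (P.conj (quat a b c d))) ⊜ re ((quat a b c d))) refl a b c d
    lᵢ : ∀ x → im (conj (conj x)) ≡ im (x)
    lᵢ (quat a b c d) = solve 4 (λ a b c d → im (P.conj (P.conj (quat a b c d))) ⊜ im ((quat a b c d))) refl a b c d
    lⱼ : ∀ x → jm (conj (conj x)) ≡ jm (x)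
    lⱼ (quat a b c d) = solve 4 (λ a b c d → jm (P.conj (P.conj (quat a b c d))) ⊜ jm ((quat a b c d))) refl a b c d
    lω : ∀ x → om (conj (conj x)) ≡ om (x)
    lω (quat a b c d) = solve 4 (λ a b c d → om (P.conj (P.conj (quat a b c d))) ⊜ om ((quat a b c d))) refl a b c d

  conj-neg : ∀ x → conj (neg x) ≡ neg (conj x)
  conj-neg x = quat-≡ (l₁ x) (lᵢ x) (lⱼ x) (lω x)
    where
    l₁ : ∀ x → re (conj (neg x)) ≡ re (neg (conj x))
    l₁ (quat a b c d) = solve 4 (λ a b c d → re (P.conj (P.neg (quat a b c d))) ⊜ re (P.neg (P.conj (quat a b c d)))) refl a b c d
    lᵢ : ∀ x → im (conj (neg x)) ≡ im (neg (conj x))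
    lᵢ (quat a b c d) = solve 4 (λ a b c d → im (P.conj (P.neg (quat a b c d))) ⊜ im (P.neg (P.conj (quat a b c d)))) refl a b c d
    lⱼ : ∀ x → jm (conj (neg x)) ≡ jm (neg (conj x))
    lⱼ (quat a b c d) = solve 4 (λ a b c d → jm (P.conj (P.neg (quat a b c d))) ⊜ jm (P.neg (P.conj (quat a b c d)))) refl a b c d
    lω : ∀ x → om (conj (neg x)) ≡ om (neg (conj x))
    lω (quat a b c d) = solve 4 (λ a b c d → om (P.conj (P.neg (quat a b c d))) ⊜ om (P.neg (P.conj (quat a b c d)))) refl a b c d

  ⋆-neg : ∀ x y → x ⋆ neg y ≡ neg (x ⋆ y)
  ⋆-neg x y = quat-≡ (l₁ x y) (lᵢ x y) (lⱼ x y) (lω x y)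
    where
    l₁ : ∀ x y → re (x ⋆ neg y) ≡ re (neg (x ⋆ y))
    l₁ (quat a b c d) (quat e f g h) = solve 8 (λ a b c d e f g h → re ((quat a b c d) P.⋆ P.neg (quat e f g h)) ⊜ re (P.neg ((quat a b c d) P.⋆ (quat e f g h)))) refl a b c d e f g h
    lᵢ : ∀ x y → im (x ⋆ neg y) ≡ im (neg (x ⋆ y))
    lᵢ (quat a b c d) (quat e f g h) = solve 8 (λ a b c d e f g h → im ((quat a b c d) P.⋆ P.neg (quat e f g h)) ⊜ im (P.neg ((quat a b c d) P.⋆ (quat e f g h)))) refl a b c d e f g h
    lⱼ : ∀ x y → jm (x ⋆ neg y) ≡ jm (neg (x ⋆ y))
    lⱼ (quat a b c d) (quat e f g h) = solve 8 (λ a b c d e f g h → jm ((quat a b c d) P.⋆ P.neg (quat e f g h)) ⊜ jm (P.neg ((quat a b c d) P.⋆ (quat e f g h)))) refl a b c d e f g h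
    lω : ∀ x y → om (x ⋆ neg y) ≡ om (neg (x ⋆ y))
    lω (quat a b c d) (quat e f g h) = solve 8 (λ a b c d e f g h → om ((quat a b c d) P.⋆ P.neg (quat e f g h)) ⊜ om (P.neg ((quat a b c d) P.⋆ (quat e f g h)))) refl a b c d e f g h

  neg-⋆ : ∀ x y → neg x ⋆ y ≡ neg (x ⋆ y)
  neg-⋆ x y = quat-≡ (l₁ x y) (lᵢ x y) (lⱼ x y) (lω x y)
    where
    l₁ : ∀ x y → re (neg x ⋆ y) ≡ re (neg (x ⋆ y))
    l₁ (quat a b c d) (quat e f g h) = solve 8 (λ a b c d e f g h → re (P.neg (quat a b c d) P.⋆ (quat e f g h)) ⊜ re (P.neg ((quat a b c d) P.⋆ (quat e f g h)))) refl a b c d e f g h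
    lᵢ : ∀ x y → im (neg x ⋆ y) ≡ im (neg (x ⋆ y))
    lᵢ (quat a b c d) (quat e f g h) = solve 8 (λ a b c d e f g h → im (P.neg (quat a b c d) P.⋆ (quat e f g h)) ⊜ im (P.neg ((quat a b c d) P.⋆ (quat e f g h)))) refl a b c d e f g h
    lⱼ : ∀ x y → jm (neg x ⋆ y) ≡ jm (neg (x ⋆ y))
    lⱼ (quat a b c d) (quat e f g h) = solve 8 (λ a b c d e f g h → jm (P.neg (quat a b c d) P.⋆ (quat e f g h)) ⊜ jm (P.neg ((quat a b c d) P.⋆ (quat e f g h)))) refl a b c d e f g h
    lω : ∀ x y → om (neg x ⋆ y) ≡ om (neg (x ⋆ y))
    lω (quat a b c d) (quat e f g h) = solve 8 (λ a b c d e f g h → om (P.neg (quat a b c d) P.⋆ (quat e f g h)) ⊜ om (P.neg ((quat a b c d) P.⋆ (quat e f g h)))) refl a b c d e f g h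

  ⊹-comm : ∀ x y → x ⊹ y ≡ y ⊹ x
  ⊹-comm x y = quat-≡ (l₁ x y) (lᵢ x y) (lⱼ x y) (lω x y)
    where
    l₁ : ∀ x y → re (x ⊹ y) ≡ re (y ⊹ x)
    l₁ (quat a b c d) (quat e f g h) = solve 8 (λ a b c d e f g h → re ((quat a b c d) P.⊹ (quat e f g h)) ⊜ re ((quat e f g h) P.⊹ (quat a b c d))) refl a b c d e f g h
    lᵢ : ∀ x y → im (x ⊹ y) ≡ im (y ⊹ x)
    lᵢ (quat a b c d) (quat e f g h) = solve 8 (λ a b c d e f g h → im ((quat a b c d) P.⊹ (quat e f g h)) ⊜ im ((quat e f g h) P.⊹ (quat a b c d))) refl a b c d e f g h
    lⱼ : ∀ x y → jm (x ⊹ y) ≡ jm (y ⊹ x)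
    lⱼ (quat a b c d) (quat e f g h) = solve 8 (λ a b c d e f g h → jm ((quat a b c d) P.⊹ (quat e f g h)) ⊜ jm ((quat e f g h) P.⊹ (quat a b c d))) refl a b c d e f g h
    lω : ∀ x y → om (x ⊹ y) ≡ om (y ⊹ x)
    lω (quat a b c d) (quat e f g h) = solve 8 (λ a b c d e f g h → om ((quat a b c d) P.⊹ (quat e f g h)) ⊜ om ((quat e f g h) P.⊹ (quat a b c d))) refl a b c d e f g h

  ⊹-assoc : ∀ x y z → x ⊹ y ⊹ z ≡ x ⊹ (y ⊹ z)
  ⊹-assoc x y z = quat-≡ (l₁ x y z) (lᵢ x y z) (lⱼ x y z) (lω x y z)
    where
    l₁ : ∀ x y z → re (x ⊹ y ⊹ z) ≡ re (x ⊹ (y ⊹ z))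
    l₁ (quat a b c d) (quat e f g h) (quat k l m n) = solve 12 (λ a b c d e f g h k l m n → re ((quat a b c d) P.⊹ (quat e f g h) P.⊹ (quat k l m n)) ⊜ re ((quat a b c d) P.⊹ ((quat e f g h) P.⊹ (quat k l m n)))) refl a b c d e f g h k l m n
    lᵢ : ∀ x y z → im (x ⊹ y ⊹ z) ≡ im (x ⊹ (y ⊹ z))
    lᵢ (quat a b c d) (quat e f g h) (quat k l m n) = solve 12 (λ a b c d e f g h k l m n → im ((quat a b c d) P.⊹ (quat e f g h) P.⊹ (quat k l m n)) ⊜ im ((quat a b c d) P.⊹ ((quat e f g h) P.⊹ (quat k l m n)))) refl a b c d e f g h k l m n
    lⱼ : ∀ x y z → jm (x ⊹ y ⊹ z) ≡ jm (x ⊹ (y ⊹ z))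
    lⱼ (quat a b c d) (quat e f g h) (quat k l m n) = solve 12 (λ a b c d e f g h k l m n → jm ((quat a b c d) P.⊹ (quat e f g h) P.⊹ (quat k l m n)) ⊜ jm ((quat a b c d) P.⊹ ((quat e f g h) P.⊹ (quat k l m n)))) refl a b c d e f g h k l m n
    lω : ∀ x y z → om (x ⊹ y ⊹ z) ≡ om (x ⊹ (y ⊹ z))
    lω (quat a b c d) (quat e f g h) (quat k l m n) = solve 12 (λ a b c d e f g h k l m n → om ((quat a b c d) P.⊹ (quat e f g h) P.⊹ (quat k l m n)) ⊜ om ((quat a b c d) P.⊹ ((quat e f g h) P.⊹ (quat k l m n)))) refl a b c d e f g h k l m n

  •-⊹ : ∀ s x y → s • (x ⊹ y) ≡ s • x ⊹ s • y
  •-⊹ s x y = quat-≡ (l₁ s x y) (lᵢ s x y) (lⱼ s x y) (lω s x y)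
    where
    l₁ : ∀ s x y → re (s • (x ⊹ y)) ≡ re (s • x ⊹ s • y)
    l₁ s (quat a b c d) (quat e f g h) = solve 9 (λ s a b c d e f g h → re (s P.• ((quat a b c d) P.⊹ (quat e f g h))) ⊜ re (s P.• (quat a b c d) P.⊹ s P.• (quat e f g h))) refl s a b c d e f g h
    lᵢ : ∀ s x y → im (s • (x ⊹ y)) ≡ im (s • x ⊹ s • y)
    lᵢ s (quat a b c d) (quat e f g h) = solve 9 (λ s a b c d e f g h → im (s P.• ((quat a b c d) P.⊹ (quat e f g h))) ⊜ im (s P.• (quat a b c d) P.⊹ s P.• (quat e f g h))) refl s a b c d e f g h
    lⱼ : ∀ s x y → jm (s • (x ⊹ y)) ≡ jm (s • x ⊹ s • y)
    lⱼ s (quat a b c d) (quat e f g h) = solve 9 (λ s a b c d e f g h → jm (s P.• ((quat a b c d) P.⊹ (quat e f g h))) ⊜ jm (s P.• (quat a b c d) P.⊹ s P.• (quat e f g h))) refl s a b c d e f g h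
    lω : ∀ s x y → om (s • (x ⊹ y)) ≡ om (s • x ⊹ s • y)
    lω s (quat a b c d) (quat e f g h) = solve 9 (λ s a b c d e f g h → om (s P.• ((quat a b c d) P.⊹ (quat e f g h))) ⊜ om (s P.• (quat a b c d) P.⊹ s P.• (quat e f g h))) refl s a b c d e f g h

  •-neg : ∀ s x → s • neg x ≡ neg (s • x)
  •-neg s x = quat-≡ (l₁ s x) (lᵢ s x) (lⱼ s x) (lω s x)
    where
    l₁ : ∀ s x → re (s • neg x) ≡ re (neg (s • x))
    l₁ s (quat a b c d) = solve 5 (λ s a b c d → re (s P.• P.neg (quat a b c d)) ⊜ re (P.neg (s P.• (quat a b c d)))) refl s a b c d
    lᵢ : ∀ s x → im (s • neg x) ≡ im (neg (s • x))
    lᵢ s (quat a b c d) = solve 5 (λ s a b c d → im (s P.• P.neg (quat a b c d)) ⊜ im (P.neg (s P.• (quat a b c d)))) refl s a b c d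
    lⱼ : ∀ s x → jm (s • neg x) ≡ jm (neg (s • x))
    lⱼ s (quat a b c d) = solve 5 (λ s a b c d → jm (s P.• P.neg (quat a b c d)) ⊜ jm (P.neg (s P.• (quat a b c d)))) refl s a b c d
    lω : ∀ s x → om (s • neg x) ≡ om (neg (s • x))
    lω s (quat a b c d) = solve 5 (λ s a b c d → om (s P.• P.neg (quat a b c d)) ⊜ om (P.neg (s P.• (quat a b c d)))) refl s a b c d

  •-• : ∀ s t x → s • (t • x) ≡ (s * t) • x
  •-• s t x = quat-≡ (l₁ s t x) (lᵢ s t x) (lⱼ s t x) (lω s t x)
    where
    l₁ : ∀ s t x → re (s • (t • x)) ≡ re ((s * t) • x)
    l₁ s t (quat a b c d) = solve 6 (λ s t a b c d → re (s P.• (t P.• (quat a b c d))) ⊜ re ((s ⊠ t) P.• (quat a b c d))) refl s t a b c d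
    lᵢ : ∀ s t x → im (s • (t • x)) ≡ im ((s * t) • x)
    lᵢ s t (quat a b c d) = solve 6 (λ s t a b c d → im (s P.• (t P.• (quat a b c d))) ⊜ im ((s ⊠ t) P.• (quat a b c d))) refl s t a b c d
    lⱼ : ∀ s t x → jm (s • (t • x)) ≡ jm ((s * t) • x)
    lⱼ s t (quat a b c d) = solve 6 (λ s t a b c d → jm (s P.• (t P.• (quat a b c d))) ⊜ jm ((s ⊠ t) P.• (quat a b c d))) refl s t a b c d
    lω : ∀ s t x → om (s • (t • x)) ≡ om ((s * t) • x)
    lω s t (quat a b c d) = solve 6 (λ s t a b c d → om (s P.• (t P.• (quat a b c d))) ⊜ om ((s ⊠ t) P.• (quat a b c d))) refl s t a b c d

  ⋆-conj : ∀ x → x ⋆ conj x ≡ embed (norm x)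
  ⋆-conj x = quat-≡ (l₁ x) (lᵢ x) (lⱼ x) (lω x)
    where
    l₁ : ∀ x → re (x ⋆ conj x) ≡ re (embed (norm x))
    l₁ (quat a b c d) = solve 4 (λ a b c d → re ((quat a b c d) P.⋆ P.conj (quat a b c d)) ⊜ re (quat (P.norm (quat a b c d)) (Κ (+ 0)) (Κ (+ 0)) (Κ (+ 0)))) refl a b c d
    lᵢ : ∀ x → im (x ⋆ conj x) ≡ im (embed (norm x))
    lᵢ (quat a b c d) = solve 4 (λ a b c d → im ((quat a b c d) P.⋆ P.conj (quat a b c d)) ⊜ im (quat (P.norm (quat a b c d)) (Κ (+ 0)) (Κ (+ 0)) (Κ (+ 0)))) refl a b c d
    lⱼ : ∀ x → jm (x ⋆ conj x) ≡ jm (embed (norm x))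
    lⱼ (quat a b c d) = solve 4 (λ a b c d → jm ((quat a b c d) P.⋆ P.conj (quat a b c d)) ⊜ jm (quat (P.norm (quat a b c d)) (Κ (+ 0)) (Κ (+ 0)) (Κ (+ 0)))) refl a b c d
    lω : ∀ x → om (x ⋆ conj x) ≡ om (embed (norm x))
    lω (quat a b c d) = solve 4 (λ a b c d → om ((quat a b c d) P.⋆ P.conj (quat a b c d)) ⊜ om (quat (P.norm (quat a b c d)) (Κ (+ 0)) (Κ (+ 0)) (Κ (+ 0)))) refl a b c d

  conj-⋆-self : ∀ x → conj x ⋆ x ≡ embed (norm x)
  conj-⋆-self x = quat-≡ (l₁ x) (lᵢ x) (lⱼ x) (lω x)
    where
    l₁ : ∀ x → re (conj x ⋆ x) ≡ re (embed (norm x))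
    l₁ (quat a b c d) = solve 4 (λ a b c d → re (P.conj (quat a b c d) P.⋆ (quat a b c d)) ⊜ re (quat (P.norm (quat a b c d)) (Κ (+ 0)) (Κ (+ 0)) (Κ (+ 0)))) refl a b c d
    lᵢ : ∀ x → im (conj x ⋆ x) ≡ im (embed (norm x))
    lᵢ (quat a b c d) = solve 4 (λ a b c d → im (P.conj (quat a b c d) P.⋆ (quat a b c d)) ⊜ im (quat (P.norm (quat a b c d)) (Κ (+ 0)) (Κ (+ 0)) (Κ (+ 0)))) refl a b c d
    lⱼ : ∀ x → jm (conj x ⋆ x) ≡ jm (embed (norm x))
    lⱼ (quat a b c d) = solve 4 (λ a b c d → jm (P.conj (quat a b c d) P.⋆ (quat a b c d)) ⊜ jm (quat (P.norm (quat a b c d)) (Κ (+ 0)) (Κ (+ 0)) (Κ (+ 0)))) refl a b c d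
    lω : ∀ x → om (conj x ⋆ x) ≡ om (embed (norm x))
    lω (quat a b c d) = solve 4 (λ a b c d → om (P.conj (quat a b c d) P.⋆ (quat a b c d)) ⊜ om (quat (P.norm (quat a b c d)) (Κ (+ 0)) (Κ (+ 0)) (Κ (+ 0)))) refl a b c d

  embed-⋆ : ∀ s x → embed s ⋆ x ≡ s • x
  embed-⋆ s x = quat-≡ (l₁ s x) (lᵢ s x) (lⱼ s x) (lω s x)
    where
    l₁ : ∀ s x → re (embed s ⋆ x) ≡ re (s • x)
    l₁ s (quat a b c d) = solve 5 (λ s a b c d → re (quat s (Κ (+ 0)) (Κ (+ 0)) (Κ (+ 0)) P.⋆ (quat a b c d)) ⊜ re (s P.• (quat a b c d))) refl s a b c d
    lᵢ : ∀ s x → im (embed s ⋆ x) ≡ im (s • x)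
    lᵢ s (quat a b c d) = solve 5 (λ s a b c d → im (quat s (Κ (+ 0)) (Κ (+ 0)) (Κ (+ 0)) P.⋆ (quat a b c d)) ⊜ im (s P.• (quat a b c d))) refl s a b c d
    lⱼ : ∀ s x → jm (embed s ⋆ x) ≡ jm (s • x)
    lⱼ s (quat a b c d) = solve 5 (λ s a b c d → jm (quat s (Κ (+ 0)) (Κ (+ 0)) (Κ (+ 0)) P.⋆ (quat a b c d)) ⊜ jm (s P.• (quat a b c d))) refl s a b c d
    lω : ∀ s x → om (embed s ⋆ x) ≡ om (s • x)
    lω s (quat a b c d) = solve 5 (λ s a b c d → om (quat s (Κ (+ 0)) (Κ (+ 0)) (Κ (+ 0)) P.⋆ (quat a b c d)) ⊜ om (s P.• (quat a b c d))) refl s a b c d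

  ⋆-embed : ∀ s x → x ⋆ embed s ≡ s • x
  ⋆-embed s x = quat-≡ (l₁ s x) (lᵢ s x) (lⱼ s x) (lω s x)
    where
    l₁ : ∀ s x → re (x ⋆ embed s) ≡ re (s • x)
    l₁ s (quat a b c d) = solve 5 (λ s a b c d → re ((quat a b c d) P.⋆ quat s (Κ (+ 0)) (Κ (+ 0)) (Κ (+ 0))) ⊜ re (s P.• (quat a b c d))) refl s a b c d
    lᵢ : ∀ s x → im (x ⋆ embed s) ≡ im (s • x)
    lᵢ s (quat a b c d) = solve 5 (λ s a b c d → im ((quat a b c d) P.⋆ quat s (Κ (+ 0)) (Κ (+ 0)) (Κ (+ 0))) ⊜ im (s P.• (quat a b c d))) refl s a b c d
    lⱼ : ∀ s x → jm (x ⋆ embed s) ≡ jm (s • x)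
    lⱼ s (quat a b c d) = solve 5 (λ s a b c d → jm ((quat a b c d) P.⋆ quat s (Κ (+ 0)) (Κ (+ 0)) (Κ (+ 0))) ⊜ jm (s P.• (quat a b c d))) refl s a b c d
    lω : ∀ s x → om (x ⋆ embed s) ≡ om (s • x)
    lω s (quat a b c d) = solve 5 (λ s a b c d → om ((quat a b c d) P.⋆ quat s (Κ (+ 0)) (Κ (+ 0)) (Κ (+ 0))) ⊜ om (s P.• (quat a b c d))) refl s a b c d

  ⊖-self : ∀ x → x ⊹ neg x ≡ 0ℍ
  ⊖-self x = quat-≡ (l₁ x) (lᵢ x) (lⱼ x) (lω x)
    where
    l₁ : ∀ x → re (x ⊹ neg x) ≡ re (0ℍ)
    l₁ (quat a b c d) = solve 4 (λ a b c d → re ((quat a b c d) P.⊹ P.neg (quat a b c d)) ⊜ re ((quat (Κ (+ 0)) (Κ (+ 0)) (Κ (+ 0)) (Κ (+ 0))))) refl a b c d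
    lᵢ : ∀ x → im (x ⊹ neg x) ≡ im (0ℍ)
    lᵢ (quat a b c d) = solve 4 (λ a b c d → im ((quat a b c d) P.⊹ P.neg (quat a b c d)) ⊜ im ((quat (Κ (+ 0)) (Κ (+ 0)) (Κ (+ 0)) (Κ (+ 0))))) refl a b c d
    lⱼ : ∀ x → jm (x ⊹ neg x) ≡ jm (0ℍ)
    lⱼ (quat a b c d) = solve 4 (λ a b c d → jm ((quat a b c d) P.⊹ P.neg (quat a b c d)) ⊜ jm ((quat (Κ (+ 0)) (Κ (+ 0)) (Κ (+ 0)) (Κ (+ 0))))) refl a b c d
    lω : ∀ x → om (x ⊹ neg x) ≡ om (0ℍ)
    lω (quat a b c d) = solve 4 (λ a b c d → om ((quat a b c d) P.⊹ P.neg (quat a b c d)) ⊜ om ((quat (Κ (+ 0)) (Κ (+ 0)) (Κ (+ 0)) (Κ (+ 0))))) refl a b c d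

  ⊹-0 : ∀ x → x ⊹ 0ℍ ≡ x
  ⊹-0 x = quat-≡ (l₁ x) (lᵢ x) (lⱼ x) (lω x)
    where
    l₁ : ∀ x → re (x ⊹ 0ℍ) ≡ re (x)
    l₁ (quat a b c d) = solve 4 (λ a b c d → re ((quat a b c d) P.⊹ (quat (Κ (+ 0)) (Κ (+ 0)) (Κ (+ 0)) (Κ (+ 0)))) ⊜ re ((quat a b c d))) refl a b c d
    lᵢ : ∀ x → im (x ⊹ 0ℍ) ≡ im (x)
    lᵢ (quat a b c d) = solve 4 (λ a b c d → im ((quat a b c d) P.⊹ (quat (Κ (+ 0)) (Κ (+ 0)) (Κ (+ 0)) (Κ (+ 0)))) ⊜ im ((quat a b c d))) refl a b c d
    lⱼ : ∀ x → jm (x ⊹ 0ℍ) ≡ jm (x)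
    lⱼ (quat a b c d) = solve 4 (λ a b c d → jm ((quat a b c d) P.⊹ (quat (Κ (+ 0)) (Κ (+ 0)) (Κ (+ 0)) (Κ (+ 0)))) ⊜ jm ((quat a b c d))) refl a b c d
    lω : ∀ x → om (x ⊹ 0ℍ) ≡ om (x)
    lω (quat a b c d) = solve 4 (λ a b c d → om ((quat a b c d) P.⊹ (quat (Κ (+ 0)) (Κ (+ 0)) (Κ (+ 0)) (Κ (+ 0)))) ⊜ om ((quat a b c d))) refl a b c d

  0-⋆ : ∀ x → 0ℍ ⋆ x ≡ 0ℍ
  0-⋆ x = quat-≡ (l₁ x) (lᵢ x) (lⱼ x) (lω x)
    where
    l₁ : ∀ x → re (0ℍ ⋆ x) ≡ re (0ℍ)
    l₁ (quat a b c d) = solve 4 (λ a b c d → re ((quat (Κ (+ 0)) (Κ (+ 0)) (Κ (+ 0)) (Κ (+ 0))) P.⋆ (quat a b c d)) ⊜ re ((quat (Κ (+ 0)) (Κ (+ 0)) (Κ (+ 0)) (Κ (+ 0))))) refl a b c d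
    lᵢ : ∀ x → im (0ℍ ⋆ x) ≡ im (0ℍ)
    lᵢ (quat a b c d) = solve 4 (λ a b c d → im ((quat (Κ (+ 0)) (Κ (+ 0)) (Κ (+ 0)) (Κ (+ 0))) P.⋆ (quat a b c d)) ⊜ im ((quat (Κ (+ 0)) (Κ (+ 0)) (Κ (+ 0)) (Κ (+ 0))))) refl a b c d
    lⱼ : ∀ x → jm (0ℍ ⋆ x) ≡ jm (0ℍ)
    lⱼ (quat a b c d) = solve 4 (λ a b c d → jm ((quat (Κ (+ 0)) (Κ (+ 0)) (Κ (+ 0)) (Κ (+ 0))) P.⋆ (quat a b c d)) ⊜ jm ((quat (Κ (+ 0)) (Κ (+ 0)) (Κ (+ 0)) (Κ (+ 0))))) refl a b c d
    lω : ∀ x → om (0ℍ ⋆ x) ≡ om (0ℍ)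
    lω (quat a b c d) = solve 4 (λ a b c d → om ((quat (Κ (+ 0)) (Κ (+ 0)) (Κ (+ 0)) (Κ (+ 0))) P.⋆ (quat a b c d)) ⊜ om ((quat (Κ (+ 0)) (Κ (+ 0)) (Κ (+ 0)) (Κ (+ 0))))) refl a b c d

  0-⊹ : ∀ x → 0ℍ ⊹ x ≡ x
  0-⊹ x = quat-≡ (l₁ x) (lᵢ x) (lⱼ x) (lω x)
    where
    l₁ : ∀ x → re (0ℍ ⊹ x) ≡ re (x)
    l₁ (quat a b c d) = solve 4 (λ a b c d → re ((quat (Κ (+ 0)) (Κ (+ 0)) (Κ (+ 0)) (Κ (+ 0))) P.⊹ (quat a b c d)) ⊜ re ((quat a b c d))) refl a b c d
    lᵢ : ∀ x → im (0ℍ ⊹ x) ≡ im (x)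
    lᵢ (quat a b c d) = solve 4 (λ a b c d → im ((quat (Κ (+ 0)) (Κ (+ 0)) (Κ (+ 0)) (Κ (+ 0))) P.⊹ (quat a b c d)) ⊜ im ((quat a b c d))) refl a b c d
    lⱼ : ∀ x → jm (0ℍ ⊹ x) ≡ jm (x)
    lⱼ (quat a b c d) = solve 4 (λ a b c d → jm ((quat (Κ (+ 0)) (Κ (+ 0)) (Κ (+ 0)) (Κ (+ 0))) P.⊹ (quat a b c d)) ⊜ jm ((quat a b c d))) refl a b c d
    lω : ∀ x → om (0ℍ ⊹ x) ≡ om (x)
    lω (quat a b c d) = solve 4 (λ a b c d → om ((quat (Κ (+ 0)) (Κ (+ 0)) (Κ (+ 0)) (Κ (+ 0))) P.⊹ (quat a b c d)) ⊜ om ((quat a b c d))) refl a b c d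

  •-0 : ∀ s → s • 0ℍ ≡ 0ℍ
  •-0 s = quat-≡ (l₁ s) (lᵢ s) (lⱼ s) (lω s)
    where
    l₁ : ∀ s → re (s • 0ℍ) ≡ re (0ℍ)
    l₁ s = solve 1 (λ s → re (s P.• (quat (Κ (+ 0)) (Κ (+ 0)) (Κ (+ 0)) (Κ (+ 0)))) ⊜ re ((quat (Κ (+ 0)) (Κ (+ 0)) (Κ (+ 0)) (Κ (+ 0))))) refl s
    lᵢ : ∀ s → im (s • 0ℍ) ≡ im (0ℍ)
    lᵢ s = solve 1 (λ s → im (s P.• (quat (Κ (+ 0)) (Κ (+ 0)) (Κ (+ 0)) (Κ (+ 0)))) ⊜ im ((quat (Κ (+ 0)) (Κ (+ 0)) (Κ (+ 0)) (Κ (+ 0))))) refl s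
    lⱼ : ∀ s → jm (s • 0ℍ) ≡ jm (0ℍ)
    lⱼ s = solve 1 (λ s → jm (s P.• (quat (Κ (+ 0)) (Κ (+ 0)) (Κ (+ 0)) (Κ (+ 0)))) ⊜ jm ((quat (Κ (+ 0)) (Κ (+ 0)) (Κ (+ 0)) (Κ (+ 0))))) refl s
    lω : ∀ s → om (s • 0ℍ) ≡ om (0ℍ)
    lω s = solve 1 (λ s → om (s P.• (quat (Κ (+ 0)) (Κ (+ 0)) (Κ (+ 0)) (Κ (+ 0)))) ⊜ om ((quat (Κ (+ 0)) (Κ (+ 0)) (Κ (+ 0)) (Κ (+ 0))))) refl s

  1-• : ∀ x → 1# • x ≡ x
  1-• x = quat-≡ (l₁ x) (lᵢ x) (lⱼ x) (lω x)
    where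
    l₁ : ∀ x → re (1# • x) ≡ re (x)
    l₁ (quat a b c d) = solve 4 (λ a b c d → re (Κ (+ 1) P.• (quat a b c d)) ⊜ re ((quat a b c d))) refl a b c d
    lᵢ : ∀ x → im (1# • x) ≡ im (x)
    lᵢ (quat a b c d) = solve 4 (λ a b c d → im (Κ (+ 1) P.• (quat a b c d)) ⊜ im ((quat a b c d))) refl a b c d
    lⱼ : ∀ x → jm (1# • x) ≡ jm (x)
    lⱼ (quat a b c d) = solve 4 (λ a b c d → jm (Κ (+ 1) P.• (quat a b c d)) ⊜ jm ((quat a b c d))) refl a b c d
    lω : ∀ x → om (1# • x) ≡ om (x)
    lω (quat a b c d) = solve 4 (λ a b c d → om (Κ (+ 1) P.• (quat a b c d)) ⊜ om ((quat a b c d))) refl a b c d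

  ⋆-1 : ∀ x → x ⋆ 1ℍ ≡ x
  ⋆-1 x = quat-≡ (l₁ x) (lᵢ x) (lⱼ x) (lω x)
    where
    l₁ : ∀ x → re (x ⋆ 1ℍ) ≡ re (x)
    l₁ (quat a b c d) = solve 4 (λ a b c d → re ((quat a b c d) P.⋆ (quat (Κ (+ 1)) (Κ (+ 0)) (Κ (+ 0)) (Κ (+ 0)))) ⊜ re ((quat a b c d))) refl a b c d
    lᵢ : ∀ x → im (x ⋆ 1ℍ) ≡ im (x)
    lᵢ (quat a b c d) = solve 4 (λ a b c d → im ((quat a b c d) P.⋆ (quat (Κ (+ 1)) (Κ (+ 0)) (Κ (+ 0)) (Κ (+ 0)))) ⊜ im ((quat a b c d))) refl a b c d
    lⱼ : ∀ x → jm (x ⋆ 1ℍ) ≡ jm (x)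
    lⱼ (quat a b c d) = solve 4 (λ a b c d → jm ((quat a b c d) P.⋆ (quat (Κ (+ 1)) (Κ (+ 0)) (Κ (+ 0)) (Κ (+ 0)))) ⊜ jm ((quat a b c d))) refl a b c d
    lω : ∀ x → om (x ⋆ 1ℍ) ≡ om (x)
    lω (quat a b c d) = solve 4 (λ a b c d → om ((quat a b c d) P.⋆ (quat (Κ (+ 1)) (Κ (+ 0)) (Κ (+ 0)) (Κ (+ 0)))) ⊜ om ((quat a b c d))) refl a b c d

  1-⋆ : ∀ x → 1ℍ ⋆ x ≡ x
  1-⋆ x = quat-≡ (l₁ x) (lᵢ x) (lⱼ x) (lω x)
    where
    l₁ : ∀ x → re (1ℍ ⋆ x) ≡ re (x)
    l₁ (quat a b c d) = solve 4 (λ a b c d → re ((quat (Κ (+ 1)) (Κ (+ 0)) (Κ (+ 0)) (Κ (+ 0))) P.⋆ (quat a b c d)) ⊜ re ((quat a b c d))) refl a b c d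
    lᵢ : ∀ x → im (1ℍ ⋆ x) ≡ im (x)
    lᵢ (quat a b c d) = solve 4 (λ a b c d → im ((quat (Κ (+ 1)) (Κ (+ 0)) (Κ (+ 0)) (Κ (+ 0))) P.⋆ (quat a b c d)) ⊜ im ((quat a b c d))) refl a b c d
    lⱼ : ∀ x → jm (1ℍ ⋆ x) ≡ jm (x)
    lⱼ (quat a b c d) = solve 4 (λ a b c d → jm ((quat (Κ (+ 1)) (Κ (+ 0)) (Κ (+ 0)) (Κ (+ 0))) P.⋆ (quat a b c d)) ⊜ jm ((quat a b c d))) refl a b c d
    lω : ∀ x → om (1ℍ ⋆ x) ≡ om (x)
    lω (quat a b c d) = solve 4 (λ a b c d → om ((quat (Κ (+ 1)) (Κ (+ 0)) (Κ (+ 0)) (Κ (+ 0))) P.⋆ (quat a b c d)) ⊜ om ((quat a b c d))) refl a b c d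

  norm-⋆ : ∀ x y → norm (x ⋆ y) ≡ norm x * norm y
  norm-⋆ (quat a b c d) (quat e f g h) = solve 8 (λ a b c d e f g h → P.norm ((quat a b c d) P.⋆ (quat e f g h)) ⊜ P.norm (quat a b c d) ⊠ P.norm (quat e f g h)) refl a b c d e f g h

  norm-conj : ∀ x → norm (conj x) ≡ norm x
  norm-conj (quat a b c d) = solve 4 (λ a b c d → P.norm (P.conj (quat a b c d)) ⊜ P.norm (quat a b c d)) refl a b c d

  norm-• : ∀ s x → norm (s • x) ≡ s * s * norm x
  norm-• s (quat a b c d) = solve 5 (λ s a b c d → P.norm (s P.• (quat a b c d)) ⊜ s ⊠ s ⊠ P.norm (quat a b c d)) refl s a b c d

  norm-⊹ : ∀ x y → norm (x ⊹ y) ≡ norm x + norm y + tr (x ⋆ conj y)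
  norm-⊹ (quat a b c d) (quat e f g h) = solve 8 (λ a b c d e f g h → P.norm ((quat a b c d) P.⊹ (quat e f g h)) ⊜ P.norm (quat a b c d) ⊞ P.norm (quat e f g h) ⊞ P.tr ((quat a b c d) P.⋆ P.conj (quat e f g h))) refl a b c d e f g h

  norm-neg : ∀ x → norm (neg x) ≡ norm x
  norm-neg (quat a b c d) = solve 4 (λ a b c d → P.norm (P.neg (quat a b c d)) ⊜ P.norm (quat a b c d)) refl a b c d

  tr-⊹ : ∀ x y → tr (x ⊹ y) ≡ tr x + tr y
  tr-⊹ (quat a b c d) (quat e f g h) = solve 8 (λ a b c d e f g h → P.tr ((quat a b c d) P.⊹ (quat e f g h)) ⊜ P.tr (quat a b c d) ⊞ P.tr (quat e f g h)) refl a b c d e f g h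

  tr-• : ∀ s x → tr (s • x) ≡ s * tr x
  tr-• s (quat a b c d) = solve 5 (λ s a b c d → P.tr (s P.• (quat a b c d)) ⊜ s ⊠ P.tr (quat a b c d)) refl s a b c d

  tr-comm : ∀ x y → tr (x ⋆ y) ≡ tr (y ⋆ x)
  tr-comm (quat a b c d) (quat e f g h) = solve 8 (λ a b c d e f g h → P.tr ((quat a b c d) P.⋆ (quat e f g h)) ⊜ P.tr ((quat e f g h) P.⋆ (quat a b c d))) refl a b c d e f g h

  tr-conj : ∀ x → tr (conj x) ≡ tr x
  tr-conj (quat a b c d) = solve 4 (λ a b c d → P.tr (P.conj (quat a b c d)) ⊜ P.tr (quat a b c d)) refl a b c d

  -- Left ideals generated by a scalar and a quaternion.

  LeftIdeal : Carrier → ℍ → ℍ → Set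
  LeftIdeal n s v = ∃₂ λ x y → v ≡ n • x ⊹ y ⋆ s

  ideal-⊹ : ∀ {n s u v} → LeftIdeal n s u → LeftIdeal n s v → LeftIdeal n s (u ⊹ v)
  ideal-⊹ {n} {s} (x , y , refl) (x′ , y′ , refl) = x ⊹ x′ , y ⊹ y′ , (begin
    n • x ⊹ y ⋆ s ⊹ (n • x′ ⊹ y′ ⋆ s)   ≡⟨ ⊹-assoc (n • x) (y ⋆ s) (n • x′ ⊹ y′ ⋆ s) ⟩
    n • x ⊹ (y ⋆ s ⊹ (n • x′ ⊹ y′ ⋆ s)) ≡⟨ cong (n • x ⊹_) (sym (⊹-assoc (y ⋆ s) (n • x′) (y′ ⋆ s))) ⟩
    n • x ⊹ (y ⋆ s ⊹ n • x′ ⊹ y′ ⋆ s)   ≡⟨ cong (λ t → n • x ⊹ (t ⊹ y′ ⋆ s)) (⊹-comm (y ⋆ s) (n • x′)) ⟩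
    n • x ⊹ (n • x′ ⊹ y ⋆ s ⊹ y′ ⋆ s)   ≡⟨ cong (n • x ⊹_) (⊹-assoc (n • x′) (y ⋆ s) (y′ ⋆ s)) ⟩
    n • x ⊹ (n • x′ ⊹ (y ⋆ s ⊹ y′ ⋆ s)) ≡⟨ sym (⊹-assoc (n • x) (n • x′) (y ⋆ s ⊹ y′ ⋆ s)) ⟩
    n • x ⊹ n • x′ ⊹ (y ⋆ s ⊹ y′ ⋆ s)   ≡⟨ cong₂ _⊹_ (sym (•-⊹ n x x′)) (sym (⋆-distribʳ y y′ s)) ⟩
    n • (x ⊹ x′) ⊹ (y ⊹ y′) ⋆ s         ∎)
    where open ≡-Reasoning

  ideal-⋆ : ∀ {n s v} z → LeftIdeal n s v → LeftIdeal n s (z ⋆ v)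
  ideal-⋆ {n} {s} z (x , y , refl) = z ⋆ x , z ⋆ y , trans (⋆-distribˡ z (n • x) (y ⋆ s))
    (cong₂ _⊹_ (⋆-• n z x) (sym (⋆-assoc z y s)))

  ideal-modulus : ∀ {n s} x → LeftIdeal n s (n • x)
  ideal-modulus {n} {s} x = x , 0ℍ , sym (trans (cong (n • x ⊹_) (0-⋆ s)) (⊹-0 (n • x)))

  ideal-generator : ∀ {n s} → LeftIdeal n s s
  ideal-generator {n} {s} = 0ℍ , 1ℍ , sym (trans (cong₂ _⊹_ (•-0 n) (1-⋆ s)) (0-⊹ s))

  -- In the expansion of N(n x + y s) the outer terms carry n² and N(s), and the cross term carries
  -- n. So the norm form divided by n is still integral on the ideal.
  ideal-norm : ∀ {n s v k} → norm s ≡ n * k → LeftIdeal n s v → ∃ λ m → norm v ≡ n * m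
  ideal-norm {n} {s} {_} {k} s≡ (x , y , refl) = n * norm x + norm y * k + tr (x ⋆ conj (y ⋆ s)) , (begin
    norm (n • x ⊹ y ⋆ s)                                            ≡⟨ norm-⊹ (n • x) (y ⋆ s) ⟩
    norm (n • x) + norm (y ⋆ s) + tr (n • x ⋆ conj (y ⋆ s))          ≡⟨ cong₂ _+_ (cong₂ _+_ (norm-• n x) (trans (norm-⋆ y s) (cong (norm y *_) s≡)))
                                                                          (trans (cong tr (•-⋆ n x (conj (y ⋆ s)))) (tr-• n (x ⋆ conj (y ⋆ s)))) ⟩
    n * n * norm x + norm y * (n * k) + n * tr (x ⋆ conj (y ⋆ s))    ≡⟨ lemma n (norm x) (norm y) k (tr (x ⋆ conj (y ⋆ s))) ⟩
    n * (n * norm x + norm y * k + tr (x ⋆ conj (y ⋆ s)))            ∎)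
    where
    open ≡-Reasoning
    lemma : ∀ n X Y k t → n * n * X + Y * (n * k) + n * t ≡ n * (n * X + Y * k + t)
    lemma = solve 5 (λ n X Y k t → n ⊠ n ⊠ X ⊞ Y ⊠ (n ⊠ k) ⊞ n ⊠ t ⊜ n ⊠ (n ⊠ X ⊞ Y ⊠ k ⊞ t)) refl

  -- Because s s̄ = N(s) is divisible by n. Multiplying the result by v on the right exhibits N(v) s
  -- as n times a left multiple of v, which is how right divisors of s are recognised later.
  ideal-conj : ∀ {n s v k} → norm s ≡ n * k → LeftIdeal n s v → ∃ λ w → s ⋆ conj v ≡ n • w
  ideal-conj {n} {s} {_} {k} s≡ (x , y , refl) = s ⋆ conj x ⊹ k • conj y , (begin
    s ⋆ conj (n • x ⊹ y ⋆ s)                 ≡⟨ cong (s ⋆_) (trans (conj-⊹ (n • x) (y ⋆ s)) (cong₂ _⊹_ (conj-• n x) (conj-⋆ y s))) ⟩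
    s ⋆ (n • conj x ⊹ conj s ⋆ conj y)       ≡⟨ ⋆-distribˡ s (n • conj x) (conj s ⋆ conj y) ⟩
    s ⋆ (n • conj x) ⊹ s ⋆ (conj s ⋆ conj y) ≡⟨ cong₂ _⊹_ (⋆-• n s (conj x)) (trans (sym (⋆-assoc s (conj s) (conj y))) (trans (cong (_⋆ conj y) (⋆-conj s)) (embed-⋆ (norm s) (conj y)))) ⟩
    n • (s ⋆ conj x) ⊹ norm s • conj y       ≡⟨ cong (n • (s ⋆ conj x) ⊹_) (trans (cong (_• conj y) s≡) (sym (•-• n k (conj y)))) ⟩
    n • (s ⋆ conj x) ⊹ n • (k • conj y)      ≡⟨ sym (•-⊹ n (s ⋆ conj x) (k • conj y)) ⟩
    n • (s ⋆ conj x ⊹ k • conj y)            ∎)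
    where open ≡-Reasoning

open import Data.Integer using (_+_; _*_; _-_; -_; _≤_; _<_)

-- Sums of two squares that are −1 modulo an odd number.

inverse-mod-prime : ∀ {p} → Prime p → (x : ℤ) →
  (∃ λ k → x ≡ + p * k) ⊎ (∃₂ λ y z → x * y ≡ + 1 + + p * z)
inverse-mod-prime {p} pr x = go (x ℤ.%ℕ p) (ℤ.n%ℕd<d x p) (ℤ.a≡a%ℕn+[a/ℕn]*n x p)
  where
  instance _ = prime⇒nonZero pr
  q = x ℤ./ℕ p
  plus : ∀ r q p y z → r * y ≡ + 1 + p * z → (r + q * p) * y ≡ + 1 + p * (z + q * y)
  plus r q p y z e = trans (lemma₁ r q p y) (trans (cong (_+ p * (q * y)) e) (lemma₂ q p y z))
    where
    lemma₁ : ∀ r q p y → (r + q * p) * y ≡ r * y + p * (q * y)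
    lemma₁ = solve-∀
    lemma₂ : ∀ q p y z → + 1 + p * z + p * (q * y) ≡ + 1 + p * (z + q * y)
    lemma₂ = solve-∀
  ℕ⇒ℤ : ∀ a b c d → 1 ℕ.+ a ℕ.* b ≡ c ℕ.* d → + c * + d ≡ + 1 + + a * + b
  ℕ⇒ℤ a b c d e = trans (sym (ℤ.pos-* c d)) (trans (cong +_ (sym e))
    (trans (ℤ.pos-+ 1 (a ℕ.* b)) (cong (_+_ (+ 1)) (ℤ.pos-* a b))))
  go : ∀ r → r ℕ.< p → x ≡ + r + q * + p →
       (∃ λ k → x ≡ + p * k) ⊎ (∃₂ λ y z → x * y ≡ + 1 + + p * z)
  go zero _ e = inj₁ (q , trans e (trans (ℤ.+-identityˡ _) (ℤ.*-comm q (+ p))))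
  go r@(suc _) r<p e with Coprimality.coprime-Bézout (Coprimality.prime⇒coprime pr r<p)
  ... | Bézout.-+ a b eq = inj₂ (+ b , _ , trans (cong (_* + b) e)
          (plus (+ r) q (+ p) (+ b) (+ a)
            (trans (ℤ.*-comm (+ r) (+ b)) (trans (ℕ⇒ℤ a p b r eq) (cong (_+_ (+ 1)) (ℤ.*-comm (+ a) (+ p)))))))
  ... | Bézout.+- a b eq = inj₂ (- (+ b) , _ , trans (cong (_* - (+ b)) e)
          (plus (+ r) q (+ p) (- (+ b)) (- (+ a))
            (trans (lemma (+ b) (+ r)) (trans (cong (_-_ (+ 1)) (sym (ℕ⇒ℤ b r a p eq))) (lemma′ (+ a) (+ p))))))
    where
    lemma : ∀ b r → r * (- b) ≡ + 1 - (+ 1 + b * r)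
    lemma = solve-∀
    lemma′ : ∀ a p → + 1 - a * p ≡ + 1 + p * (- a)
    lemma′ = solve-∀

MinusOneIsSumOfTwoSquaresMod : ℤ → Set
MinusOneIsSumOfTwoSquaresMod N = ∃₂ λ a b → ∃ λ k → a * a + b * b + + 1 ≡ N * k

odd-half : ∀ {n} → ¬ 2 ℕ.∣ n → ∃ λ q → n ≡ 1 ℕ.+ q ℕ.* 2
odd-half {n} odd = go (n ℕ.% 2) (ℕ.m%n<n n 2) (ℕ.m≡m%n+[m/n]*n n 2)
  where
  go : ∀ r → r ℕ.< 2 → n ≡ r ℕ.+ n ℕ./ 2 ℕ.* 2 → ∃ λ q → n ≡ 1 ℕ.+ q ℕ.* 2
  go 0 _ e = ⊥-elim (odd (ℕ.divides (n ℕ./ 2) e))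
  go 1 _ e = n ℕ./ 2 , e
  go (suc (suc r)) (s≤s (s≤s ())) _

-- b² - a² = (b - a)(b + a), and both factors lie strictly between 0 and p because a < b ≤ q = (p -
-- 1) / 2.
squares-distinct-mod : ∀ {p} → Prime p → ∀ {a b q} → p ≡ 1 ℕ.+ q ℕ.* 2 → a ℕ.< b → b ℕ.≤ q →
  ∀ k → ¬ (+ b * + b - + a * + a ≡ + p * k)
squares-distinct-mod {p} pr {a} {b} {q} p≡ a<b b≤q k eq = go (ℕ.m≤n⇒∃[o]m+o≡n a<b)
  where
  too-small : ∀ m → m ℕ.≤ q ℕ.+ q → .{{ℕ.NonZero m}} → ¬ (p ℕ.∣ m)
  too-small m m≤ p∣m = ℕ.<-irrefl refl (ℕ.<-≤-trans
    (subst (m ℕ.<_) (sym p≡) (s≤s (subst (m ℕ.≤_) (trans (cong (q ℕ.+_) (sym (ℕ.+-identityʳ q))) (ℕ.*-comm 2 q)) m≤)))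
    (ℕ.∣⇒≤ p∣m))
  identity : ∀ a c → (a + c) * (a + c) - a * a ≡ c * (a + a + c)
  identity = solve-∀
  go : ∃ (λ o → suc a ℕ.+ o ≡ b) → ⊥
  go (o , e) with euclidsLemma (suc o) (a ℕ.+ b) pr
      (ℕ.divides ∣ k ∣ (trans natural (ℕ.*-comm p ∣ k ∣)))
    where
    b≡ : + b ≡ + a + + suc o
    b≡ = trans (cong +_ (trans (sym e) (sym (ℕ.+-suc a o)))) (ℤ.pos-+ a (suc o))
    natural : suc o ℕ.* (a ℕ.+ b) ≡ p ℕ.* ∣ k ∣
    natural = trans (cong ∣_∣ (sym step)) (trans (cong ∣_∣ eq) (ℤ.abs-* (+ p) k))
      where
      step : + b * + b - + a * + a ≡ + (suc o ℕ.* (a ℕ.+ b))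
      step = trans (cong (λ t → t * t - + a * + a) b≡) (trans (identity (+ a) (+ suc o))
        (trans (cong (+ suc o *_) (trans (ℤ.+-assoc (+ a) (+ a) (+ suc o)) (trans (cong (_+_ (+ a)) (sym b≡)) (sym (ℤ.pos-+ a b)))))
          (sym (ℤ.pos-* (suc o) (a ℕ.+ b)))))
  ... | inj₁ p∣ = too-small (suc o) (ℕ.≤-trans (ℕ.≤-trans (subst (suc o ℕ.≤_) (trans (ℕ.+-suc a o) e) (ℕ.m≤n+m (suc o) a)) b≤q) (ℕ.m≤m+n q q)) p∣
  ... | inj₂ p∣ = too-small (a ℕ.+ b) (ℕ.+-mono-≤ (ℕ.≤-trans (ℕ.<⇒≤ a<b) b≤q) b≤q) {{nz}} p∣
    where
    nz : ℕ.NonZero (a ℕ.+ b)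
    nz = ℕ.>-nonZero (ℕ.<-≤-trans (ℕ.≤-<-trans z≤n a<b) (ℕ.m≤n+m b a))

-- The (p + 1) / 2 squares and the (p + 1) / 2 numbers −1 − x² cannot be distinct modulo p.
minus-one-mod-prime : ∀ {p} → Prime p → ¬ 2 ℕ.∣ p → MinusOneIsSumOfTwoSquaresMod (+ p)
minus-one-mod-prime {p} pr odd with odd-half odd
... | q , p≡ = collide (Fin.pigeonhole (ℕ.n<1+n p) f)
  where
  instance _ = prime⇒nonZero pr
  g : ∀ i → i ℕ.≤ q ⊎ q ℕ.< i → ℤ
  g i (inj₁ _) = + i * + i
  g i (inj₂ _) = - (+ 1) - + (i ℕ.∸ suc q) * + (i ℕ.∸ suc q)
  G : ℕ → ℤ
  G i = g i (ℕ.≤-<-connex i q)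
  f : Fin (suc p) → Fin p
  f i = fromℕ< (ℤ.n%ℕd<d (G (toℕ i)) p)
  same-residue : ∀ x y → x ℤ.%ℕ p ≡ y ℤ.%ℕ p → ∃ λ k → y - x ≡ + p * k
  same-residue x y e = y ℤ./ℕ p - x ℤ./ℕ p , trans (cong₂ _-_ (ℤ.a≡a%ℕn+[a/ℕn]*n y p)
      (trans (ℤ.a≡a%ℕn+[a/ℕn]*n x p) (cong (λ r → + r + x ℤ./ℕ p * + p) e)))
    (lemma (+ (y ℤ.%ℕ p)) (x ℤ./ℕ p) (y ℤ./ℕ p) (+ p))
    where
    lemma : ∀ r u v p → (r + v * p) - (r + u * p) ≡ p * (v - u)
    lemma = solve-∀
  half : ∀ {j} → j ℕ.≤ p → j ℕ.∸ suc q ℕ.≤ q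
  half {j} j≤p = ℕ.≤-trans (ℕ.∸-monoˡ-≤ (suc q) (subst (j ℕ.≤_) (trans p≡ (cong suc (trans (ℕ.*-comm q 2) (cong (q ℕ.+_) (ℕ.+-identityʳ q))))) j≤p))
    (ℕ.≤-reflexive (ℕ.m+n∸m≡n q q))
  cases : ∀ i j → i ℕ.< j → j ℕ.≤ p → (ci : i ℕ.≤ q ⊎ q ℕ.< i) (cj : j ℕ.≤ q ⊎ q ℕ.< j) →
          ∃ (λ k → g j cj - g i ci ≡ + p * k) → MinusOneIsSumOfTwoSquaresMod (+ p)
  cases i j i<j _ (inj₁ _) (inj₁ j≤q) (k , e) = ⊥-elim (squares-distinct-mod pr p≡ i<j j≤q k e)
  cases i j i<j _ (inj₂ q<i) (inj₁ j≤q) _ = ⊥-elim (ℕ.<-irrefl refl (ℕ.<-≤-trans (ℕ.<-trans q<i i<j) j≤q))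
  -- Only a collision between the two families survives, and it reads i² ≡ -1 - y² modulo p with y =
  -- j - q - 1.
  cases i j i<j _ (inj₁ _) (inj₂ _) (k , e) =
    + i , + (j ℕ.∸ suc q) , - k , trans (lemma (+ i) (+ (j ℕ.∸ suc q))) (trans (cong -_ e) (lemma′ (+ p) k))
    where
    lemma : ∀ x y → x * x + y * y + + 1 ≡ - ((- (+ 1) - y * y) - x * x)
    lemma = solve-∀
    lemma′ : ∀ p k → - (p * k) ≡ p * (- k)
    lemma′ = solve-∀
  cases i j i<j j≤p (inj₂ q<i) (inj₂ _) (k , e) =
    ⊥-elim (squares-distinct-mod pr p≡ (ℕ.∸-monoˡ-< i<j q<i) (half j≤p) (- k)
      (trans (lemma (+ (i ℕ.∸ suc q)) (+ (j ℕ.∸ suc q))) (trans (cong -_ e) (lemma′ (+ p) k))))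
    where
    lemma : ∀ x y → y * y - x * x ≡ - ((- (+ 1) - y * y) - (- (+ 1) - x * x))
    lemma = solve-∀
    lemma′ : ∀ p k → - (p * k) ≡ p * (- k)
    lemma′ = solve-∀
  collide : ∃₂ (λ i j → i Fin.< j × f i ≡ f j) → MinusOneIsSumOfTwoSquaresMod (+ p)
  collide (i , j , i<j , e) = cases (toℕ i) (toℕ j) i<j (ℕ.≤-pred (Fin.toℕ<n j)) (ℕ.≤-<-connex (toℕ i) q) (ℕ.≤-<-connex (toℕ j) q)
    (same-residue (G (toℕ i)) (G (toℕ j)) (Fin.fromℕ<-injective _ _ _ _ e))

-- Newton's correction of a: with y inverse to a and h inverse to 2 modulo p, subtracting N k y h
-- lowers a² by N k up to multiples of p N. The quadratic term is harmless since p divides N.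
hensel-identity : ∀ a b N p M k y z h → N ≡ p * M → a * a + b * b + + 1 ≡ N * k → a * y ≡ + 1 + p * z → + 2 * h ≡ + 1 + p →
    (a - N * k * y * h) * (a - N * k * y * h) + b * b + + 1 ≡ p * N * (M * k * y * h * (k * y * h) - k * (+ 1 + z + p * z))
hensel-identity a b N p M k y z h refl e₁ e₂ e₃ = trans (lemma₁ a b p M k y h)
  (trans (cong₂ (λ u v → u - p * M * k * v + p * M * (p * M) * (k * y * h) * (k * y * h)) e₁ (cong₂ _*_ e₂ e₃)) (lemma₂ p M k y z h))
  where
  lemma₁ : ∀ a b p M k y h → (a - p * M * k * y * h) * (a - p * M * k * y * h) + b * b + + 1 ≡
    (a * a + b * b + + 1) - p * M * k * (a * y * (+ 2 * h)) + p * M * (p * M) * (k * y * h) * (k * y * h)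
  lemma₁ = solve-∀
  lemma₂ : ∀ p M k y z h → p * M * k - p * M * k * ((+ 1 + p * z) * (+ 1 + p)) + p * M * (p * M) * (k * y * h) * (k * y * h) ≡
    p * (p * M) * (M * k * y * h * (k * y * h) - k * (+ 1 + z + p * z))
  lemma₂ = solve-∀

hensel-step : ∀ a b N p M k y z h → N ≡ p * M → a * a + b * b + + 1 ≡ N * k → a * y ≡ + 1 + p * z → + 2 * h ≡ + 1 + p →
  MinusOneIsSumOfTwoSquaresMod (p * N)
hensel-step a b N p M k y z h N≡ e₁ e₂ e₃ =
  (a - N * k * y * h) , b , (M * k * y * h * (k * y * h) - k * (+ 1 + z + p * z)) , hensel-identity a b N p M k y z h N≡ e₁ e₂ e₃

half-mod-odd : ∀ {n} → ¬ 2 ℕ.∣ n → ∃ λ h → + 2 * h ≡ + 1 + + n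
half-mod-odd {n} odd with odd-half odd
... | q , refl = + 1 + + q , trans (lemma (+ q)) (cong (_+_ (+ 1)) (sym (trans (ℤ.pos-+ 1 (q ℕ.* 2)) (cong (_+_ (+ 1)) (ℤ.pos-* q 2)))))
  where
  lemma : ∀ h → + 2 * (+ 1 + h) ≡ + 1 + (+ 1 + h * + 2)
  lemma = solve-∀

-- Chinese remainder: N y is 1 modulo p and 0 modulo N, so A and B agree with a₀ and b₀ modulo p and
-- with a and b modulo N. Then X = X (N y - p z) is divisible by p N, each summand by one of the two
-- congruences.
remainder-step : ∀ a b N p k y z → N * y ≡ + 1 + p * z → a * a + b * b + + 1 ≡ N * k →
  MinusOneIsSumOfTwoSquaresMod p → MinusOneIsSumOfTwoSquaresMod (p * N)
remainder-step a b N p k y z ey e (a₀ , b₀ , k₀ , e₀) =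
  A , B , k₀′ * y - K * z , trans (combine X N p y z ey) (trans (cong₂ (λ u v → u * N * y - v * p * z) X≡p X≡N) (factor p N K k₀′ y z))
  where
  A = a + N * y * (a₀ - a)
  B = b + N * y * (b₀ - b)
  X = A * A + B * B + + 1
  crt : ∀ a a₀ N y p z → N * y ≡ + 1 + p * z → a + N * y * (a₀ - a) ≡ a₀ + p * (z * (a₀ - a))
  crt a a₀ N y p z ey = trans (cong (λ t → a + t * (a₀ - a)) ey) (lemma a a₀ p z)
    where
    lemma : ∀ a a₀ p z → a + (+ 1 + p * z) * (a₀ - a) ≡ a₀ + p * (z * (a₀ - a))
    lemma = solve-∀
  shift : ∀ a b u v N k → a * a + b * b + + 1 ≡ N * k →
          (a + N * u) * (a + N * u) + (b + N * v) * (b + N * v) + + 1 ≡ N * (k + + 2 * a * u + N * u * u + + 2 * b * v + N * v * v)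
  shift a b u v N k e = trans (lemma₁ a b u v N) (trans (cong (_+ N * (+ 2 * a * u + N * u * u + + 2 * b * v + N * v * v)) e) (lemma₂ a b u v N k))
    where
    lemma₁ : ∀ a b u v N → (a + N * u) * (a + N * u) + (b + N * v) * (b + N * v) + + 1 ≡ (a * a + b * b + + 1) + N * (+ 2 * a * u + N * u * u + + 2 * b * v + N * v * v)
    lemma₁ = solve-∀
    lemma₂ : ∀ a b u v N k → N * k + N * (+ 2 * a * u + N * u * u + + 2 * b * v + N * v * v) ≡ N * (k + + 2 * a * u + N * u * u + + 2 * b * v + N * v * v)
    lemma₂ = solve-∀
  K = k + + 2 * a * (y * (a₀ - a)) + N * (y * (a₀ - a)) * (y * (a₀ - a)) + + 2 * b * (y * (b₀ - b)) + N * (y * (b₀ - b)) * (y * (b₀ - b))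
  X≡N : X ≡ N * K
  X≡N = trans (cong₂ (λ u v → (a + u) * (a + u) + (b + v) * (b + v) + + 1) (ℤ.*-assoc N y (a₀ - a)) (ℤ.*-assoc N y (b₀ - b)))
    (shift a b (y * (a₀ - a)) (y * (b₀ - b)) N k e)
  k₀′ = k₀ + + 2 * a₀ * (z * (a₀ - a)) + p * (z * (a₀ - a)) * (z * (a₀ - a)) + + 2 * b₀ * (z * (b₀ - b)) + p * (z * (b₀ - b)) * (z * (b₀ - b))
  X≡p : X ≡ p * k₀′
  X≡p = trans (cong₂ (λ u v → u * u + v * v + + 1) (crt a a₀ N y p z ey) (crt b b₀ N y p z ey))
    (shift a₀ b₀ (z * (a₀ - a)) (z * (b₀ - b)) p k₀ e₀)
  combine : ∀ X N p y z → N * y ≡ + 1 + p * z → X ≡ X * N * y - X * p * z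
  combine X N p y z e = trans (lemma₁ X p z) (trans (cong (λ t → X * t - X * p * z) (sym e)) (lemma₂ X N p y z))
    where
    lemma₁ : ∀ X p z → X ≡ X * (+ 1 + p * z) - X * p * z
    lemma₁ = solve-∀
    lemma₂ : ∀ X N p y z → X * (N * y) - X * p * z ≡ X * N * y - X * p * z
    lemma₂ = solve-∀
  factor : ∀ p N K k y z → p * k * N * y - N * K * p * z ≡ p * N * (k * y - K * z)
  factor = solve-∀

-- Hensel lifting if p ∣ N, the Chinese remainder theorem otherwise.
minus-one-lift : ∀ {p N} → Prime p → ¬ 2 ℕ.∣ p →
  MinusOneIsSumOfTwoSquaresMod N → MinusOneIsSumOfTwoSquaresMod (+ p * N)
minus-one-lift {p} {N} pr odd (a , b , k , e) with inverse-mod-prime pr N | half-mod-odd odd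
... | inj₁ (M , N≡) | h , 2h≡ = hensel (inverse-mod-prime pr a) (inverse-mod-prime pr b)
  where
  swap : ∀ a b → b * b + a * a + + 1 ≡ a * a + b * b + + 1
  swap = solve-∀
  -- Lifting needs a root that is invertible modulo p; a and b cannot both be divisible by p, since
  -- p divides a² + b² + 1.
  p∤1 : ∀ {x y} → a ≡ + p * x → b ≡ + p * y → ⊥
  p∤1 {x} {y} ex ey = ¬prime[1] (subst Prime (ℕ.∣1⇒≡1 (ℕ.divides ∣ M * k - + p * x * x - + p * y * y ∣
    (trans (cong ∣_∣ (trans (one a b) (trans (cong₂ _-_ (trans e (cong (_* k) N≡)) (cong₂ (λ u v → u * u + v * v) ex ey)) (factor (+ p) x y M k))))
      (trans (ℤ.abs-* (+ p) _) (ℕ.*-comm p _))))) pr)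
    where
    one : ∀ a b → + 1 ≡ (a * a + b * b + + 1) - (a * a + b * b)
    one = solve-∀
    factor : ∀ p x y M k → p * M * k - (p * x * (p * x) + p * y * (p * y)) ≡ p * (M * k - p * x * x - p * y * y)
    factor = solve-∀
  hensel : (∃ λ k → a ≡ + p * k) ⊎ (∃₂ λ y z → a * y ≡ + 1 + + p * z) → (∃ λ k → b ≡ + p * k) ⊎ (∃₂ λ y z → b * y ≡ + 1 + + p * z) →
           MinusOneIsSumOfTwoSquaresMod (+ p * N)
  hensel (inj₂ (y , z , ey)) _ = hensel-step a b N (+ p) M k y z h N≡ e ey 2h≡
  hensel (inj₁ _) (inj₂ (y , z , ey)) = hensel-step b a N (+ p) M k y z h N≡ (trans (swap a b) e) ey 2h≡
  hensel (inj₁ (x , ex)) (inj₁ (y , ey)) = ⊥-elim (p∤1 ex ey)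
... | inj₂ (y , z , ey) | _ = remainder-step a b N (+ p) k y z ey e (minus-one-mod-prime pr odd)

minus-one-mod-odd : ∀ n .{{_ : ℕ.NonZero n}} → ¬ 2 ℕ.∣ n → MinusOneIsSumOfTwoSquaresMod (+ n)
minus-one-mod-odd n odd = subst (λ n → MinusOneIsSumOfTwoSquaresMod (+ n)) (sym isFactorisation)
  (go factors factorsPrime (subst (λ n → ¬ 2 ℕ.∣ n) isFactorisation odd))
  where
  open PrimeFactorisation (factorise n)
  go : ∀ ps → All Prime ps → ¬ 2 ℕ.∣ product ps → MinusOneIsSumOfTwoSquaresMod (+ product ps)
  go [] [] _ = + 0 , + 0 , + 1 , refl
  go (p ∷ ps) (pr ∷ prs) odd = subst MinusOneIsSumOfTwoSquaresMod (sym (ℤ.pos-* p (product ps)))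
    (minus-one-lift pr (λ d → odd (ℕ.∣m⇒∣m*n (product ps) d)) (go ps prs (λ d → odd (ℕ.∣n⇒∣m*n p d))))

-- The Hurwitz order over ℤ and its Euclidean division.

ℤ-algebra : IntegerAlgebra
ℤ-algebra = record
  { Carrier = ℤ ; _+_ = _+_ ; _*_ = _*_ ; -_ = -_ ; fromℤ = λ x → x
  ; isCommutativeRing = CommutativeRing.isCommutativeRing ℤ.+-*-commutativeRing
  ; fromℤ-+ = λ _ _ → refl ; fromℤ-* = λ _ _ → refl ; fromℤ-neg = λ _ → refl }

open Quaternions ℤ-algebra using () renaming
  ( ℍ to ℍᶻ; _⊹_ to _⊹ᶻ_; _⋆_ to _⋆ᶻ_; _•_ to _•ᶻ_; conj to conjᶻ; neg to negᶻ
  ; norm to normᶻ; tr to trᶻ; embed to embedᶻ; 0ℍ to 0ℍᶻ; 1ℍ to 1ℍᶻ; ⋆-assoc to ⋆-assocᶻ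
  ; ⋆-distribˡ to ⋆-distribˡᶻ; ⋆-distribʳ to ⋆-distribʳᶻ; conj-⋆ to conj-⋆ᶻ; •-⋆ to •-⋆ᶻ; ⋆-• to ⋆-•ᶻ; conj-⊹ to conj-⊹ᶻ
  ; conj-• to conj-•ᶻ; conj-conj to conj-conjᶻ; conj-neg to conj-negᶻ; ⋆-neg to ⋆-negᶻ; neg-⋆ to neg-⋆ᶻ; ⊹-comm to ⊹-commᶻ
  ; ⊹-assoc to ⊹-assocᶻ; •-⊹ to •-⊹ᶻ; •-neg to •-negᶻ; •-• to •-•ᶻ; ⋆-conj to ⋆-conjᶻ; conj-⋆-self to conj-⋆-selfᶻ
  ; embed-⋆ to embed-⋆ᶻ; ⋆-embed to ⋆-embedᶻ; ⊖-self to ⊖-selfᶻ; ⊹-0 to ⊹-0ᶻ; 0-⋆ to 0-⋆ᶻ; ⋆-1 to ⋆-1ᶻ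
  ; norm-⋆ to norm-⋆ᶻ; norm-conj to norm-conjᶻ; norm-• to norm-•ᶻ; norm-⊹ to norm-⊹ᶻ; norm-neg to norm-negᶻ; tr-⊹ to tr-⊹ᶻ
  ; tr-• to tr-•ᶻ; tr-comm to tr-commᶻ; tr-conj to tr-conjᶻ; LeftIdeal to LeftIdealᶻ; ideal-⊹ to ideal-⊹ᶻ; ideal-⋆ to ideal-⋆ᶻ
  ; ideal-modulus to ideal-modulusᶻ; ideal-generator to ideal-generatorᶻ; ideal-norm to ideal-normᶻ; ideal-conj to ideal-conjᶻ )

0≤+ : ∀ {a b} → + 0 ≤ a → + 0 ≤ b → + 0 ≤ a + b
0≤+ p q = ℤ.+-mono-≤ p q

0≤* : ∀ {a b} → + 0 ≤ a → + 0 ≤ b → + 0 ≤ a * b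
0≤* {+ m} {+ n} _ _ = subst (+ 0 ≤_) (ℤ.pos-* m n) (+≤+ z≤n)

0<* : ∀ {a b} → + 0 < a → + 0 < b → + 0 < a * b
0<* {+ suc m} {+ suc n} _ _ = subst (+ 0 <_) (ℤ.pos-* (suc m) (suc n)) (+<+ (s≤s z≤n))
0<* {+ zero} (+<+ ())
0<* {+ suc m} {+ zero} _ (+<+ ())

0≤² : ∀ a → + 0 ≤ a * a
0≤² (+ m) = 0≤* {+ m} {+ m} (+≤+ z≤n) (+≤+ z≤n)
0≤² -[1+ m ] = +≤+ z≤n

≢0⇒0<² : ∀ {a} → a ≢ + 0 → + 0 < a * a
≢0⇒0<² {+ zero} a≢0 = ⊥-elim (a≢0 refl)
≢0⇒0<² {+ suc m} _ = 0<* {+ suc m} {+ suc m} (+<+ (s≤s z≤n)) (+<+ (s≤s z≤n))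
≢0⇒0<² { -[1+ m ]} _ = +<+ (s≤s z≤n)

0≤*-cancel : ∀ {a b} → + 0 < a → + 0 ≤ a * b → + 0 ≤ b
0≤*-cancel {+ zero} (+<+ ()) _
0≤*-cancel {+ suc m} {+ n} _ _ = +≤+ z≤n
0≤*-cancel {+ suc m} { -[1+ n ]} _ ()

0<*-cancel : ∀ {a b} → + 0 < a → + 0 < a * b → + 0 < b
0<*-cancel {+ zero} (+<+ ()) _
0<*-cancel {+ suc m} {+ suc n} _ _ = +<+ (s≤s z≤n)
0<*-cancel {+ suc m} {+ zero} _ q = ⊥-elim (ℤ.<-irrefl (sym (ℤ.*-zeroʳ (+ suc m))) q)
0<*-cancel {+ suc m} { -[1+ n ]} _ ()

0<⇒≢0 : ∀ {a} → + 0 < a → a ≢ + 0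
0<⇒≢0 p refl = ℤ.<-irrefl refl p

0≤∧≢0⇒0< : ∀ {a} → + 0 ≤ a → a ≢ + 0 → + 0 < a
0≤∧≢0⇒0< p n = ℤ.≤∧≢⇒< p (λ e → n (sym e))

*-cancelˡ : ∀ {a b c} → a ≢ + 0 → a * b ≡ a * c → b ≡ c
*-cancelˡ {a} {b} {c} a≢0 = ℤ.*-cancelˡ-≡ a b c {{ℤ.≢-nonZero a≢0}}

+-cancelʳ : ∀ c {a b} → a + c ≡ b + c → a ≡ b
+-cancelʳ c {a} {b} e = trans (lemma a c) (trans (cong (_- c) e) (sym (lemma b c)))
  where
  lemma : ∀ a c → a ≡ a + c - c
  lemma = solve-∀

0≤-⇒≤ : ∀ {a b} → + 0 ≤ b - a → a ≤ b
0≤-⇒≤ = ℤ.0≤i-j⇒j≤i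

≤⇒0≤- : ∀ {a b} → a ≤ b → + 0 ≤ b - a
≤⇒0≤- = ℤ.i≤j⇒0≤j-i

-- Rounding A / n to an even and to an odd number, with remainders e and f of opposite signs.
Rounding : ℤ → ℤ → Set
Rounding n A = ∃₂ λ p q → ∃₂ λ e f →
  A ≡ n * (+ 2 * p) + e × A ≡ n * (+ 2 * q + + 1) + f × + 0 ≤ n * n - (e * e + f * f)

rounding : ∀ n → + 0 < n → ∀ A → Rounding n A
rounding (+ zero) (+<+ ())
rounding (+ n@(suc _)) 0<n A = go (A ℤ.%ℕ n) (A ℤ./ℕ n) (A ℤ./ℕ n ℤ.%ℕ 2) (A ℤ./ℕ n ℤ./ℕ 2)
  (ℤ.n%ℕd<d A n) (ℤ.n%ℕd<d (A ℤ./ℕ n) 2) (ℤ.a≡a%ℕn+[a/ℕn]*n A n) (ℤ.a≡a%ℕn+[a/ℕn]*n (A ℤ./ℕ n) 2)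
  where
  bound : ∀ r → r ℕ.< n → + 0 ≤ + n * + n - (+ r * + r + (+ r - + n) * (+ r - + n))
  bound r r<n = subst (+ 0 ≤_) (lemma (+ n) (+ r)) (0≤* {+ 2} (+≤+ z≤n)
    (0≤* {+ r} (+≤+ z≤n) (≤⇒0≤- (+≤+ (ℕ.<⇒≤ r<n)))))
    where
    lemma : ∀ n r → + 2 * (r * (n - r)) ≡ n * n - (r * r + (r - n) * (r - n))
    lemma = solve-∀
  go : ∀ r k b h → r ℕ.< n → b ℕ.< 2 → A ≡ + r + k * + n → k ≡ + b + h * + 2 → Rounding (+ n) A
  go r k 0 h r<n _ A≡ k≡ = h , h , + r , + r - + n ,
    trans A≡ (trans (cong (λ k → + r + k * + n) k≡) (lemma₁ (+ r) h (+ n))) ,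
    trans A≡ (trans (cong (λ k → + r + k * + n) k≡) (lemma₂ (+ r) h (+ n))) , bound r r<n
    where
    lemma₁ : ∀ r h n → r + (+ 0 + h * + 2) * n ≡ n * (+ 2 * h) + r
    lemma₁ = solve-∀
    lemma₂ : ∀ r h n → r + (+ 0 + h * + 2) * n ≡ n * (+ 2 * h + + 1) + (r - n)
    lemma₂ = solve-∀
  go r k 1 h r<n _ A≡ k≡ = h + + 1 , h , + r - + n , + r ,
    trans A≡ (trans (cong (λ k → + r + k * + n) k≡) (lemma₁ (+ r) h (+ n))) ,
    trans A≡ (trans (cong (λ k → + r + k * + n) k≡) (lemma₂ (+ r) h (+ n))) ,
    subst (λ t → + 0 ≤ + n * + n - t) (ℤ.+-comm (+ r * + r) _) (bound r r<n)
    where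
    lemma₁ : ∀ r h n → r + (+ 1 + h * + 2) * n ≡ n * (+ 2 * (h + + 1)) + (r - n)
    lemma₁ = solve-∀
    lemma₂ : ∀ r h n → r + (+ 1 + h * + 2) * n ≡ n * (+ 2 * h + + 1) + r
    lemma₂ = solve-∀
  go r k (suc (suc _)) h _ (s≤s (s≤s ())) _ _

four-normᶻ : ∀ a b c d → + 4 * normᶻ (quat a b c d) ≡
  (+ 2 * a + d) * (+ 2 * a + d) + (+ 2 * b + d) * (+ 2 * b + d) + (+ 2 * c + d) * (+ 2 * c + d) + d * d
four-normᶻ = lemma
  where
  lemma : ∀ a b c d → + 4 * (a * a + b * b + c * c + d * d + d * (a + b + c)) ≡
    (+ 2 * a + d) * (+ 2 * a + d) + (+ 2 * b + d) * (+ 2 * b + d) + (+ 2 * c + d) * (+ 2 * c + d) + d * d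
  lemma = solve-∀

0≤normᶻ : ∀ x → + 0 ≤ normᶻ x
0≤normᶻ (quat a b c d) = 0≤*-cancel {+ 4} (+<+ (s≤s z≤n)) (subst (+ 0 ≤_) (sym (four-normᶻ a b c d))
  (0≤+ (0≤+ (0≤+ (0≤² (+ 2 * a + d)) (0≤² (+ 2 * b + d))) (0≤² (+ 2 * c + d))) (0≤² d)))

0≤sum≡0 : ∀ {a b} → + 0 ≤ a → + 0 ≤ b → a + b ≡ + 0 → a ≡ + 0 × b ≡ + 0
0≤sum≡0 {+ zero} {+ zero} _ _ _ = refl , refl

²≡0 : ∀ {a} → a * a ≡ + 0 → a ≡ + 0
²≡0 {a} e with ℤ.i*j≡0⇒i≡0∨j≡0 a e
... | inj₁ p = p
... | inj₂ p = p

normᶻ≡0 : ∀ x → normᶻ x ≡ + 0 → x ≡ 0ℍᶻ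
normᶻ≡0 (quat a b c d) e
  with 0≤sum≡0 (0≤+ (0≤+ (0≤² (+ 2 * a + d)) (0≤² (+ 2 * b + d))) (0≤² (+ 2 * c + d))) (0≤² d)
         (trans (sym (four-normᶻ a b c d)) (cong (+ 4 *_) e))
... | abc , d²≡0 with 0≤sum≡0 (0≤+ (0≤² (+ 2 * a + d)) (0≤² (+ 2 * b + d))) (0≤² (+ 2 * c + d)) abc
...   | ab , C with 0≤sum≡0 (0≤² (+ 2 * a + d)) (0≤² (+ 2 * b + d)) ab | ²≡0 {d} d²≡0
...     | A , B | refl = quat-≡ (half a A) (half b B) (half c C) refl
  where
  half : ∀ a → (+ 2 * a + + 0) * (+ 2 * a + + 0) ≡ + 0 → a ≡ + 0
  half a e = *-cancelˡ {+ 2} (λ ()) (trans (sym (ℤ.+-identityʳ (+ 2 * a))) (²≡0 e))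

-- The factor 2 reflects the covering radius of the Hurwitz lattice D₄: every real quaternion is
-- within squared distance 1/2 of it. Both steps of the Hermite reduction below inherit their
-- constants from it.
EuclideanDivision : ℤ → ℍᶻ → Set
EuclideanDivision n x = ∃₂ λ q r → x ≡ (n •ᶻ q) ⊹ᶻ r × + 0 ≤ n * n - + 2 * normᶻ r

-- In the doubled coordinates 2a + d, 2b + d, 2c + d, d the Hurwitz integers are the vectors whose
-- entries all have the same parity. So the four quotients are rounded either all to even or all to
-- odd numbers. The two remainders together have squared length at most 4 n², and the shorter one is
-- taken.
euclid : ∀ n → + 0 < n → ∀ x → EuclideanDivision n x
euclid n 0<n (quat a b c d)
  with rounding n 0<n (+ 2 * a + d) | rounding n 0<n (+ 2 * b + d) | rounding n 0<n (+ 2 * c + d) | rounding n 0<n d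
... | pa , qa , ea , fa , Aₑ , Aₒ , ≤a | pb , qb , eb , fb , Bₑ , Bₒ , ≤b | pc , qc , ec , fc , Cₑ , Cₒ , ≤c | pd , qd , ed , fd , Dₑ , Dₒ , ≤d
  = choose (ℤ.≤-total (sum ea eb ec ed) (sum fa fb fc fd))
  where
  sum : ℤ → ℤ → ℤ → ℤ → ℤ
  sum x y z w = x * x + y * y + z * z + w * w
  total : + 0 ≤ + 4 * (n * n) - sum ea eb ec ed - sum fa fb fc fd
  total = subst (+ 0 ≤_) (lemma n ea eb ec ed fa fb fc fd) (0≤+ (0≤+ (0≤+ ≤a ≤b) ≤c) ≤d)
    where
    lemma : ∀ n ea eb ec ed fa fb fc fd → n * n - (ea * ea + fa * fa) + (n * n - (eb * eb + fb * fb)) + (n * n - (ec * ec + fc * fc)) + (n * n - (ed * ed + fd * fd)) ≡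
      + 4 * (n * n) - (ea * ea + eb * eb + ec * ec + ed * ed) - (fa * fa + fb * fb + fc * fc + fd * fd)
    lemma = solve-∀
  finish : ∀ u v w t x y z s → sum x y z s ≤ + 2 * (n * n) →
    + 2 * a + d ≡ n * (+ 2 * u + t) + x → + 2 * b + d ≡ n * (+ 2 * v + t) + y → + 2 * c + d ≡ n * (+ 2 * w + t) + z → d ≡ n * t + s →
    EuclideanDivision n (quat a b c d)
  finish u v w t x y z s ≤ eA eB eC eD = quat u v w t , quat (a - n * u) (b - n * v) (c - n * w) (d - n * t) ,
    quat-≡ (cancel a n u) (cancel b n v) (cancel c n w) (cancel d n t) ,
    0≤*-cancel {+ 2} (+<+ (s≤s z≤n)) (subst (+ 0 ≤_) eq (≤⇒0≤- ≤))
    where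
    cancel : ∀ a n u → a ≡ n * u + (a - n * u)
    cancel = solve-∀
    residue : ∀ a n u d t x → + 2 * a + d ≡ n * (+ 2 * u + t) + x → + 2 * (a - n * u) + (d - n * t) ≡ x
    residue a n u d t x e = trans (lemma a n u d t) (trans (cong (_- n * (+ 2 * u + t)) e) (lemma′ (n * (+ 2 * u + t)) x))
      where
      lemma : ∀ a n u d t → + 2 * (a - n * u) + (d - n * t) ≡ + 2 * a + d - n * (+ 2 * u + t)
      lemma = solve-∀
      lemma′ : ∀ m x → m + x - m ≡ x
      lemma′ = solve-∀
    residue′ : ∀ d n t s → d ≡ n * t + s → d - n * t ≡ s
    residue′ d n t s e = trans (cong (_- n * t) e) (lemma′ (n * t) s)
      where
      lemma′ : ∀ m x → m + x - m ≡ x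
      lemma′ = solve-∀
    eq : + 2 * (n * n) - sum x y z s ≡ + 2 * (n * n - + 2 * normᶻ (quat (a - n * u) (b - n * v) (c - n * w) (d - n * t)))
    eq = trans (cong (_-_ (+ 2 * (n * n))) (sym (trans (four-normᶻ (a - n * u) (b - n * v) (c - n * w) (d - n * t))
      (cong₂ _+_ (cong₂ _+_ (cong₂ _+_ (cong² (residue a n u d t x eA)) (cong² (residue b n v d t y eB))) (cong² (residue c n w d t z eC))) (cong² (residue′ d n t s eD))))))
      (lemma n (normᶻ (quat (a - n * u) (b - n * v) (c - n * w) (d - n * t))))
      where
      cong² : ∀ {x y} → x ≡ y → x * x ≡ y * y
      cong² refl = refl
      lemma : ∀ n N → + 2 * (n * n) - + 4 * N ≡ + 2 * (n * n - + 2 * N)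
      lemma = solve-∀
  half : ∀ {s t} → + 0 ≤ + 4 * (n * n) - s - t → s ≤ t → s ≤ + 2 * (n * n)
  half {s} {t} p q = 0≤-⇒≤ (0≤*-cancel {+ 2} (+<+ (s≤s z≤n)) (subst (+ 0 ≤_) (lemma n s t) (0≤+ p (≤⇒0≤- q))))
    where
    lemma : ∀ n s t → + 4 * (n * n) - s - t + (t - s) ≡ + 2 * (+ 2 * (n * n) - s)
    lemma = solve-∀
  even : ∀ n a p e pd → a ≡ n * (+ 2 * p) + e → a ≡ n * (+ 2 * (p - pd) + + 2 * pd) + e
  even n a p e pd q = trans q (lemma n p e pd)
    where
    lemma : ∀ n p e pd → n * (+ 2 * p) + e ≡ n * (+ 2 * (p - pd) + + 2 * pd) + e
    lemma = solve-∀
  odd : ∀ n a p e pd → a ≡ n * (+ 2 * p + + 1) + e → a ≡ n * (+ 2 * (p - pd) + (+ 2 * pd + + 1)) + e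
  odd n a p e pd q = trans q (lemma n p e pd)
    where
    lemma : ∀ n p e pd → n * (+ 2 * p + + 1) + e ≡ n * (+ 2 * (p - pd) + (+ 2 * pd + + 1)) + e
    lemma = solve-∀
  swap : ∀ a b c → a - b - c ≡ a - c - b
  swap = solve-∀
  choose : sum ea eb ec ed ≤ sum fa fb fc fd ⊎ sum fa fb fc fd ≤ sum ea eb ec ed → EuclideanDivision n (quat a b c d)
  choose (inj₁ le) = finish (pa - pd) (pb - pd) (pc - pd) (+ 2 * pd) ea eb ec ed (half total le)
    (even n _ pa ea pd Aₑ) (even n _ pb eb pd Bₑ) (even n _ pc ec pd Cₑ) Dₑ
  choose (inj₂ le) = finish (qa - qd) (qb - qd) (qc - qd) (+ 2 * qd + + 1) fa fb fc fd
    (half (subst (+ 0 ≤_) (swap (+ 4 * (n * n)) (sum ea eb ec ed) (sum fa fb fc fd)) total) le)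
    (odd n _ qa fa qd Aₒ) (odd n _ qb fb qd Bₒ) (odd n _ qc fc qd Cₒ) Dₒ

-- One step of the Euclidean algorithm on the left ideal generated by n and s,
-- applied to t = (z / m) T, where the norm of T is n m.
ideal-step : ∀ {n s k m T t z} → + 0 < n → + 0 < m → normᶻ s ≡ n * k →
  LeftIdealᶻ n s T → LeftIdealᶻ n s t → normᶻ T ≡ n * m → m •ᶻ t ≡ z ⋆ᶻ T →
  (∃ λ q → z ≡ m •ᶻ q) ⊎ (∃₂ λ T′ m′ → LeftIdealᶻ n s T′ × normᶻ T′ ≡ n * m′ × + 0 < m′ × + 2 * m′ ≤ m)
ideal-step {n} {s} {k} {m} {T} {t} {z} 0<n 0<m s≡ T∈ t∈ T≡ zT with euclid m 0<m z
... | q , r , z≡ , r≤ = split (ideal-normᶻ s≡ T′∈)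
  where
  T′ = t ⊹ᶻ (negᶻ q ⋆ᶻ T)
  T′∈ : LeftIdealᶻ n s T′
  T′∈ = ideal-⊹ᶻ t∈ (ideal-⋆ᶻ (negᶻ q) T∈)
  mT′ : m •ᶻ T′ ≡ r ⋆ᶻ T
  mT′ = begin
    m •ᶻ (t ⊹ᶻ (negᶻ q ⋆ᶻ T))                    ≡⟨ •-⊹ᶻ m t (negᶻ q ⋆ᶻ T) ⟩
    (m •ᶻ t) ⊹ᶻ (m •ᶻ (negᶻ q ⋆ᶻ T))              ≡⟨ cong₂ _⊹ᶻ_ (trans zT (cong (_⋆ᶻ T) z≡)) (trans (sym (•-⋆ᶻ m (negᶻ q) T)) (cong (_⋆ᶻ T) (•-negᶻ m q))) ⟩
    (((m •ᶻ q) ⊹ᶻ r) ⋆ᶻ T) ⊹ᶻ (negᶻ (m •ᶻ q) ⋆ᶻ T) ≡⟨ sym (⋆-distribʳᶻ ((m •ᶻ q) ⊹ᶻ r) (negᶻ (m •ᶻ q)) T) ⟩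
    (((m •ᶻ q) ⊹ᶻ r) ⊹ᶻ negᶻ (m •ᶻ q)) ⋆ᶻ T       ≡⟨ cong (_⋆ᶻ T) (trans (cong (_⊹ᶻ negᶻ (m •ᶻ q)) (⊹-commᶻ (m •ᶻ q) r))
                                                      (trans (⊹-assocᶻ r (m •ᶻ q) (negᶻ (m •ᶻ q))) (trans (cong (r ⊹ᶻ_) (⊖-selfᶻ (m •ᶻ q))) (⊹-0ᶻ r)))) ⟩
    r ⋆ᶻ T                                        ∎
    where open ≡-Reasoning
  split : (∃ λ m′ → normᶻ T′ ≡ n * m′) → _
  split (m′ , T′≡) = decide (ℤ._≟_ (normᶻ r) (+ 0))
    where
    mm′ : m * m′ ≡ normᶻ r
    mm′ = *-cancelˡ (0<⇒≢0 0<m) (*-cancelˡ (0<⇒≢0 0<n) (begin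
      n * (m * (m * m′))   ≡⟨ lemma₁ n m m′ ⟩
      m * m * (n * m′)     ≡⟨ cong (m * m *_) (sym T′≡) ⟩
      m * m * normᶻ T′     ≡⟨ sym (norm-•ᶻ m T′) ⟩
      normᶻ (m •ᶻ T′)      ≡⟨ cong normᶻ mT′ ⟩
      normᶻ (r ⋆ᶻ T)       ≡⟨ norm-⋆ᶻ r T ⟩
      normᶻ r * normᶻ T    ≡⟨ cong (normᶻ r *_) T≡ ⟩
      normᶻ r * (n * m)    ≡⟨ lemma₂ (normᶻ r) n m ⟩
      n * (m * normᶻ r)    ∎))
      where
      open ≡-Reasoning
      lemma₁ : ∀ n m m′ → n * (m * (m * m′)) ≡ m * m * (n * m′)
      lemma₁ = solve-∀
      lemma₂ : ∀ r n m → r * (n * m) ≡ n * (m * r)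
      lemma₂ = solve-∀
    decide : Dec (normᶻ r ≡ + 0) → _
    decide (yes r≡0) = inj₁ (q , trans z≡ (trans (cong ((m •ᶻ q) ⊹ᶻ_) (normᶻ≡0 r r≡0)) (⊹-0ᶻ (m •ᶻ q))))
    decide (no r≢0) = inj₂ (T′ , m′ , T′∈ , T′≡ , 0<*-cancel 0<m (subst (+ 0 <_) (sym mm′) (0≤∧≢0⇒0< (0≤normᶻ r) r≢0)) ,
      0≤-⇒≤ (0≤*-cancel 0<m (subst (+ 0 ≤_) (trans (cong (λ N → m * m - + 2 * N) (sym mm′)) (lemma m m′)) r≤)))
      where
      lemma : ∀ m m′ → m * m - + 2 * (m * m′) ≡ m * (m - + 2 * m′)
      lemma = solve-∀

•-cancelᶻ : ∀ {n x y} → n ≢ + 0 → n •ᶻ x ≡ n •ᶻ y → x ≡ y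
•-cancelᶻ {x = quat _ _ _ _} {quat _ _ _ _} n≢0 e = quat-≡ (*-cancelˡ n≢0 (cong re e)) (*-cancelˡ n≢0 (cong im e))
  (*-cancelˡ n≢0 (cong jm e)) (*-cancelˡ n≢0 (cong om e))
  where open Quaternion

IdealGenerator : ℤ → ℍᶻ → Set
IdealGenerator n s = ∃ λ T → LeftIdealᶻ n s T × normᶻ T ≡ n

unit-factor : ∀ {m} → + 0 < m → (∃ λ k → + 1 ≡ m * k) → m ≡ + 1
unit-factor {+ m} 0<m (k , e) = cong +_ (ℕ.m*n≡1⇒m≡1 m ∣ k ∣ (sym (trans (cong ∣_∣ e) (ℤ.abs-* (+ m) k))))

-- Descent starting from T = n, with N(T) = n m. Dividing n and s by T either produces an element of
-- the ideal with at most half the value of m or shows that both are left multiples of T. In the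
-- second case T is also divisible by m, hence so is s, and the coefficient 1 of j in s forces m =
-- 1.
ideal-generator-exists : ∀ {n a b k} → + 0 < n → normᶻ (quat a b (+ 1) (+ 0)) ≡ n * k → IdealGenerator n (quat a b (+ 1) (+ 0))
ideal-generator-exists {n} {a} {b} {k} 0<n s≡ = go n 0<n (<-wellFounded ∣ n ∣) (n •ᶻ 1ℍᶻ) (ideal-modulusᶻ 1ℍᶻ)
    (trans (norm-•ᶻ n 1ℍᶻ) (ℤ.*-identityʳ (n * n)))
  where
  s = quat a b (+ 1) (+ 0)
  smaller : ∀ {m m′} → + 0 < m → + 0 < m′ → + 2 * m′ ≤ m → ∣ m′ ∣ ℕ.< ∣ m ∣
  smaller {+ m} {+ suc m′} _ _ (+≤+ le) = ℕ.<-≤-trans (ℕ.m<n+m (suc m′) (s≤s z≤n)) (ℕ.≤-trans (ℕ.≤-reflexive (cong (suc m′ ℕ.+_) (sym (ℕ.+-identityʳ (suc m′))))) le)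
  smaller {_} {+ zero} _ (+<+ ())
  smaller { -[1+ _ ]} ()
  second : ∀ m T w → normᶻ T ≡ n * m → s ⋆ᶻ conjᶻ T ≡ n •ᶻ w → m •ᶻ s ≡ w ⋆ᶻ T
  second m T w T≡ sT̄ = •-cancelᶻ (0<⇒≢0 0<n) (begin
    n •ᶻ (m •ᶻ s)            ≡⟨ •-•ᶻ n m s ⟩
    (n * m) •ᶻ s             ≡⟨ cong (_•ᶻ s) (sym T≡) ⟩
    normᶻ T •ᶻ s             ≡⟨ sym (⋆-embedᶻ (normᶻ T) s) ⟩
    s ⋆ᶻ embedᶻ (normᶻ T)    ≡⟨ cong (s ⋆ᶻ_) (sym (conj-⋆-selfᶻ T)) ⟩
    s ⋆ᶻ (conjᶻ T ⋆ᶻ T)      ≡⟨ sym (⋆-assocᶻ s (conjᶻ T) T) ⟩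
    (s ⋆ᶻ conjᶻ T) ⋆ᶻ T      ≡⟨ cong (_⋆ᶻ T) sT̄ ⟩
    (n •ᶻ w) ⋆ᶻ T            ≡⟨ •-⋆ᶻ n w T ⟩
    n •ᶻ (w ⋆ᶻ T)            ∎)
    where
    open ≡-Reasoning
  divides-one : ∀ m T w q′ q → + 0 < m → m •ᶻ s ≡ w ⋆ᶻ T → w ≡ m •ᶻ q′ → conjᶻ T ≡ m •ᶻ q → ∃ λ k → + 1 ≡ m * k
  divides-one m T _ q′ q 0<m ms≡ refl T̄≡ = Quaternion.jm (q′ ⋆ᶻ conjᶻ q) , trans (cong Quaternion.jm s≡mx) (coordinate (q′ ⋆ᶻ conjᶻ q))
    where
    T≡ : T ≡ m •ᶻ conjᶻ q
    T≡ = trans (sym (conj-conjᶻ T)) (trans (cong conjᶻ T̄≡) (conj-•ᶻ m q))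
    s≡mx : s ≡ m •ᶻ (q′ ⋆ᶻ conjᶻ q)
    s≡mx = trans (•-cancelᶻ (0<⇒≢0 0<m) (trans ms≡ (•-⋆ᶻ m q′ T))) (trans (cong (q′ ⋆ᶻ_) T≡) (⋆-•ᶻ m q′ (conjᶻ q)))
    coordinate : ∀ x → Quaternion.jm (m •ᶻ x) ≡ m * Quaternion.jm x
    coordinate (quat _ _ _ _) = refl
  go : ∀ m → + 0 < m → Acc ℕ._<_ ∣ m ∣ → ∀ T → LeftIdealᶻ n s T → normᶻ T ≡ n * m → IdealGenerator n s
  go m 0<m (acc rec) T T∈ T≡ with ideal-step 0<n 0<m s≡ T∈ (ideal-modulusᶻ 1ℍᶻ) T≡ first
    where
    first : m •ᶻ (n •ᶻ 1ℍᶻ) ≡ conjᶻ T ⋆ᶻ T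
    first = trans (•-•ᶻ m n 1ℍᶻ) (trans (cong (_•ᶻ 1ℍᶻ) (trans (ℤ.*-comm m n) (sym T≡))) (trans (sym (embed-⋆ᶻ (normᶻ T) 1ℍᶻ)) (trans (⋆-1ᶻ (embedᶻ (normᶻ T))) (sym (conj-⋆-selfᶻ T)))))
  ... | inj₂ (T′ , m′ , T′∈ , T′≡ , 0<m′ , m′≤) = go m′ 0<m′ (rec (smaller 0<m 0<m′ m′≤)) T′ T′∈ T′≡
  ... | inj₁ (q , T̄≡) with ideal-conjᶻ s≡ T∈
  ...   | w , sT̄ with ideal-step 0<n 0<m s≡ T∈ ideal-generatorᶻ T≡ (second m T w T≡ sT̄)
  ...     | inj₂ (T′ , m′ , T′∈ , T′≡ , 0<m′ , m′≤) = go m′ 0<m′ (rec (smaller 0<m 0<m′ m′≤)) T′ T′∈ T′≡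
  ...     | inj₁ (q′ , w≡) = T , T∈ , trans T≡ (trans (cong (n *_) (unit-factor 0<m (divides-one m T w q′ q 0<m (second m T w T≡ sT̄) w≡ T̄≡))) (ℤ.*-identityʳ n))

-- The determinant of the Hermitian matrix with diagonal a, b, c and upper triangle x, y, z.
hermitianDet : ℤ → ℤ → ℤ → ℍᶻ → ℍᶻ → ℍᶻ → ℤ
hermitianDet a b c x y z = a * b * c + trᶻ ((x ⋆ᶻ z) ⋆ᶻ conjᶻ y) - a * normᶻ z - b * normᶻ y - c * normᶻ x

norm-⊹-• : ∀ x s y → normᶻ (x ⊹ᶻ (s •ᶻ y)) ≡ normᶻ x + s * s * normᶻ y + s * trᶻ (x ⋆ᶻ conjᶻ y)
norm-⊹-• x s y = trans (norm-⊹ᶻ x (s •ᶻ y)) (cong₂ _+_ (cong (_+_ (normᶻ x)) (norm-•ᶻ s y))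
  (trans (cong trᶻ (trans (cong (x ⋆ᶻ_) (conj-•ᶻ s y)) (⋆-•ᶻ s x (conjᶻ y)))) (tr-•ᶻ s (x ⋆ᶻ conjᶻ y))))

-- Projecting the second and third basis vector away from the first.
projected : ℤ → ℍᶻ → ℍᶻ → ℍᶻ → ℍᶻ
projected a x y z = (a •ᶻ z) ⊹ᶻ negᶻ (conjᶻ x ⋆ᶻ y)

tr-rotate : ∀ x y z → trᶻ ((x ⋆ᶻ y) ⋆ᶻ z) ≡ trᶻ ((z ⋆ᶻ x) ⋆ᶻ y)
tr-rotate x y z = trans (tr-commᶻ (x ⋆ᶻ y) z) (cong trᶻ (sym (⋆-assocᶻ z x y)))

tr-neg : ∀ x → trᶻ (negᶻ x) ≡ - trᶻ x
tr-neg (quat a b c d) = lemma a d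
  where
  lemma : ∀ a d → - a + - a + - d ≡ - (a + a + d)
  lemma = solve-∀

norm-projected : ∀ a x y z → normᶻ (projected a x y z) ≡
  a * a * normᶻ z + normᶻ x * normᶻ y - a * trᶻ ((x ⋆ᶻ z) ⋆ᶻ conjᶻ y)
norm-projected a x y z = begin
  normᶻ ((a •ᶻ z) ⊹ᶻ negᶻ (conjᶻ x ⋆ᶻ y))
    ≡⟨ norm-⊹ᶻ (a •ᶻ z) (negᶻ (conjᶻ x ⋆ᶻ y)) ⟩
  normᶻ (a •ᶻ z) + normᶻ (negᶻ (conjᶻ x ⋆ᶻ y)) + trᶻ ((a •ᶻ z) ⋆ᶻ conjᶻ (negᶻ (conjᶻ x ⋆ᶻ y)))
    ≡⟨ cong₂ _+_ (cong₂ _+_ (norm-•ᶻ a z) (trans (norm-negᶻ (conjᶻ x ⋆ᶻ y)) (trans (norm-⋆ᶻ (conjᶻ x) y) (cong (_* normᶻ y) (norm-conjᶻ x))))) cross ⟩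
  a * a * normᶻ z + normᶻ x * normᶻ y + - (a * trᶻ ((x ⋆ᶻ z) ⋆ᶻ conjᶻ y)) ∎
  where
  open ≡-Reasoning
  cross : trᶻ ((a •ᶻ z) ⋆ᶻ conjᶻ (negᶻ (conjᶻ x ⋆ᶻ y))) ≡ - (a * trᶻ ((x ⋆ᶻ z) ⋆ᶻ conjᶻ y))
  cross = begin
    trᶻ ((a •ᶻ z) ⋆ᶻ conjᶻ (negᶻ (conjᶻ x ⋆ᶻ y)))   ≡⟨ cong (λ t → trᶻ ((a •ᶻ z) ⋆ᶻ t)) (trans (conj-negᶻ (conjᶻ x ⋆ᶻ y))
                                                          (cong negᶻ (trans (conj-⋆ᶻ (conjᶻ x) y) (cong (conjᶻ y ⋆ᶻ_) (conj-conjᶻ x))))) ⟩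
    trᶻ ((a •ᶻ z) ⋆ᶻ negᶻ (conjᶻ y ⋆ᶻ x))           ≡⟨ trans (cong trᶻ (⋆-negᶻ (a •ᶻ z) (conjᶻ y ⋆ᶻ x))) (tr-neg ((a •ᶻ z) ⋆ᶻ (conjᶻ y ⋆ᶻ x))) ⟩
    - trᶻ ((a •ᶻ z) ⋆ᶻ (conjᶻ y ⋆ᶻ x))              ≡⟨ cong -_ (trans (cong trᶻ (•-⋆ᶻ a z (conjᶻ y ⋆ᶻ x))) (tr-•ᶻ a (z ⋆ᶻ (conjᶻ y ⋆ᶻ x)))) ⟩
    - (a * trᶻ (z ⋆ᶻ (conjᶻ y ⋆ᶻ x)))               ≡⟨ cong (λ t → - (a * t)) (trans (cong trᶻ (sym (⋆-assocᶻ z (conjᶻ y) x))) (tr-rotate z (conjᶻ y) x)) ⟩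
    - (a * trᶻ ((x ⋆ᶻ z) ⋆ᶻ conjᶻ y))               ∎

-- The Schur complement of a: after projecting away the first vector, the Gram matrix of the other
-- two has, up to scaling, the entries ab - N(x), ac - N(y) and `projected`, and its determinant is
-- a times the ternary one. Invariance under base change is deduced from this by cancelling a, which
-- avoids expanding the noncommutative determinant.
schur : ∀ a b c x y z → (a * b - normᶻ x) * (a * c - normᶻ y) ≡ a * hermitianDet a b c x y z + normᶻ (projected a x y z)
schur a b c x y z = trans (lemma a b c (normᶻ x) (normᶻ y) (normᶻ z) (trᶻ ((x ⋆ᶻ z) ⋆ᶻ conjᶻ y)))
  (cong (_+_ (a * hermitianDet a b c x y z)) (sym (norm-projected a x y z)))
  where
  lemma : ∀ a b c X Y Z t → (a * b - X) * (a * c - Y) ≡ a * (a * b * c + t - a * Z - b * Y - c * X) + (a * a * Z + X * Y - a * t)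
  lemma = solve-∀

det-swap₂₃ : ∀ a b c x y z → hermitianDet a c b y x (conjᶻ z) ≡ hermitianDet a b c x y z
det-swap₂₃ a b c x y z = trans (cong₂ (λ t Z → a * c * b + t - a * Z - c * normᶻ x - b * normᶻ y) trace (norm-conjᶻ z))
  (lemma a b c (normᶻ x) (normᶻ y) (normᶻ z) (trᶻ ((x ⋆ᶻ z) ⋆ᶻ conjᶻ y)))
  where
  trace : trᶻ ((y ⋆ᶻ conjᶻ z) ⋆ᶻ conjᶻ x) ≡ trᶻ ((x ⋆ᶻ z) ⋆ᶻ conjᶻ y)
  trace = trans (cong trᶻ (trans (⋆-assocᶻ y (conjᶻ z) (conjᶻ x)) (sym (trans (conj-⋆ᶻ (x ⋆ᶻ z) (conjᶻ y)) (cong₂ _⋆ᶻ_ (conj-conjᶻ y) (conj-⋆ᶻ x z))))))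
    (tr-conjᶻ ((x ⋆ᶻ z) ⋆ᶻ conjᶻ y))
  lemma : ∀ a b c X Y Z t → a * c * b + t - a * Z - c * X - b * Y ≡ a * b * c + t - a * Z - b * Y - c * X
  lemma = solve-∀

det-swap₁₂ : ∀ a b c x y z → hermitianDet b a c (conjᶻ x) z y ≡ hermitianDet a b c x y z
det-swap₁₂ a b c x y z = trans (cong₂ (λ t X → b * a * c + t - b * normᶻ y - a * normᶻ z - c * X) trace (norm-conjᶻ x))
  (lemma a b c (normᶻ x) (normᶻ y) (normᶻ z) (trᶻ ((x ⋆ᶻ z) ⋆ᶻ conjᶻ y)))
  where
  trace : trᶻ ((conjᶻ x ⋆ᶻ y) ⋆ᶻ conjᶻ z) ≡ trᶻ ((x ⋆ᶻ z) ⋆ᶻ conjᶻ y)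
  trace = trans (cong trᶻ (trans (cong (_⋆ᶻ conjᶻ z) (trans (cong (conjᶻ x ⋆ᶻ_) (sym (conj-conjᶻ y))) (sym (conj-⋆ᶻ (conjᶻ y) x)))) (sym (conj-⋆ᶻ z (conjᶻ y ⋆ᶻ x)))))
    (trans (tr-conjᶻ (z ⋆ᶻ (conjᶻ y ⋆ᶻ x))) (trans (cong trᶻ (sym (⋆-assocᶻ z (conjᶻ y) x))) (tr-rotate z (conjᶻ y) x)))
  lemma : ∀ a b c X Y Z t → b * a * c + t - b * Y - a * Z - c * X ≡ a * b * c + t - a * Z - b * Y - c * X
  lemma = solve-∀

-- Replacing the second vector v₂ by v₂ + q v₁.
minor-shear : ∀ a b x q → a * (b + trᶻ (q ⋆ᶻ x) + normᶻ q * a) - normᶻ (x ⊹ᶻ (a •ᶻ conjᶻ q)) ≡ a * b - normᶻ x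
minor-shear a b x q = trans (cong (_-_ (a * (b + trᶻ (q ⋆ᶻ x) + normᶻ q * a))) (trans (norm-⊹-• x a (conjᶻ q))
    (cong₂ (λ u v → normᶻ x + a * a * u + a * v) (norm-conjᶻ q) (trans (cong (λ t → trᶻ (x ⋆ᶻ t)) (conj-conjᶻ q)) (tr-commᶻ x q)))))
  (lemma a b (trᶻ (q ⋆ᶻ x)) (normᶻ q) (normᶻ x))
  where
  lemma : ∀ a b t Q X → a * (b + t + Q * a) - (X + a * a * Q + a * t) ≡ a * b - X
  lemma = solve-∀

projected-shear : ∀ a x y z q → projected a (x ⊹ᶻ (a •ᶻ conjᶻ q)) y (z ⊹ᶻ (q ⋆ᶻ y)) ≡ projected a x y z
projected-shear a x y z q = begin
  (a •ᶻ (z ⊹ᶻ (q ⋆ᶻ y))) ⊹ᶻ negᶻ (conjᶻ (x ⊹ᶻ (a •ᶻ conjᶻ q)) ⋆ᶻ y)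
    ≡⟨ cong₂ (λ u v → u ⊹ᶻ negᶻ v) (•-⊹ᶻ a z (q ⋆ᶻ y)) (trans (cong (_⋆ᶻ y) (trans (conj-⊹ᶻ x (a •ᶻ conjᶻ q)) (cong (conjᶻ x ⊹ᶻ_) (trans (conj-•ᶻ a (conjᶻ q)) (cong (a •ᶻ_) (conj-conjᶻ q))))))
         (trans (⋆-distribʳᶻ (conjᶻ x) (a •ᶻ q) y) (cong ((conjᶻ x ⋆ᶻ y) ⊹ᶻ_) (•-⋆ᶻ a q y)))) ⟩
  ((a •ᶻ z) ⊹ᶻ (a •ᶻ (q ⋆ᶻ y))) ⊹ᶻ negᶻ ((conjᶻ x ⋆ᶻ y) ⊹ᶻ (a •ᶻ (q ⋆ᶻ y)))
    ≡⟨ cancel (a •ᶻ z) (a •ᶻ (q ⋆ᶻ y)) (conjᶻ x ⋆ᶻ y) ⟩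
  (a •ᶻ z) ⊹ᶻ negᶻ (conjᶻ x ⋆ᶻ y) ∎
  where
  open ≡-Reasoning
  cancel : ∀ u v w → (u ⊹ᶻ v) ⊹ᶻ negᶻ (w ⊹ᶻ v) ≡ u ⊹ᶻ negᶻ w
  cancel (quat a b c d) (quat e f g h) (quat k l m n) = quat-≡ (lemma a e k) (lemma b f l) (lemma c g m) (lemma d h n)
    where
    lemma : ∀ u v w → u + v + - (w + v) ≡ u + - w
    lemma = solve-∀

-- Neither the first minor nor the projection away from the first vector sees this shear, so `schur`
-- fixes a times the determinant.
det-shear₁₂ : ∀ {a} → a ≢ + 0 → ∀ b c x y z q →
  hermitianDet a (b + trᶻ (q ⋆ᶻ x) + normᶻ q * a) c (x ⊹ᶻ (a •ᶻ conjᶻ q)) y (z ⊹ᶻ (q ⋆ᶻ y)) ≡ hermitianDet a b c x y z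
det-shear₁₂ {a} a≢0 b c x y z q = *-cancelˡ a≢0 (+-cancelʳ (normᶻ (projected a x y z)) (begin
  a * hermitianDet a b′ c x′ y z′ + normᶻ (projected a x y z)     ≡⟨ cong (λ t → a * hermitianDet a b′ c x′ y z′ + normᶻ t) (sym (projected-shear a x y z q)) ⟩
  a * hermitianDet a b′ c x′ y z′ + normᶻ (projected a x′ y z′)   ≡⟨ sym (schur a b′ c x′ y z′) ⟩
  (a * b′ - normᶻ x′) * (a * c - normᶻ y)                         ≡⟨ cong (_* (a * c - normᶻ y)) (minor-shear a b x q) ⟩
  (a * b - normᶻ x) * (a * c - normᶻ y)                           ≡⟨ schur a b c x y z ⟩
  a * hermitianDet a b c x y z + normᶻ (projected a x y z)        ∎))
  where
  open ≡-Reasoning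
  b′ = b + trᶻ (q ⋆ᶻ x) + normᶻ q * a
  x′ = x ⊹ᶻ (a •ᶻ conjᶻ q)
  z′ = z ⊹ᶻ (q ⋆ᶻ y)

-- Replacing the third vector v₃ by v₃ + q v₂.
projected-shear₂₃ : ∀ a b x y z q → projected a x (y ⊹ᶻ (x ⋆ᶻ conjᶻ q)) (z ⊹ᶻ (b •ᶻ conjᶻ q)) ≡ projected a x y z ⊹ᶻ ((a * b - normᶻ x) •ᶻ conjᶻ q)
projected-shear₂₃ a b x y z q = begin
  (a •ᶻ (z ⊹ᶻ (b •ᶻ conjᶻ q))) ⊹ᶻ negᶻ (conjᶻ x ⋆ᶻ (y ⊹ᶻ (x ⋆ᶻ conjᶻ q)))
    ≡⟨ cong₂ (λ u v → u ⊹ᶻ negᶻ v) (trans (•-⊹ᶻ a z (b •ᶻ conjᶻ q)) (cong ((a •ᶻ z) ⊹ᶻ_) (•-•ᶻ a b (conjᶻ q))))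
        (trans (⋆-distribˡᶻ (conjᶻ x) y (x ⋆ᶻ conjᶻ q)) (cong ((conjᶻ x ⋆ᶻ y) ⊹ᶻ_) (trans (sym (⋆-assocᶻ (conjᶻ x) x (conjᶻ q))) (trans (cong (_⋆ᶻ conjᶻ q) (conj-⋆-selfᶻ x)) (embed-⋆ᶻ (normᶻ x) (conjᶻ q)))))) ⟩
  ((a •ᶻ z) ⊹ᶻ ((a * b) •ᶻ conjᶻ q)) ⊹ᶻ negᶻ ((conjᶻ x ⋆ᶻ y) ⊹ᶻ (normᶻ x •ᶻ conjᶻ q))
    ≡⟨ regroup (a •ᶻ z) (a * b) (normᶻ x) (conjᶻ q) (conjᶻ x ⋆ᶻ y) ⟩
  projected a x y z ⊹ᶻ ((a * b - normᶻ x) •ᶻ conjᶻ q) ∎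
  where
  open ≡-Reasoning
  regroup : ∀ u s t p w → (u ⊹ᶻ (s •ᶻ p)) ⊹ᶻ negᶻ (w ⊹ᶻ (t •ᶻ p)) ≡ (u ⊹ᶻ negᶻ w) ⊹ᶻ ((s - t) •ᶻ p)
  regroup (quat a b c d) s t (quat e f g h) (quat k l m n) = quat-≡ (lemma a s t e k) (lemma b s t f l) (lemma c s t g m) (lemma d s t h n)
    where
    lemma : ∀ u s t p w → u + s * p + - (w + t * p) ≡ u + - w + (s - t) * p
    lemma = solve-∀

minor-shear₂₃ : ∀ a b c x y z q → a * (c + trᶻ (q ⋆ᶻ z) + normᶻ q * b) - normᶻ (y ⊹ᶻ (x ⋆ᶻ conjᶻ q)) ≡
  (a * c - normᶻ y) + trᶻ (projected a x y z ⋆ᶻ q) + normᶻ q * (a * b - normᶻ x)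
minor-shear₂₃ a b c x y z q = trans (cong (_-_ (a * (c + trᶻ (q ⋆ᶻ z) + normᶻ q * b))) (trans (norm-⊹ᶻ y (x ⋆ᶻ conjᶻ q))
    (cong₂ (λ u v → normᶻ y + u + v) (trans (norm-⋆ᶻ x (conjᶻ q)) (cong (normᶻ x *_) (norm-conjᶻ q))) cross)))
  (trans (lemma a b c (trᶻ (q ⋆ᶻ z)) (normᶻ q) (normᶻ x) (normᶻ y) (trᶻ ((conjᶻ x ⋆ᶻ y) ⋆ᶻ q)))
    (cong (λ t → (a * c - normᶻ y) + t + normᶻ q * (a * b - normᶻ x)) (sym trace)))
  where
  cross : trᶻ (y ⋆ᶻ conjᶻ (x ⋆ᶻ conjᶻ q)) ≡ trᶻ ((conjᶻ x ⋆ᶻ y) ⋆ᶻ q)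
  cross = trans (cong (λ t → trᶻ (y ⋆ᶻ t)) (trans (conj-⋆ᶻ x (conjᶻ q)) (cong (_⋆ᶻ conjᶻ x) (conj-conjᶻ q))))
    (trans (cong trᶻ (sym (⋆-assocᶻ y q (conjᶻ x)))) (tr-rotate y q (conjᶻ x)))
  trace : trᶻ (projected a x y z ⋆ᶻ q) ≡ a * trᶻ (q ⋆ᶻ z) - trᶻ ((conjᶻ x ⋆ᶻ y) ⋆ᶻ q)
  trace = trans (cong trᶻ (⋆-distribʳᶻ (a •ᶻ z) (negᶻ (conjᶻ x ⋆ᶻ y)) q)) (trans (tr-⊹ᶻ ((a •ᶻ z) ⋆ᶻ q) (negᶻ (conjᶻ x ⋆ᶻ y) ⋆ᶻ q))
    (cong₂ _+_ (trans (cong trᶻ (•-⋆ᶻ a z q)) (trans (tr-•ᶻ a (z ⋆ᶻ q)) (cong (a *_) (tr-commᶻ z q))))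
      (trans (cong trᶻ (neg-⋆ᶻ (conjᶻ x ⋆ᶻ y) q)) (tr-neg ((conjᶻ x ⋆ᶻ y) ⋆ᶻ q)))))
  lemma : ∀ a b c t Q X Y u → a * (c + t + Q * b) - (Y + X * Q + u) ≡ (a * c - Y) + (a * t - u) + Q * (a * b - X)
  lemma = solve-∀

-- On the Schur complement this is again a shear: its off-diagonal entry g becomes g + G q̄ with G =
-- ab - N(x), which changes the two sides of `schur` by the same amount.
det-shear₂₃ : ∀ {a} → a ≢ + 0 → ∀ b c x y z q →
  hermitianDet a b (c + trᶻ (q ⋆ᶻ z) + normᶻ q * b) x (y ⊹ᶻ (x ⋆ᶻ conjᶻ q)) (z ⊹ᶻ (b •ᶻ conjᶻ q)) ≡ hermitianDet a b c x y z
det-shear₂₃ {a} a≢0 b c x y z q = *-cancelˡ a≢0 (+-cancelʳ (normᶻ (g ⊹ᶻ (G •ᶻ conjᶻ q))) (begin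
  a * hermitianDet a b c′ x y′ z′ + normᶻ (g ⊹ᶻ (G •ᶻ conjᶻ q))   ≡⟨ cong (λ t → a * hermitianDet a b c′ x y′ z′ + normᶻ t) (sym (projected-shear₂₃ a b x y z q)) ⟩
  a * hermitianDet a b c′ x y′ z′ + normᶻ (projected a x y′ z′)   ≡⟨ sym (schur a b c′ x y′ z′) ⟩
  G * (a * c′ - normᶻ y′)                                         ≡⟨ cong (G *_) (minor-shear₂₃ a b c x y z q) ⟩
  G * ((a * c - normᶻ y) + trᶻ (g ⋆ᶻ q) + normᶻ q * G)            ≡⟨ lemma G (a * c - normᶻ y) (trᶻ (g ⋆ᶻ q)) (normᶻ q) ⟩
  G * (a * c - normᶻ y) + (G * G * normᶻ q + G * trᶻ (g ⋆ᶻ q))    ≡⟨ cong (_+ (G * G * normᶻ q + G * trᶻ (g ⋆ᶻ q))) (schur a b c x y z) ⟩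
  a * hermitianDet a b c x y z + normᶻ g + (G * G * normᶻ q + G * trᶻ (g ⋆ᶻ q))
    ≡⟨ lemma′ (a * hermitianDet a b c x y z) (normᶻ g) (G * G * normᶻ q) (G * trᶻ (g ⋆ᶻ q)) ⟩
  a * hermitianDet a b c x y z + (normᶻ g + G * G * normᶻ q + G * trᶻ (g ⋆ᶻ q))
    ≡⟨ cong (_+_ (a * hermitianDet a b c x y z)) (sym (trans (norm-⊹-• g G (conjᶻ q)) (cong₂ (λ u v → normᶻ g + G * G * u + G * trᶻ (g ⋆ᶻ v)) (norm-conjᶻ q) (conj-conjᶻ q)))) ⟩
  a * hermitianDet a b c x y z + normᶻ (g ⊹ᶻ (G •ᶻ conjᶻ q))      ∎))
  where
  open ≡-Reasoning
  c′ = c + trᶻ (q ⋆ᶻ z) + normᶻ q * b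
  y′ = y ⊹ᶻ (x ⋆ᶻ conjᶻ q)
  z′ = z ⊹ᶻ (b •ᶻ conjᶻ q)
  g = projected a x y z
  G = a * b - normᶻ x
  lemma : ∀ G M t Q → G * (M + t + Q * G) ≡ G * M + (G * G * Q + G * t)
  lemma = solve-∀
  lemma′ : ∀ u v s t → u + v + (s + t) ≡ u + (v + s + t)
  lemma′ = solve-∀

remainder : ∀ u r → (u ⊹ᶻ r) ⊹ᶻ negᶻ u ≡ r
remainder (quat a b c d) (quat e f g h) = quat-≡ (lemma a e) (lemma b f) (lemma c g) (lemma d h)
  where
  lemma : ∀ u r → u + r + - u ≡ r
  lemma = solve-∀

∣<∣ : ∀ {a b} → + 0 ≤ a → a < b → ∣ a ∣ ℕ.< ∣ b ∣
∣<∣ {+ _} {+ _} _ (+<+ lt) = lt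

-- Hermite reduction of ternary Hermitian forms over the Hurwitz order.

record HermitianSpace : Set₁ where
  infixl 6 _⊞_
  infixr 7 _⊡_
  field
    V    : Set
    _⊞_  : V → V → V
    _⊡_  : ℍᶻ → V → V
    form : V → V → ℍᶻ
    len  : V → ℤ
    form-⊞ˡ   : ∀ u v w → form (u ⊞ v) w ≡ form u w ⊹ᶻ form v w
    form-⊡ˡ   : ∀ q u v → form (q ⊡ u) v ≡ q ⋆ᶻ form u v
    form-conj : ∀ u v → form v u ≡ conjᶻ (form u v)
    form-self : ∀ v → form v v ≡ embedᶻ (len v)
    len-⊡     : ∀ q v → len (q ⊡ v) ≡ normᶻ q * len v
    len-⊞-⊡   : ∀ v q u → len (v ⊞ q ⊡ u) ≡ len v + trᶻ (q ⋆ᶻ form u v) + normᶻ q * len u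
    len-nonneg : ∀ v → + 0 ≤ len v
    isotropic  : ∀ v → len v ≡ + 0 → ∀ w → form v w ≡ 0ℍᶻ

module HermiteReduction (S : HermitianSpace) where
  open HermitianSpace S

  form-⊡ʳ : ∀ u q v → form u (q ⊡ v) ≡ form u v ⋆ᶻ conjᶻ q
  form-⊡ʳ u q v = trans (form-conj (q ⊡ v) u) (trans (cong conjᶻ (form-⊡ˡ q v u))
    (trans (conj-⋆ᶻ q (form v u)) (cong (_⋆ᶻ conjᶻ q) (sym (form-conj v u)))))

  form-⊞ʳ : ∀ u v w → form u (v ⊞ w) ≡ form u v ⊹ᶻ form u w
  form-⊞ʳ u v w = trans (form-conj (v ⊞ w) u) (trans (cong conjᶻ (form-⊞ˡ v w u))
    (trans (conj-⊹ᶻ (form v u) (form w u)) (cong₂ _⊹ᶻ_ (sym (form-conj v u)) (sym (form-conj w u)))))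

  det : V → V → V → ℤ
  det u v w = hermitianDet (len u) (len v) (len w) (form u v) (form u w) (form v w)

  minor : V → V → ℤ
  minor u v = len u * len v - normᶻ (form u v)

  det-swap-last : ∀ u v w → det u w v ≡ det u v w
  det-swap-last u v w = trans (cong (hermitianDet (len u) (len w) (len v) (form u w) (form u v)) (form-conj v w))
    (det-swap₂₃ (len u) (len v) (len w) (form u v) (form u w) (form v w))

  det-swap-first : ∀ u v w → det v u w ≡ det u v w
  det-swap-first u v w = trans (cong (λ t → hermitianDet (len v) (len u) (len w) t (form v w) (form u w)) (form-conj u v))
    (det-swap₁₂ (len u) (len v) (len w) (form u v) (form u w) (form v w))

  form-shear : ∀ u v q → form u (v ⊞ q ⊡ u) ≡ form u v ⊹ᶻ (len u •ᶻ conjᶻ q)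
  form-shear u v q = trans (form-⊞ʳ u v (q ⊡ u)) (cong (form u v ⊹ᶻ_) (trans (form-⊡ʳ u q u)
    (trans (cong (_⋆ᶻ conjᶻ q) (form-self u)) (embed-⋆ᶻ (len u) (conjᶻ q)))))

  det-shear-second : ∀ u v w q → len u ≢ + 0 → det u (v ⊞ q ⊡ u) w ≡ det u v w
  det-shear-second u v w q u≢0 = trans
    (trans (cong₂ (λ s t → hermitianDet (len u) (len (v ⊞ q ⊡ u)) (len w) s (form u w) t) (form-shear u v q)
              (trans (form-⊞ˡ v (q ⊡ u) w) (cong (form v w ⊹ᶻ_) (form-⊡ˡ q u w))))
           (cong (λ s → hermitianDet (len u) s (len w) (form u v ⊹ᶻ (len u •ᶻ conjᶻ q)) (form u w) (form v w ⊹ᶻ (q ⋆ᶻ form u w))) (len-⊞-⊡ v q u)))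
    (det-shear₁₂ u≢0 (len v) (len w) (form u v) (form u w) (form v w) q)

  det-shear-third : ∀ u v w q → len u ≢ + 0 → det u v (w ⊞ q ⊡ v) ≡ det u v w
  det-shear-third u v w q u≢0 = trans
    (trans (cong₂ (λ s t → hermitianDet (len u) (len v) (len (w ⊞ q ⊡ v)) (form u v) s t)
              (trans (form-⊞ʳ u w (q ⊡ v)) (cong (form u w ⊹ᶻ_) (form-⊡ʳ u q v))) (form-shear v w q))
           (cong (λ s → hermitianDet (len u) (len v) s (form u v) (form u w ⊹ᶻ (form u v ⋆ᶻ conjᶻ q)) (form v w ⊹ᶻ (len v •ᶻ conjᶻ q))) (len-⊞-⊡ w q v)))
    (det-shear₂₃ u≢0 (len v) (len w) (form u v) (form u w) (form v w) q)

  -- Cauchy-Schwarz: the vector a v - x̄ u has length a times the minor.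
  minor-nonneg : ∀ u v → + 0 < len u → + 0 ≤ minor u v
  minor-nonneg u v 0<a = 0≤*-cancel 0<a (subst (+ 0 ≤_) expand (len-nonneg (embedᶻ a ⊡ v ⊞ q ⊡ u)))
    where
    a = len u
    x = form u v
    q = negᶻ (conjᶻ x)
    cross : trᶻ (q ⋆ᶻ form u (embedᶻ a ⊡ v)) ≡ - (a * trᶻ (embedᶻ (normᶻ x)))
    cross = trans (cong (λ t → trᶻ (q ⋆ᶻ t)) (trans (form-⊡ʳ u (embedᶻ a) v) (trans (cong (x ⋆ᶻ_) (conj-embed a)) (⋆-embedᶻ a x))))
      (trans (cong trᶻ (trans (⋆-•ᶻ a q x) (cong (a •ᶻ_) (trans (neg-⋆ᶻ (conjᶻ x) x) (cong negᶻ (conj-⋆-selfᶻ x))))))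
        (trans (tr-•ᶻ a (negᶻ (embedᶻ (normᶻ x)))) (trans (cong (a *_) (tr-neg (embedᶻ (normᶻ x)))) (sym (ℤ.neg-distribʳ-* a (trᶻ (embedᶻ (normᶻ x))))))))
      where
      conj-embed : ∀ a → conjᶻ (embedᶻ a) ≡ embedᶻ a
      conj-embed a = quat-≡ (ℤ.+-identityʳ a) refl refl refl
    expand : len (embedᶻ a ⊡ v ⊞ q ⊡ u) ≡ a * minor u v
    expand = trans (len-⊞-⊡ (embedᶻ a ⊡ v) q u) (trans (cong₂ _+_ (cong₂ _+_ (len-⊡ (embedᶻ a) v) cross)
      (cong (_* a) (trans (norm-negᶻ (conjᶻ x)) (norm-conjᶻ x)))) (lemma a (len v) (normᶻ x)))
      where
      lemma : ∀ a b X → (a * a + + 0 * + 0 + + 0 * + 0 + + 0 * + 0 + + 0 * (a + + 0 + + 0)) * b + - (a * (X + X + + 0)) + X * a ≡ a * (a * b - X)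
      lemma = solve-∀

  len-positive : ∀ u v w → + 0 < det u v w → + 0 < len u
  len-positive u v w 0<D = 0≤∧≢0⇒0< (len-nonneg u) λ a≡0 → 0<⇒≢0 0<D
    (trans (cong₂ (λ x y → hermitianDet (len u) (len v) (len w) x y (form v w)) (isotropic u a≡0 v) (isotropic u a≡0 w))
      (trans (cong (λ a → hermitianDet a (len v) (len w) 0ℍᶻ 0ℍᶻ (form v w)) a≡0)
        (trans (cong (λ t → + 0 * len v * len w + t - + 0 * normᶻ (form v w) - len v * + 0 - len w * + 0)
          (cong trᶻ (trans (⋆-assocᶻ 0ℍᶻ (form v w) (conjᶻ 0ℍᶻ)) (0-⋆ᶻ (form v w ⋆ᶻ conjᶻ 0ℍᶻ)))))
          (lemma (len v) (len w) (normᶻ (form v w))))))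
    where
    lemma : ∀ b c Z → + 0 * b * c + + 0 - + 0 * Z - b * + 0 - c * + 0 ≡ + 0
    lemma = solve-∀

  -- A vanishing minor would make the left side of `schur` zero, while the right side is at least a
  -- times the determinant and so positive.
  minor-positive : ∀ u v w → + 0 < det u v w → + 0 < minor u v
  minor-positive u v w 0<D = 0≤∧≢0⇒0< (minor-nonneg u v 0<a) λ G≡0 → ℤ.<-irrefl refl (ℤ.<-≤-trans
    (ℤ.+-mono-<-≤ (0<* 0<a 0<D) (0≤normᶻ (projected (len u) (form u v) (form u w) (form v w))))
    (ℤ.≤-reflexive (trans (sym (schur (len u) (len v) (len w) (form u v) (form u w) (form v w))) (cong (_* (len u * len w - normᶻ (form u w))) G≡0))))
    where
    0<a = len-positive u v w 0<D

  module _ (P : V → Set) (P-⊞ : ∀ {u v} → P u → P v → P (u ⊞ v)) (P-⊡ : ∀ {v} q → P v → P (q ⊡ v)) where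

    -- A frame lives in the submodule `P`, which in the application is a left ideal. The first
    -- vector is a parameter of the type because the inner reduction leaves it fixed; the
    -- determinant is what both reductions preserve.
    record Frame (D : ℤ) (u : V) : Set where
      constructor frame
      field
        {v w} : V
        u∈ : P u
        v∈ : P v
        w∈ : P w
        det≡ : det u v w ≡ D

    open Frame

    -- The binary Hermite bound for the form left after projecting away `u`: that form has
    -- determinant a D with a = `len u`, and its first vector, of length G, satisfies G² ≤ 2 a D.
    Reduced : ∀ {D u} → Frame D u → Set
    Reduced {D} {u} b = + 0 ≤ + 2 * (len u * D) - minor u (v b) * minor u (v b)

    frame-minor-positive : ∀ {D u} → + 0 < D → (b : Frame D u) → + 0 < minor u (v b)
    frame-minor-positive {u = u} 0<D b = minor-positive u (v b) (w b) (subst (+ 0 <_) (sym (det≡ b)) 0<D)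

    frame-len-positive : ∀ {D u} → + 0 < D → (b : Frame D u) → + 0 < len u
    frame-len-positive {u = u} 0<D b = len-positive u (v b) (w b) (subst (+ 0 <_) (sym (det≡ b)) 0<D)

    -- Gauss reduction of the projected binary form. Division by G makes the off-diagonal entry r
    -- satisfy 2 N(r) ≤ G². If the second vector is then not shorter than the first, G² ≤ G G′ = a D
    -- + N(r) gives the bound; otherwise the two are exchanged.
    reduce-third : ∀ {D u} → + 0 < D → (b : Frame D u) →
      Reduced b ⊎ (∃ λ (b′ : Frame D u) → ∣ minor u (v b′) ∣ ℕ.< ∣ minor u (v b) ∣)
    reduce-third {D} {u} 0<D b@(frame {v} {w} u∈ v∈ w∈ det≡) =
      step (euclid G 0<G (projected (len u) (form u v) (form u w) (form v w)))
      where
      a = len u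
      G = minor u v
      0<G : + 0 < G
      0<G = frame-minor-positive 0<D b
      a≢0 : a ≢ + 0
      a≢0 = 0<⇒≢0 (frame-len-positive 0<D b)
      step : EuclideanDivision G (projected (len u) (form u v) (form u w) (form v w)) →
        Reduced b ⊎ (∃ λ (b′ : Frame D u) → ∣ minor u (Frame.v b′) ∣ ℕ.< ∣ G ∣)
      step (q₀ , r , g≡ , r≤) = decide (minor u w′ ℤ.<? minor u v)
        where
        q = negᶻ (conjᶻ q₀)
        w′ = w ⊞ q ⊡ v
        det′≡ : det u v w′ ≡ D
        det′≡ = trans (det-shear-third u v w q a≢0) det≡
        g′≡ : projected a (form u v) (form u w′) (form v w′) ≡ r
        g′≡ = begin
          projected a (form u v) (form u w′) (form v w′)
            ≡⟨ cong₂ (projected a (form u v)) (trans (form-⊞ʳ u w (q ⊡ v)) (cong (form u w ⊹ᶻ_) (form-⊡ʳ u q v))) (form-shear v w q) ⟩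
          projected a (form u v) (form u w ⊹ᶻ (form u v ⋆ᶻ conjᶻ q)) (form v w ⊹ᶻ (len v •ᶻ conjᶻ q))
            ≡⟨ projected-shear₂₃ a (len v) (form u v) (form u w) (form v w) q ⟩
          projected a (form u v) (form u w) (form v w) ⊹ᶻ (G •ᶻ conjᶻ q)
            ≡⟨ cong₂ (λ s t → s ⊹ᶻ (G •ᶻ t)) g≡ (trans (conj-negᶻ (conjᶻ q₀)) (cong negᶻ (conj-conjᶻ q₀))) ⟩
          ((G •ᶻ q₀) ⊹ᶻ r) ⊹ᶻ (G •ᶻ negᶻ q₀)
            ≡⟨ trans (cong (((G •ᶻ q₀) ⊹ᶻ r) ⊹ᶻ_) (•-negᶻ G q₀)) (remainder (G •ᶻ q₀) r) ⟩
          r ∎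
          where open ≡-Reasoning
        schur′ : G * minor u w′ ≡ a * D + normᶻ r
        schur′ = trans (schur a (len v) (len w′) (form u v) (form u w′) (form v w′)) (cong₂ (λ s t → a * s + normᶻ t) det′≡ g′≡)
        decide : Dec (minor u w′ < G) →
          Reduced b ⊎ (∃ λ (b′ : Frame D u) → ∣ minor u (Frame.v b′) ∣ ℕ.< ∣ G ∣)
        decide (yes G′<G) = inj₂ (frame {v = w′} {w = v} u∈ (P-⊞ w∈ (P-⊡ q v∈)) v∈ (trans (det-swap-last u v w′) det′≡) ,
          ∣<∣ (minor-nonneg u w′ (frame-len-positive 0<D b)) G′<G)
        decide (no G≤G′) = inj₁ (subst (+ 0 ≤_)
          (trans (lemma G (minor u w′) (normᶻ r)) (cong (λ t → + 2 * t - G * G) (trans (cong (_- normᶻ r) schur′) (cancel (a * D) (normᶻ r)))))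
          (0≤+ r≤ (0≤* {+ 2} (+≤+ z≤n) (0≤* (ℤ.<⇒≤ 0<G) (≤⇒0≤- (ℤ.≮⇒≥ G≤G′))))))
          where
          lemma : ∀ G G′ N → G * G - + 2 * N + + 2 * (G * (G′ - G)) ≡ + 2 * (G * G′ - N) - G * G
          lemma = solve-∀
          cancel : ∀ s t → s + t - t ≡ s
          cancel = solve-∀

    reduce-inner : ∀ {D u} → + 0 < D → (b : Frame D u) → Acc ℕ._<_ ∣ minor u (v b) ∣ → ∃ λ (b′ : Frame D u) → Reduced b′
    reduce-inner {D} {u} 0<D b (acc rec) = continue (reduce-third 0<D b)
      where
      continue : Reduced b ⊎ (∃ λ (b′ : Frame D u) → ∣ minor u (v b′) ∣ ℕ.< ∣ minor u (v b) ∣) → ∃ λ (b′ : Frame D u) → Reduced b′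
      continue (inj₁ reduced) = b , reduced
      continue (inj₂ (b′ , smaller)) = reduce-inner 0<D b′ (rec smaller)

    ShortVector : ℤ → Set
    ShortVector D = ∃ λ t → P t × + 0 < len t × + 0 ≤ + 8 * D - len t * len t * len t

    -- The same step for u and v: unless v′ is shorter than u, a² ≤ a · len v′ = G + N(r) gives a² ≤
    -- 2 G. With G² ≤ 2 a D this yields a⁴ ≤ 8 a D, hence the constant 8.
    reduce-second : ∀ {D u} → + 0 < D → (b : Frame D u) → Reduced b →
      ShortVector D ⊎ (∃ λ u′ → Frame D u′ × ∣ len u′ ∣ ℕ.< ∣ len u ∣)
    reduce-second {D} {u} 0<D b@(frame {v} {w} u∈ v∈ w∈ det≡) G≤ = step (euclid a 0<a (form u v))
      where
      a = len u
      G = minor u v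
      0<a : + 0 < a
      0<a = frame-len-positive 0<D b
      step : EuclideanDivision a (form u v) → ShortVector D ⊎ (∃ λ u′ → Frame D u′ × ∣ len u′ ∣ ℕ.< ∣ len u ∣)
      step (q₀ , r , x≡ , r≤) = decide (len v′ ℤ.<? a)
        where
        q = negᶻ (conjᶻ q₀)
        v′ = v ⊞ q ⊡ u
        x′≡ : form u v′ ≡ r
        x′≡ = trans (form-shear u v q) (trans (cong₂ (λ s t → s ⊹ᶻ (a •ᶻ t)) x≡ (trans (conj-negᶻ (conjᶻ q₀)) (cong negᶻ (conj-conjᶻ q₀))))
          (trans (cong (((a •ᶻ q₀) ⊹ᶻ r) ⊹ᶻ_) (•-negᶻ a q₀)) (remainder (a •ᶻ q₀) r)))
        minor′ : a * len v′ - normᶻ r ≡ G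
        minor′ = trans (cong₂ (λ s t → a * s - normᶻ t) (len-⊞-⊡ v q u) (trans (sym x′≡) (form-shear u v q))) (minor-shear a (len v) (form u v) q)
        decide : Dec (len v′ < a) → ShortVector D ⊎ (∃ λ u′ → Frame D u′ × ∣ len u′ ∣ ℕ.< ∣ len u ∣)
        decide (yes v′<u) = inj₂ (v′ , frame {v = u} {w = w} (P-⊞ v∈ (P-⊡ q u∈)) u∈ w∈
            (trans (det-swap-first u v′ w) (trans (det-shear-second u v w q (0<⇒≢0 0<a)) det≡)) ,
          ∣<∣ (len-nonneg v′) v′<u)
        decide (no v′≮u) = inj₁ (u , u∈ , 0<a , 0≤*-cancel 0<a (subst (+ 0 ≤_) (lemma₂ a G D)
            (0≤+ (0≤* {+ 4} (+≤+ z≤n) G≤) (0≤* a²≤2G (0≤+ (0≤* {+ 2} (+≤+ z≤n) (minor-nonneg u v 0<a)) (0≤² a))))))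
          where
          lemma₁ : ∀ a b N → a * a - + 2 * N + + 2 * (a * (b - a)) ≡ + 2 * (a * b - N) - a * a
          lemma₁ = solve-∀
          a²≤2G : + 0 ≤ + 2 * G - a * a
          a²≤2G = subst (+ 0 ≤_) (trans (lemma₁ a (len v′) (normᶻ r)) (cong (λ t → + 2 * t - a * a) minor′))
            (0≤+ r≤ (0≤* {+ 2} (+≤+ z≤n) (0≤* (ℤ.<⇒≤ 0<a) (≤⇒0≤- (ℤ.≮⇒≥ v′≮u)))))
          lemma₂ : ∀ a G D → + 4 * (+ 2 * (a * D) - G * G) + (+ 2 * G - a * a) * (+ 2 * G + a * a) ≡ a * (+ 8 * D - a * a * a)
          lemma₂ = solve-∀

    -- Exchanging u and v spoils the inner reduction, which is therefore run afresh in each round;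
    -- `len u` strictly decreases from one round to the next.
    short-vector : ∀ {D u} → + 0 < D → Frame D u → Acc ℕ._<_ ∣ len u ∣ → ShortVector D
    short-vector {D} {u} 0<D b (acc rec) = continue (reduce-inner 0<D b (<-wellFounded ∣ minor u (v b) ∣))
      where
      continue′ : ShortVector D ⊎ (∃ λ u′ → Frame D u′ × ∣ len u′ ∣ ℕ.< ∣ len u ∣) → ShortVector D
      continue′ (inj₁ short) = short
      continue′ (inj₂ (u′ , b″ , smaller)) = short-vector 0<D b″ (rec smaller)
      continue : (∃ λ (b′ : Frame D u) → Reduced b′) → ShortVector D
      continue (b′ , reduced) = continue′ (reduce-second 0<D b′ reduced)

-- The ring of integers with its trace, norm and adjugate.

O-≡ : ∀ {x y : O} → O.c₀ x ≡ O.c₀ y → O.c₁ x ≡ O.c₁ y → O.c₂ x ≡ O.c₂ y → x ≡ y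
O-≡ refl refl refl = refl

record Triple (A : Set) : Set where
  no-eta-equality
  pattern
  constructor triple
  field
    fst snd trd : A

module CubicFormulas {A : Set} (_+_ _*_ : A → A → A) (-_ : A → A) (κ : ℤ → A) where
  private
    infixl 6 _∔_ _∸_
    infixl 7 _·_
    _∔_ = _+_
    _·_ = _*_
    _∸_ : A → A → A
    x ∸ y = x ∔ (- y)

  _⊹_ mul : Triple A → Triple A → Triple A
  triple a b c ⊹ triple d e f = triple (a ∔ d) (b ∔ e) (c ∔ f)
  mul (triple a b c) (triple d e f) = triple (e₀ ∔ e₃ ∸ e₄) (e₁ ∔ κ (+ 2) · e₃ ∸ e₄) (e₂ ∸ e₃ ∔ κ (+ 3) · e₄)
    where
    e₀ = a · d
    e₁ = a · e ∔ b · d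
    e₂ = a · f ∔ b · e ∔ c · d
    e₃ = b · f ∔ c · e
    e₄ = c · f

  -- The product of the two other conjugates of x, computed as the cofactors of the first row of the
  -- matrix of multiplication by x in the basis 1, θ, θ².
  adjugate : Triple A → Triple A
  adjugate (triple a b c) = triple
    ((a ∔ κ (+ 2) · c) · (a ∸ b ∔ κ (+ 3) · c) ∸ (b ∸ c) · (κ (+ 2) · b ∸ c))
    (c · (κ (+ 2) · b ∸ c) ∸ b · (a ∸ b ∔ κ (+ 3) · c))
    (b · (b ∸ c) ∸ c · (a ∔ κ (+ 2) · c))

  -- The first coordinate of mul x (adjugate x); the others vanish.
  cubicNorm traceForm : Triple A → A
  cubicNorm x@(triple a b c) with adjugate x
  ... | triple d e f = a · d ∔ c · e ∔ (b ∸ c) · f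
  -- 3, -1 and 5 are the traces of 1, θ and θ².
  traceForm (triple a b c) = κ (+ 3) · a ∸ b ∔ κ (+ 5) · c

module S = IntegerSolver ℤ-algebra
module C = CubicFormulas _+_ _*_ -_ (λ a → a)
module P {n} = CubicFormulas {S.Expr ℤ n} S._⊞_ S._⊠_ S.⊝_ S.Κ

private
  toTriple : O → Triple ℤ
  toTriple ⟨ a , b , c ⟩ = triple a b c

  fromTriple : Triple ℤ → O
  fromTriple (triple a b c) = ⟨ a , b , c ⟩

open Triple

infixl 6 _+ₒ_
infixl 7 _*ₒ_
infix 8 -ₒ_

-- Sealing the operations keeps terms over O from unfolding into polynomials in their coordinates,
-- so that O acts as an abstract ring. Concrete elements are computed in the blocks that unfold
-- these definitions.
opaque
  _+ₒ_ _*ₒ_ : O → O → O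
  _+ₒ_ = _⊕_
  _*ₒ_ = _⊗_

  -ₒ_ adj : O → O
  -ₒ ⟨ a , b , c ⟩ = ⟨ - a , - b , - c ⟩
  adj x = fromTriple (C.adjugate (toTriple x))

  int : ℤ → O
  int a = ⟨ a , + 0 , + 0 ⟩

  Tr Nm : O → ℤ
  Tr x = C.traceForm (toTriple x)
  Nm x = C.cubicNorm (toTriple x)

  +ₒ-def : ∀ x y → x +ₒ y ≡ x ⊕ y
  +ₒ-def _ _ = refl

  *ₒ-def : ∀ x y → x *ₒ y ≡ x ⊗ y
  *ₒ-def _ _ = refl

  int-def : ∀ a → int a ≡ ⟨ a , + 0 , + 0 ⟩
  int-def _ = refl

  +ₒ-assoc : ∀ x y z → (x +ₒ y) +ₒ z ≡ x +ₒ (y +ₒ z)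
  +ₒ-assoc ⟨ a , b , c ⟩ ⟨ d , e , f ⟩ ⟨ g , h , i ⟩ = O-≡ (ℤ.+-assoc a d g) (ℤ.+-assoc b e h) (ℤ.+-assoc c f i)

  +ₒ-comm : ∀ x y → x +ₒ y ≡ y +ₒ x
  +ₒ-comm ⟨ a , b , c ⟩ ⟨ d , e , f ⟩ = O-≡ (ℤ.+-comm a d) (ℤ.+-comm b e) (ℤ.+-comm c f)

  +ₒ-identityˡ : ∀ x → int (+ 0) +ₒ x ≡ x
  +ₒ-identityˡ ⟨ a , b , c ⟩ = O-≡ (ℤ.+-identityˡ a) (ℤ.+-identityˡ b) (ℤ.+-identityˡ c)

  +ₒ-inverseˡ : ∀ x → (-ₒ x) +ₒ x ≡ int (+ 0)
  +ₒ-inverseˡ ⟨ a , b , c ⟩ = O-≡ (ℤ.+-inverseˡ a) (ℤ.+-inverseˡ b) (ℤ.+-inverseˡ c)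

  *ₒ-comm : ∀ x y → x *ₒ y ≡ y *ₒ x
  *ₒ-comm ⟨ a , b , c ⟩ ⟨ d , e , f ⟩ = O-≡
    (S.solve 6 (λ a b c d e f → fst (P.mul (triple a b c) (triple d e f)) S.⊜ fst (P.mul (triple d e f) (triple a b c))) refl a b c d e f)
    (S.solve 6 (λ a b c d e f → snd (P.mul (triple a b c) (triple d e f)) S.⊜ snd (P.mul (triple d e f) (triple a b c))) refl a b c d e f)
    (S.solve 6 (λ a b c d e f → trd (P.mul (triple a b c) (triple d e f)) S.⊜ trd (P.mul (triple d e f) (triple a b c))) refl a b c d e f)

  *ₒ-assoc : ∀ x y z → (x *ₒ y) *ₒ z ≡ x *ₒ (y *ₒ z)
  *ₒ-assoc ⟨ a , b , c ⟩ ⟨ d , e , f ⟩ ⟨ g , h , i ⟩ = O-≡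
    (S.solve 9 (λ a b c d e f g h i → fst (P.mul (P.mul (triple a b c) (triple d e f)) (triple g h i)) S.⊜ fst (P.mul (triple a b c) (P.mul (triple d e f) (triple g h i)))) refl a b c d e f g h i)
    (S.solve 9 (λ a b c d e f g h i → snd (P.mul (P.mul (triple a b c) (triple d e f)) (triple g h i)) S.⊜ snd (P.mul (triple a b c) (P.mul (triple d e f) (triple g h i)))) refl a b c d e f g h i)
    (S.solve 9 (λ a b c d e f g h i → trd (P.mul (P.mul (triple a b c) (triple d e f)) (triple g h i)) S.⊜ trd (P.mul (triple a b c) (P.mul (triple d e f) (triple g h i)))) refl a b c d e f g h i)

  *ₒ-identityˡ : ∀ x → int (+ 1) *ₒ x ≡ x
  *ₒ-identityˡ ⟨ a , b , c ⟩ = O-≡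
    (S.solve 3 (λ a b c → fst (P.mul (triple (S.Κ (+ 1)) (S.Κ (+ 0)) (S.Κ (+ 0))) (triple a b c)) S.⊜ fst ((triple a b c))) refl a b c)
    (S.solve 3 (λ a b c → snd (P.mul (triple (S.Κ (+ 1)) (S.Κ (+ 0)) (S.Κ (+ 0))) (triple a b c)) S.⊜ snd ((triple a b c))) refl a b c)
    (S.solve 3 (λ a b c → trd (P.mul (triple (S.Κ (+ 1)) (S.Κ (+ 0)) (S.Κ (+ 0))) (triple a b c)) S.⊜ trd ((triple a b c))) refl a b c)

  *ₒ-distribʳ : ∀ x y z → (y +ₒ z) *ₒ x ≡ y *ₒ x +ₒ z *ₒ x
  *ₒ-distribʳ ⟨ a , b , c ⟩ ⟨ d , e , f ⟩ ⟨ g , h , i ⟩ = O-≡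
    (S.solve 9 (λ a b c d e f g h i → fst (P.mul ((triple d e f) P.⊹ (triple g h i)) (triple a b c)) S.⊜ fst (P.mul (triple d e f) (triple a b c) P.⊹ P.mul (triple g h i) (triple a b c))) refl a b c d e f g h i)
    (S.solve 9 (λ a b c d e f g h i → snd (P.mul ((triple d e f) P.⊹ (triple g h i)) (triple a b c)) S.⊜ snd (P.mul (triple d e f) (triple a b c) P.⊹ P.mul (triple g h i) (triple a b c))) refl a b c d e f g h i)
    (S.solve 9 (λ a b c d e f g h i → trd (P.mul ((triple d e f) P.⊹ (triple g h i)) (triple a b c)) S.⊜ trd (P.mul (triple d e f) (triple a b c) P.⊹ P.mul (triple g h i) (triple a b c))) refl a b c d e f g h i)

  int-* : ∀ s t → int (s * t) ≡ int s *ₒ int t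
  int-* s t = O-≡
    (S.solve 2 (λ s t → fst (triple (s S.⊠ t) (S.Κ (+ 0)) (S.Κ (+ 0))) S.⊜ fst (P.mul (triple s (S.Κ (+ 0)) (S.Κ (+ 0))) (triple t (S.Κ (+ 0)) (S.Κ (+ 0))))) refl s t)
    (S.solve 2 (λ s t → snd (triple (s S.⊠ t) (S.Κ (+ 0)) (S.Κ (+ 0))) S.⊜ snd (P.mul (triple s (S.Κ (+ 0)) (S.Κ (+ 0))) (triple t (S.Κ (+ 0)) (S.Κ (+ 0))))) refl s t)
    (S.solve 2 (λ s t → trd (triple (s S.⊠ t) (S.Κ (+ 0)) (S.Κ (+ 0))) S.⊜ trd (P.mul (triple s (S.Κ (+ 0)) (S.Κ (+ 0))) (triple t (S.Κ (+ 0)) (S.Κ (+ 0))))) refl s t)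

  *ₒ-adj : ∀ x → x *ₒ adj x ≡ int (Nm x)
  *ₒ-adj ⟨ a , b , c ⟩ = O-≡
    (S.solve 3 (λ a b c → fst (P.mul (triple a b c) (P.adjugate (triple a b c))) S.⊜ fst ((triple (P.cubicNorm (triple a b c)) (S.Κ (+ 0)) (S.Κ (+ 0))))) refl a b c)
    (S.solve 3 (λ a b c → snd (P.mul (triple a b c) (P.adjugate (triple a b c))) S.⊜ snd ((triple (P.cubicNorm (triple a b c)) (S.Κ (+ 0)) (S.Κ (+ 0))))) refl a b c)
    (S.solve 3 (λ a b c → trd (P.mul (triple a b c) (P.adjugate (triple a b c))) S.⊜ trd ((triple (P.cubicNorm (triple a b c)) (S.Κ (+ 0)) (S.Κ (+ 0))))) refl a b c)

  Tr-int : ∀ s x → Tr (int s *ₒ x) ≡ s * Tr x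
  Tr-int s ⟨ a , b , c ⟩ =
    S.solve 4 (λ s a b c → P.traceForm (P.mul (triple s (S.Κ (+ 0)) (S.Κ (+ 0))) (triple a b c)) S.⊜ s S.⊠ P.traceForm (triple a b c)) refl s a b c

  Tr-+ : ∀ x y → Tr (x +ₒ y) ≡ Tr x + Tr y
  Tr-+ ⟨ a , b , c ⟩ ⟨ d , e , f ⟩ =
    S.solve 6 (λ a b c d e f → P.traceForm ((triple a b c) P.⊹ (triple d e f)) S.⊜ P.traceForm (triple a b c) S.⊞ P.traceForm (triple d e f)) refl a b c d e f

  Nm-* : ∀ x y → Nm (x *ₒ y) ≡ Nm x * Nm y
  Nm-* ⟨ a , b , c ⟩ ⟨ d , e , f ⟩ =
    S.solve 6 (λ a b c d e f → P.cubicNorm (P.mul (triple a b c) (triple d e f)) S.⊜ P.cubicNorm (triple a b c) S.⊠ P.cubicNorm (triple d e f)) refl a b c d e f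

  Nm-int : ∀ s → Nm (int s) ≡ s * (s * s)
  Nm-int s =
    S.solve 1 (λ s → P.cubicNorm (triple s (S.Κ (+ 0)) (S.Κ (+ 0))) S.⊜ s S.⊠ (s S.⊠ s)) refl s

  -- Completed squares: this makes the trace form positive definite without any appeal to real
  -- embeddings.
  Tr-square : ∀ x → + 3 * Tr (x *ₒ x) ≡ Tr x * Tr x + + 7 * (O.c₁ x * O.c₁ x + O.c₂ x * O.c₂ x + (O.c₁ x - O.c₂ x) * (O.c₁ x - O.c₂ x))
  Tr-square ⟨ a , b , c ⟩ =
    S.solve 3 (λ a b c → S.Κ (+ 3) S.⊠ P.traceForm (P.mul (triple a b c) (triple a b c)) S.⊜ P.traceForm (triple a b c) S.⊠ P.traceForm (triple a b c) S.⊞ S.Κ (+ 7) S.⊠ (b S.⊠ b S.⊞ c S.⊠ c S.⊞ (b S.⊟ c) S.⊠ (b S.⊟ c))) refl a b c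

  int-+ : ∀ s t → int (s + t) ≡ int s +ₒ int t
  int-+ s t = refl

  int-neg : ∀ s → int (- s) ≡ -ₒ int s
  int-neg s = refl

  Tr-neg : ∀ x → Tr (-ₒ x) ≡ - Tr x
  Tr-neg ⟨ a , b , c ⟩ = lemma a b c
    where
    lemma : ∀ a b c → + 3 * - a - - b + + 5 * - c ≡ - (+ 3 * a - b + + 5 * c)
    lemma = solve-∀

  int-injective : ∀ {s t} → int s ≡ int t → s ≡ t
  int-injective e = cong O.c₀ e

  Tr-1 : ∀ s → Tr (int s) ≡ + 3 * s
  Tr-1 s = lemma s
    where
    lemma : ∀ s → + 3 * s - + 0 + + 5 * + 0 ≡ + 3 * s
    lemma = solve-∀

O-algebra : IntegerAlgebra
O-algebra = record
  { Carrier = O ; _+_ = _+ₒ_ ; _*_ = _*ₒ_ ; -_ = -ₒ_ ; fromℤ = int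
  ; isCommutativeRing = isCommutativeRing
  ; fromℤ-+ = int-+ ; fromℤ-* = int-* ; fromℤ-neg = int-neg }
  where
  isCommutativeRing : IsCommutativeRing _≡_ _+ₒ_ _*ₒ_ -ₒ_ (int (+ 0)) (int (+ 1))
  isCommutativeRing = record
    { isRing = record
      { +-isAbelianGroup = record
        { isGroup = record
          { isMonoid = record
            { isSemigroup = record
              { isMagma = record { isEquivalence = isEquivalence ; ∙-cong = cong₂ _+ₒ_ }
              ; assoc = +ₒ-assoc }
            ; identity = comm∧idˡ⇒id +ₒ-comm +ₒ-identityˡ }
          ; inverse = comm∧invˡ⇒inv +ₒ-comm +ₒ-inverseˡ
          ; ⁻¹-cong = cong -ₒ_ }
        ; comm = +ₒ-comm }
      ; *-cong = cong₂ _*ₒ_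
      ; *-assoc = *ₒ-assoc
      ; *-identity = comm∧idˡ⇒id *ₒ-comm *ₒ-identityˡ
      ; distrib = (λ x y z → trans (*ₒ-comm x (y +ₒ z)) (trans (*ₒ-distribʳ x y z) (cong₂ _+ₒ_ (*ₒ-comm y x) (*ₒ-comm z x)))) , *ₒ-distribʳ }
    ; *-comm = *ₒ-comm }

module SO = IntegerSolver O-algebra

0ₒ 1ₒ 2ₒ : O
0ₒ = int (+ 0)
1ₒ = int (+ 1)
2ₒ = int (+ 2)

infix 4 _∣ₒ_
_∣ₒ_ : O → O → Set
α ∣ₒ x = ∃ λ y → x ≡ α *ₒ y

_≟ₒ_ : (x y : O) → Dec (x ≡ y)
⟨ a , b , c ⟩ ≟ₒ ⟨ d , e , f ⟩ with a ℤ.≟ d | b ℤ.≟ e | c ℤ.≟ f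
... | yes refl | yes refl | yes refl = yes refl
... | no a≢d | _ | _ = no λ e → a≢d (cong O.c₀ e)
... | yes _ | no b≢e | _ = no λ p → b≢e (cong O.c₁ p)
... | yes _ | yes _ | no c≢f = no λ p → c≢f (cong O.c₂ p)

*ₒ-zeroʳ : ∀ x → x *ₒ 0ₒ ≡ 0ₒ
*ₒ-zeroʳ = SO.solve 1 (λ x → x SO.⊠ SO.Κ (+ 0) SO.⊜ SO.Κ (+ 0)) refl

*ₒ-identityʳ : ∀ x → x *ₒ 1ₒ ≡ x
*ₒ-identityʳ = SO.solve 1 (λ x → x SO.⊠ SO.Κ (+ 1) SO.⊜ x) refl

x-y≡0⇒x≡y : ∀ {x y} → x +ₒ -ₒ y ≡ 0ₒ → x ≡ y
x-y≡0⇒x≡y {x} {y} e = trans (lemma x y) (trans (cong (_+ₒ y) e) (+ₒ-identityˡ y))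
  where
  lemma : ∀ x y → x ≡ x +ₒ -ₒ y +ₒ y
  lemma = SO.solve 2 (λ x y → x SO.⊜ x SO.⊞ (SO.⊝ y) SO.⊞ y) refl

-- Parity of norms, and the absence of zero divisors in O.

Bit : ℤ → Set
Bit p = p ≡ + 0 ⊎ p ≡ + 1

opaque
  unfolding _+ₒ_

  int-scale : ∀ n a b c → int n *ₒ ⟨ a , b , c ⟩ ≡ ⟨ n * a , n * b , n * c ⟩
  int-scale n a b c = O-≡
    (S.solve 4 (λ n a b c → fst (P.mul (triple n (S.Κ (+ 0)) (S.Κ (+ 0))) (triple a b c)) S.⊜ n S.⊠ a) refl n a b c)
    (S.solve 4 (λ n a b c → snd (P.mul (triple n (S.Κ (+ 0)) (S.Κ (+ 0))) (triple a b c)) S.⊜ n S.⊠ b) refl n a b c)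
    (S.solve 4 (λ n a b c → trd (P.mul (triple n (S.Κ (+ 0)) (S.Κ (+ 0))) (triple a b c)) S.⊜ n S.⊠ c) refl n a b c)

  Nm-shift : ∀ x y → Nm (x +ₒ 2ₒ *ₒ y) ≡ Nm x + + 2 * (Tr (adj x *ₒ y) + + 2 * Tr (x *ₒ adj y) + + 4 * Nm y)
  Nm-shift ⟨ a , b , c ⟩ ⟨ d , e , f ⟩ = S.solve 6 (λ a b c d e f →
      let x = triple a b c ; y = triple d e f ; two = S.Κ (+ 2) in
      P.cubicNorm (x P.⊹ P.mul (triple two (S.Κ (+ 0)) (S.Κ (+ 0))) y) S.⊜
      P.cubicNorm x S.⊞ two S.⊠ (P.traceForm (P.mul (P.adjugate x) y) S.⊞ two S.⊠ P.traceForm (P.mul x (P.adjugate y)) S.⊞ S.Κ (+ 4) S.⊠ P.cubicNorm y))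
      refl a b c d e f

  combine : ∀ r a b c d e f → ⟨ a , b , c ⟩ +ₒ -ₒ (int r *ₒ ⟨ d , e , f ⟩) ≡ ⟨ a - r * d , b - r * e , c - r * f ⟩
  combine r a b c d e f = cong (λ y → ⟨ a , b , c ⟩ +ₒ -ₒ y) (int-scale r d e f)

  θ-shift : ∀ a b c → ⟨ + 0 , + 1 , + 0 ⟩ *ₒ ⟨ a , b , c ⟩ ≡ ⟨ c , a + + 2 * c , b - c ⟩
  θ-shift a b c = O-≡
    (S.solve 3 (λ a b c → fst (P.mul (triple (S.Κ (+ 0)) (S.Κ (+ 1)) (S.Κ (+ 0))) (triple a b c)) S.⊜ c) refl a b c)
    (S.solve 3 (λ a b c → snd (P.mul (triple (S.Κ (+ 0)) (S.Κ (+ 1)) (S.Κ (+ 0))) (triple a b c)) S.⊜ a S.⊞ S.Κ (+ 2) S.⊠ c) refl a b c)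
    (S.solve 3 (λ a b c → trd (P.mul (triple (S.Κ (+ 0)) (S.Κ (+ 1)) (S.Κ (+ 0))) (triple a b c)) S.⊜ b S.⊟ c) refl a b c)

  Nm-bits : ∀ p q r → Bit p → Bit q → Bit r → (p ≡ + 0 × q ≡ + 0 × r ≡ + 0) ⊎ (∃ λ k → Nm ⟨ p , q , r ⟩ ≡ + 1 + + 2 * k)
  Nm-bits _ _ _ (inj₁ refl) (inj₁ refl) (inj₁ refl) = inj₁ (refl , refl , refl)
  Nm-bits _ _ _ (inj₁ refl) (inj₁ refl) (inj₂ refl) = inj₂ (+ 0 , refl)
  Nm-bits _ _ _ (inj₁ refl) (inj₂ refl) (inj₁ refl) = inj₂ (+ 0 , refl)
  Nm-bits _ _ _ (inj₁ refl) (inj₂ refl) (inj₂ refl) = inj₂ (- + 1 , refl)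
  Nm-bits _ _ _ (inj₂ refl) (inj₁ refl) (inj₁ refl) = inj₂ (+ 0 , refl)
  Nm-bits _ _ _ (inj₂ refl) (inj₁ refl) (inj₂ refl) = inj₂ (+ 6 , refl)
  Nm-bits _ _ _ (inj₂ refl) (inj₂ refl) (inj₁ refl) = inj₂ (- + 1 , refl)
  Nm-bits _ _ _ (inj₂ refl) (inj₂ refl) (inj₂ refl) = inj₂ (+ 3 , refl)

  bits-decompose : ∀ p q r a b c → ⟨ p + + 2 * a , q + + 2 * b , r + + 2 * c ⟩ ≡ ⟨ p , q , r ⟩ +ₒ 2ₒ *ₒ ⟨ a , b , c ⟩
  bits-decompose p q r a b c = cong (⟨ p , q , r ⟩ +ₒ_) (sym (int-scale (+ 2) a b c))

halve : ∀ a → ∃₂ λ p k → Bit p × a ≡ p + + 2 * k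
halve a = go (a ℤ.%ℕ 2) (ℤ.n%ℕd<d a 2) (ℤ.a≡a%ℕn+[a/ℕn]*n a 2)
  where
  go : ∀ r → r ℕ.< 2 → a ≡ + r + a ℤ./ℕ 2 * + 2 → ∃₂ λ p k → Bit p × a ≡ p + + 2 * k
  go 0 _ e = + 0 , a ℤ./ℕ 2 , inj₁ refl , trans e (cong (_+_ (+ 0)) (ℤ.*-comm (a ℤ./ℕ 2) (+ 2)))
  go 1 _ e = + 1 , a ℤ./ℕ 2 , inj₂ refl , trans e (cong (_+_ (+ 1)) (ℤ.*-comm (a ℤ./ℕ 2) (+ 2)))
  go (suc (suc _)) (s≤s (s≤s ())) _

-- x³ + x² - 2x - 1 has no root modulo 2, so 2 is inert, O / 2 is a field with eight elements, and
-- every nonzero class has odd norm. `Nm-bits` inspects the classes one by one.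
even-or-odd-norm : ∀ x → 2ₒ ∣ₒ x ⊎ (∃ λ k → Nm x ≡ + 1 + + 2 * k)
even-or-odd-norm ⟨ a , b , c ⟩ with halve a | halve b | halve c
... | p , a′ , bp , refl | q , b′ , bq , refl | r , c′ , br , refl = go (Nm-bits p q r bp bq br)
  where
  y = ⟨ a′ , b′ , c′ ⟩
  go : (p ≡ + 0 × q ≡ + 0 × r ≡ + 0) ⊎ (∃ λ k → Nm ⟨ p , q , r ⟩ ≡ + 1 + + 2 * k) → 2ₒ ∣ₒ ⟨ p + + 2 * a′ , q + + 2 * b′ , r + + 2 * c′ ⟩ ⊎ (∃ λ k → Nm ⟨ p + + 2 * a′ , q + + 2 * b′ , r + + 2 * c′ ⟩ ≡ + 1 + + 2 * k)
  go (inj₁ (refl , refl , refl)) = inj₁ (y , trans (bits-decompose p q r a′ b′ c′)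
    (trans (cong (_+ₒ 2ₒ *ₒ y) (sym (int-def (+ 0)))) (+ₒ-identityˡ (2ₒ *ₒ y))))
  go (inj₂ (k , e)) = inj₂ (k + M , trans (cong Nm (bits-decompose p q r a′ b′ c′))
    (trans (Nm-shift ⟨ p , q , r ⟩ y) (trans (cong (_+ + 2 * M) e) (lemma k M))))
    where
    M = Tr (adj ⟨ p , q , r ⟩ *ₒ y) + + 2 * Tr (⟨ p , q , r ⟩ *ₒ adj y) + + 4 * Nm y
    lemma : ∀ k M → + 1 + + 2 * k + + 2 * M ≡ + 1 + + 2 * (k + M)
    lemma = solve-∀

odd≢even : ∀ {k m} → ¬ (+ 1 + + 2 * k ≡ + 2 * m)
odd≢even {k} {m} e = contradiction (ℕ.∣1⇒≡1 (ℕ.divides ∣ m - k ∣ (trans (cong ∣_∣ one) (trans (ℤ.abs-* (+ 2) (m - k)) (ℕ.*-comm 2 ∣ m - k ∣))))) λ ()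
  where
  lemma : ∀ k m → + 1 ≡ (+ 1 + + 2 * k) - + 2 * m + + 2 * (m - k)
  lemma = solve-∀
  cancel : ∀ m k → + 2 * m - + 2 * m + + 2 * (m - k) ≡ + 2 * (m - k)
  cancel = solve-∀
  one : + 1 ≡ + 2 * (m - k)
  one = trans (lemma k m) (trans (cong (λ t → t - + 2 * m + + 2 * (m - k)) e) (cancel m k))

size : O → ℕ
size ⟨ a , b , c ⟩ = ∣ a ∣ ℕ.+ ∣ b ∣ ℕ.+ ∣ c ∣

size≡0 : ∀ x → size x ≡ 0 → x ≡ ⟨ + 0 , + 0 , + 0 ⟩
size≡0 ⟨ a , b , c ⟩ e = O-≡ (ℤ.∣i∣≡0⇒i≡0 (ℕ.m+n≡0⇒m≡0 ∣ a ∣ ab)) (ℤ.∣i∣≡0⇒i≡0 (ℕ.m+n≡0⇒n≡0 ∣ a ∣ ab)) (ℤ.∣i∣≡0⇒i≡0 (ℕ.m+n≡0⇒n≡0 (∣ a ∣ ℕ.+ ∣ b ∣) e))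
  where
  ab = ℕ.m+n≡0⇒m≡0 (∣ a ∣ ℕ.+ ∣ b ∣) e

size-double : ∀ y → size (2ₒ *ₒ y) ≡ 2 ℕ.* size y
size-double ⟨ a , b , c ⟩ = trans (cong size (int-scale (+ 2) a b c))
  (trans (cong₂ ℕ._+_ (cong₂ ℕ._+_ (ℤ.abs-* (+ 2) a) (ℤ.abs-* (+ 2) b)) (ℤ.abs-* (+ 2) c))
    (sym (trans (ℕ.*-distribˡ-+ 2 (∣ a ∣ ℕ.+ ∣ b ∣) ∣ c ∣) (cong (ℕ._+ 2 ℕ.* ∣ c ∣) (ℕ.*-distribˡ-+ 2 ∣ a ∣ ∣ b ∣)))))

-- Infinite descent: an element of norm zero does not have odd norm, so it is twice another element
-- of norm zero, and `size` halves.
Nm≡0 : ∀ x → Nm x ≡ + 0 → x ≡ 0ₒ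
Nm≡0 x = go x (<-wellFounded (size x))
  where
  go : ∀ x → Acc ℕ._<_ (size x) → Nm x ≡ + 0 → x ≡ 0ₒ
  go x (acc rec) e with even-or-odd-norm x
  ... | inj₂ (k , o) = ⊥-elim (odd≢even {k} {+ 0} (trans (sym o) e))
  ... | inj₁ (y , refl) = halved (size y ℕ.≟ 0)
    where
    Nm-y : Nm y ≡ + 0
    Nm-y = *-cancelˡ {Nm 2ₒ} (λ e₈ → contradiction (trans (sym (Nm-int (+ 2))) e₈) λ ()) (trans (sym (Nm-* 2ₒ y)) (trans e (sym (ℤ.*-zeroʳ (Nm 2ₒ)))))
    halved : Dec (size y ≡ 0) → 2ₒ *ₒ y ≡ 0ₒ
    halved (yes z) = trans (cong (2ₒ *ₒ_) (trans (size≡0 y z) (sym (int-def (+ 0))))) (*ₒ-zeroʳ 2ₒ)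
    halved (no nz) = trans (cong (2ₒ *ₒ_) (go y (rec (subst (size y ℕ.<_) (sym (size-double y))
      (ℕ.m<m+n (size y) (subst (0 ℕ.<_) (sym (ℕ.+-identityʳ (size y))) (ℕ.n≢0⇒n>0 nz))))) Nm-y)) (*ₒ-zeroʳ 2ₒ)

int-cancel : ∀ {n x} → n ≢ + 0 → int n *ₒ x ≡ 0ₒ → x ≡ 0ₒ
int-cancel {n} {⟨ a , b , c ⟩} n≢0 e = trans (O-≡ (z (cong O.c₀ e′)) (z (cong O.c₁ e′)) (z (cong O.c₂ e′))) (sym (int-def (+ 0)))
  where
  e′ : ⟨ n * a , n * b , n * c ⟩ ≡ ⟨ + 0 , + 0 , + 0 ⟩
  e′ = trans (sym (int-scale n a b c)) (trans e (int-def (+ 0)))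
  z : ∀ {a} → n * a ≡ + 0 → a ≡ + 0
  z {a} e = *-cancelˡ n≢0 (trans e (sym (ℤ.*-zeroʳ n)))

no-zero-divisors : ∀ {x y} → x ≢ 0ₒ → x *ₒ y ≡ 0ₒ → y ≡ 0ₒ
no-zero-divisors {x} {y} x≢0 e = int-cancel (λ n → x≢0 (Nm≡0 x n))
  (trans (cong (_*ₒ y) (trans (sym (*ₒ-adj x)) (*ₒ-comm x (adj x)))) (trans (*ₒ-assoc (adj x) x y) (trans (cong (adj x *ₒ_) e) (*ₒ-zeroʳ (adj x)))))

*ₒ-cancelˡ : ∀ {x y z} → x ≢ 0ₒ → x *ₒ y ≡ x *ₒ z → y ≡ z
*ₒ-cancelˡ {x} {y} {z} x≢0 e = x-y≡0⇒x≡y (no-zero-divisors x≢0 (trans (lemma x y z) (trans (cong (λ t → t +ₒ -ₒ (x *ₒ z)) e) (cancel (x *ₒ z)))))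
  where
  lemma : ∀ x y z → x *ₒ (y +ₒ -ₒ z) ≡ x *ₒ y +ₒ -ₒ (x *ₒ z)
  lemma = SO.solve 3 (λ x y z → x SO.⊠ (y SO.⊞ SO.⊝ z) SO.⊜ x SO.⊠ y SO.⊞ SO.⊝ (x SO.⊠ z)) refl
  cancel : ∀ x → x +ₒ -ₒ x ≡ 0ₒ
  cancel = SO.solve 1 (λ x → x SO.⊞ SO.⊝ x SO.⊜ SO.Κ (+ 0)) refl

int≢0 : ∀ {n} → n ≢ + 0 → int n ≢ 0ₒ
int≢0 n≢0 e = n≢0 (int-injective e)

-- Hermite normal forms of principal ideals.

∣-combine : ∀ {α a b c d e f} r → α ∣ₒ ⟨ a , b , c ⟩ → α ∣ₒ ⟨ d , e , f ⟩ → α ∣ₒ ⟨ a - r * d , b - r * e , c - r * f ⟩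
∣-combine {α} {a} {b} {c} {d} {e} {f} r (x , p) (y , q) = x +ₒ -ₒ (int r *ₒ y) ,
  trans (sym (combine r a b c d e f)) (trans (cong₂ (λ u v → u +ₒ -ₒ (int r *ₒ v)) p q) (lemma α x y (int r)))
  where
  lemma : ∀ α x y r → α *ₒ x +ₒ -ₒ (r *ₒ (α *ₒ y)) ≡ α *ₒ (x +ₒ -ₒ (r *ₒ y))
  lemma = SO.solve 4 (λ α x y r → α SO.⊠ x SO.⊞ SO.⊝ (r SO.⊠ (α SO.⊠ y)) SO.⊜ α SO.⊠ (x SO.⊞ SO.⊝ (r SO.⊠ y))) refl

∣-θ : ∀ {α a b c} → α ∣ₒ ⟨ a , b , c ⟩ → α ∣ₒ ⟨ c , a + + 2 * c , b - c ⟩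
∣-θ {α} {a} {b} {c} (x , p) = ⟨ + 0 , + 1 , + 0 ⟩ *ₒ x , trans (sym (θ-shift a b c)) (trans (cong (⟨ + 0 , + 1 , + 0 ⟩ *ₒ_) p) (lemma α ⟨ + 0 , + 1 , + 0 ⟩ x))
  where
  lemma : ∀ α t x → t *ₒ (α *ₒ x) ≡ α *ₒ (t *ₒ x)
  lemma = SO.solve 3 (λ α t x → t SO.⊠ (α SO.⊠ x) SO.⊜ α SO.⊠ (t SO.⊠ x)) refl

-- Three elements of the ideal (α) in triangular form. They need not span it yet: `index`, the
-- product of the pivots, is lowered until they do.
record TriangularBasis (α : O) : Set where
  constructor triangular
  field
    {d₁ d₂ d₃ a₂ b₃ c₃} : ℤ
    0<d₁ : + 0 < d₁
    0<d₂ : + 0 < d₂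
    0<d₃ : + 0 < d₃
    e₁∈ : α ∣ₒ ⟨ d₁ , + 0 , + 0 ⟩
    e₂∈ : α ∣ₒ ⟨ a₂ , d₂ , + 0 ⟩
    e₃∈ : α ∣ₒ ⟨ c₃ , b₃ , d₃ ⟩

  index : ℕ
  index = ∣ d₁ ∣ ℕ.* ∣ d₂ ∣ ℕ.* ∣ d₃ ∣

  Spanned : O → Set
  Spanned ⟨ x , y , z ⟩ = ∃ λ p → ∃₂ λ q r → x ≡ p * d₁ + q * a₂ + r * c₃ × y ≡ q * d₂ + r * b₃ × z ≡ r * d₃

divide : ∀ x d → + 0 < d → (∃ λ r → x ≡ r * d) ⊎ (∃₂ λ r s → x ≡ r * d + s × + 0 < s × s < d)
divide x (+ zero) (+<+ ())
divide x (+ d@(suc _)) _ = go (x ℤ.%ℕ d) (ℤ.n%ℕd<d x d) (ℤ.a≡a%ℕn+[a/ℕn]*n x d)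
  where
  go : ∀ s → s ℕ.< d → x ≡ + s + x ℤ./ℕ d * + d → (∃ λ r → x ≡ r * + d) ⊎ (∃₂ λ r s → x ≡ r * + d + s × + 0 < s × s < + d)
  go zero _ e = inj₁ (x ℤ./ℕ d , trans e (ℤ.+-identityˡ (x ℤ./ℕ d * + d)))
  go s@(suc _) s<d e = inj₂ (x ℤ./ℕ d , + s , trans e (ℤ.+-comm (+ s) (x ℤ./ℕ d * + d)) , +<+ (s≤s z≤n) , +<+ s<d)

open TriangularBasis

Smaller : ∀ {α} → TriangularBasis α → Set
Smaller {α} B = ∃ λ (B′ : TriangularBasis α) → index B′ ℕ.< index B

module _ {α : O} (B : TriangularBasis α) where
  private
    positive : ∀ {d} → + 0 < d → ℕ.NonZero ∣ d ∣
    positive {+ suc _} _ = _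
    positive {+ zero} (+<+ ())

    remainder≡ : ∀ {x s} r d → x ≡ r * d + s → x - r * d ≡ s
    remainder≡ {x} {s} r d e = trans (cong (_- r * d) e) (lemma (r * d) s)
      where
      lemma : ∀ m s → m + s - m ≡ s
      lemma = solve-∀

    exact : ∀ {x} r d → x ≡ r * d → x - r * d ≡ + 0
    exact {x} r d e = trans (cong (_- r * d) e) (ℤ.+-inverseʳ (r * d))

    drop : ∀ x r b → x ≡ x - r * b + r * b
    drop = solve-∀

    vanish : ∀ x q → x - q * + 0 ≡ x
    vanish = solve-∀

  reduce₁ : ∀ x → α ∣ₒ ⟨ x , + 0 , + 0 ⟩ → (∃ λ p → x ≡ p * d₁ B) ⊎ Smaller B
  reduce₁ x x∈ with divide x (d₁ B) (0<d₁ B)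
  ... | inj₁ x≡ = inj₁ x≡
  ... | inj₂ (r , s , x≡ , 0<s , s<d) = inj₂ (record B { d₁ = s ; 0<d₁ = 0<s ; e₁∈ =
      subst₂ (λ u v → α ∣ₒ ⟨ u , v , v ⟩) (remainder≡ r (d₁ B) x≡) (vanish (+ 0) r) (∣-combine r x∈ (e₁∈ B)) } ,
    ℕ.*-monoˡ-< ∣ d₃ B ∣ {{positive (0<d₃ B)}} (ℕ.*-monoˡ-< ∣ d₂ B ∣ {{positive (0<d₂ B)}} (∣<∣ (ℤ.<⇒≤ 0<s) s<d)))

  reduce₂ : ∀ x y → α ∣ₒ ⟨ x , y , + 0 ⟩ → (∃₂ λ p q → x ≡ p * d₁ B + q * a₂ B × y ≡ q * d₂ B) ⊎ Smaller B
  reduce₂ x y x∈ with divide y (d₂ B) (0<d₂ B)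
  ... | inj₂ (r , s , y≡ , 0<s , s<d) = inj₂ (record B { d₂ = s ; a₂ = x - r * a₂ B ; 0<d₂ = 0<s ; e₂∈ =
      subst₂ (λ u v → α ∣ₒ ⟨ x - r * a₂ B , u , v ⟩) (remainder≡ r (d₂ B) y≡) (vanish (+ 0) r) (∣-combine r x∈ (e₂∈ B)) } ,
    ℕ.*-monoˡ-< ∣ d₃ B ∣ {{positive (0<d₃ B)}} (ℕ.*-monoʳ-< ∣ d₁ B ∣ {{positive (0<d₁ B)}} (∣<∣ (ℤ.<⇒≤ 0<s) s<d)))
  ... | inj₁ (q , y≡) with reduce₁ (x - q * a₂ B) (subst₂ (λ u v → α ∣ₒ ⟨ x - q * a₂ B , u , v ⟩) (exact q (d₂ B) y≡) (vanish (+ 0) q) (∣-combine q x∈ (e₂∈ B)))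
  ...   | inj₂ smaller = inj₂ smaller
  ...   | inj₁ (p , x≡) = inj₁ (p , q , trans (drop x q (a₂ B)) (cong (_+ q * a₂ B) x≡) , y≡)

  -- Division by the pivots, from the top coordinate down. The first nonzero remainder is a smaller
  -- pivot realised inside the ideal; if there is none, the element is spanned.
  reduce₃ : ∀ x y z → α ∣ₒ ⟨ x , y , z ⟩ → Spanned B ⟨ x , y , z ⟩ ⊎ Smaller B
  reduce₃ x y z x∈ with divide z (d₃ B) (0<d₃ B)
  ... | inj₂ (r , s , z≡ , 0<s , s<d) = inj₂ (record B { d₃ = s ; b₃ = y - r * b₃ B ; c₃ = x - r * c₃ B ; 0<d₃ = 0<s ; e₃∈ =
      subst (λ u → α ∣ₒ ⟨ x - r * c₃ B , y - r * b₃ B , u ⟩) (remainder≡ r (d₃ B) z≡) (∣-combine r x∈ (e₃∈ B)) } ,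
    ℕ.*-monoʳ-< (∣ d₁ B ∣ ℕ.* ∣ d₂ B ∣) {{ℕ.m*n≢0 ∣ d₁ B ∣ ∣ d₂ B ∣ {{positive (0<d₁ B)}} {{positive (0<d₂ B)}}}} (∣<∣ (ℤ.<⇒≤ 0<s) s<d))
  ... | inj₁ (r , z≡) with reduce₂ (x - r * c₃ B) (y - r * b₃ B) (subst (λ u → α ∣ₒ ⟨ x - r * c₃ B , y - r * b₃ B , u ⟩) (exact r (d₃ B) z≡) (∣-combine r x∈ (e₃∈ B)))
  ...   | inj₂ smaller = inj₂ smaller
  ...   | inj₁ (p , q , x≡ , y≡) = inj₁ (p , q , r , trans (drop x r (c₃ B)) (cong (_+ r * c₃ B) x≡) , trans (drop y r (b₃ B)) (cong (_+ r * b₃ B) y≡) , z≡)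

infixr 2 _and_
_and_ : ∀ {A B C : Set} → A ⊎ C → B ⊎ C → (A × B) ⊎ C
inj₂ c and _ = inj₂ c
inj₁ _ and inj₂ c = inj₂ c
inj₁ a and inj₁ b = inj₁ (a , b)

θ· : O → O
θ· ⟨ a , b , c ⟩ = ⟨ c , a + + 2 * c , b - c ⟩

-- The first three conditions put α, θα and θ²α, and hence the whole ideal, into the span; their
-- determinant is the norm of α, so the index divides it. The other three say that the span is
-- stable under θ, which forces the divisibilities in the normal form.
Saturated : ∀ {α} → TriangularBasis α → Set
Saturated {α} B = Spanned B α × Spanned B (θ· α) × Spanned B (θ· (θ· α)) ×
  Spanned B (θ· ⟨ d₁ B , + 0 , + 0 ⟩) × Spanned B (θ· ⟨ a₂ B , d₂ B , + 0 ⟩) × Spanned B (θ· ⟨ c₃ B , b₃ B , d₃ B ⟩)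

saturate : ∀ {α} (B : TriangularBasis α) → Acc ℕ._<_ (index B) → ∃ λ (B′ : TriangularBasis α) → Saturated B′
saturate {α} B (acc rec) = continue (check α α∈ and check (θ· α) (∣-θ α∈) and check (θ· (θ· α)) (∣-θ (∣-θ α∈)) and
    check (θ· ⟨ d₁ B , + 0 , + 0 ⟩) (∣-θ (e₁∈ B)) and check (θ· ⟨ a₂ B , d₂ B , + 0 ⟩) (∣-θ (e₂∈ B)) and check (θ· ⟨ c₃ B , b₃ B , d₃ B ⟩) (∣-θ (e₃∈ B)))
  where
  α∈ : α ∣ₒ α
  α∈ = 1ₒ , sym (*ₒ-identityʳ α)
  check : ∀ x → α ∣ₒ x → Spanned B x ⊎ Smaller B
  check ⟨ x , y , z ⟩ = reduce₃ B x y z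
  continue : Saturated B ⊎ Smaller B → ∃ λ (B′ : TriangularBasis α) → Saturated B′
  continue (inj₁ saturated) = B , saturated
  continue (inj₂ (B′ , smaller)) = saturate B′ (rec smaller)

det₃ : ℤ → ℤ → ℤ → ℤ → ℤ → ℤ → ℤ → ℤ → ℤ → ℤ
det₃ x₀ x₁ x₂ y₀ y₁ y₂ z₀ z₁ z₂ = x₀ * (y₁ * z₂ - y₂ * z₁) + y₀ * (z₁ * x₂ - z₂ * x₁) + z₀ * (x₁ * y₂ - x₂ * y₁)

opaque
  unfolding _+ₒ_

  Nm-det : ∀ a b c → Nm ⟨ a , b , c ⟩ ≡ det₃ a b c c (a + + 2 * c) (b - c) (b - c) (c + + 2 * (b - c)) (a + + 2 * c - (b - c))
  Nm-det a b c = S.solve 3 (λ a b c →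
    let y₁ = a S.⊞ S.Κ (+ 2) S.⊠ c ; y₂ = b S.⊟ c ; z₁ = c S.⊞ S.Κ (+ 2) S.⊠ y₂ ; z₂ = y₁ S.⊟ y₂ in
    P.cubicNorm (triple a b c) S.⊜
    a S.⊠ (y₁ S.⊠ z₂ S.⊟ y₂ S.⊠ z₁) S.⊞ c S.⊠ (z₁ S.⊠ c S.⊟ z₂ S.⊠ b) S.⊞ y₂ S.⊠ (b S.⊠ y₂ S.⊟ c S.⊠ y₁)) refl a b c

det₃-cong : ∀ {x₀ x₁ x₂ y₀ y₁ y₂ z₀ z₁ z₂ x₀′ x₁′ x₂′ y₀′ y₁′ y₂′ z₀′ z₁′ z₂′} →
  x₀ ≡ x₀′ → x₁ ≡ x₁′ → x₂ ≡ x₂′ → y₀ ≡ y₀′ → y₁ ≡ y₁′ → y₂ ≡ y₂′ → z₀ ≡ z₀′ → z₁ ≡ z₁′ → z₂ ≡ z₂′ →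
  det₃ x₀ x₁ x₂ y₀ y₁ y₂ z₀ z₁ z₂ ≡ det₃ x₀′ x₁′ x₂′ y₀′ y₁′ y₂′ z₀′ z₁′ z₂′
det₃-cong refl refl refl refl refl refl refl refl refl = refl

det₃-triangular : ∀ d₁ d₂ d₃ a b c p q r s t u v w x →
  det₃ (p * d₁ + q * a + r * c) (q * d₂ + r * b) (r * d₃) (s * d₁ + t * a + u * c) (t * d₂ + u * b) (u * d₃)
       (v * d₁ + w * a + x * c) (w * d₂ + x * b) (x * d₃) ≡ d₁ * d₂ * d₃ * det₃ p q r s t u v w x
det₃-triangular = lemma
  where
  lemma : ∀ d₁ d₂ d₃ a b c p q r s t u v w x →
    (p * d₁ + q * a + r * c) * ((t * d₂ + u * b) * (x * d₃) - (u * d₃) * (w * d₂ + x * b)) +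
    (s * d₁ + t * a + u * c) * ((w * d₂ + x * b) * (r * d₃) - (x * d₃) * (q * d₂ + r * b)) +
    (v * d₁ + w * a + x * c) * ((q * d₂ + r * b) * (u * d₃) - (r * d₃) * (t * d₂ + u * b)) ≡
    d₁ * d₂ * d₃ * (p * (t * x - u * w) + s * (w * r - x * q) + v * (q * u - r * t))
  lemma = solve-∀

index-divides : ∀ {α} (B : TriangularBasis α) → Saturated B → ∃ λ t → Nm α ≡ d₁ B * d₂ B * d₃ B * t
index-divides {⟨ x , y , z ⟩} B ((p , q , r , x≡ , y≡ , z≡) , (s , t , u , x′≡ , y′≡ , z′≡) , (v , w , o , x″≡ , y″≡ , z″≡) , _) =
  det₃ p q r s t u v w o , trans (Nm-det x y z) (trans (det₃-cong x≡ y≡ z≡ x′≡ y′≡ z′≡ x″≡ y″≡ z″≡)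
    (det₃-triangular (d₁ B) (d₂ B) (d₃ B) (a₂ B) (b₃ B) (c₃ B) p q r s t u v w o))

≤-of-multiple : ∀ {m n t} → + 0 < m → + 0 < n → n ≡ m * t → m ≤ n
≤-of-multiple {m} {n} {t} 0<m 0<n n≡ = 0≤-⇒≤ (subst (+ 0 ≤_) (trans (lemma m t) (cong (_- m) (sym n≡)))
  (0≤* (ℤ.<⇒≤ 0<m) (≤⇒0≤- (ℤ.i<j⇒suc[i]≤j 0<t))))
  where
  0<t : + 0 < t
  0<t = 0<*-cancel 0<m (subst (+ 0 <_) n≡ 0<n)
  lemma : ∀ m t → m * (t - + 1) ≡ m * t - m
  lemma = solve-∀

-- A ℤ-basis c k l, c k (θ + r), c (θ² + u θ + w) of the ideal generated by α.
record NormalForm (α : O) : Set where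
  field
    {c k l r u w} : ℤ
    0<c : + 0 < c
    0<k : + 0 < k
    0<l : + 0 < l
    f₁∈ : α ∣ₒ int (c * k * l)
    f₂∈ : α ∣ₒ int (c * k) *ₒ ⟨ r , + 1 , + 0 ⟩
    f₃∈ : α ∣ₒ int c *ₒ ⟨ w , u , + 1 ⟩
    index∣ : ∃ λ t → Nm α ≡ (c * k * l) * (c * k) * c * t

normal-form : ∀ {α} → + 0 < Nm α → NormalForm α
normal-form {α} 0<N = convert (saturate start (<-wellFounded _))
  where
  N = Nm α
  N∈ : α ∣ₒ ⟨ N , + 0 , + 0 ⟩
  N∈ = adj α , trans (sym (int-def N)) (sym (*ₒ-adj α))
  -- N = α · adj α lies in the ideal, hence so do N θ and N θ².
  start : TriangularBasis α
  start = triangular 0<N 0<N 0<N N∈ (subst₂ (λ u v → α ∣ₒ ⟨ + 0 , u , v ⟩) (ℤ.+-identityʳ N) refl (∣-θ N∈))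
    (subst₂ (λ u v → α ∣ₒ ⟨ + 0 , u , v ⟩) refl (ℤ.+-identityʳ N) (subst (λ u → α ∣ₒ ⟨ + 0 , + 0 , u - + 0 ⟩) (ℤ.+-identityʳ N) (∣-θ (∣-θ N∈))))
  convert : (∃ λ (B : TriangularBasis α) → Saturated B) → NormalForm α
  -- The θ-multiples of the three basis elements have top coordinates 0, D₂ and b₃ - D₃. Being
  -- spanned, they give r₁ = 0 and so D₂ ∣ D₁, then D₃ ∣ D₂, and finally D₃ ∣ b₃ and D₃ ∣ c₃.
  convert (B , sat@(_ , _ , _ , (p₁ , q₁ , r₁ , _ , y₁≡ , z₁≡) , (p₂ , q₂ , r₂ , _ , y₂≡ , z₂≡) , (p₃ , q₃ , r₃ , _ , y₃≡ , z₃≡))) = record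
    { c = D₃ ; k = r₂ ; l = q₁ ; r = q₂ + u ; u = u ; w = w
    ; 0<c = 0<d₃ B
    ; 0<k = 0<*-cancel (0<d₃ B) (subst (+ 0 <_) D₂≡ (0<d₂ B))
    ; 0<l = 0<*-cancel (0<d₂ B) (subst (+ 0 <_) (trans D₁≡ (ℤ.*-comm q₁ D₂)) (0<d₁ B))
    ; f₁∈ = subst (α ∣ₒ_) (trans (sym (int-def D₁)) (cong int ckl≡)) (e₁∈ B)
    ; f₂∈ = subst (α ∣ₒ_) (trans (O-≡ a≡ (trans D₂≡ (sym (ℤ.*-identityʳ (D₃ * r₂)))) (sym (ℤ.*-zeroʳ (D₃ * r₂)))) (sym (int-scale (D₃ * r₂) (q₂ + u) (+ 1) (+ 0)))) (e₂∈ B)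
    ; f₃∈ = subst (α ∣ₒ_) (trans (O-≡ c≡ b≡ (sym (ℤ.*-identityʳ D₃))) (sym (int-scale D₃ w u (+ 1)))) (e₃∈ B)
    ; index∣ = proj₁ (index-divides B sat) , trans (proj₂ (index-divides B sat)) (cong₂ (λ s t → s * t * D₃ * proj₁ (index-divides B sat)) ckl≡ D₂≡) }
    where
    D₁ = d₁ B
    D₂ = d₂ B
    D₃ = d₃ B
    u = r₃ + + 1
    w = q₃ * r₂ + r₃ * u - + 2
    r₁≡0 : r₁ ≡ + 0
    r₁≡0 = *-cancelˡ {D₃} (0<⇒≢0 (0<d₃ B)) (trans (ℤ.*-comm D₃ r₁) (trans (sym z₁≡) (sym (ℤ.*-zeroʳ D₃))))
    D₁≡ : D₁ ≡ q₁ * D₂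
    D₁≡ = trans (trans (sym (ℤ.+-identityʳ D₁)) y₁≡) (trans (cong (λ t → q₁ * D₂ + t * b₃ B) r₁≡0) (ℤ.+-identityʳ (q₁ * D₂)))
    D₂≡ : D₂ ≡ D₃ * r₂
    D₂≡ = trans (trans (sym (ℤ.+-identityʳ D₂)) z₂≡) (ℤ.*-comm r₂ D₃)
    ckl≡ : D₁ ≡ D₃ * r₂ * q₁
    ckl≡ = trans D₁≡ (trans (cong (q₁ *_) D₂≡) (ℤ.*-comm q₁ (D₃ * r₂)))
    b≡ : b₃ B ≡ D₃ * u
    b≡ = trans (restore (b₃ B) D₃) (trans (cong (_+ D₃) z₃≡) (lemma r₃ D₃))
      where
      restore : ∀ b d → b ≡ b - d + d
      restore = solve-∀
      lemma : ∀ r d → r * d + d ≡ d * (r + + 1)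
      lemma = solve-∀
    a≡ : a₂ B ≡ D₃ * r₂ * (q₂ + u)
    a≡ = trans (trans (sym (ℤ.+-identityʳ (a₂ B))) y₂≡) (trans (cong₂ (λ s t → q₂ * s + r₂ * t) D₂≡ b≡) (lemma q₂ D₃ r₂ u))
      where
      lemma : ∀ q d r u → q * (d * r) + r * (d * u) ≡ d * r * (q + u)
      lemma = solve-∀
    c≡ : c₃ B ≡ D₃ * w
    c≡ = trans (restore (c₃ B) D₃) (trans (cong (_- + 2 * D₃) y₃≡) (trans (cong₂ (λ s t → q₃ * s + r₃ * t - + 2 * D₃) D₂≡ b≡) (lemma q₃ D₃ r₂ r₃ u)))
      where
      restore : ∀ c d → c ≡ c + + 2 * d - + 2 * d
      restore = solve-∀
      lemma : ∀ q d r s u → q * (d * r) + s * (d * u) - + 2 * d ≡ d * (q * r + s * u - + 2)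
      lemma = solve-∀

-- Total positivity, expressed by the trace form.

Pos : O → Set
Pos α = ∀ y → y ≢ 0ₒ → + 0 < Tr (α *ₒ (y *ₒ y))

Tr-0 : Tr 0ₒ ≡ + 0
Tr-0 = Tr-1 (+ 0)

three-Tr-square≥0 : ∀ x → + 0 ≤ + 3 * Tr (x *ₒ x)
three-Tr-square≥0 x = subst (+ 0 ≤_) (sym (Tr-square x)) (0≤+ (0≤² (Tr x)) (0≤* {+ 7} (+≤+ z≤n)
  (0≤+ (0≤+ (0≤² (O.c₁ x)) (0≤² (O.c₂ x))) (0≤² (O.c₁ x - O.c₂ x)))))

0≤Tr-square : ∀ x → + 0 ≤ Tr (x *ₒ x)
0≤Tr-square x = 0≤*-cancel {+ 3} (+<+ (s≤s z≤n)) (three-Tr-square≥0 x)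

opaque
  unfolding Tr

  Tr-rational : ∀ a → Tr ⟨ a , + 0 , + 0 ⟩ ≡ + 3 * a
  Tr-rational a = lemma a
    where
    lemma : ∀ s → + 3 * s - + 0 + + 5 * + 0 ≡ + 3 * s
    lemma = solve-∀

Tr-square≡0 : ∀ x → Tr (x *ₒ x) ≡ + 0 → x ≡ 0ₒ
Tr-square≡0 x@(⟨ a , b , c ⟩) e with 0≤sum≡0 (0≤² (Tr x)) (0≤* {+ 7} (+≤+ z≤n) (0≤+ (0≤+ (0≤² b) (0≤² c)) (0≤² (b - c))))
    (trans (sym (Tr-square x)) (cong (+ 3 *_) e))
... | t² , rest with 0≤sum≡0 (0≤+ (0≤² b) (0≤² c)) (0≤² (b - c)) (*-cancelˡ {+ 7} (λ ()) rest)
...   | bc , _ with 0≤sum≡0 (0≤² b) (0≤² c) bc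
...     | b² , c² = finish (²≡0 {b} b²) (²≡0 {c} c²) (²≡0 {Tr x} t²)
  where
  finish : b ≡ + 0 → c ≡ + 0 → Tr x ≡ + 0 → x ≡ 0ₒ
  finish refl refl t≡0 = trans (O-≡ (*-cancelˡ {+ 3} (λ ()) (trans (sym (Tr-rational a)) t≡0)) refl refl) (sym (int-def (+ 0)))

0<Tr-square : ∀ x → x ≢ 0ₒ → + 0 < Tr (x *ₒ x)
0<Tr-square x x≢0 = 0≤∧≢0⇒0< (0≤Tr-square x) (λ e → x≢0 (Tr-square≡0 x e))

*ₒ-≢0 : ∀ {x y} → x ≢ 0ₒ → y ≢ 0ₒ → x *ₒ y ≢ 0ₒ
*ₒ-≢0 x≢0 y≢0 e = y≢0 (no-zero-divisors x≢0 e)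

adj≢0 : ∀ {x} → x ≢ 0ₒ → adj x ≢ 0ₒ
adj≢0 {x} x≢0 e = x≢0 (Nm≡0 x (int-injective (trans (sym (*ₒ-adj x)) (trans (cong (x *ₒ_) e) (*ₒ-zeroʳ x)))))

-- Evaluating at `adj x *ₒ y` turns x² into the square of the rational integer Nm x, which can be
-- cancelled.
Pos-*⁻¹ : ∀ {α x} → x ≢ 0ₒ → Pos (α *ₒ (x *ₒ x)) → Pos α
Pos-*⁻¹ {α} {x} x≢0 pos y y≢0 = 0<*-cancel (≢0⇒0<² {Nm x} (λ e → x≢0 (Nm≡0 x e)))
  (subst (+ 0 <_) eq (pos (adj x *ₒ y) (*ₒ-≢0 (adj≢0 x≢0) y≢0)))
  where
  lemma : ∀ α x z y → α *ₒ (x *ₒ x) *ₒ (z *ₒ y *ₒ (z *ₒ y)) ≡ x *ₒ z *ₒ (x *ₒ z) *ₒ (α *ₒ (y *ₒ y))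
  lemma = SO.solve 4 (λ α x z y → α SO.⊠ (x SO.⊠ x) SO.⊠ (z SO.⊠ y SO.⊠ (z SO.⊠ y)) SO.⊜ x SO.⊠ z SO.⊠ (x SO.⊠ z) SO.⊠ (α SO.⊠ (y SO.⊠ y))) refl
  eq : Tr (α *ₒ (x *ₒ x) *ₒ (adj x *ₒ y *ₒ (adj x *ₒ y))) ≡ Nm x * Nm x * Tr (α *ₒ (y *ₒ y))
  eq = trans (cong Tr (trans (lemma α x (adj x) y) (cong (_*ₒ (α *ₒ (y *ₒ y))) (trans (cong₂ _*ₒ_ (*ₒ-adj x) (*ₒ-adj x)) (sym (int-* (Nm x) (Nm x)))))))
    (Tr-int (Nm x * Nm x) (α *ₒ (y *ₒ y)))

Pos⇒≢0 : ∀ {α} → Pos α → α ≢ 0ₒ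
Pos⇒≢0 pos refl = ℤ.<-irrefl (sym (trans (cong Tr (lemma 1ₒ)) Tr-0)) (pos 1ₒ (int≢0 (λ ())))
  where
  lemma : ∀ y → 0ₒ *ₒ (y *ₒ y) ≡ 0ₒ
  lemma = SO.solve 1 (λ y → SO.Κ (+ 0) SO.⊠ (y SO.⊠ y) SO.⊜ SO.Κ (+ 0)) refl

-- ν spans the orthogonal complement of 1 and θ for the trace form.
opaque
  unfolding _+ₒ_

  ν : O
  ν = ⟨ - + 3 , + 1 , + 2 ⟩

  -- With α = a + bθ + cθ², the element Tr(α) θ - Tr(αθ) is orthogonal to 1 for the form Tr(α x y).
  -- So the left side is Tr α times the Gram determinant of 1 and θ, and by duality that determinant
  -- is the value of the form of `adj α` at ν.
  minor-identity : ∀ a b c → Tr (⟨ a , b , c ⟩ *ₒ (⟨ - Tr (⟨ a , b , c ⟩ *ₒ ⟨ + 0 , + 1 , + 0 ⟩) , Tr ⟨ a , b , c ⟩ , + 0 ⟩ *ₒ ⟨ - Tr (⟨ a , b , c ⟩ *ₒ ⟨ + 0 , + 1 , + 0 ⟩) , Tr ⟨ a , b , c ⟩ , + 0 ⟩))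
    ≡ Tr ⟨ a , b , c ⟩ * Tr (adj ⟨ a , b , c ⟩ *ₒ (ν *ₒ ν))
  minor-identity = S.solve 3 (λ a b c →
    let x = triple a b c ; o = S.Κ (+ 0)
        y = triple (S.⊝ P.traceForm (P.mul x (triple o (S.Κ (+ 1)) o))) (P.traceForm x) o
        ν = triple (S.Κ (- + 3)) (S.Κ (+ 1)) (S.Κ (+ 2)) in
    P.traceForm (P.mul x (P.mul y y)) S.⊜ P.traceForm x S.⊠ P.traceForm (P.mul (P.adjugate x) (P.mul ν ν))) refl

Pos⇒0<Tr : ∀ {α} → Pos α → + 0 < Tr α
Pos⇒0<Tr {α} pos = subst (λ t → + 0 < Tr t) (lemma α) (pos 1ₒ (int≢0 (λ ())))
  where
  lemma : ∀ α → α *ₒ (1ₒ *ₒ 1ₒ) ≡ α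
  lemma = SO.solve 1 (λ α → α SO.⊠ (SO.Κ (+ 1) SO.⊠ SO.Κ (+ 1)) SO.⊜ α) refl

adj-square : ∀ α z → α *ₒ (adj α *ₒ z *ₒ (adj α *ₒ z)) ≡ int (Nm α) *ₒ (adj α *ₒ (z *ₒ z))
adj-square α z = trans (lemma α (adj α) z) (cong (_*ₒ (adj α *ₒ (z *ₒ z))) (*ₒ-adj α))
  where
  lemma : ∀ α β z → α *ₒ (β *ₒ z *ₒ (β *ₒ z)) ≡ α *ₒ β *ₒ (β *ₒ (z *ₒ z))
  lemma = SO.solve 3 (λ α β z → α SO.⊠ (β SO.⊠ z SO.⊠ (β SO.⊠ z)) SO.⊜ α SO.⊠ β SO.⊠ (β SO.⊠ (z SO.⊠ z))) refl

-- `minor-identity` makes Tr(adj α · ν²) positive, and evaluating the form of α at adj α · ν gives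
-- Nm α times this number.
Pos⇒0<Nm : ∀ {α} → Pos α → + 0 < Nm α
Pos⇒0<Nm {α@(⟨ a , b , c ⟩)} pos = 0<*-cancel {Tr (adj α *ₒ (ν *ₒ ν))} 0<A (subst (+ 0 <_) (trans (cong Tr (adj-square α ν))
    (trans (Tr-int (Nm α) (adj α *ₒ (ν *ₒ ν))) (ℤ.*-comm (Nm α) _))) (pos (adj α *ₒ ν) βν≢0))
  where
  y = ⟨ - Tr (α *ₒ ⟨ + 0 , + 1 , + 0 ⟩) , Tr α , + 0 ⟩
  0<A : + 0 < Tr (adj α *ₒ (ν *ₒ ν))
  0<A = 0<*-cancel (Pos⇒0<Tr pos) (subst (+ 0 <_) (minor-identity a b c) (pos y (λ e → 0<⇒≢0 (Pos⇒0<Tr pos) (cong O.c₁ (trans e (int-def (+ 0)))))))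
  βν≢0 : adj α *ₒ ν ≢ 0ₒ
  βν≢0 e = 0<⇒≢0 0<A (trans (cong Tr (trans (sym (*ₒ-assoc (adj α) ν ν)) (trans (cong (_*ₒ ν) e) (trans (*ₒ-comm 0ₒ ν) (*ₒ-zeroʳ ν))))) Tr-0)

Pos-adj : ∀ {α} → Pos α → Pos (adj α)
Pos-adj {α} pos y y≢0 = 0<*-cancel (Pos⇒0<Nm pos) (subst (+ 0 <_) (trans (cong Tr (adj-square α y)) (Tr-int (Nm α) (adj α *ₒ (y *ₒ y))))
  (pos (adj α *ₒ y) (*ₒ-≢0 (adj≢0 (Pos⇒≢0 pos)) y≢0)))

-- Quaternions over O, with the Hermitian form Tr (β u v̄).

open Quaternions O-algebra

ι : ℍᶻ → ℍ
ι (quat a b c d) = quat (int a) (int b) (int c) (int d)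

module TraceForm {β : O} (pos : Pos β) where

  lin : O → ℤ
  lin x = Tr (β *ₒ x)

  lin-+ : ∀ {x y s t} → lin x ≡ s → lin y ≡ t → lin (x +ₒ y) ≡ s + t
  lin-+ {x} {y} p q = trans (cong Tr (lemma β x y)) (trans (Tr-+ (β *ₒ x) (β *ₒ y)) (cong₂ _+_ p q))
    where
    lemma : ∀ β x y → β *ₒ (x +ₒ y) ≡ β *ₒ x +ₒ β *ₒ y
    lemma = SO.solve 3 (λ β x y → β SO.⊠ (x SO.⊞ y) SO.⊜ β SO.⊠ x SO.⊞ β SO.⊠ y) refl

  lin-neg : ∀ {x s} → lin x ≡ s → lin (-ₒ x) ≡ - s
  lin-neg {x} p = trans (cong Tr (lemma β x)) (trans (Tr-neg (β *ₒ x)) (cong -_ p))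
    where
    lemma : ∀ β x → β *ₒ (-ₒ x) ≡ -ₒ (β *ₒ x)
    lemma = SO.solve 2 (λ β x → β SO.⊠ (SO.⊝ x) SO.⊜ SO.⊝ (β SO.⊠ x)) refl

  lin-- : ∀ {x y s t} → lin x ≡ s → lin y ≡ t → lin (x +ₒ -ₒ y) ≡ s - t
  lin-- p q = lin-+ p (lin-neg q)

  lin-int : ∀ a x → lin (int a *ₒ x) ≡ a * lin x
  lin-int a x = trans (cong Tr (lemma β (int a) x)) (Tr-int a (β *ₒ x))
    where
    lemma : ∀ β a x → β *ₒ (a *ₒ x) ≡ a *ₒ (β *ₒ x)
    lemma = SO.solve 3 (λ β a x → β SO.⊠ (a SO.⊠ x) SO.⊜ a SO.⊠ (β SO.⊠ x)) refl

  lin-0 : lin 0ₒ ≡ + 0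
  lin-0 = trans (cong Tr (*ₒ-zeroʳ β)) Tr-0

  trace : ℍ → ℍᶻ
  trace (quat a b c d) = quat (lin a) (lin b) (lin c) (lin d)

  trace-⊹ : ∀ x y → trace (x ⊹ y) ≡ trace x ⊹ᶻ trace y
  trace-⊹ (quat _ _ _ _) (quat _ _ _ _) = quat-≡ (lin-+ refl refl) (lin-+ refl refl) (lin-+ refl refl) (lin-+ refl refl)

  trace-conj : ∀ x → trace (conj x) ≡ conjᶻ (trace x)
  trace-conj (quat _ _ _ _) = quat-≡ (lin-+ refl refl) (lin-neg refl) (lin-neg refl) (lin-neg refl)

  trace-⋆ : ∀ q x → trace (ι q ⋆ x) ≡ q ⋆ᶻ trace x
  trace-⋆ (quat a b c d) (quat e f g h) = quat-≡
    (lin-- (lin-- (lin-- (lin-+ (lin-- (lin-- (lin-- (lin-int a e) (lin-int b f)) (lin-int b g)) (lin-int b h)) (lin-int c f)) (lin-int c g)) (lin-int d g)) (lin-int d h))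
    (lin-- (lin-+ (lin-+ (lin-+ (lin-- (lin-+ (lin-int a f) (lin-int b e)) (lin-int b g)) (lin-int c f)) (lin-int c h)) (lin-int d f)) (lin-int d g))
    (lin-+ (lin-+ (lin-+ (lin-- (lin-- (lin-+ (lin-int a g) (lin-int c e)) (lin-int b g)) (lin-int b h)) (lin-int c f)) (lin-int c h)) (lin-int d f))
    (lin-+ (lin-+ (lin-- (lin-- (lin-- (lin-- (lin-+ (lin-+ (lin-+ (lin-+ (lin-int a h) (lin-int d e)) (lin-int b g)) (lin-int b g)) (lin-int b h)) (lin-int c f)) (lin-int c f)) (lin-int c h)) (lin-int d f)) (lin-int d g)) (lin-int d h))

  trace-tr : ∀ x → lin (tr x) ≡ trᶻ (trace x)
  trace-tr (quat _ _ _ _) = lin-+ (lin-+ refl refl) refl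

  trace-embed : ∀ s → trace (embed s) ≡ embedᶻ (lin s)
  trace-embed s = quat-≡ refl lin-0 lin-0 lin-0

  form : ℍ → ℍ → ℍᶻ
  form u v = trace (u ⋆ conj v)

  len : ℍ → ℤ
  len v = lin (norm v)

norm-ι : ∀ q → norm (ι q) ≡ int (normᶻ q)
norm-ι (quat a b c d) = sym (int-+′ (int-+′ (int-+′ (int-+′ (int-* a a) (int-* b b)) (int-* c c)) (int-* d d))
  (trans (int-* d (a + b + c)) (cong (int d *ₒ_) (int-+′ (int-+ a b) refl))))
  where
  int-+′ : ∀ {s t x y} → int s ≡ x → int t ≡ y → int (s + t) ≡ x +ₒ y
  int-+′ {s} {t} p q = trans (int-+ s t) (cong₂ _+ₒ_ p q)

four-norm : ∀ a b c d → int (+ 4) *ₒ norm (quat a b c d) ≡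
  (2ₒ *ₒ a +ₒ d) *ₒ (2ₒ *ₒ a +ₒ d) +ₒ (2ₒ *ₒ b +ₒ d) *ₒ (2ₒ *ₒ b +ₒ d) +ₒ (2ₒ *ₒ c +ₒ d) *ₒ (2ₒ *ₒ c +ₒ d) +ₒ d *ₒ d
four-norm = SO.solve 4 (λ a b c d →
  SO.Κ (+ 4) SO.⊠ (a SO.⊠ a SO.⊞ b SO.⊠ b SO.⊞ c SO.⊠ c SO.⊞ d SO.⊠ d SO.⊞ d SO.⊠ (a SO.⊞ b SO.⊞ c)) SO.⊜
  (SO.Κ (+ 2) SO.⊠ a SO.⊞ d) SO.⊠ (SO.Κ (+ 2) SO.⊠ a SO.⊞ d) SO.⊞ (SO.Κ (+ 2) SO.⊠ b SO.⊞ d) SO.⊠ (SO.Κ (+ 2) SO.⊠ b SO.⊞ d) SO.⊞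
  (SO.Κ (+ 2) SO.⊠ c SO.⊞ d) SO.⊠ (SO.Κ (+ 2) SO.⊠ c SO.⊞ d) SO.⊞ d SO.⊠ d) refl

module _ {β : O} (pos : Pos β) where
  open TraceForm pos

  0≤lin-square : ∀ y → + 0 ≤ lin (y *ₒ y)
  0≤lin-square y with y ≟ₒ 0ₒ
  ... | yes refl = ℤ.≤-reflexive (sym (trans (cong lin (*ₒ-zeroʳ 0ₒ)) lin-0))
  ... | no y≢0 = ℤ.<⇒≤ (pos y y≢0)

  lin-square≡0 : ∀ y → lin (y *ₒ y) ≡ + 0 → y ≡ 0ₒ
  lin-square≡0 y e with y ≟ₒ 0ₒ
  ... | yes y≡0 = y≡0
  ... | no y≢0 = ⊥-elim (0<⇒≢0 (pos y y≢0) e)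

  four-len : ∀ a b c d → + 4 * len (quat a b c d) ≡ lin ((2ₒ *ₒ a +ₒ d) *ₒ (2ₒ *ₒ a +ₒ d)) + lin ((2ₒ *ₒ b +ₒ d) *ₒ (2ₒ *ₒ b +ₒ d)) +
    lin ((2ₒ *ₒ c +ₒ d) *ₒ (2ₒ *ₒ c +ₒ d)) + lin (d *ₒ d)
  four-len a b c d = trans (sym (lin-int (+ 4) (norm (quat a b c d)))) (trans (cong lin (four-norm a b c d)) (lin-+ (lin-+ (lin-+ refl refl) refl) refl))

  len-nonneg : ∀ v → + 0 ≤ len v
  len-nonneg (quat a b c d) = 0≤*-cancel {+ 4} (+<+ (s≤s z≤n)) (subst (+ 0 ≤_) (sym (four-len a b c d))
    (0≤+ (0≤+ (0≤+ (0≤lin-square (2ₒ *ₒ a +ₒ d)) (0≤lin-square (2ₒ *ₒ b +ₒ d))) (0≤lin-square (2ₒ *ₒ c +ₒ d))) (0≤lin-square d)))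

  len≡0 : ∀ v → len v ≡ + 0 → v ≡ 0ℍ
  len≡0 (quat a b c d) e
    with 0≤sum≡0 (0≤+ (0≤+ (0≤lin-square (2ₒ *ₒ a +ₒ d)) (0≤lin-square (2ₒ *ₒ b +ₒ d))) (0≤lin-square (2ₒ *ₒ c +ₒ d))) (0≤lin-square d)
           (trans (sym (four-len a b c d)) (cong (+ 4 *_) e))
  ... | abc , D with 0≤sum≡0 (0≤+ (0≤lin-square (2ₒ *ₒ a +ₒ d)) (0≤lin-square (2ₒ *ₒ b +ₒ d))) (0≤lin-square (2ₒ *ₒ c +ₒ d)) abc
  ...   | ab , C with 0≤sum≡0 (0≤lin-square (2ₒ *ₒ a +ₒ d)) (0≤lin-square (2ₒ *ₒ b +ₒ d)) ab
  ...     | A , B = quat-≡ (half a A) (half b B) (half c C) d≡0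
    where
    d≡0 = lin-square≡0 d D
    half : ∀ a → lin ((2ₒ *ₒ a +ₒ d) *ₒ (2ₒ *ₒ a +ₒ d)) ≡ + 0 → a ≡ 0ₒ
    half a A = int-cancel {+ 2} (λ ()) (trans (lemma (2ₒ *ₒ a)) (trans (cong (2ₒ *ₒ a +ₒ_) (sym d≡0)) (lin-square≡0 (2ₒ *ₒ a +ₒ d) A)))
      where
      lemma : ∀ x → x ≡ x +ₒ 0ₒ
      lemma = SO.solve 1 (λ x → x SO.⊜ x SO.⊞ SO.Κ (+ 0)) refl

  traceSpace : HermitianSpace
  traceSpace = record
    { V = ℍ ; _⊞_ = _⊹_ ; _⊡_ = λ q v → ι q ⋆ v ; form = form ; len = len
    ; form-⊞ˡ = λ u v w → trans (cong trace (⋆-distribʳ u v (conj w))) (trace-⊹ (u ⋆ conj w) (v ⋆ conj w))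
    ; form-⊡ˡ = λ q u v → trans (cong trace (⋆-assoc (ι q) u (conj v))) (trace-⋆ q (u ⋆ conj v))
    ; form-conj = λ u v → trans (cong trace (swap u v)) (trace-conj (u ⋆ conj v))
    ; form-self = λ v → trans (cong trace (⋆-conj v)) (trace-embed (norm v))
    ; len-⊡ = λ q v → trans (cong lin (trans (norm-⋆ (ι q) v) (cong (_*ₒ norm v) (norm-ι q)))) (lin-int (normᶻ q) (norm v))
    ; len-⊞-⊡ = len-shear
    ; len-nonneg = len-nonneg
    ; isotropic = λ v e w → trans (cong (λ t → trace (t ⋆ conj w)) (len≡0 v e)) (trans (cong trace (0-⋆ (conj w))) (trans (trace-embed 0ₒ) (cong embedᶻ lin-0)))
    }
    where
    swap : ∀ u v → v ⋆ conj u ≡ conj (u ⋆ conj v)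
    swap u v = sym (trans (conj-⋆ u (conj v)) (cong (_⋆ conj u) (conj-conj v)))
    len-shear : ∀ v q u → len (v ⊹ ι q ⋆ u) ≡ len v + trᶻ (q ⋆ᶻ form u v) + normᶻ q * len u
    len-shear v q u = trans (cong lin (norm-⊹ v (ι q ⋆ u))) (trans
      (lin-+ (lin-+ refl (trans (cong lin (trans (norm-⋆ (ι q) u) (cong (_*ₒ norm u) (norm-ι q)))) (lin-int (normᶻ q) (norm u))))
        (trans (cong lin cross) (trans (trace-tr (ι q ⋆ (u ⋆ conj v))) (cong trᶻ (trace-⋆ q (u ⋆ conj v))))))
      (lemma (len v) (normᶻ q * len u) (trᶻ (q ⋆ᶻ form u v))))
      where
      cross : tr (v ⋆ conj (ι q ⋆ u)) ≡ tr (ι q ⋆ (u ⋆ conj v))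
      cross = trans (cong tr (swap (ι q ⋆ u) v)) (trans (tr-conj (ι q ⋆ u ⋆ conj v)) (cong tr (⋆-assoc (ι q) u (conj v))))
      lemma : ∀ x y z → x + y + z ≡ x + z + y
      lemma = solve-∀

-- Three elements of the left ideal and their Gram determinant.

int-⊞ : ∀ {s t x y} → int s ≡ x → int t ≡ y → int (s + t) ≡ x +ₒ y
int-⊞ {s} {t} p q = trans (int-+ s t) (cong₂ _+ₒ_ p q)

int-⊟ : ∀ {s t x y} → int s ≡ x → int t ≡ y → int (s - t) ≡ x +ₒ -ₒ y
int-⊟ {s} {t} p q = int-⊞ p (trans (int-neg t) (cong -ₒ_ q))

ι-⊹ : ∀ x y → ι (x ⊹ᶻ y) ≡ ι x ⊹ ι y
ι-⊹ (quat a b c d) (quat e f g h) = quat-≡ (int-+ a e) (int-+ b f) (int-+ c g) (int-+ d h)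

ι-• : ∀ s x → ι (s •ᶻ x) ≡ int s • ι x
ι-• s (quat a b c d) = quat-≡ (int-* s a) (int-* s b) (int-* s c) (int-* s d)

ι-conj : ∀ x → ι (conjᶻ x) ≡ conj (ι x)
ι-conj (quat a b c d) = quat-≡ (int-+ a d) (int-neg b) (int-neg c) (int-neg d)

ι-⋆ : ∀ x y → ι (x ⋆ᶻ y) ≡ ι x ⋆ ι y
ι-⋆ (quat a b c d) (quat e f g h) = quat-≡
  (int-⊟ (int-⊟ (int-⊟ (int-⊞ (int-⊟ (int-⊟ (int-⊟ (int-* a e) (int-* b f)) (int-* b g)) (int-* b h)) (int-* c f)) (int-* c g)) (int-* d g)) (int-* d h))
  (int-⊟ (int-⊞ (int-⊞ (int-⊞ (int-⊟ (int-⊞ (int-* a f) (int-* b e)) (int-* b g)) (int-* c f)) (int-* c h)) (int-* d f)) (int-* d g))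
  (int-⊞ (int-⊞ (int-⊞ (int-⊟ (int-⊟ (int-⊞ (int-* a g) (int-* c e)) (int-* b g)) (int-* b h)) (int-* c f)) (int-* c h)) (int-* d f))
  (int-⊞ (int-⊞ (int-⊟ (int-⊟ (int-⊟ (int-⊟ (int-⊞ (int-⊞ (int-⊞ (int-⊞ (int-* a h) (int-* d e)) (int-* b g)) (int-* b g)) (int-* b h)) (int-* c f)) (int-* c f)) (int-* c h)) (int-* d f)) (int-* d g)) (int-* d h))

-- For a member d e of the ℤ-basis of (α) and a generator T of the left ideal of d and s in H, the
-- product e T lies in ℍα + ℍs. The three products obtained in this way form the starting frame.
ideal-lift : ∀ {α d e s T} → α ∣ₒ int d *ₒ e → LeftIdealᶻ d s T → LeftIdeal α (ι s) (e • ι T)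
ideal-lift {α} {d} {e} {s} {T} (m , m≡) (x , y , refl) = m • ι x , e • ι y , (begin
  e • ι ((d •ᶻ x) ⊹ᶻ (y ⋆ᶻ s))                ≡⟨ cong (e •_) (trans (ι-⊹ (d •ᶻ x) (y ⋆ᶻ s)) (cong₂ _⊹_ (ι-• d x) (ι-⋆ y s))) ⟩
  e • (int d • ι x ⊹ ι y ⋆ ι s)               ≡⟨ •-⊹ e (int d • ι x) (ι y ⋆ ι s) ⟩
  e • (int d • ι x) ⊹ e • (ι y ⋆ ι s)         ≡⟨ cong₂ _⊹_ (trans (•-• e (int d) (ι x)) (trans (cong (_• ι x) (trans (*ₒ-comm e (int d)) m≡)) (sym (•-• α m (ι x))))) (sym (•-⋆ e (ι y) (ι s))) ⟩
  α • (m • ι x) ⊹ (e • ι y) ⋆ ι s             ∎)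
  where open ≡-Reasoning

symmetricDet : ℤ → ℤ → ℤ → ℤ → ℤ → ℤ → ℤ
symmetricDet a b c x y z = a * b * c + + 2 * (x * y * z) - a * (z * z) - b * (y * y) - c * (x * x)

-- A symmetric Gram matrix is multiplied by diag(T₁, T₂, T₃) on the left and by its conjugate
-- transpose on the right, so the determinant gains the norms of the three entries.
hermitianDet-scaled : ∀ a b c x y z T₁ T₂ T₃ →
  hermitianDet (a * normᶻ T₁) (b * normᶻ T₂) (c * normᶻ T₃) (x •ᶻ (T₁ ⋆ᶻ conjᶻ T₂)) (y •ᶻ (T₁ ⋆ᶻ conjᶻ T₃)) (z •ᶻ (T₂ ⋆ᶻ conjᶻ T₃)) ≡
  normᶻ T₁ * normᶻ T₂ * normᶻ T₃ * symmetricDet a b c x y z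
hermitianDet-scaled a b c x y z T₁ T₂ T₃ = trans
  (cong₂ (λ t N → a * N₁ * (b * N₂) * (c * N₃) + t - a * N₁ * N - b * N₂ * normᶻ (y •ᶻ (T₁ ⋆ᶻ conjᶻ T₃)) - c * N₃ * normᶻ (x •ᶻ (T₁ ⋆ᶻ conjᶻ T₂))) cross (norm₂ z T₂ T₃))
  (trans (cong₂ (λ N M → a * N₁ * (b * N₂) * (c * N₃) + x * y * z * (N₂ * (+ 2 * (N₁ * N₃))) - a * N₁ * (z * z * (N₂ * N₃)) - b * N₂ * N - c * N₃ * M) (norm₂ y T₁ T₃) (norm₂ x T₁ T₂))
    (lemma a b c x y z N₁ N₂ N₃))
  where
  N₁ = normᶻ T₁
  N₂ = normᶻ T₂
  N₃ = normᶻ T₃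
  norm₂ : ∀ s T T′ → normᶻ (s •ᶻ (T ⋆ᶻ conjᶻ T′)) ≡ s * s * (normᶻ T * normᶻ T′)
  norm₂ s T T′ = trans (norm-•ᶻ s (T ⋆ᶻ conjᶻ T′)) (cong (s * s *_) (trans (norm-⋆ᶻ T (conjᶻ T′)) (cong (normᶻ T *_) (norm-conjᶻ T′))))
  p = T₁ ⋆ᶻ conjᶻ T₂
  q = T₂ ⋆ᶻ conjᶻ T₃
  r = T₁ ⋆ᶻ conjᶻ T₃
  pq : p ⋆ᶻ q ≡ N₂ •ᶻ r
  pq = trans (⋆-assocᶻ T₁ (conjᶻ T₂) q) (trans (cong (T₁ ⋆ᶻ_) (trans (sym (⋆-assocᶻ (conjᶻ T₂) T₂ (conjᶻ T₃)))
    (trans (cong (_⋆ᶻ conjᶻ T₃) (conj-⋆-selfᶻ T₂)) (embed-⋆ᶻ N₂ (conjᶻ T₃))))) (⋆-•ᶻ N₂ T₁ (conjᶻ T₃)))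
  tr-embed : ∀ s → trᶻ (embedᶻ s) ≡ + 2 * s
  tr-embed s = double s
    where
    double : ∀ s → s + s + + 0 ≡ + 2 * s
    double = solve-∀
  cross : trᶻ (((x •ᶻ p) ⋆ᶻ (z •ᶻ q)) ⋆ᶻ conjᶻ (y •ᶻ r)) ≡ x * y * z * (N₂ * (+ 2 * (N₁ * N₃)))
  cross = begin
    trᶻ (((x •ᶻ p) ⋆ᶻ (z •ᶻ q)) ⋆ᶻ conjᶻ (y •ᶻ r))
      ≡⟨ cong trᶻ (cong₂ _⋆ᶻ_ (trans (•-⋆ᶻ x p (z •ᶻ q)) (trans (cong (x •ᶻ_) (⋆-•ᶻ z p q)) (•-•ᶻ x z (p ⋆ᶻ q)))) (conj-•ᶻ y r)) ⟩
    trᶻ (((x * z) •ᶻ (p ⋆ᶻ q)) ⋆ᶻ (y •ᶻ conjᶻ r))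
      ≡⟨ cong trᶻ (trans (•-⋆ᶻ (x * z) (p ⋆ᶻ q) (y •ᶻ conjᶻ r)) (trans (cong ((x * z) •ᶻ_) (⋆-•ᶻ y (p ⋆ᶻ q) (conjᶻ r))) (•-•ᶻ (x * z) y ((p ⋆ᶻ q) ⋆ᶻ conjᶻ r)))) ⟩
    trᶻ ((x * z * y) •ᶻ ((p ⋆ᶻ q) ⋆ᶻ conjᶻ r))
      ≡⟨ trans (tr-•ᶻ (x * z * y) ((p ⋆ᶻ q) ⋆ᶻ conjᶻ r)) (cong₂ _*_ (reorder x y z) (trans (cong (λ t → trᶻ (t ⋆ᶻ conjᶻ r)) pq) (trans (cong trᶻ (•-⋆ᶻ N₂ r (conjᶻ r))) (tr-•ᶻ N₂ (r ⋆ᶻ conjᶻ r))))) ⟩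
    x * y * z * (N₂ * trᶻ (r ⋆ᶻ conjᶻ r))
      ≡⟨ cong (λ t → x * y * z * (N₂ * t)) (trans (cong trᶻ (⋆-conjᶻ r)) (trans (tr-embed (normᶻ r)) (cong (+ 2 *_) (trans (norm-⋆ᶻ T₁ (conjᶻ T₃)) (cong (N₁ *_) (norm-conjᶻ T₃)))))) ⟩
    x * y * z * (N₂ * (+ 2 * (N₁ * N₃))) ∎
    where
    open ≡-Reasoning
    reorder : ∀ x y z → x * z * y ≡ x * y * z
    reorder = solve-∀
  lemma : ∀ a b c x y z P Q R → a * P * (b * Q) * (c * R) + x * y * z * (Q * (+ 2 * (P * R))) - a * P * (z * z * (Q * R)) - b * Q * (y * y * (P * R)) - c * R * (x * x * (P * Q)) ≡
    P * Q * R * (a * b * c + + 2 * (x * y * z) - a * (z * z) - b * (y * y) - c * (x * x))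
  lemma = solve-∀

opaque
  unfolding _+ₒ_

  -- 1, θ + r and θ² + uθ + w arise from 1, θ, θ² by a unitriangular change, so for all r, u, w the
  -- determinant is Nm β times the discriminant 49 of O.
  trace-discriminant : ∀ β r u w → symmetricDet (Tr (β *ₒ (1ₒ *ₒ 1ₒ))) (Tr (β *ₒ (⟨ r , + 1 , + 0 ⟩ *ₒ ⟨ r , + 1 , + 0 ⟩))) (Tr (β *ₒ (⟨ w , u , + 1 ⟩ *ₒ ⟨ w , u , + 1 ⟩)))
      (Tr (β *ₒ (1ₒ *ₒ ⟨ r , + 1 , + 0 ⟩))) (Tr (β *ₒ (1ₒ *ₒ ⟨ w , u , + 1 ⟩))) (Tr (β *ₒ (⟨ r , + 1 , + 0 ⟩ *ₒ ⟨ w , u , + 1 ⟩))) ≡ + 49 * Nm β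
  trace-discriminant ⟨ b₀ , b₁ , b₂ ⟩ r u w = S.solve 6 (λ b₀ b₁ b₂ r u w →
    let β = triple b₀ b₁ b₂ ; o = S.Κ (+ 0) ; i = S.Κ (+ 1)
        e₁ = triple i o o ; e₂ = triple r i o ; e₃ = triple w u i
        g = λ x y → P.traceForm (P.mul β (P.mul x y)) in
    g e₁ e₁ S.⊠ g e₂ e₂ S.⊠ g e₃ e₃ S.⊞ S.Κ (+ 2) S.⊠ (g e₁ e₂ S.⊠ g e₁ e₃ S.⊠ g e₂ e₃) S.⊟ g e₁ e₁ S.⊠ (g e₂ e₃ S.⊠ g e₂ e₃)
      S.⊟ g e₂ e₂ S.⊠ (g e₁ e₃ S.⊠ g e₁ e₃) S.⊟ g e₃ e₃ S.⊠ (g e₁ e₂ S.⊠ g e₁ e₂) S.⊜ S.Κ (+ 49) S.⊠ P.cubicNorm β) refl b₀ b₁ b₂ r u w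

Nm-adj : ∀ {α} → Nm α ≢ + 0 → Nm (adj α) ≡ Nm α * Nm α
Nm-adj {α} n≢0 = *-cancelˡ n≢0 (trans (sym (Nm-* α (adj α))) (trans (cong Nm (*ₒ-adj α)) (Nm-int (Nm α))))

module _ {β : O} (pos : Pos β) where
  open TraceForm pos

  trace-• : ∀ x q → trace (x • ι q) ≡ lin x •ᶻ q
  trace-• x (quat a b c d) = quat-≡ (scale a) (scale b) (scale c) (scale d)
    where
    scale : ∀ a → lin (x *ₒ int a) ≡ lin x * a
    scale a = trans (cong lin (*ₒ-comm x (int a))) (trans (lin-int a x) (ℤ.*-comm a (lin x)))

  form-scaled : ∀ e e′ T T′ → form (e • ι T) (e′ • ι T′) ≡ lin (e *ₒ e′) •ᶻ (T ⋆ᶻ conjᶻ T′)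
  form-scaled e e′ T T′ = trans (cong trace (begin
    (e • ι T) ⋆ conj (e′ • ι T′)      ≡⟨ cong ((e • ι T) ⋆_) (conj-• e′ (ι T′)) ⟩
    (e • ι T) ⋆ (e′ • conj (ι T′))    ≡⟨ trans (•-⋆ e (ι T) (e′ • conj (ι T′))) (trans (cong (e •_) (⋆-• e′ (ι T) (conj (ι T′)))) (•-• e e′ (ι T ⋆ conj (ι T′)))) ⟩
    (e *ₒ e′) • (ι T ⋆ conj (ι T′))   ≡⟨ cong ((e *ₒ e′) •_) (trans (cong (ι T ⋆_) (sym (ι-conj T′))) (sym (ι-⋆ T (conjᶻ T′)))) ⟩
    (e *ₒ e′) • ι (T ⋆ᶻ conjᶻ T′)     ∎)) (trace-• (e *ₒ e′) (T ⋆ᶻ conjᶻ T′))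
    where open ≡-Reasoning

  len-scaled : ∀ e T → len (e • ι T) ≡ lin (e *ₒ e) * normᶻ T
  len-scaled e T = trans (cong lin (trans (norm-• e (ι T)) (trans (cong (e *ₒ e *ₒ_) (norm-ι T)) (*ₒ-comm (e *ₒ e) (int (normᶻ T))))))
    (trans (lin-int (normᶻ T) (e *ₒ e)) (ℤ.*-comm (normᶻ T) (lin (e *ₒ e))))

-- 392 = 8 · 49 is the Hermite bound for determinant 49, and 8³ = 392 + 120 exceeds it.
cube≤⇒≤7 : ∀ {t} → + 0 < t → + 0 ≤ + 392 - t * t * t → t ≤ + 7
cube≤⇒≤7 {+ t} 0<t le with t ℕ.≤? 7
... | yes t≤7 = +≤+ t≤7
... | no t≰7 = ⊥-elim (ℕ.<⇒≱ (ℕ.m<m+n 392 {120} (s≤s z≤n)) (ℕ.≤-trans (ℕ.*-mono-≤ (ℕ.*-mono-≤ 8≤t 8≤t) 8≤t)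
    (drop (subst (_≤ + 392) (trans (cong (_* + t) (sym (ℤ.pos-* t t))) (sym (ℤ.pos-* (t ℕ.* t) t))) (0≤-⇒≤ le)))))
  where
  8≤t = ℕ.≰⇒> t≰7
  drop : ∀ {m n} → + m ≤ + n → m ℕ.≤ n
  drop (+≤+ p) = p

-- `a` and `b` define s = a + bi + j. The relation s v̄ = α w is kept because it later limits the
-- scalars that can divide an element of norm α.
record SmallMultiple (α : O) : Set where
  field
    m : O
    v w : ℍ
    a b : ℤ
    norm≡ : norm v ≡ α *ₒ m
    0<Tr : + 0 < Tr m
    Tr≤7 : Tr m ≤ + 7
    nonneg : ∀ y → + 0 ≤ Tr (m *ₒ (y *ₒ y))
    s-conj≡ : ι (quat a b (+ 1) (+ 0)) ⋆ conj v ≡ α • w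

-- To stay in ℤ, β = adj α replaces 1 / α, so every length is n = Nm α times the wanted trace. The
-- determinant becomes X · 49 · Nm(adj α) = 49 X n², where X is the product of the norms of the Tᵢ
-- and divides n; dividing by n³ leaves at most 49.
small-multiple : ∀ {α} → Pos α → (∃ λ k → Nm α ≡ + 1 + + 2 * k) → SmallMultiple α
small-multiple {α} posα (h , odd) = build (normal-form 0<n)
  where
  n = Nm α
  0<n : + 0 < n
  0<n = Pos⇒0<Nm posα
  β = adj α
  posβ : Pos β
  posβ = Pos-adj posα
  open TraceForm posβ
  module H = HermiteReduction (traceSpace posβ)

  build : NormalForm α → SmallMultiple α
  build nf = withRoots (minus-one-mod-odd ∣ M ∣ {{ℕ.≢-nonZero λ e → 0<⇒≢0 0<M (ℤ.∣i∣≡0⇒i≡0 e)}} M-odd)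
    where
    open NormalForm nf
    M = c * k * l
    0<M : + 0 < M
    0<M = 0<* (0<* 0<c 0<k) 0<l
    -- M divides the odd number n, and for an odd modulus -1 is a sum of two squares.
    M-odd : ¬ 2 ℕ.∣ ∣ M ∣
    M-odd (ℕ.divides q e) = odd≢even {h} {+ q * ((c * k) * c * proj₁ index∣)} (trans (sym odd) (trans (proj₂ index∣)
      (trans (cong (λ t → t * (c * k) * c * proj₁ index∣) (trans (sym (ℤ.0≤i⇒+∣i∣≡i (ℤ.<⇒≤ 0<M))) (trans (cong +_ e) (ℤ.pos-* q 2))))
        (lemma (+ q) (c * k) c (proj₁ index∣)))))
      where
      lemma : ∀ q x y t → q * + 2 * x * y * t ≡ + 2 * (q * (x * y * t))
      lemma = solve-∀
    withRoots : MinusOneIsSumOfTwoSquaresMod (+ ∣ M ∣) → SmallMultiple α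
    withRoots (a , b , K , e) = withGenerators (ideal-generator-exists 0<M s≡₁) (ideal-generator-exists (0<* 0<c 0<k) s≡₂) (ideal-generator-exists 0<c s≡₃)
      where
      s = quat a b (+ 1) (+ 0)
      s≡₁ : normᶻ s ≡ M * K
      s≡₁ = trans (lemma a b) (trans e (cong (_* K) (ℤ.0≤i⇒+∣i∣≡i (ℤ.<⇒≤ 0<M))))
        where
        lemma : ∀ a b → a * a + b * b + + 1 + + 0 + + 0 * (a + b + + 1) ≡ a * a + b * b + + 1
        lemma = solve-∀
      s≡₂ : normᶻ s ≡ (c * k) * (l * K)
      s≡₂ = trans s≡₁ (ℤ.*-assoc (c * k) l K)
      s≡₃ : normᶻ s ≡ c * (k * (l * K))
      s≡₃ = trans s≡₂ (ℤ.*-assoc c k (l * K))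
      α∣s : ∃ λ t → norm (ι s) ≡ α *ₒ t
      α∣s = proj₁ f₁∈ *ₒ int K , trans (norm-ι s) (trans (cong int s≡₁) (trans (int-* M K) (trans (cong (_*ₒ int K) (proj₂ f₁∈)) (*ₒ-assoc α (proj₁ f₁∈) (int K)))))
      withGenerators : IdealGenerator M s → IdealGenerator (c * k) s → IdealGenerator c s → SmallMultiple α
      withGenerators (T₁ , T₁∈ , N₁) (T₂ , T₂∈ , N₂) (T₃ , T₃∈ , N₃) =
        finish (H.short-vector (LeftIdeal α (ι s)) ideal-⊹ (λ q → ideal-⋆ (ι q)) 0<D
          (H.frame (ideal-lift (subst (α ∣ₒ_) (sym (*ₒ-identityʳ (int M))) f₁∈) T₁∈) (ideal-lift f₂∈ T₂∈) (ideal-lift f₃∈ T₃∈) D≡) (<-wellFounded _))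
        where
        E₂ = ⟨ r , + 1 , + 0 ⟩
        E₃ = ⟨ w , u , + 1 ⟩
        X = M * (c * k) * c
        D = X * (+ 49 * (n * n))
        0<X : + 0 < X
        0<X = 0<* (0<* 0<M (0<* 0<c 0<k)) 0<c
        0<D : + 0 < D
        0<D = 0<* 0<X (0<* {+ 49} (+<+ (s≤s z≤n)) (0<* 0<n 0<n))
        D≡ : H.det (1ₒ • ι T₁) (E₂ • ι T₂) (E₃ • ι T₃) ≡ D
        D≡ = trans (hermitianDet-cong (len-scaled posβ 1ₒ T₁) (len-scaled posβ E₂ T₂) (len-scaled posβ E₃ T₃)
            (form-scaled posβ 1ₒ E₂ T₁ T₂) (form-scaled posβ 1ₒ E₃ T₁ T₃) (form-scaled posβ E₂ E₃ T₂ T₃))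
          (trans (hermitianDet-scaled (lin (1ₒ *ₒ 1ₒ)) (lin (E₂ *ₒ E₂)) (lin (E₃ *ₒ E₃)) (lin (1ₒ *ₒ E₂)) (lin (1ₒ *ₒ E₃)) (lin (E₂ *ₒ E₃)) T₁ T₂ T₃) (cong₂ _*_ (cong₂ _*_ (cong₂ _*_ N₁ N₂) N₃)
            (trans (trace-discriminant β r u w) (cong (+ 49 *_) (Nm-adj (0<⇒≢0 0<n))))))
          where
          hermitianDet-cong : ∀ {a b c x y z a′ b′ c′ x′ y′ z′} → a ≡ a′ → b ≡ b′ → c ≡ c′ → x ≡ x′ → y ≡ y′ → z ≡ z′ →
            hermitianDet a b c x y z ≡ hermitianDet a′ b′ c′ x′ y′ z′
          hermitianDet-cong refl refl refl refl refl refl = refl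
        finish : (∃ λ t → LeftIdeal α (ι s) t × + 0 < len t × + 0 ≤ + 8 * D - len t * len t * len t) → SmallMultiple α
        finish (v , v∈ , 0<F , F≤) = record
          { m = m ; v = v ; w = proj₁ (ideal-conj (proj₂ α∣s) v∈) ; a = a ; b = b
          ; norm≡ = norm≡ ; 0<Tr = 0<T ; Tr≤7 = cube≤⇒≤7 0<T (0≤*-cancel {n * n * n} (0<* (0<* 0<n 0<n) 0<n) bound)
          ; nonneg = λ y → 0≤*-cancel 0<n (subst (+ 0 ≤_) (nonneg≡ y) (len-nonneg posβ (y • v)))
          ; s-conj≡ = proj₂ (ideal-conj (proj₂ α∣s) v∈) }
          where
          m = proj₁ (ideal-norm (proj₂ α∣s) v∈)
          norm≡ : norm v ≡ α *ₒ m
          norm≡ = proj₂ (ideal-norm (proj₂ α∣s) v∈)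
          β-α : ∀ x → lin (α *ₒ x) ≡ n * Tr x
          β-α x = trans (cong Tr (trans (lemma β α x) (cong (_*ₒ x) (*ₒ-adj α)))) (Tr-int n x)
            where
            lemma : ∀ β α x → β *ₒ (α *ₒ x) ≡ α *ₒ β *ₒ x
            lemma = SO.solve 3 (λ β α x → β SO.⊠ (α SO.⊠ x) SO.⊜ α SO.⊠ β SO.⊠ x) refl
          F≡ : len v ≡ n * Tr m
          F≡ = trans (cong lin norm≡) (β-α m)
          0<T : + 0 < Tr m
          0<T = 0<*-cancel 0<n (subst (+ 0 <_) F≡ 0<F)
          nonneg≡ : ∀ y → len (y • v) ≡ n * Tr (m *ₒ (y *ₒ y))
          nonneg≡ y = trans (cong lin (trans (norm-• y v) (trans (cong (y *ₒ y *ₒ_) norm≡) (lemma y α m)))) (β-α (m *ₒ (y *ₒ y)))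
            where
            lemma : ∀ y α m → y *ₒ y *ₒ (α *ₒ m) ≡ α *ₒ (m *ₒ (y *ₒ y))
            lemma = SO.solve 3 (λ y α m → y SO.⊠ y SO.⊠ (α SO.⊠ m) SO.⊜ α SO.⊠ (m SO.⊠ (y SO.⊠ y))) refl
          X≤n : + 0 ≤ n - X
          X≤n = ≤⇒0≤- (≤-of-multiple 0<X 0<n (proj₂ index∣))
          bound : + 0 ≤ n * n * n * (+ 392 - Tr m * Tr m * Tr m)
          bound = subst (+ 0 ≤_) (trans (cong (λ F → + 8 * D - F * F * F + + 392 * (n * n * (n - X))) F≡) (lemma n X (Tr m)))
            (0≤+ F≤ (0≤* {+ 392} (+≤+ z≤n) (0≤* (0≤* (ℤ.<⇒≤ 0<n) (ℤ.<⇒≤ 0<n)) X≤n)))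
            where
            lemma : ∀ n X T → + 8 * (X * (+ 49 * (n * n))) - n * T * (n * T) * (n * T) + + 392 * (n * n * (n - X)) ≡ n * n * n * (+ 392 - T * T * T)
            lemma = solve-∀

-- Reduction modulo 1 + i, onto the field F₆₄ = F₈[ω].

bit : Bool → ℤ
bit false = + 0
bit true  = + 1

odd? : ℤ → Bool
odd? a with halve a
... | _ , _ , inj₁ _ , _ = false
... | _ , _ , inj₂ _ , _ = true

odd?-unique : ∀ {a} b k → a ≡ bit b + + 2 * k → odd? a ≡ b
odd?-unique {a} b k e with halve a
odd?-unique {a} false k e | _ , _ , inj₁ refl , _ = refl
odd?-unique {a} true k e | _ , k′ , inj₁ refl , e′ = ⊥-elim (odd≢even {k} {k′} (trans (sym e) (trans e′ (ℤ.+-identityˡ (+ 2 * k′)))))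
odd?-unique {a} false k e | _ , k′ , inj₂ refl , e′ = ⊥-elim (odd≢even {k′} {k} (trans (sym e′) (trans e (ℤ.+-identityˡ (+ 2 * k)))))
odd?-unique {a} true k e | _ , _ , inj₂ refl , _ = refl

odd?-decompose : ∀ a → ∃ λ k → a ≡ bit (odd? a) + + 2 * k
odd?-decompose a with halve a
... | _ , k , inj₁ refl , e = k , e
... | _ , k , inj₂ refl , e = k , e

odd?-+ : ∀ a b → odd? (a + b) ≡ odd? a xor odd? b
odd?-+ a b with odd?-decompose a | odd?-decompose b
... | k , p | l , q = go (odd? a) (odd? b) p q
  where
  regroup : ∀ x y k l → x + + 2 * k + (y + + 2 * l) ≡ x + y + + 2 * (k + l)
  regroup = solve-∀
  carry : ∀ k → + 2 + + 2 * k ≡ + 0 + + 2 * (k + + 1)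
  carry = solve-∀
  go : ∀ x y → a ≡ bit x + + 2 * k → b ≡ bit y + + 2 * l → odd? (a + b) ≡ x xor y
  go false y p q = odd?-unique y (k + l) (trans (cong₂ _+_ p q) (trans (regroup (+ 0) (bit y) k l) (cong (_+ + 2 * (k + l)) (ℤ.+-identityˡ (bit y)))))
  go true false p q = odd?-unique true (k + l) (trans (cong₂ _+_ p q) (regroup (+ 1) (+ 0) k l))
  go true true p q = odd?-unique false (k + l + + 1) (trans (cong₂ _+_ p q) (trans (regroup (+ 1) (+ 1) k l) (carry (k + l))))

odd?-* : ∀ a b → odd? (a * b) ≡ odd? a ∧ odd? b
odd?-* a b with odd?-decompose a | odd?-decompose b
... | k , p | l , q = go (odd? a) (odd? b) p q
  where
  expand₀ : ∀ k y → (+ 0 + + 2 * k) * y ≡ + 0 + + 2 * (k * y)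
  expand₀ = solve-∀
  expand₁ : ∀ k y l → (+ 1 + + 2 * k) * (y + + 2 * l) ≡ y + + 2 * (l + k * (y + + 2 * l))
  expand₁ = solve-∀
  go : ∀ x y → a ≡ bit x + + 2 * k → b ≡ bit y + + 2 * l → odd? (a * b) ≡ x ∧ y
  go false y p q = odd?-unique false (k * (bit y + + 2 * l)) (trans (cong₂ _*_ p q) (expand₀ k (bit y + + 2 * l)))
  go true y p q = odd?-unique y (l + k * (bit y + + 2 * l)) (trans (cong₂ _*_ p q) (expand₁ k (bit y) l))

odd?-neg : ∀ a → odd? (- a) ≡ odd? a
odd?-neg a with odd?-decompose a
... | k , p = odd?-unique (odd? a) (- bit (odd? a) - k) (trans (cong -_ p) (lemma (bit (odd? a)) k))
  where
  lemma : ∀ b k → - (b + + 2 * k) ≡ b + + 2 * (- b - k)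
  lemma = solve-∀

record F₈ : Set where
  constructor ⟪_,_,_⟫
  field
    b₀ b₁ b₂ : Bool

infixl 6 _+₈_
infixl 7 _*₈_

_+₈_ _*₈_ : F₈ → F₈ → F₈
⟪ a , b , c ⟫ +₈ ⟪ d , e , f ⟫ = ⟪ a xor d , b xor e , c xor f ⟫
⟪ a , b , c ⟫ *₈ ⟪ d , e , f ⟫ =
  let e₃ = (b ∧ f) xor (c ∧ e)
      e₄ = c ∧ f
  -- `xor false` stands for the term 2 e₃ of the product in O, and the coefficient 3 of e₄ has
  -- become 1. The shape of `_⊗_` is kept so that `reduce₈-*` goes term by term.
  in ⟪ ((a ∧ d) xor e₃) xor e₄ , (((a ∧ e) xor (b ∧ d)) xor false) xor e₄ , ((((a ∧ f) xor (b ∧ e)) xor (c ∧ d)) xor e₃) xor e₄ ⟫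

0₈ 1₈ : F₈
0₈ = ⟪ false , false , false ⟫
1₈ = ⟪ true , false , false ⟫

reduce₈ : O → F₈
reduce₈ ⟨ a , b , c ⟩ = ⟪ odd? a , odd? b , odd? c ⟫

F₈-≡ : ∀ {a b c a′ b′ c′} → a ≡ a′ → b ≡ b′ → c ≡ c′ → ⟪ a , b , c ⟫ ≡ ⟪ a′ , b′ , c′ ⟫
F₈-≡ refl refl refl = refl

private
  plus : ∀ {a b x y} → odd? a ≡ x → odd? b ≡ y → odd? (a + b) ≡ x xor y
  plus {a} {b} p q = trans (odd?-+ a b) (cong₂ _xor_ p q)
  minus : ∀ {a b x y} → odd? a ≡ x → odd? b ≡ y → odd? (a - b) ≡ x xor y
  minus {a} {b} p q = plus p (trans (odd?-neg b) q)
  times : ∀ a b → odd? (a * b) ≡ odd? a ∧ odd? b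
  times = odd?-*
  scale : ∀ {b x y} c → odd? c ≡ x → odd? b ≡ y → odd? (c * b) ≡ x ∧ y
  scale {b} c p q = trans (odd?-* c b) (cong₂ _∧_ p q)

opaque
  unfolding _+ₒ_

  reduce₈-+ : ∀ x y → reduce₈ (x +ₒ y) ≡ reduce₈ x +₈ reduce₈ y
  reduce₈-+ ⟨ a , b , c ⟩ ⟨ d , e , f ⟩ = F₈-≡ (odd?-+ a d) (odd?-+ b e) (odd?-+ c f)

  reduce₈-* : ∀ x y → reduce₈ (x *ₒ y) ≡ reduce₈ x *₈ reduce₈ y
  reduce₈-* ⟨ a , b , c ⟩ ⟨ d , e , f ⟩ = F₈-≡
    (minus (plus (times a d) e₃) (times c f))
    (minus (plus (plus (times a e) (times b d)) (scale (+ 2) refl e₃)) (times c f))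
    (plus (minus (plus (plus (times a f) (times b e)) (times c d)) e₃) (scale (+ 3) refl (times c f)))
    where
    e₃ : odd? (b * f + c * e) ≡ (odd? b ∧ odd? f) xor (odd? c ∧ odd? e)
    e₃ = plus (times b f) (times c e)

  reduce₈-double : ∀ x → reduce₈ (2ₒ *ₒ x) ≡ 0₈
  reduce₈-double ⟨ a , b , c ⟩ = trans (cong reduce₈ (int-scale (+ 2) a b c)) (F₈-≡ (even a) (even b) (even c))
    where
    even : ∀ a → odd? (+ 2 * a) ≡ false
    even a = scale (+ 2) refl refl

  reduce₈≡0 : ∀ x → reduce₈ x ≡ 0₈ → 2ₒ ∣ₒ x
  reduce₈≡0 ⟨ a , b , c ⟩ e with even a (cong F₈.b₀ e) | even b (cong F₈.b₁ e) | even c (cong F₈.b₂ e)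
    where
    even : ∀ a → odd? a ≡ false → ∃ λ k → a ≡ + 2 * k
    even a o with odd?-decompose a
    ... | k , p = k , trans p (trans (cong (λ b → bit b + + 2 * k) o) (ℤ.+-identityˡ (+ 2 * k)))
  ... | a′ , refl | b′ , refl | c′ , refl = ⟨ a′ , b′ , c′ ⟩ , sym (int-scale (+ 2) a′ b′ c′)

+₈-identityʳ : ∀ x → x +₈ 0₈ ≡ x
+₈-identityʳ ⟪ a , b , c ⟫ = F₈-≡ (xor-identityʳ a) (xor-identityʳ b) (xor-identityʳ c)

reduce₈-drop : ∀ x y → reduce₈ (x +ₒ 2ₒ *ₒ y) ≡ reduce₈ x
reduce₈-drop x y = trans (reduce₈-+ x (2ₒ *ₒ y)) (trans (cong (reduce₈ x +₈_) (reduce₈-double y)) (+₈-identityʳ (reduce₈ x)))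

record F₆₄ : Set where
  constructor _+_ω
  field
    u d : F₈

infixl 7 _*₆₄_
_*₆₄_ : F₆₄ → F₆₄ → F₆₄
(u + d ω) *₆₄ (v + e ω) = (u *₈ v +₈ d *₈ e) + (u *₈ e +₈ d *₈ v +₈ d *₈ e) ω

-- 1 + i generates a two-sided ideal modulo which i, j and k become 1 and 2 becomes 0, so only a + b
-- + c and the coefficient of ω survive.
reduce : ℍ → F₆₄
reduce (quat a b c d) = reduce₈ (a +ₒ b +ₒ c) + reduce₈ d ω

reduce-⋆ : ∀ x y → reduce (x ⋆ y) ≡ reduce x *₆₄ reduce y
reduce-⋆ (quat a b c d) (quat e f g h) = cong₂ _+_ω
  (trans (cong reduce₈ (re-identity a b c d e f g h)) (trans (reduce₈-drop (u *ₒ v +ₒ d *ₒ h) _)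
    (trans (reduce₈-+ (u *ₒ v) (d *ₒ h)) (cong₂ _+₈_ (reduce₈-* u v) (reduce₈-* d h)))))
  (trans (cong reduce₈ (om-identity a b c d e f g h)) (trans (reduce₈-drop (u *ₒ h +ₒ d *ₒ v +ₒ d *ₒ h) _)
    (trans (reduce₈-+ (u *ₒ h +ₒ d *ₒ v) (d *ₒ h)) (cong₂ _+₈_ (trans (reduce₈-+ (u *ₒ h) (d *ₒ v)) (cong₂ _+₈_ (reduce₈-* u h) (reduce₈-* d v))) (reduce₈-* d h)))))
  where
  u = a +ₒ b +ₒ c
  v = e +ₒ f +ₒ g
  open SO using (_⊞_; _⊠_; _⊟_; _⊜_; Κ)
  re-identity : ∀ a b c d e f g h →
    (a *ₒ e +ₒ -ₒ (b *ₒ f) +ₒ -ₒ (b *ₒ g) +ₒ -ₒ (b *ₒ h) +ₒ c *ₒ f +ₒ -ₒ (c *ₒ g) +ₒ -ₒ (d *ₒ g) +ₒ -ₒ (d *ₒ h)) +ₒ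
    (a *ₒ f +ₒ b *ₒ e +ₒ -ₒ (b *ₒ g) +ₒ c *ₒ f +ₒ c *ₒ h +ₒ d *ₒ f +ₒ -ₒ (d *ₒ g)) +ₒ
    (a *ₒ g +ₒ c *ₒ e +ₒ -ₒ (b *ₒ g) +ₒ -ₒ (b *ₒ h) +ₒ c *ₒ f +ₒ c *ₒ h +ₒ d *ₒ f) ≡
    (a +ₒ b +ₒ c) *ₒ (e +ₒ f +ₒ g) +ₒ d *ₒ h +ₒ 2ₒ *ₒ (c *ₒ f +ₒ c *ₒ h +ₒ d *ₒ f +ₒ -ₒ (b *ₒ f) +ₒ -ₒ (2ₒ *ₒ (b *ₒ g)) +ₒ -ₒ (b *ₒ h) +ₒ -ₒ (c *ₒ g) +ₒ -ₒ (d *ₒ g) +ₒ -ₒ (d *ₒ h))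
  re-identity = SO.solve 8 (λ a b c d e f g h →
    (a ⊠ e ⊟ b ⊠ f ⊟ b ⊠ g ⊟ b ⊠ h ⊞ c ⊠ f ⊟ c ⊠ g ⊟ d ⊠ g ⊟ d ⊠ h) ⊞ (a ⊠ f ⊞ b ⊠ e ⊟ b ⊠ g ⊞ c ⊠ f ⊞ c ⊠ h ⊞ d ⊠ f ⊟ d ⊠ g) ⊞
    (a ⊠ g ⊞ c ⊠ e ⊟ b ⊠ g ⊟ b ⊠ h ⊞ c ⊠ f ⊞ c ⊠ h ⊞ d ⊠ f) ⊜
    (a ⊞ b ⊞ c) ⊠ (e ⊞ f ⊞ g) ⊞ d ⊠ h ⊞ Κ (+ 2) ⊠ (c ⊠ f ⊞ c ⊠ h ⊞ d ⊠ f ⊟ b ⊠ f ⊟ Κ (+ 2) ⊠ (b ⊠ g) ⊟ b ⊠ h ⊟ c ⊠ g ⊟ d ⊠ g ⊟ d ⊠ h)) refl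
  om-identity : ∀ a b c d e f g h →
    a *ₒ h +ₒ d *ₒ e +ₒ b *ₒ g +ₒ b *ₒ g +ₒ b *ₒ h +ₒ -ₒ (c *ₒ f) +ₒ -ₒ (c *ₒ f) +ₒ -ₒ (c *ₒ h) +ₒ -ₒ (d *ₒ f) +ₒ d *ₒ g +ₒ d *ₒ h ≡
    (a +ₒ b +ₒ c) *ₒ h +ₒ d *ₒ (e +ₒ f +ₒ g) +ₒ d *ₒ h +ₒ 2ₒ *ₒ (b *ₒ g +ₒ -ₒ (c *ₒ f) +ₒ -ₒ (c *ₒ h) +ₒ -ₒ (d *ₒ f))
  om-identity = SO.solve 8 (λ a b c d e f g h →
    a ⊠ h ⊞ d ⊠ e ⊞ b ⊠ g ⊞ b ⊠ g ⊞ b ⊠ h ⊟ c ⊠ f ⊟ c ⊠ f ⊟ c ⊠ h ⊟ d ⊠ f ⊞ d ⊠ g ⊞ d ⊠ h ⊜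
    (a ⊞ b ⊞ c) ⊠ h ⊞ d ⊠ (e ⊞ f ⊞ g) ⊞ d ⊠ h ⊞ Κ (+ 2) ⊠ (b ⊠ g ⊟ c ⊠ f ⊟ c ⊠ h ⊟ d ⊠ f)) refl

norm₆₄ : F₆₄ → F₈
norm₆₄ (u + d ω) = u *₈ u +₈ d *₈ d +₈ d *₈ u

reduce-norm : ∀ x → reduce₈ (norm x) ≡ norm₆₄ (reduce x)
reduce-norm (quat a b c d) = trans (cong reduce₈ (identity a b c d)) (trans (reduce₈-drop (u *ₒ u +ₒ d *ₒ d +ₒ d *ₒ u) _)
  (trans (reduce₈-+ (u *ₒ u +ₒ d *ₒ d) (d *ₒ u)) (cong₂ _+₈_ (trans (reduce₈-+ (u *ₒ u) (d *ₒ d)) (cong₂ _+₈_ (reduce₈-* u u) (reduce₈-* d d))) (reduce₈-* d u))))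
  where
  u = a +ₒ b +ₒ c
  open SO using (_⊞_; _⊠_; _⊟_; _⊜_; Κ)
  identity : ∀ a b c d → a *ₒ a +ₒ b *ₒ b +ₒ c *ₒ c +ₒ d *ₒ d +ₒ d *ₒ (a +ₒ b +ₒ c) ≡
    (a +ₒ b +ₒ c) *ₒ (a +ₒ b +ₒ c) +ₒ d *ₒ d +ₒ d *ₒ (a +ₒ b +ₒ c) +ₒ 2ₒ *ₒ (-ₒ (a *ₒ b +ₒ a *ₒ c +ₒ b *ₒ c))
  identity = SO.solve 4 (λ a b c d → a ⊠ a ⊞ b ⊠ b ⊞ c ⊠ c ⊞ d ⊠ d ⊞ d ⊠ (a ⊞ b ⊞ c) ⊜
    (a ⊞ b ⊞ c) ⊠ (a ⊞ b ⊞ c) ⊞ d ⊠ d ⊞ d ⊠ (a ⊞ b ⊞ c) ⊞ Κ (+ 2) ⊠ (SO.⊝ (a ⊠ b ⊞ a ⊠ c ⊞ b ⊠ c))) refl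

-- Cubic residue colours and sums of four squares.

data Colour : Set where
  none c₀ c₁ c₂ : Colour

infixl 7 _·_
_·_ : Colour → Colour → Colour
none · _ = none
_ · none = none
c₀ · y = y
x · c₀ = x
c₁ · c₁ = c₂
c₁ · c₂ = c₀
c₂ · c₁ = c₀
c₂ · c₂ = c₁

-- The cubic residue character y ↦ y²¹ of F₆₄; the norm n to F₈ is y⁹, so y²¹ = n² y³.
colour₆₄ : F₆₄ → Colour
colour₆₄ (u + d ω) = read (F₈.b₀ (n² *₈ (u² *₈ u +₈ d² *₈ d +₈ ud *₈ d))) (F₈.b₀ (n² *₈ (ud *₈ (u +₈ d))))
  where
  u² = u *₈ u
  d² = d *₈ d
  ud = u *₈ d
  n² = (u² +₈ d² +₈ ud) *₈ (u² +₈ d² +₈ ud)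
  -- A nonzero y²¹ is a cube root of unity, that is 1, ω or ω² = 1 + ω. Its two coordinates are 0 or
  -- 1, so the constant bit determines each of them.
  read : Bool → Bool → Colour
  read true false = c₀
  read false true = c₁
  read true true = c₂
  read false false = none

every : (Bool → Bool) → Bool
every f = f false ∧ f true

every-sound : ∀ f → every f ≡ true → ∀ b → f b ≡ true
every-sound f e b with f false in p | f true in q
every-sound f e false | true | _ = p
every-sound f e true | true | true = q

every₈ : (F₈ → Bool) → Bool
every₈ f = every λ a → every λ b → every λ c → f ⟪ a , b , c ⟫

every₈-sound : ∀ f → every₈ f ≡ true → ∀ x → f x ≡ true
every₈-sound f e ⟪ a , b , c ⟫ = every-sound (λ c → f ⟪ a , b , c ⟫)
  (every-sound (λ b → every λ c → f ⟪ a , b , c ⟫) (every-sound (λ a → every λ b → every λ c → f ⟪ a , b , c ⟫) e a) b) c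

every₆₄ : (F₆₄ → Bool) → Bool
every₆₄ f = every₈ λ u → every₈ λ d → f (u + d ω)

every₆₄-sound : ∀ f → every₆₄ f ≡ true → ∀ x → f x ≡ true
every₆₄-sound f e (u + d ω) = every₈-sound (λ d → f (u + d ω)) (every₈-sound (λ u → every₈ λ d → f (u + d ω)) e u) d

_≟ᶜ_ : (x y : Colour) → Dec (x ≡ y)
none ≟ᶜ none = yes refl
none ≟ᶜ c₀ = no λ ()
none ≟ᶜ c₁ = no λ ()
none ≟ᶜ c₂ = no λ ()
c₀ ≟ᶜ none = no λ ()
c₀ ≟ᶜ c₀ = yes refl
c₀ ≟ᶜ c₁ = no λ ()
c₀ ≟ᶜ c₂ = no λ ()
c₁ ≟ᶜ none = no λ ()
c₁ ≟ᶜ c₀ = no λ ()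
c₁ ≟ᶜ c₁ = yes refl
c₁ ≟ᶜ c₂ = no λ ()
c₂ ≟ᶜ none = no λ ()
c₂ ≟ᶜ c₀ = no λ ()
c₂ ≟ᶜ c₁ = no λ ()
c₂ ≟ᶜ c₂ = yes refl

does-sound : ∀ {A : Set} (d : Dec A) → does d ≡ true → A
does-sound (yes p) _ = p

colour₆₄-* : ∀ x y → colour₆₄ (x *₆₄ y) ≡ colour₆₄ x · colour₆₄ y
colour₆₄-* x@(u + d ω) y = does-sound (colour₆₄ (x *₆₄ y) ≟ᶜ (colour₆₄ x · colour₆₄ y)) (every₆₄-sound (multiplicative u d) (every₈-sound (λ d → every₆₄ (multiplicative u d)) (table u) d) y)
  where
  multiplicative : F₈ → F₈ → F₆₄ → Bool
  multiplicative u d y = does (colour₆₄ ((u + d ω) *₆₄ y) ≟ᶜ (colour₆₄ (u + d ω) · colour₆₄ y))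
  -- The 64 · 64 products are evaluated in eight separate blocks, one for each value of u.
  table : ∀ u → every₈ (λ d → every₆₄ (multiplicative u d)) ≡ true
  table ⟪ false , false , false ⟫ = refl
  table ⟪ false , false , true ⟫ = refl
  table ⟪ false , true , false ⟫ = refl
  table ⟪ false , true , true ⟫ = refl
  table ⟪ true , false , false ⟫ = refl
  table ⟪ true , false , true ⟫ = refl
  table ⟪ true , true , false ⟫ = refl
  table ⟪ true , true , true ⟫ = refl

zero₈ : F₈ → Bool
zero₈ ⟪ a , b , c ⟫ = not (a ∨ b ∨ c)

zero₈-sound : ∀ x → zero₈ x ≡ true → x ≡ 0₈
zero₈-sound ⟪ false , false , false ⟫ _ = refl

modus-ponens : ∀ {b c} → not b ∨ c ≡ true → b ≡ true → c ≡ true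
modus-ponens {true} p _ = p

∧-sound : ∀ {b c} → b ∧ c ≡ true → b ≡ true × c ≡ true
∧-sound {true} {true} _ = refl , refl

∨-sound : ∀ {b c} → b ∨ c ≡ true → b ≡ true ⊎ c ≡ true
∨-sound {true} _ = inj₁ refl
∨-sound {false} p = inj₂ p

zero₈-complete : ∀ {x} → x ≡ 0₈ → zero₈ x ≡ true
zero₈-complete refl = refl

does-complete : ∀ {A : Set} (d : Dec A) → A → does d ≡ true
does-complete (yes _) _ = refl
does-complete (no ¬a) a = ⊥-elim (¬a a)

-- u² + ud + d² is the norm form of the field extension F₆₄ / F₈, so it has no nontrivial zero.
norm₆₄-anisotropic : ∀ y → norm₆₄ y ≡ 0₈ → F₆₄.u y ≡ 0₈ × F₆₄.d y ≡ 0₈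
norm₆₄-anisotropic y e with ∧-sound (modus-ponens (every₆₄-sound (λ y → not (zero₈ (norm₆₄ y)) ∨ (zero₈ (F₆₄.u y) ∧ zero₈ (F₆₄.d y))) refl y) (zero₈-complete e))
... | p , q = zero₈-sound (F₆₄.u y) p , zero₈-sound (F₆₄.d y) q

colour₆₄-none : ∀ y → colour₆₄ y ≡ none → norm₆₄ y ≡ 0₈
colour₆₄-none y e = zero₈-sound (norm₆₄ y) (modus-ponens (every₆₄-sound (λ y → not (does (colour₆₄ y ≟ᶜ none)) ∨ zero₈ (norm₆₄ y)) refl y)
  (does-complete (colour₆₄ y ≟ᶜ none) e))

-- The 21 cubes are the seven nonzero elements of F₈ times 1, ω and ω² = 1 + ω; the three
-- alternatives list these cosets in this order.
colour₆₄-trivial : ∀ y → colour₆₄ y ≡ c₀ → F₆₄.d y ≡ 0₈ ⊎ F₆₄.u y ≡ 0₈ ⊎ F₆₄.u y +₈ F₆₄.d y ≡ 0₈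
colour₆₄-trivial y e with ∨-sound (modus-ponens (every₆₄-sound
    (λ y → not (does (colour₆₄ y ≟ᶜ c₀)) ∨ (zero₈ (F₆₄.d y) ∨ zero₈ (F₆₄.u y) ∨ zero₈ (F₆₄.u y +₈ F₆₄.d y))) refl y) (does-complete (colour₆₄ y ≟ᶜ c₀) e))
... | inj₁ p = inj₁ (zero₈-sound (F₆₄.d y) p)
... | inj₂ q with ∨-sound q
...   | inj₁ p = inj₂ (inj₁ (zero₈-sound (F₆₄.u y) p))
...   | inj₂ p = inj₂ (inj₂ (zero₈-sound (F₆₄.u y +₈ F₆₄.d y) p))

opaque
  colour : ℍ → Colour
  colour x = colour₆₄ (reduce x)

  colour-def : ∀ x → colour x ≡ colour₆₄ (reduce x)
  colour-def x = refl

colour-⋆ : ∀ x y → colour (x ⋆ y) ≡ colour x · colour y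
colour-⋆ x y = trans (colour-def (x ⋆ y)) (trans (cong colour₆₄ (reduce-⋆ x y)) (trans (colour₆₄-* (reduce x) (reduce y)) (sym (cong₂ _·_ (colour-def x) (colour-def y)))))

FourSquares : O → Set
FourSquares α = ∃₂ λ x y → ∃₂ λ z w → α ≡ x *ₒ x +ₒ y *ₒ y +ₒ z *ₒ z +ₒ w *ₒ w

lipschitz : ∀ x → 2ₒ ∣ₒ Quaternion.om x → FourSquares (norm x)
lipschitz (quat a b c _) (d , refl) = a +ₒ d , b +ₒ d , c +ₒ d , d , identity a b c d
  where
  open SO using (_⊞_; _⊠_; _⊟_; _⊜_; Κ)
  identity : ∀ a b c d → a *ₒ a +ₒ b *ₒ b +ₒ c *ₒ c +ₒ (2ₒ *ₒ d) *ₒ (2ₒ *ₒ d) +ₒ (2ₒ *ₒ d) *ₒ (a +ₒ b +ₒ c) ≡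
    (a +ₒ d) *ₒ (a +ₒ d) +ₒ (b +ₒ d) *ₒ (b +ₒ d) +ₒ (c +ₒ d) *ₒ (c +ₒ d) +ₒ d *ₒ d
  identity = SO.solve 4 (λ a b c d → a ⊠ a ⊞ b ⊠ b ⊞ c ⊠ c ⊞ (Κ (+ 2) ⊠ d) ⊠ (Κ (+ 2) ⊠ d) ⊞ (Κ (+ 2) ⊠ d) ⊠ (a ⊞ b ⊞ c) ⊜
    (a ⊞ d) ⊠ (a ⊞ d) ⊞ (b ⊞ d) ⊠ (b ⊞ d) ⊞ (c ⊞ d) ⊠ (c ⊞ d) ⊞ d ⊠ d) refl

ωᶻ : ℍᶻ
ωᶻ = quat (+ 0) (+ 0) (+ 0) (+ 1)

lipschitz-reduced : ∀ x → F₆₄.d (reduce x) ≡ 0₈ → FourSquares (norm x)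
lipschitz-reduced x@(quat _ _ _ d) e = lipschitz x (reduce₈≡0 d e)

opaque
  unfolding int

  reduce-ω : reduce (ι ωᶻ) ≡ 0₈ + 1₈ ω
  reduce-ω = refl

  norm-ω : ∀ x → norm (x ⋆ ι ωᶻ) ≡ norm x
  norm-ω x = trans (norm-⋆ x (ι ωᶻ)) (trans (cong (norm x *ₒ_) (norm-ι ωᶻ)) (*ₒ-identityʳ (norm x)))

ω-shift : ∀ u d → (u + d ω) *₆₄ (0₈ + 1₈ ω) ≡ d + (u +₈ d) ω
ω-shift u d = does-sound₈ u d
  where
  _==_ : F₈ → F₈ → Bool
  ⟪ a , b , c ⟫ == ⟪ a′ , b′ , c′ ⟫ = not (a xor a′) ∧ (not (b xor b′) ∧ not (c xor c′))
  bits : ∀ {a b} → not (a xor b) ≡ true → a ≡ b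
  bits {false} {false} _ = refl
  bits {true} {true} _ = refl
  ==-sound : ∀ {x y} → (x == y) ≡ true → x ≡ y
  ==-sound {⟪ a , b , c ⟫} {⟪ a′ , b′ , c′ ⟫} p with ∧-sound p
  ... | q , r with ∧-sound r
  ...   | s , t = F₈-≡ (bits q) (bits s) (bits t)
  does-sound₈ : ∀ u d → (u + d ω) *₆₄ (0₈ + 1₈ ω) ≡ d + (u +₈ d) ω
  does-sound₈ u d with ∧-sound (every₆₄-sound (λ y → let z = y *₆₄ (0₈ + 1₈ ω) in (F₆₄.u z == F₆₄.d y) ∧ (F₆₄.d z == (F₆₄.u y +₈ F₆₄.d y))) refl (u + d ω))
  ... | p , q = cong₂ _+_ω (==-sound p) (==-sound q)

reduce-⋆ω : ∀ x → reduce (x ⋆ ι ωᶻ) ≡ F₆₄.d (reduce x) + (F₆₄.u (reduce x) +₈ F₆₄.d (reduce x)) ω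
reduce-⋆ω x = trans (reduce-⋆ x (ι ωᶻ)) (trans (cong (reduce x *₆₄_) reduce-ω) (ω-shift (F₆₄.u (reduce x)) (F₆₄.d (reduce x))))

-- Right multiplication by ω preserves the norm and permutes F₈, F₈ω and F₈ω². At most two
-- multiplications bring the residue into F₈; then the ω coordinate is even, and the quaternion has
-- integral coordinates in 1, i, j, k.
colour-trivial⇒four-squares : ∀ x → colour x ≡ c₀ → FourSquares (norm x)
colour-trivial⇒four-squares x e with colour₆₄-trivial (reduce x) (trans (sym (colour-def x)) e)
... | inj₁ d≡0 = lipschitz-reduced x d≡0
... | inj₂ (inj₂ u+d≡0) = subst FourSquares (norm-ω x) (lipschitz-reduced (x ⋆ ι ωᶻ) (trans (cong F₆₄.d (reduce-⋆ω x)) u+d≡0))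
... | inj₂ (inj₁ u≡0) = subst FourSquares (trans (norm-ω (x ⋆ ι ωᶻ)) (norm-ω x)) (lipschitz-reduced (x ⋆ ι ωᶻ ⋆ ι ωᶻ)
    (trans (cong F₆₄.d (trans (reduce-⋆ω (x ⋆ ι ωᶻ)) (cong (λ y → F₆₄.d y + (F₆₄.u y +₈ F₆₄.d y) ω) (reduce-⋆ω x))))
      (trans (cancel (F₆₄.d (reduce x)) (F₆₄.u (reduce x))) u≡0)))
  where
  cancel : ∀ d u → d +₈ (u +₈ d) ≡ u
  cancel ⟪ a , b , c ⟫ ⟪ a′ , b′ , c′ ⟫ = F₈-≡ (c₂′ a a′) (c₂′ b b′) (c₂′ c c′)
    where
    c₂′ : ∀ a b → a xor (b xor a) ≡ b
    c₂′ false false = refl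
    c₂′ false true = refl
    c₂′ true false = refl
    c₂′ true true = refl

even-norm-reduced : ∀ {x α} → norm x ≡ 2ₒ *ₒ α → F₆₄.u (reduce x) ≡ 0₈ × F₆₄.d (reduce x) ≡ 0₈
even-norm-reduced {x} {α} e = norm₆₄-anisotropic (reduce x) (trans (sym (reduce-norm x)) (trans (cong reduce₈ e) (reduce₈-double α)))

colour-none⇒even-norm : ∀ x → colour x ≡ none → 2ₒ ∣ₒ norm x
colour-none⇒even-norm x e = reduce₈≡0 (norm x) (trans (reduce-norm x) (colour₆₄-none (reduce x) (trans (sym (colour-def x)) e)))

1+i : ℍ
1+i = quat 1ₒ 1ₒ 0ₒ 0ₒ

norm-1+i : norm 1+i ≡ 2ₒ
norm-1+i = identity 1ₒ
  where
  open SO using (_⊞_; _⊠_; _⊜_; Κ)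
  identity : ∀ (x : O) → 1ₒ *ₒ 1ₒ +ₒ 1ₒ *ₒ 1ₒ +ₒ 0ₒ *ₒ 0ₒ +ₒ 0ₒ *ₒ 0ₒ +ₒ 0ₒ *ₒ (1ₒ +ₒ 1ₒ +ₒ 0ₒ) ≡ 2ₒ
  identity = SO.solve 1 (λ x → Κ (+ 1) ⊠ Κ (+ 1) ⊞ Κ (+ 1) ⊠ Κ (+ 1) ⊞ Κ (+ 0) ⊠ Κ (+ 0) ⊞ Κ (+ 0) ⊠ Κ (+ 0) ⊞ Κ (+ 0) ⊠ (Κ (+ 1) ⊞ Κ (+ 1) ⊞ Κ (+ 0)) ⊜ Κ (+ 2)) refl

module QP {n} = Formulas {SO.Expr ℤ n} SO._⊞_ SO._⊠_ SO.⊝_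

1+i-quotient : ∀ a c u d → 1+i ⋆ quat (u +ₒ d) (u +ₒ -ₒ a) (c +ₒ d) (-ₒ c) ≡ quat a (2ₒ *ₒ u +ₒ -ₒ a +ₒ -ₒ c) c (2ₒ *ₒ d)
1+i-quotient a c u d = quat-≡
  (SO.solve 4 (λ a c u d → Quaternion.re (P a c u d) SO.⊜ a) refl a c u d)
  (SO.solve 4 (λ a c u d → Quaternion.im (P a c u d) SO.⊜ SO.Κ (+ 2) SO.⊠ u SO.⊟ a SO.⊟ c) refl a c u d)
  (SO.solve 4 (λ a c u d → Quaternion.jm (P a c u d) SO.⊜ c) refl a c u d)
  (SO.solve 4 (λ a c u d → Quaternion.om (P a c u d) SO.⊜ SO.Κ (+ 2) SO.⊠ d) refl a c u d)
  where
  P : ∀ {n} (a c u d : SO.Expr ℤ n) → Quaternion (SO.Expr ℤ n)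
  P a c u d = quat (SO.Κ (+ 1)) (SO.Κ (+ 1)) (SO.Κ (+ 0)) (SO.Κ (+ 0)) QP.⋆ quat (u SO.⊞ d) (u SO.⊟ a) (c SO.⊞ d) (SO.⊝ c)

-- By anisotropy the residue in F₆₄ vanishes, so a + b + c and d are even; their halves give the
-- quotient by 1 + i explicitly.
even-norm-divisible : ∀ {α} x → norm x ≡ 2ₒ *ₒ α → ∃ λ y → x ≡ 1+i ⋆ y
even-norm-divisible {α} x@(quat a b c d) e = quotient (reduce₈≡0 (a +ₒ b +ₒ c) (proj₁ even)) (reduce₈≡0 d (proj₂ even))
  where
  even : F₆₄.u (reduce x) ≡ 0₈ × F₆₄.d (reduce x) ≡ 0₈
  even = even-norm-reduced {x} {α} e
  lemma : ∀ a b c → a +ₒ b +ₒ c +ₒ -ₒ a +ₒ -ₒ c ≡ b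
  lemma = SO.solve 3 (λ a b c → a SO.⊞ b SO.⊞ c SO.⊟ a SO.⊟ c SO.⊜ b) refl
  quotient : 2ₒ ∣ₒ (a +ₒ b +ₒ c) → 2ₒ ∣ₒ d → ∃ λ y → x ≡ 1+i ⋆ y
  quotient (u , u≡) (d′ , d≡) = quat (u +ₒ d′) (u +ₒ -ₒ a) (c +ₒ d′) (-ₒ c) ,
    sym (trans (1+i-quotient a c u d′) (quat-≡ refl (trans (cong (λ t → t +ₒ -ₒ a +ₒ -ₒ c) (sym u≡)) (lemma a b c)) refl (sym d≡)))

•-cancel : ∀ {s x y} → s ≢ 0ₒ → s • x ≡ s • y → x ≡ y
•-cancel {x = quat _ _ _ _} {quat _ _ _ _} s≢0 e = quat-≡ (*ₒ-cancelˡ s≢0 (cong re e)) (*ₒ-cancelˡ s≢0 (cong im e))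
  (*ₒ-cancelˡ s≢0 (cong jm e)) (*ₒ-cancelˡ s≢0 (cong om e))
  where open Quaternion

-- Reduction modulo the totally positive prime δ = 2 − θ of norm 7.

δ : O
δ = ⟨ + 2 , - + 1 , + 0 ⟩

opaque
  unfolding _+ₒ_

  Nm-δ : Nm δ ≡ + 7
  Nm-δ = refl

  residue-identity : ∀ a b c → ⟨ a , b , c ⟩ ≡ int (a + + 2 * b + + 4 * c) +ₒ δ *ₒ ⟨ - b - + 2 * c , - c , + 0 ⟩
  residue-identity a b c = O-≡
    (S.solve 3 (λ a b c → a S.⊜ fst (rhs a b c)) refl a b c)
    (S.solve 3 (λ a b c → b S.⊜ snd (rhs a b c)) refl a b c)
    (S.solve 3 (λ a b c → c S.⊜ trd (rhs a b c)) refl a b c)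
    where
    rhs : ∀ {n} (a b c : S.Expr ℤ n) → Triple (S.Expr ℤ n)
    rhs a b c = triple (a S.⊞ S.Κ (+ 2) S.⊠ b S.⊞ S.Κ (+ 4) S.⊠ c) (S.Κ (+ 0)) (S.Κ (+ 0)) P.⊹
      P.mul (triple (S.Κ (+ 2)) (S.Κ (- + 1)) (S.Κ (+ 0))) (triple (S.⊝ b S.⊟ S.Κ (+ 2) S.⊠ c) (S.⊝ c) (S.Κ (+ 0)))

δ≢0 : δ ≢ 0ₒ
δ≢0 e = contradiction (cong O.c₀ (trans e (int-def (+ 0)))) λ ()

-- θ ≡ 2 modulo δ, so this represents the image in O / δ = F₇ by an integer.
residue : O → ℤ
residue ⟨ a , b , c ⟩ = a + + 2 * b + + 4 * c

opaque
  unfolding _+ₒ_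

  residue-δ : ∀ x → residue (δ *ₒ x) ≡ + 7 * O.c₂ x
  residue-δ ⟨ a , b , c ⟩ = S.solve 3 (λ a b c →
    let y = P.mul (triple (S.Κ (+ 2)) (S.Κ (- + 1)) (S.Κ (+ 0))) (triple a b c) in
    fst y S.⊞ S.Κ (+ 2) S.⊠ snd y S.⊞ S.Κ (+ 4) S.⊠ trd y S.⊜ S.Κ (+ 7) S.⊠ c) refl a b c

residue-int : ∀ n → residue (int n) ≡ n
residue-int n = trans (cong residue (int-def n)) (lemma n)
  where
  lemma : ∀ n → n + + 2 * + 0 + + 4 * + 0 ≡ n
  lemma = solve-∀

7∈δ : ∀ k → int (+ 7 * k) ≡ δ *ₒ (adj δ *ₒ int k)
7∈δ k = trans (int-* (+ 7) k) (trans (cong (_*ₒ int k) (trans (cong int (sym Nm-δ)) (sym (*ₒ-adj δ)))) (*ₒ-assoc δ (adj δ) (int k)))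

δ∣int : ∀ {n} → δ ∣ₒ int n → ∃ λ k → n ≡ + 7 * k
δ∣int {n} (y , e) = O.c₂ y , trans (sym (residue-int n)) (trans (cong residue e) (residue-δ y))

zero₇ : ℤ → Bool
zero₇ x = (∣ x ∣ ℕ.% 7) ℕ.≡ᵇ 0

zero₇-sound : ∀ x → zero₇ x ≡ true → ∃ λ k → x ≡ + 7 * k
zero₇-sound x e with ℕ.m%n≡0⇒n∣m ∣ x ∣ 7 (ℕ.≡ᵇ⇒≡ (∣ x ∣ ℕ.% 7) 0 (subst T (sym e) _))
... | ℕ.divides q eq = signed x (trans eq (ℕ.*-comm q 7))
  where
  signed : ∀ x → ∣ x ∣ ≡ 7 ℕ.* q → ∃ λ k → x ≡ + 7 * k
  signed (+ n) e = + q , trans (cong +_ e) (ℤ.pos-* 7 q)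
  signed -[1+ n ] e = - + q , trans (cong (λ m → - + m) e) (trans (cong -_ (ℤ.pos-* 7 q)) (ℤ.neg-distribʳ-* (+ 7) (+ q)))

zero₇-complete : ∀ k → zero₇ (+ 7 * k) ≡ true
zero₇-complete k = cong (ℕ._≡ᵇ 0) (trans (cong (ℕ._% 7) (trans (ℤ.abs-* (+ 7) k) (ℕ.*-comm 7 ∣ k ∣))) (ℕ.m*n%n≡0 ∣ k ∣ 7))

zero₇-complete′ : ∀ {n} → (∃ λ k → n ≡ + 7 * k) → zero₇ n ≡ true
zero₇-complete′ (k , refl) = zero₇-complete k

infix 4 _≡δ_
infixr 4 _,δ_
record _≡δ_ (x : ℍ) (a : ℍᶻ) : Set where
  constructor _,δ_
  field
    quotient : ℍ
    equality : x ≡ ι a ⊹ δ • quotient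

digit : ∀ a → ∃₂ λ i k → i ℕ.< 7 × a ≡ + i + + 7 * k
digit a = a ℤ.%ℕ 7 , a ℤ./ℕ 7 , ℤ.n%ℕd<d a 7 , trans (ℤ.a≡a%ℕn+[a/ℕn]*n a 7) (cong (_+_ (+ (a ℤ.%ℕ 7))) (ℤ.*-comm (a ℤ./ℕ 7) (+ 7)))

residues : ℍ → ℍᶻ
residues (quat a b c d) = quat (residue a) (residue b) (residue c) (residue d)

residues-≡δ : ∀ x → x ≡δ residues x
residues-≡δ (quat a b c d) = quat (q a) (q b) (q c) (q d) ,δ quat-≡ (eq a) (eq b) (eq c) (eq d)
  where
  q : O → O
  q ⟨ a , b , c ⟩ = ⟨ - b - + 2 * c , - c , + 0 ⟩
  eq : ∀ x → x ≡ int (residue x) +ₒ δ *ₒ q x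
  eq ⟨ a , b , c ⟩ = residue-identity a b c

-- With the representatives 0, ..., 6 a statement about ℍ modulo δ becomes a check over 7⁴
-- quaternions.
Digits : ℍᶻ → Set
Digits r = ∃₂ λ a b → ∃₂ λ c d → r ≡ quat (+ a) (+ b) (+ c) (+ d) × (a ℕ.< 7 × b ℕ.< 7 × c ℕ.< 7 × d ℕ.< 7)

digits-≡δ : ∀ x → ∃ λ r → Digits r × x ≡δ r
digits-≡δ x@(quat a b c d) with residues-≡δ x | digit (residue a) | digit (residue b) | digit (residue c) | digit (residue d)
... | quat z₁ z₂ z₃ z₄ ,δ e | i₁ , k₁ , <₁ , e₁ | i₂ , k₂ , <₂ , e₂ | i₃ , k₃ , <₃ , e₃ | i₄ , k₄ , <₄ , e₄ =
  quat (+ i₁) (+ i₂) (+ i₃) (+ i₄) , (i₁ , i₂ , i₃ , i₄ , refl , <₁ , <₂ , <₃ , <₄) ,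
  quat (adj δ *ₒ int k₁ +ₒ z₁) (adj δ *ₒ int k₂ +ₒ z₂) (adj δ *ₒ int k₃ +ₒ z₃) (adj δ *ₒ int k₄ +ₒ z₄) ,δ
  trans e (quat-≡ (shift e₁) (shift e₂) (shift e₃) (shift e₄))
  where
  shift : ∀ {n i k z} → n ≡ + i + + 7 * k → int n +ₒ δ *ₒ z ≡ int (+ i) +ₒ δ *ₒ (adj δ *ₒ int k +ₒ z)
  shift {_} {i} {k} {z} refl = trans (cong (_+ₒ δ *ₒ z) (trans (int-+ (+ i) (+ 7 * k)) (cong (int (+ i) +ₒ_) (7∈δ k)))) (lemma (int (+ i)) δ (adj δ *ₒ int k) z)
    where
    lemma : ∀ i d k z → i +ₒ d *ₒ k +ₒ d *ₒ z ≡ i +ₒ d *ₒ (k +ₒ z)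
    lemma = SO.solve 4 (λ i d k z → i SO.⊞ d SO.⊠ k SO.⊞ d SO.⊠ z SO.⊜ i SO.⊞ d SO.⊠ (k SO.⊞ z)) refl

≡δ-⋆ : ∀ {x y a b} → x ≡δ a → y ≡δ b → (x ⋆ y) ≡δ (a ⋆ᶻ b)
≡δ-⋆ {a = a} {b} (z ,δ refl) (w ,δ refl) = ι a ⋆ w ⊹ z ⋆ (ι b ⊹ δ • w) ,δ (begin
  (ι a ⊹ δ • z) ⋆ (ι b ⊹ δ • w)                              ≡⟨ ⋆-distribʳ (ι a) (δ • z) (ι b ⊹ δ • w) ⟩
  ι a ⋆ (ι b ⊹ δ • w) ⊹ (δ • z) ⋆ (ι b ⊹ δ • w)              ≡⟨ cong₂ _⊹_ (trans (⋆-distribˡ (ι a) (ι b) (δ • w)) (cong₂ _⊹_ (sym (ι-⋆ a b)) (⋆-• δ (ι a) w))) (•-⋆ δ z (ι b ⊹ δ • w)) ⟩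
  ι (a ⋆ᶻ b) ⊹ δ • (ι a ⋆ w) ⊹ δ • (z ⋆ (ι b ⊹ δ • w))       ≡⟨ trans (⊹-assoc (ι (a ⋆ᶻ b)) (δ • (ι a ⋆ w)) (δ • (z ⋆ (ι b ⊹ δ • w)))) (cong (ι (a ⋆ᶻ b) ⊹_) (sym (•-⊹ δ (ι a ⋆ w) (z ⋆ (ι b ⊹ δ • w))))) ⟩
  ι (a ⋆ᶻ b) ⊹ δ • (ι a ⋆ w ⊹ z ⋆ (ι b ⊹ δ • w))             ∎)
  where open ≡-Reasoning

≡δ-conj : ∀ {x a} → x ≡δ a → conj x ≡δ conjᶻ a
≡δ-conj {a = a} (z ,δ refl) = conj z ,δ trans (conj-⊹ (ι a) (δ • z)) (cong₂ _⊹_ (sym (ι-conj a)) (conj-• δ z))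

≡δ-ι : ∀ a → ι a ≡δ a
≡δ-ι a = 0ℍ ,δ sym (trans (cong (ι a ⊹_) (•-0 δ)) (⊹-0 (ι a)))

zeroᴴ pureᴴ : ℍᶻ → Bool
zeroᴴ (quat a b c d) = zero₇ a ∧ (zero₇ b ∧ (zero₇ c ∧ zero₇ d))
pureᴴ (quat a b c d) = zero₇ b ∧ (zero₇ c ∧ zero₇ d)

coordinate-sound : ∀ {x n z} → x ≡ int n +ₒ δ *ₒ z → zero₇ n ≡ true → δ ∣ₒ x
coordinate-sound {n = n} {z} refl p with zero₇-sound n p
... | k , refl = adj δ *ₒ int k +ₒ z , trans (cong (_+ₒ δ *ₒ z) (7∈δ k)) (lemma δ (adj δ *ₒ int k) z)
  where
  lemma : ∀ d k z → d *ₒ k +ₒ d *ₒ z ≡ d *ₒ (k +ₒ z)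
  lemma = SO.solve 3 (λ d k z → d SO.⊠ k SO.⊞ d SO.⊠ z SO.⊜ d SO.⊠ (k SO.⊞ z)) refl

coordinate-complete : ∀ {x n z} → x ≡ int n +ₒ δ *ₒ z → δ ∣ₒ x → zero₇ n ≡ true
coordinate-complete {n = n} {z} e (y , refl) = zero₇-complete′ (δ∣int (y +ₒ -ₒ z , trans (lemma (int n) (δ *ₒ z)) (trans (cong (_+ₒ -ₒ (δ *ₒ z)) (sym e)) (lemma′ δ y z))))
  where
  lemma : ∀ n z → n ≡ n +ₒ z +ₒ -ₒ z
  lemma = SO.solve 2 (λ n z → n SO.⊜ n SO.⊞ z SO.⊟ z) refl
  lemma′ : ∀ d y z → d *ₒ y +ₒ -ₒ (d *ₒ z) ≡ d *ₒ (y +ₒ -ₒ z)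
  lemma′ = SO.solve 3 (λ d y z → d SO.⊠ y SO.⊟ d SO.⊠ z SO.⊜ d SO.⊠ (y SO.⊟ z)) refl

zeroᴴ-sound : ∀ {x a} → x ≡δ a → zeroᴴ a ≡ true → ∃ λ y → x ≡ δ • y
zeroᴴ-sound {a = quat _ _ _ _} (quat _ _ _ _ ,δ refl) p with ∧-sound p
... | p₁ , q with ∧-sound q
...   | p₂ , r with ∧-sound r
...     | p₃ , p₄ with coordinate-sound refl p₁ | coordinate-sound refl p₂ | coordinate-sound refl p₃ | coordinate-sound refl p₄
...       | y₁ , e₁ | y₂ , e₂ | y₃ , e₃ | y₄ , e₄ = quat y₁ y₂ y₃ y₄ , quat-≡ e₁ e₂ e₃ e₄

ScalarModδ : ℍ → Set
ScalarModδ (quat a b c d) = δ ∣ₒ b × δ ∣ₒ c × δ ∣ₒ d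

pureᴴ-sound : ∀ {x a} → x ≡δ a → pureᴴ a ≡ true → ScalarModδ x
pureᴴ-sound {a = quat _ _ _ _} (quat _ _ _ _ ,δ refl) p with ∧-sound p
... | p₂ , r with ∧-sound r
...   | p₃ , p₄ = coordinate-sound refl p₂ , coordinate-sound refl p₃ , coordinate-sound refl p₄

pureᴴ-complete : ∀ {x a} → x ≡δ a → ScalarModδ x → pureᴴ a ≡ true
pureᴴ-complete {a = quat _ _ _ _} (quat _ _ _ _ ,δ refl) (p₂ , p₃ , p₄) =
  cong₂ _∧_ (coordinate-complete refl p₂) (cong₂ _∧_ (coordinate-complete refl p₃) (coordinate-complete refl p₄))

norm-≡δ : ∀ {x a} → x ≡δ a → ∃ λ z → norm x ≡ int (normᶻ a) +ₒ δ *ₒ z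
norm-≡δ {a = a} (z ,δ refl) = δ *ₒ norm z +ₒ tr (ι a ⋆ conj z) , trans (norm-⊹ (ι a) (δ • z))
  (trans (cong₂ _+ₒ_ (cong₂ _+ₒ_ (norm-ι a) (norm-• δ z)) (trans (cong tr (trans (cong (ι a ⋆_) (conj-• δ z)) (⋆-• δ (ι a) (conj z)))) (tr-• δ (ι a ⋆ conj z))))
    (lemma (int (normᶻ a)) δ (norm z) (tr (ι a ⋆ conj z))))
  where
  lemma : ∀ n d m t → n +ₒ d *ₒ d *ₒ m +ₒ d *ₒ t ≡ n +ₒ d *ₒ (d *ₒ m +ₒ t)
  lemma = SO.solve 4 (λ n d m t → n SO.⊞ d SO.⊠ d SO.⊠ m SO.⊞ d SO.⊠ t SO.⊜ n SO.⊞ d SO.⊠ (d SO.⊠ m SO.⊞ t)) refl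

tr-ι : ∀ a → tr (ι a) ≡ int (trᶻ a)
tr-ι (quat a b c d) = sym (int-⊞ (int-+ a a) refl)

tr-≡δ : ∀ {x a} → x ≡δ a → ∃ λ z → tr x ≡ int (trᶻ a) +ₒ δ *ₒ z
tr-≡δ {a = a} (z ,δ refl) = tr z , trans (tr-⊹ (ι a) (δ • z)) (cong₂ _+ₒ_ (tr-ι a) (tr-• δ z))

-- The discriminant of the characteristic polynomial, which does not change when a scalar is added.
discᶻ : ℍᶻ → ℤ
discᶻ a = trᶻ a * trᶻ a - + 4 * normᶻ a

disc : ℍ → O
disc x = tr x *ₒ tr x +ₒ -ₒ (int (+ 4) *ₒ norm x)

disc-≡δ : ∀ {x a} → x ≡δ a → ∃ λ z → disc x ≡ int (discᶻ a) +ₒ δ *ₒ z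
disc-≡δ {x} {a} e with tr-≡δ {x} {a} e | norm-≡δ {x} {a} e
... | z , t≡ | w , n≡ = int (+ 2 * trᶻ a) *ₒ z +ₒ δ *ₒ z *ₒ z +ₒ -ₒ (int (+ 4) *ₒ w) ,
  trans (cong₂ (λ t n → t *ₒ t +ₒ -ₒ (int (+ 4) *ₒ n)) t≡ n≡) (trans (lemma (int (trᶻ a)) δ z (int (normᶻ a)) w)
    (cong₂ (λ s t → s +ₒ δ *ₒ (t *ₒ z +ₒ δ *ₒ z *ₒ z +ₒ -ₒ (int (+ 4) *ₒ w)))
      (sym (int-⊟ (int-* (trᶻ a) (trᶻ a)) (int-* (+ 4) (normᶻ a)))) (sym (int-* (+ 2) (trᶻ a)))))
  where
  lemma : ∀ t d z n w → (t +ₒ d *ₒ z) *ₒ (t +ₒ d *ₒ z) +ₒ -ₒ (int (+ 4) *ₒ (n +ₒ d *ₒ w)) ≡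
    t *ₒ t +ₒ -ₒ (int (+ 4) *ₒ n) +ₒ d *ₒ (int (+ 2) *ₒ t *ₒ z +ₒ d *ₒ z *ₒ z +ₒ -ₒ (int (+ 4) *ₒ w))
  lemma = SO.solve 5 (λ t d z n w → (t SO.⊞ d SO.⊠ z) SO.⊠ (t SO.⊞ d SO.⊠ z) SO.⊟ SO.Κ (+ 4) SO.⊠ (n SO.⊞ d SO.⊠ w) SO.⊜
    t SO.⊠ t SO.⊟ SO.Κ (+ 4) SO.⊠ n SO.⊞ d SO.⊠ (SO.Κ (+ 2) SO.⊠ t SO.⊠ z SO.⊞ d SO.⊠ z SO.⊠ z SO.⊟ SO.Κ (+ 4) SO.⊠ w)) refl

private
  𝟎 𝟏 -𝟏 σ -σ : O
  𝟎 = ⟨ + 0 , + 0 , + 0 ⟩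
  𝟏 = ⟨ + 1 , + 0 , + 0 ⟩
  -𝟏 = ⟨ - + 1 , + 0 , + 0 ⟩
  σ = ⟨ + 1 , + 0 , - + 1 ⟩
  -σ = ⟨ - + 1 , + 0 , + 1 ⟩

-- Generators of the eight right ideals of norm δ, sorted by colour.
G₁ G₂ : List ℍ
G₁ = quat 𝟎 𝟎 σ 𝟏 ∷ quat σ 𝟎 𝟎 𝟏 ∷ quat 𝟎 σ 𝟎 𝟏 ∷ quat -𝟏 -𝟏 -𝟏 ⟨ + 0 , + 0 , + 1 ⟩ ∷ []
G₂ = quat 𝟎 𝟎 -𝟏 -σ ∷ quat 𝟎 -𝟏 𝟎 -σ ∷ quat 𝟏 𝟎 𝟎 σ ∷ quat 𝟎 𝟏 -σ -𝟏 ∷ []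

-- The units of the Hurwitz order other than ±1, up to sign.
units : List ℍᶻ
units = quat (+ 0) (+ 1) (+ 0) (+ 0) ∷ quat (+ 0) (+ 0) (+ 1) (+ 0) ∷ quat (- + 1) (- + 1) (- + 1) (+ 2) ∷
  quat (+ 0) (+ 0) (+ 0) (+ 1) ∷ quat (- + 1) (+ 0) (+ 0) (+ 1) ∷ quat (+ 0) (- + 1) (+ 0) (+ 1) ∷ quat (+ 0) (+ 0) (- + 1) (+ 1) ∷
  quat (- + 1) (- + 1) (+ 0) (+ 1) ∷ quat (- + 1) (+ 0) (- + 1) (+ 1) ∷ quat (+ 0) (- + 1) (- + 1) (+ 1) ∷ quat (- + 1) (- + 1) (- + 1) (+ 1) ∷ []

opaque
  unfolding _+ₒ_ colour

  G₁-data : All (λ g → norm g ≡ δ × colour g ≡ c₁) G₁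
  G₁-data = (refl , refl) ∷ (refl , refl) ∷ (refl , refl) ∷ (refl , refl) ∷ []

  G₂-data : All (λ g → norm g ≡ δ × colour g ≡ c₂) G₂
  G₂-data = (refl , refl) ∷ (refl , refl) ∷ (refl , refl) ∷ (refl , refl) ∷ []

  units-data : All (λ u → normᶻ u ≡ + 1 × colour (conj (ι u)) ≡ c₀) units
  units-data = (refl , refl) ∷ (refl , refl) ∷ (refl , refl) ∷ (refl , refl) ∷ (refl , refl) ∷ (refl , refl) ∷ (refl , refl) ∷ (refl , refl) ∷ (refl , refl) ∷ (refl , refl) ∷ (refl , refl) ∷ []

-- Changing the colour of an element without changing its norm.

any-sound : ∀ {A : Set} {P : A → Set} (f : A → Bool) {xs} → All P xs → any f xs ≡ true → ∃ λ x → P x × f x ≡ true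
any-sound f {x ∷ _} (p ∷ ps) e with f x in eq
... | true = x , p , eq
... | false = any-sound f ps e

opaque
  -- Since g⁻¹ = ḡ / δ, the congruence ḡ r g′ ≡ 0 modulo δ says that g⁻¹ h g′ is integral for every
  -- h with residue r. This test and the three after it search a list for a witness, computing with
  -- integers modulo 7 only.
  recolouring : List ℍ → List ℍ → ℍᶻ → Bool
  recolouring A B r = any (λ g → let x = conjᶻ (residues g) ⋆ᶻ r in any (λ g′ → zeroᴴ (x ⋆ᶻ residues g′)) B) A

  unital : List ℍᶻ → ℍᶻ → Bool
  unital U r = any (λ u → pureᴴ (r ⋆ᶻ conjᶻ u)) U ∧ not (zero₇ (discᶻ r))

  divisible : List ℍ → ℍᶻ → Bool
  divisible A r = any (λ g → zeroᴴ (conjᶻ (residues g) ⋆ᶻ r)) A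

  conjugable : List ℍ → ℍᶻ → Bool
  conjugable A r = any (λ g → not (pureᴴ ((residues g ⋆ᶻ r) ⋆ᶻ conjᶻ (residues g)))) A

recolourable : ℍᶻ → Bool
recolourable r = recolouring G₁ G₂ r ∧ recolouring G₂ G₁ r

below : ℕ → (ℤ → Bool) → Bool
below zero f = true
below (suc n) f = f (+ n) ∧ below n f

below-sound : ∀ {n} f → below n f ≡ true → ∀ {m} → m ℕ.< n → f (+ m) ≡ true
below-sound {suc n} f e {m} (s≤s m≤n) with ∧-sound e | m ℕ.≟ n
... | p , _ | yes refl = p
... | _ , q | no m≢n = below-sound f q (ℕ.≤∧≢⇒< m≤n m≢n)

everyDigit : (ℍᶻ → Bool) → Bool
everyDigit f = below 7 λ a → below 7 λ b → below 7 λ c → below 7 λ d → f (quat a b c d)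

everyDigit-sound : ∀ f → everyDigit f ≡ true → ∀ {r} → Digits r → f r ≡ true
everyDigit-sound f e (a , b , c , d , refl , a< , b< , c< , d<) =
  below-sound (λ d → f (quat (+ a) (+ b) (+ c) d)) (below-sound (λ c → below 7 λ d → f (quat (+ a) (+ b) c d))
    (below-sound (λ b → below 7 λ c → below 7 λ d → f (quat (+ a) b c d)) (below-sound (λ a → below 7 λ b → below 7 λ c → below 7 λ d → f (quat a b c d)) e a<) b<) c<) d<

opaque
  unfolding recolouring

  -- ℍ / δ is the matrix ring M₂(F₇), and the eight right ideals of norm δ are the points of the
  -- projective line over F₇, split four and four by colour. An invertible r either carries points
  -- across this partition in both directions or preserves it, and the latter happens only for
  -- scalars times units. All 7⁴ residues are checked.
  classification : ∀ {r} → Digits r → zero₇ (normᶻ r) ∨ (pureᴴ r ∨ (recolourable r ∨ unital units r)) ≡ true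
  classification = everyDigit-sound (λ r → zero₇ (normᶻ r) ∨ (pureᴴ r ∨ (recolourable r ∨ unital units r))) refl

  divisibility : ∀ {r} → Digits r → not (zero₇ (normᶻ r)) ∨ (divisible G₁ r ∨ divisible G₂ r) ≡ true
  divisibility = everyDigit-sound (λ r → not (zero₇ (normᶻ r)) ∨ (divisible G₁ r ∨ divisible G₂ r)) refl

  -- g is singular modulo δ, and g r ḡ is scalar there only if the kernel of g is an eigenline of r.
  -- A non-scalar r has at most two eigenlines, and the check confirms that some listed g avoids
  -- them.
  conjugability : ∀ {r} → Digits r → pureᴴ r ∨ (conjugable G₁ r ∨ conjugable G₂ r) ≡ true
  conjugability = everyDigit-sound (λ r → pureᴴ r ∨ (conjugable G₁ r ∨ conjugable G₂ r)) refl

opaque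
  unfolding recolouring

  divisible-sound : ∀ {A h r} {c : Colour} → All (λ g → norm g ≡ δ × colour g ≡ c) A → h ≡δ r → divisible A r ≡ true → ∃₂ λ g y → norm g ≡ δ × h ≡ g ⋆ y
  divisible-sound {A} {h} {r} norms h≡ e with any-sound (λ g → zeroᴴ (conjᶻ (residues g) ⋆ᶻ r)) norms e
  ... | g , (g-norm , _) , z with zeroᴴ-sound (≡δ-⋆ (≡δ-conj (residues-≡δ g)) h≡) z
  ...   | y , ḡh≡ = g , y , g-norm , •-cancel δ≢0 (begin
    δ • h                ≡⟨ cong (_• h) (sym g-norm) ⟩
    norm g • h           ≡⟨ sym (embed-⋆ (norm g) h) ⟩
    embed (norm g) ⋆ h   ≡⟨ cong (_⋆ h) (sym (⋆-conj g)) ⟩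
    g ⋆ conj g ⋆ h       ≡⟨ ⋆-assoc g (conj g) h ⟩
    g ⋆ (conj g ⋆ h)     ≡⟨ cong (g ⋆_) ḡh≡ ⟩
    g ⋆ (δ • y)          ≡⟨ ⋆-• δ g y ⟩
    δ • (g ⋆ y)          ∎)
    where open ≡-Reasoning

-- Modulo δ such an h is a singular matrix, so hℍ falls into one of the eight right ideals of norm
-- δ, whose generators are listed in `G₁` and `G₂`.
δ-divisible : ∀ {h} → δ ∣ₒ norm h → ∃₂ λ g y → norm g ≡ δ × h ≡ g ⋆ y
δ-divisible {h} δ∣N with digits-≡δ h
... | r , digits , h≡ with norm-≡δ h≡
...   | z , N≡ with ∨-sound (modus-ponens (divisibility digits) (coordinate-complete N≡ δ∣N))
...     | inj₁ p = divisible-sound G₁-data h≡ p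
...     | inj₂ p = divisible-sound G₂-data h≡ p

intertwine : ∀ {g h g′ h′} → norm g ≡ δ → conj g ⋆ h ⋆ g′ ≡ δ • h′ → g ⋆ h′ ≡ h ⋆ g′
intertwine {g} {h} {g′} {h′} g-norm e = •-cancel δ≢0 (begin
  δ • (g ⋆ h′)                ≡⟨ sym (⋆-• δ g h′) ⟩
  g ⋆ (δ • h′)                ≡⟨ cong (g ⋆_) (trans (sym e) (⋆-assoc (conj g) h g′)) ⟩
  g ⋆ (conj g ⋆ (h ⋆ g′))     ≡⟨ sym (⋆-assoc g (conj g) (h ⋆ g′)) ⟩
  g ⋆ conj g ⋆ (h ⋆ g′)       ≡⟨ cong (_⋆ (h ⋆ g′)) (⋆-conj g) ⟩
  embed (norm g) ⋆ (h ⋆ g′)   ≡⟨ embed-⋆ (norm g) (h ⋆ g′) ⟩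
  norm g • (h ⋆ g′)           ≡⟨ cong (_• (h ⋆ g′)) g-norm ⟩
  δ • (h ⋆ g′)                ∎)
  where open ≡-Reasoning

Recoloured : ℍ → Colour → Colour → Set
Recoloured h c c′ = ∃ λ h′ → norm h′ ≡ norm h × c · colour h′ ≡ colour h · c′

recoloured : ∀ {h g g′ c c′} → norm g ≡ δ → colour g ≡ c → norm g′ ≡ δ → colour g′ ≡ c′ → (∃ λ h′ → conj g ⋆ h ⋆ g′ ≡ δ • h′) → Recoloured h c c′
recoloured {h} {g} {g′} {c} {c′} g-norm g-colour g′-norm g′-colour (h′ , e) = h′ , norm≡ , colour≡
  where
  gh′≡ : g ⋆ h′ ≡ h ⋆ g′
  gh′≡ = intertwine g-norm e
  norm≡ : norm h′ ≡ norm h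
  norm≡ = *ₒ-cancelˡ δ≢0 (trans (cong (_*ₒ norm h′) (sym g-norm)) (trans (sym (norm-⋆ g h′)) (trans (cong norm gh′≡)
    (trans (norm-⋆ h g′) (trans (cong (norm h *ₒ_) g′-norm) (*ₒ-comm (norm h) δ))))))
  colour≡ : c · colour h′ ≡ colour h · c′
  colour≡ = trans (cong (_· colour h′) (sym g-colour)) (trans (sym (colour-⋆ g h′)) (trans (cong colour gh′≡) (trans (colour-⋆ h g′) (cong (colour h ·_) g′-colour))))

opaque
  unfolding recolouring

  recolouring-sound : ∀ {A B h r c c′} → All (λ g → norm g ≡ δ × colour g ≡ c) A → All (λ g → norm g ≡ δ × colour g ≡ c′) B →
    h ≡δ r → recolouring A B r ≡ true → Recoloured h c c′
  recolouring-sound {A} {B} {h} {r} {c} {c′} As Bs h≡ e =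
    outer (any-sound (λ g → any (λ g′ → zeroᴴ ((conjᶻ (residues g) ⋆ᶻ r) ⋆ᶻ residues g′)) B) As e)
    where
    inner : ∀ {g} → norm g ≡ δ → colour g ≡ c → (∃ λ g′ → (norm g′ ≡ δ × colour g′ ≡ c′) × zeroᴴ ((conjᶻ (residues g) ⋆ᶻ r) ⋆ᶻ residues g′) ≡ true) → Recoloured h c c′
    inner {g} g-norm g-colour (g′ , (g′-norm , g′-colour) , z) =
      recoloured g-norm g-colour g′-norm g′-colour (zeroᴴ-sound (≡δ-⋆ (≡δ-⋆ (≡δ-conj (residues-≡δ g)) h≡) (residues-≡δ g′)) z)
    outer : (∃ λ g → (norm g ≡ δ × colour g ≡ c) × any (λ g′ → zeroᴴ ((conjᶻ (residues g) ⋆ᶻ r) ⋆ᶻ residues g′)) B ≡ true) → Recoloured h c c′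
    outer (g , (g-norm , g-colour) , e′) = inner g-norm g-colour (any-sound (λ g′ → zeroᴴ ((conjᶻ (residues g) ⋆ᶻ r) ⋆ᶻ residues g′)) Bs e′)

AllColours : O → Set
AllColours α = ∀ c → c ≢ none → ∃ λ h → norm h ≡ α × colour h ≡ c

-- The equations amount to y = c₁ · x and z = c₂ · x, so x, y and z run through all three colours.
-- The other triples violate an equation and are dismissed by the coverage checker.
colour-choice : ∀ x y z → x ≢ none → c₁ · y ≡ x · c₂ → c₂ · z ≡ x · c₁ → ∀ c → c ≢ none → x ≡ c ⊎ y ≡ c ⊎ z ≡ c
colour-choice none _ _ x≢ = ⊥-elim (x≢ refl)
colour-choice _ _ _ _ _ _ none c≢ = ⊥-elim (c≢ refl)
colour-choice c₀ c₁ c₂ _ _ _ c₀ _ = inj₁ refl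
colour-choice c₀ c₁ c₂ _ _ _ c₁ _ = inj₂ (inj₁ refl)
colour-choice c₀ c₁ c₂ _ _ _ c₂ _ = inj₂ (inj₂ refl)
colour-choice c₁ c₂ c₀ _ _ _ c₁ _ = inj₁ refl
colour-choice c₁ c₂ c₀ _ _ _ c₂ _ = inj₂ (inj₁ refl)
colour-choice c₁ c₂ c₀ _ _ _ c₀ _ = inj₂ (inj₂ refl)
colour-choice c₂ c₀ c₁ _ _ _ c₂ _ = inj₁ refl
colour-choice c₂ c₀ c₁ _ _ _ c₀ _ = inj₂ (inj₁ refl)
colour-choice c₂ c₀ c₁ _ _ _ c₁ _ = inj₂ (inj₂ refl)

recolourable-sound : ∀ {h r} → colour h ≢ none → h ≡δ r → recolourable r ≡ true → AllColours (norm h)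
recolourable-sound {h} {r} h≢ h≡ e =
  combine′ (recolouring-sound G₁-data G₂-data h≡ (proj₁ (∧-sound e))) (recolouring-sound G₂-data G₁-data h≡ (proj₂ (∧-sound {recolouring G₁ G₂ r} e)))
  where
  combine′ : Recoloured h c₁ c₂ → Recoloured h c₂ c₁ → AllColours (norm h)
  combine′ (h₁ , n₁ , e₁) (h₂ , n₂ , e₂) c c≢ = choose (colour-choice (colour h) (colour h₁) (colour h₂) h≢ e₁ e₂ c c≢)
    where
    choose : colour h ≡ c ⊎ colour h₁ ≡ c ⊎ colour h₂ ≡ c → ∃ λ h′ → norm h′ ≡ norm h × colour h′ ≡ c
    choose (inj₁ p) = h , refl , p
    choose (inj₂ (inj₁ p)) = h₁ , n₁ , p
    choose (inj₂ (inj₂ p)) = h₂ , n₂ , p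

opaque
  unfolding recolouring

  unital-sound : ∀ {U h r} {P : ℍᶻ → Set} → All P U → h ≡δ r → unital U r ≡ true →
    ∃ λ u → P u × ScalarModδ (h ⋆ conj (ι u)) × ¬ (δ ∣ₒ disc h)
  unital-sound {U} {h} {r} Us h≡ e with ∧-sound {any (λ u → pureᴴ (r ⋆ᶻ conjᶻ u)) U} e
  ... | a , d with any-sound (λ u → pureᴴ (r ⋆ᶻ conjᶻ u)) Us a
  ...   | u , p , s = u , p , pureᴴ-sound (≡δ-⋆ h≡ (≡δ-conj (≡δ-ι u))) s ,
    λ δ∣ → contradiction (trans (sym d) (cong not (coordinate-complete (proj₂ (disc-≡δ h≡)) δ∣))) λ ()

  conjugable-sound : ∀ {A k r} {P : ℍ → Set} → All P A → k ≡δ r → conjugable A r ≡ true →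
    ∃ λ g → P g × ¬ ScalarModδ (g ⋆ k ⋆ conj g)
  conjugable-sound {r = r} As k≡ e with any-sound (λ g → not (pureᴴ ((residues g ⋆ᶻ r) ⋆ᶻ conjᶻ (residues g)))) As e
  ... | g , p , z = g , p ,
    λ sc → contradiction (trans (sym z) (cong not (pureᴴ-complete (≡δ-⋆ (≡δ-⋆ (residues-≡δ g) k≡) (≡δ-conj (residues-≡δ g))) sc))) λ ()

-- The constructor `unit` records that the discriminant is not divisible by δ; this is what later
-- excludes it for elements l + g k ḡ.
data Kind (h : ℍ) : Set where
  scalar : ScalarModδ h → Kind h
  mixed  : AllColours (norm h) → Kind h
  unit   : ∀ u → normᶻ u ≡ + 1 → colour (conj (ι u)) ≡ c₀ → ScalarModδ (h ⋆ conj (ι u)) → ¬ (δ ∣ₒ disc h) → Kind h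

classify : ∀ h → colour h ≢ none → ¬ (δ ∣ₒ norm h) → Kind h
classify h h≢ δ∤N with digits-≡δ h
... | r , digits , h≡ with ∨-sound {zero₇ (normᶻ r)} (classification digits)
...   | inj₁ N = ⊥-elim (δ∤N (coordinate-sound (proj₂ (norm-≡δ h≡)) N))
...   | inj₂ p with ∨-sound {pureᴴ r} p
...     | inj₁ q = scalar (pureᴴ-sound h≡ q)
...     | inj₂ q with ∨-sound {recolourable r} q
...       | inj₁ m = mixed (recolourable-sound h≢ h≡ m)
...       | inj₂ un with unital-sound units-data h≡ un
...         | u , (u-norm , u-colour) , s , disc≢ = unit u u-norm u-colour s disc≢

power : ℕ → O
power zero = 1ₒ
power (suc n) = δ *ₒ power n

-- If h is a scalar modulo δᵐ⁺¹ but not modulo δᵐ⁺², conjugating it by a suitable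
-- element of norm δ gives an element that is a scalar modulo δᵐ only.
conjugate-away : ∀ {k} → ¬ ScalarModδ k → ∃ λ g → norm g ≡ δ × colour g ≢ none × ¬ ScalarModδ (g ⋆ k ⋆ conj g)
conjugate-away {k} k-mixed with digits-≡δ k
... | r , digits , k≡ with ∨-sound {pureᴴ r} (conjugability digits)
...   | inj₁ p = ⊥-elim (k-mixed (pureᴴ-sound k≡ p))
...   | inj₂ p = from (∨-sound {conjugable G₁ r} p)
  where
  extract : ∀ {A c} → c ≢ none → All (λ g → norm g ≡ δ × colour g ≡ c) A → conjugable A r ≡ true →
    ∃ λ g → norm g ≡ δ × colour g ≢ none × ¬ ScalarModδ (g ⋆ k ⋆ conj g)
  extract c≢ As e with conjugable-sound As k≡ e
  ... | g , (g-norm , refl) , k′-mixed = g , g-norm , c≢ , k′-mixed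
  from : conjugable G₁ r ≡ true ⊎ conjugable G₂ r ≡ true → ∃ λ g → norm g ≡ δ × colour g ≢ none × ¬ ScalarModδ (g ⋆ k ⋆ conj g)
  from (inj₁ p) = extract (λ ()) G₁-data p
  from (inj₂ p) = extract (λ ()) G₂-data p

shifted : O → ℕ → ℍ → ℍ
shifted l m k = embed l ⊹ power m • k

·-cancel : ∀ {x y c} → c ≢ none → x · c ≡ c · y → x ≡ y
·-cancel {x} {y} {none} c≢ = ⊥-elim (c≢ refl)
·-cancel {none} {none} {c₀} _ _ = refl
·-cancel {c₀} {c₀} {c₀} _ _ = refl
·-cancel {c₁} {c₁} {c₀} _ _ = refl
·-cancel {c₂} {c₂} {c₀} _ _ = refl
·-cancel {none} {none} {c₁} _ _ = refl
·-cancel {c₀} {c₀} {c₁} _ _ = refl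
·-cancel {c₁} {c₁} {c₁} _ _ = refl
·-cancel {c₂} {c₂} {c₁} _ _ = refl
·-cancel {none} {none} {c₂} _ _ = refl
·-cancel {c₀} {c₀} {c₂} _ _ = refl
·-cancel {c₁} {c₁} {c₂} _ _ = refl
·-cancel {c₂} {c₂} {c₂} _ _ = refl

-- Conjugation by g, written without inverses: as g k ḡ g = δ g k, passing from h to g h g⁻¹
-- replaces k by g k ḡ at the price of one factor δ.
conjugated : ∀ {l m k g} → norm g ≡ δ → shifted l m (g ⋆ k ⋆ conj g) ⋆ g ≡ g ⋆ shifted l (suc m) k
conjugated {l} {m} {k} {g} g-norm = begin
  (embed l ⊹ power m • (g ⋆ k ⋆ conj g)) ⋆ g          ≡⟨ ⋆-distribʳ (embed l) (power m • (g ⋆ k ⋆ conj g)) g ⟩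
  embed l ⋆ g ⊹ (power m • (g ⋆ k ⋆ conj g)) ⋆ g      ≡⟨ cong₂ _⊹_ (trans (embed-⋆ l g) (sym (⋆-embed l g))) (trans (•-⋆ (power m) (g ⋆ k ⋆ conj g) g) (cong (power m •_) unwind)) ⟩
  g ⋆ embed l ⊹ power m • (δ • (g ⋆ k))               ≡⟨ cong (g ⋆ embed l ⊹_) (trans (•-• (power m) δ (g ⋆ k)) (cong (_• (g ⋆ k)) (*ₒ-comm (power m) δ))) ⟩
  g ⋆ embed l ⊹ power (suc m) • (g ⋆ k)               ≡⟨ trans (cong (g ⋆ embed l ⊹_) (sym (⋆-• (power (suc m)) g k))) (sym (⋆-distribˡ g (embed l) (power (suc m) • k))) ⟩
  g ⋆ (embed l ⊹ power (suc m) • k)                   ∎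
  where
  open ≡-Reasoning
  unwind : g ⋆ k ⋆ conj g ⋆ g ≡ δ • (g ⋆ k)
  unwind = trans (⋆-assoc (g ⋆ k) (conj g) g) (trans (cong (g ⋆ k ⋆_) (trans (conj-⋆-self g) (cong embed g-norm))) (⋆-embed δ (g ⋆ k)))

disc-shift : ∀ l k → disc (shifted l 0 k) ≡ disc k
disc-shift l (quat a b c d) = SO.solve 5 (λ l a b c d →
  D (quat (l SO.⊞ SO.Κ (+ 1) SO.⊠ a) (SO.Κ (+ 0) SO.⊞ SO.Κ (+ 1) SO.⊠ b) (SO.Κ (+ 0) SO.⊞ SO.Κ (+ 1) SO.⊠ c) (SO.Κ (+ 0) SO.⊞ SO.Κ (+ 1) SO.⊠ d)) SO.⊜ D (quat a b c d)) refl l a b c d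
  where
  D : ∀ {n} → Quaternion (SO.Expr ℤ n) → SO.Expr ℤ n
  D x = QP.tr x SO.⊠ QP.tr x SO.⊟ SO.Κ (+ 4) SO.⊠ QP.norm x

δ∣disc-conjugate : ∀ {g} k → norm g ≡ δ → δ ∣ₒ disc (g ⋆ k ⋆ conj g)
δ∣disc-conjugate {g} k g-norm = δ *ₒ disc k , trans (cong₂ (λ t n → t *ₒ t +ₒ -ₒ (int (+ 4) *ₒ n)) trace≡ norm≡) (lemma δ (tr k) (norm k))
  where
  trace≡ : tr (g ⋆ k ⋆ conj g) ≡ δ *ₒ tr k
  trace≡ = trans (tr-comm (g ⋆ k) (conj g)) (trans (cong tr (trans (sym (⋆-assoc (conj g) g k)) (trans (cong (_⋆ k) (conj-⋆-self g)) (trans (embed-⋆ (norm g) k) (cong (_• k) g-norm))))) (tr-• δ k))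
  norm≡ : norm (g ⋆ k ⋆ conj g) ≡ δ *ₒ norm k *ₒ δ
  norm≡ = trans (norm-⋆ (g ⋆ k) (conj g)) (cong₂ _*ₒ_ (trans (norm-⋆ g k) (cong (_*ₒ norm k) g-norm)) (trans (norm-conj g) g-norm))
  lemma : ∀ d t n → d *ₒ t *ₒ (d *ₒ t) +ₒ -ₒ (int (+ 4) *ₒ (d *ₒ n *ₒ d)) ≡ d *ₒ (d *ₒ (t *ₒ t +ₒ -ₒ (int (+ 4) *ₒ n)))
  lemma = SO.solve 3 (λ d t n → d SO.⊠ t SO.⊠ (d SO.⊠ t) SO.⊟ SO.Κ (+ 4) SO.⊠ (d SO.⊠ n SO.⊠ d) SO.⊜ d SO.⊠ (d SO.⊠ (t SO.⊠ t SO.⊟ SO.Κ (+ 4) SO.⊠ n))) refl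

shift-mixed : ∀ l k → ScalarModδ (shifted l 0 k) → ScalarModδ k
shift-mixed l (quat a b c d) (p , q , r) = drop b p , drop c q , drop d r
  where
  drop : ∀ x → δ ∣ₒ (0ₒ +ₒ 1ₒ *ₒ x) → δ ∣ₒ x
  drop x = subst (δ ∣ₒ_) (SO.solve 1 (λ x → SO.Κ (+ 0) SO.⊞ SO.Κ (+ 1) SO.⊠ x SO.⊜ x) refl x)

-- Induction on the power of δ in front of k. At the last step the conjugate is l + g k ḡ. It is not
-- scalar modulo δ, and its discriminant, being that of g k ḡ, is divisible by δ, so `classify` can
-- only answer `mixed`.
near-scalar : ∀ m {l k} → ¬ ScalarModδ k → colour (shifted l (suc m) k) ≢ none → ¬ (δ ∣ₒ norm (shifted l (suc m) k)) → AllColours (norm (shifted l (suc m) k))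
near-scalar m {l} {k} k-mixed h≢ δ∤ with conjugate-away k-mixed
... | g , g-norm , g-colour , k′-mixed = subst AllColours norm≡ (step m k′ k′-mixed refl h′≢ (subst (λ n → ¬ (δ ∣ₒ n)) (sym norm≡) δ∤))
  where
  k′ = g ⋆ k ⋆ conj g
  h = shifted l (suc m) k
  h′ = shifted l m k′
  norm≡ : norm h′ ≡ norm h
  norm≡ = *ₒ-cancelˡ δ≢0 (trans (*ₒ-comm δ (norm h′)) (trans (cong (norm h′ *ₒ_) (sym g-norm)) (trans (sym (norm-⋆ h′ g))
    (trans (cong norm (conjugated {l} {m} {k} {g} g-norm)) (trans (norm-⋆ g h) (cong (_*ₒ norm h) g-norm))))))
  h′≢ : colour h′ ≢ none
  h′≢ e = h≢ (trans (sym (·-cancel g-colour (trans (sym (colour-⋆ h′ g)) (trans (cong colour (conjugated {l} {m} {k} {g} g-norm)) (colour-⋆ g h))))) e)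
  step : ∀ m k′ → ¬ ScalarModδ k′ → k′ ≡ g ⋆ k ⋆ conj g → colour (shifted l m k′) ≢ none → ¬ (δ ∣ₒ norm (shifted l m k′)) → AllColours (norm (shifted l m k′))
  step (suc m) k′ mixed′ _ = near-scalar m {l} {k′} mixed′
  step zero k′ mixed′ k′≡ c≢ δ∤N with classify (shifted l 0 k′) c≢ δ∤N
  ... | scalar s = ⊥-elim (mixed′ (shift-mixed l k′ s))
  ... | mixed all = all
  ... | unit _ _ _ _ disc≢ = ⊥-elim (disc≢ (subst (δ ∣ₒ_) (sym (trans (disc-shift l k′) (cong disc k′≡))) (δ∣disc-conjugate {g} k g-norm)))

scalar-mod-δ? : ∀ k → Dec (ScalarModδ k)
scalar-mod-δ? k with pureᴴ (residues k) in eq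
... | true = yes (pureᴴ-sound (residues-≡δ k) eq)
... | false = no λ s → contradiction (trans (sym eq) (pureᴴ-complete (residues-≡δ k) s)) λ ()

-- This measure vanishes exactly for scalars and shrinks by the factor 7 when the coordinates at i,
-- j and ω are divided by δ, so the divisions in `valuation` come to an end.
pureSize : ℍ → ℕ
pureSize (quat a b c d) = ∣ Nm b ∣ ℕ.+ ∣ Nm c ∣ ℕ.+ ∣ Nm d ∣

pureSize≡0 : ∀ x → pureSize x ≡ 0 → ∃ λ l → x ≡ embed l
pureSize≡0 (quat a b c d) e = a , quat-≡ refl (vanish b (ℕ.m+n≡0⇒m≡0 ∣ Nm b ∣ bc)) (vanish c (ℕ.m+n≡0⇒n≡0 ∣ Nm b ∣ bc)) (vanish d (ℕ.m+n≡0⇒n≡0 (∣ Nm b ∣ ℕ.+ ∣ Nm c ∣) e))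
  where
  bc = ℕ.m+n≡0⇒m≡0 (∣ Nm b ∣ ℕ.+ ∣ Nm c ∣) e
  vanish : ∀ x → ∣ Nm x ∣ ≡ 0 → x ≡ 0ₒ
  vanish x e = Nm≡0 x (ℤ.∣i∣≡0⇒i≡0 e)

pureSize-δ : ∀ a a′ b c d → pureSize (quat a (δ *ₒ b) (δ *ₒ c) (δ *ₒ d)) ≡ 7 ℕ.* pureSize (quat a′ b c d)
pureSize-δ a a′ b c d = trans (cong₂ ℕ._+_ (cong₂ ℕ._+_ (seven b) (seven c)) (seven d))
  (sym (trans (ℕ.*-distribˡ-+ 7 (∣ Nm b ∣ ℕ.+ ∣ Nm c ∣) ∣ Nm d ∣) (cong (ℕ._+ 7 ℕ.* ∣ Nm d ∣) (ℕ.*-distribˡ-+ 7 ∣ Nm b ∣ ∣ Nm c ∣))))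
  where
  seven : ∀ x → ∣ Nm (δ *ₒ x) ∣ ≡ 7 ℕ.* ∣ Nm x ∣
  seven x = trans (cong ∣_∣ (trans (Nm-* δ x) (cong (_* Nm x) Nm-δ))) (ℤ.abs-* (+ 7) (Nm x))

Valuation : ℍ → Set
Valuation x = ∃ λ m → ∃₂ λ l k → x ≡ shifted l m k × ¬ ScalarModδ k

valuation : ∀ x → Acc ℕ._<_ (pureSize x) → pureSize x ≢ 0 → Valuation x
valuation x (acc rec) x≢ with scalar-mod-δ? x
... | no s = 0 , 0ₒ , x , sym (trans (0-⊹ (1ₒ • x)) (1-• x)) , s
valuation (quat a _ _ _) (acc rec) x≢ | yes ((b , refl) , (c , refl) , (d , refl)) = extend (valuation y (rec smaller) y≢)
  where
  y = quat 0ₒ b c d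
  size≡ = pureSize-δ a 0ₒ b c d
  y≢ : pureSize y ≢ 0
  y≢ e = x≢ (trans size≡ (cong (7 ℕ.*_) e))
  smaller : pureSize y ℕ.< pureSize (quat a (δ *ₒ b) (δ *ₒ c) (δ *ₒ d))
  smaller = subst (pureSize y ℕ.<_) (sym size≡) (ℕ.m<m+n (pureSize y) (ℕ.<-≤-trans (ℕ.n≢0⇒n>0 y≢) (ℕ.m≤m+n (pureSize y) (5 ℕ.* pureSize y))))
  extend : Valuation y → Valuation (quat a (δ *ₒ b) (δ *ₒ c) (δ *ₒ d))
  extend (m , l , k , y≡ , s) = suc m , a +ₒ δ *ₒ l , k , (begin
    quat a (δ *ₒ b) (δ *ₒ c) (δ *ₒ d)                     ≡⟨ quat-≡ (z₁ δ a) (z₂ δ b) (z₂ δ c) (z₂ δ d) ⟩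
    embed a ⊹ δ • y                                       ≡⟨ cong (λ t → embed a ⊹ δ • t) y≡ ⟩
    embed a ⊹ δ • (embed l ⊹ power m • k)                 ≡⟨ cong (embed a ⊹_) (trans (•-⊹ δ (embed l) (power m • k)) (cong (δ • embed l ⊹_) (•-• δ (power m) k))) ⟩
    embed a ⊹ (δ • embed l ⊹ power (suc m) • k)           ≡⟨ sym (⊹-assoc (embed a) (δ • embed l) (power (suc m) • k)) ⟩
    embed a ⊹ δ • embed l ⊹ power (suc m) • k             ≡⟨ cong (_⊹ power (suc m) • k) (quat-≡ refl (z₃ δ) (z₃ δ) (z₃ δ)) ⟩
    embed (a +ₒ δ *ₒ l) ⊹ power (suc m) • k               ∎) , s
    where
    open ≡-Reasoning
    z₁ : ∀ d a → a ≡ a +ₒ d *ₒ 0ₒ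
    z₁ = SO.solve 2 (λ d a → a SO.⊜ a SO.⊞ d SO.⊠ SO.Κ (+ 0)) refl
    z₂ : ∀ d b → d *ₒ b ≡ 0ₒ +ₒ d *ₒ b
    z₂ = SO.solve 2 (λ d b → d SO.⊠ b SO.⊜ SO.Κ (+ 0) SO.⊞ d SO.⊠ b) refl
    z₃ : ∀ d → 0ₒ +ₒ d *ₒ 0ₒ ≡ 0ₒ
    z₃ = SO.solve 1 (λ d → SO.Κ (+ 0) SO.⊞ d SO.⊠ SO.Κ (+ 0) SO.⊜ SO.Κ (+ 0)) refl

scalar-mod-δ⇒all-colours : ∀ {h} → ScalarModδ h → pureSize h ≢ 0 → colour h ≢ none → ¬ (δ ∣ₒ norm h) → AllColours (norm h)
scalar-mod-δ⇒all-colours {h} s h≢0 h≢ δ∤N with valuation h (<-wellFounded (pureSize h)) h≢0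
... | zero , l , k , refl , k-mixed = ⊥-elim (k-mixed (shift-mixed l k s))
... | suc m , l , k , refl , k-mixed = near-scalar m {l} {k} k-mixed h≢ δ∤N

ScalarTimesUnit : ℍ → Set
ScalarTimesUnit h = ∃₂ λ l u → normᶻ u ≡ + 1 × h ≡ embed l ⋆ ι u

·-c₀ : ∀ x → x · c₀ ≡ x
·-c₀ none = refl
·-c₀ c₀ = refl
·-c₀ c₁ = refl
·-c₀ c₂ = refl

recolour : ∀ h → colour h ≢ none → ¬ (δ ∣ₒ norm h) → ScalarTimesUnit h ⊎ AllColours (norm h)
recolour h h≢ δ∤N with classify h h≢ δ∤N
... | mixed all = inj₂ all
... | scalar s = decide (pureSize h ℕ.≟ 0)
  where
  decide : Dec (pureSize h ≡ 0) → ScalarTimesUnit h ⊎ AllColours (norm h)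
  decide (no h≢0) = inj₂ (scalar-mod-δ⇒all-colours s h≢0 h≢ δ∤N)
  decide (yes h≡0) with pureSize≡0 h h≡0
  ... | l , refl = inj₁ (l , 1ℍᶻ , refl , sym (⋆-1 (embed l)))
-- h ū has the norm of h and is scalar modulo δ, so the scalar case applies to it; `AllColours`
-- depends on the norm alone.
... | unit u u-norm u-colour s _ = decide (pureSize h′ ℕ.≟ 0)
  where
  h′ = h ⋆ conj (ι u)
  ι-norm : norm (ι u) ≡ 1ₒ
  ι-norm = trans (norm-ι u) (cong int u-norm)
  norm≡ : norm h′ ≡ norm h
  norm≡ = trans (norm-⋆ h (conj (ι u))) (trans (cong (norm h *ₒ_) (trans (norm-conj (ι u)) ι-norm)) (*ₒ-identityʳ (norm h)))
  h′≢ : colour h′ ≢ none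
  h′≢ e = h≢ (trans (sym (·-c₀ (colour h))) (trans (cong (colour h ·_) (sym u-colour)) (trans (sym (colour-⋆ h (conj (ι u)))) e)))
  restore : h′ ⋆ ι u ≡ h
  restore = trans (⋆-assoc h (conj (ι u)) (ι u)) (trans (cong (h ⋆_) (trans (conj-⋆-self (ι u)) (cong embed ι-norm))) (⋆-1 h))
  decide : Dec (pureSize h′ ≡ 0) → ScalarTimesUnit h ⊎ AllColours (norm h)
  decide (no h′≢0) = inj₂ (subst AllColours norm≡ (scalar-mod-δ⇒all-colours s h′≢0 h′≢ (subst (λ n → ¬ (δ ∣ₒ n)) (sym norm≡) δ∤N)))
  decide (yes h′≡0) with pureSize≡0 h′ h′≡0
  ... | l , e = inj₁ (l , u , u-norm , trans (sym restore) (cong (_⋆ ι u) e))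

-- Totally nonnegative elements of trace at most 7.

data Small (m : O) : Set where
  square  : ∀ ε η → ε *ₒ η ≡ 1ₒ → m ≡ ε *ₒ ε → Small m
  two     : m ≡ 2ₒ → Small m
  δ-times : ∀ ε η → ε *ₒ η ≡ 1ₒ → m ≡ δ *ₒ (ε *ₒ ε) → Small m

-- Seven squares of units, of traces 3, 5, 5, 5, 6, 6, 6; then 2, of trace 6; then δ and its two
-- conjugates, of trace 7.
smallElements : List O
smallElements = ⟨ + 1 , + 0 , + 0 ⟩ ∷ ⟨ + 0 , + 0 , + 1 ⟩ ∷ ⟨ + 2 , + 1 , + 0 ⟩ ∷ ⟨ + 3 , - + 1 , - + 1 ⟩ ∷ ⟨ + 0 , - + 1 , + 1 ⟩ ∷
  ⟨ + 1 , + 2 , + 1 ⟩ ∷ ⟨ + 5 , - + 1 , - + 2 ⟩ ∷ ⟨ + 2 , + 0 , + 0 ⟩ ∷ ⟨ + 2 , - + 1 , + 0 ⟩ ∷ ⟨ + 4 , + 0 , - + 1 ⟩ ∷ ⟨ + 1 , + 1 , + 1 ⟩ ∷ []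

opaque
  unfolding _+ₒ_

  smallElements-small : All Small smallElements
  smallElements-small =
    square ⟨ + 1 , + 0 , + 0 ⟩ ⟨ + 1 , + 0 , + 0 ⟩ refl refl ∷
    square ⟨ + 0 , - + 1 , + 0 ⟩ ⟨ + 2 , - + 1 , - + 1 ⟩ refl refl ∷
    square ⟨ - + 1 , + 1 , + 1 ⟩ ⟨ - + 1 , + 0 , + 1 ⟩ refl refl ∷
    square ⟨ - + 2 , + 0 , + 1 ⟩ ⟨ - + 1 , - + 1 , + 0 ⟩ refl refl ∷
    square ⟨ - + 1 , + 0 , + 1 ⟩ ⟨ - + 1 , + 1 , + 1 ⟩ refl refl ∷
    square ⟨ - + 1 , - + 1 , + 0 ⟩ ⟨ - + 2 , + 0 , + 1 ⟩ refl refl ∷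
    square ⟨ - + 2 , + 1 , + 1 ⟩ ⟨ + 0 , + 1 , + 0 ⟩ refl refl ∷
    two refl ∷
    δ-times ⟨ + 1 , + 0 , + 0 ⟩ ⟨ + 1 , + 0 , + 0 ⟩ refl refl ∷
    δ-times ⟨ - + 1 , + 1 , + 1 ⟩ ⟨ - + 1 , + 0 , + 1 ⟩ refl refl ∷
    δ-times ⟨ - + 1 , - + 1 , + 0 ⟩ ⟨ - + 2 , + 0 , + 1 ⟩ refl refl ∷ []

  -- The values of the trace form at six units suffice to cut out the list.
  trace-functionals : ∀ a b c → let m = ⟨ a , b , c ⟩ ; f = λ y → Tr (m *ₒ (y *ₒ y)) in
    Tr m ≡ + 3 * a - b + + 5 * c ×
    f ⟨ + 0 , + 1 , + 0 ⟩ ≡ + 5 * a - + 4 * b + + 13 * c × f ⟨ - + 2 , + 0 , + 1 ⟩ ≡ + 5 * a - + 4 * b + + 6 * c ×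
    f ⟨ + 1 , - + 1 , - + 1 ⟩ ≡ + 5 * a + + 3 * b + + 6 * c × f ⟨ + 0 , - + 1 , + 1 ⟩ ≡ + 26 * a - + 46 * b + + 83 * c ×
    f ⟨ + 0 , - + 2 , - + 1 ⟩ ≡ + 17 * a + + 20 * b + + 26 * c × f ⟨ - + 4 , + 1 , + 2 ⟩ ≡ + 17 * a - + 8 * b + + 5 * c
  trace-functionals a b c = refl ,
    S.solve 3 (λ a b c → f a b c (+ 0) (+ 1) (+ 0) S.⊜ K (+ 5) S.⊠ a S.⊟ K (+ 4) S.⊠ b S.⊞ K (+ 13) S.⊠ c) refl a b c ,
    S.solve 3 (λ a b c → f a b c (- + 2) (+ 0) (+ 1) S.⊜ K (+ 5) S.⊠ a S.⊟ K (+ 4) S.⊠ b S.⊞ K (+ 6) S.⊠ c) refl a b c ,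
    S.solve 3 (λ a b c → f a b c (+ 1) (- + 1) (- + 1) S.⊜ K (+ 5) S.⊠ a S.⊞ K (+ 3) S.⊠ b S.⊞ K (+ 6) S.⊠ c) refl a b c ,
    S.solve 3 (λ a b c → f a b c (+ 0) (- + 1) (+ 1) S.⊜ K (+ 26) S.⊠ a S.⊟ K (+ 46) S.⊠ b S.⊞ K (+ 83) S.⊠ c) refl a b c ,
    S.solve 3 (λ a b c → f a b c (+ 0) (- + 2) (- + 1) S.⊜ K (+ 17) S.⊠ a S.⊞ K (+ 20) S.⊠ b S.⊞ K (+ 26) S.⊠ c) refl a b c ,
    S.solve 3 (λ a b c → f a b c (- + 4) (+ 1) (+ 2) S.⊜ K (+ 17) S.⊠ a S.⊟ K (+ 8) S.⊠ b S.⊞ K (+ 5) S.⊠ c) refl a b c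
    where
    K : ∀ {n} → ℤ → S.Expr ℤ n
    K = S.Κ
    f : ∀ {n} (a b c : S.Expr ℤ n) → ℤ → ℤ → ℤ → S.Expr ℤ n
    f a b c p q r = let y = triple (K p) (K q) (K r) in P.traceForm (P.mul (triple a b c) (P.mul y y))

nonneg? : ℤ → Bool
nonneg? (+ _) = true
nonneg? -[1+ _ ] = false

nonneg?-complete : ∀ {a} → + 0 ≤ a → nonneg? a ≡ true
nonneg?-complete {+ _} _ = refl

any-false : ∀ {A : Set} (f : A → Bool) xs → any f xs ≡ false → All (λ x → f x ≡ false) xs
any-false f [] _ = []
any-false f (x ∷ xs) e with f x in eq
... | false = eq ∷ any-false f xs e

apart : ∀ M → All (λ m → any (λ m′ → does ((m +ₒ m′) ≟ₒ δ)) M ≡ false) M → ∀ x y →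
  any (λ m → does (m ≟ₒ x)) M ≡ true → any (λ m → does (m ≟ₒ y)) M ≡ true → x +ₒ y ≢ δ
apart M Ms x y p q with any-sound (λ m → does (m ≟ₒ x)) Ms p
... | m , alone , m≡ with any-sound (λ m → does (m ≟ₒ y)) (any-false (λ m′ → does ((m +ₒ m′) ≟ₒ δ)) M alone) q
...   | m′ , sum≢ , m′≡ = λ sum≡ → contradiction (trans (sym sum≢) (does-complete ((m +ₒ m′) ≟ₒ δ)
      (trans (cong₂ _+ₒ_ (does-sound (m ≟ₒ x) m≡) (does-sound (m′ ≟ₒ y) m′≡)) sum≡))) λ ()

opaque
  unfolding _+ₒ_

  feasible : ℤ → ℤ → ℤ → Bool
  feasible a b c = let T = + 3 * a - b + + 5 * c in
    nonneg? (T - + 1) ∧ (nonneg? (+ 7 - T) ∧ (nonneg? (+ 5 * a - + 4 * b + + 13 * c) ∧ (nonneg? (+ 5 * a - + 4 * b + + 6 * c) ∧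
    (nonneg? (+ 5 * a + + 3 * b + + 6 * c) ∧ (nonneg? (+ 26 * a - + 46 * b + + 83 * c) ∧ (nonneg? (+ 17 * a + + 20 * b + + 26 * c) ∧ nonneg? (+ 17 * a - + 8 * b + + 5 * c)))))))

  feasible-complete : ∀ a b c → let T = + 3 * a - b + + 5 * c in
    + 0 ≤ T - + 1 → + 0 ≤ + 7 - T → + 0 ≤ + 5 * a - + 4 * b + + 13 * c → + 0 ≤ + 5 * a - + 4 * b + + 6 * c → + 0 ≤ + 5 * a + + 3 * b + + 6 * c →
    + 0 ≤ + 26 * a - + 46 * b + + 83 * c → + 0 ≤ + 17 * a + + 20 * b + + 26 * c → + 0 ≤ + 17 * a - + 8 * b + + 5 * c → feasible a b c ≡ true
  feasible-complete a b c p₁ p₂ p₃ p₄ p₅ p₆ p₇ p₈ = cong₂ _∧_ (nonneg?-complete p₁) (cong₂ _∧_ (nonneg?-complete p₂) (cong₂ _∧_ (nonneg?-complete p₃)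
    (cong₂ _∧_ (nonneg?-complete p₄) (cong₂ _∧_ (nonneg?-complete p₅) (cong₂ _∧_ (nonneg?-complete p₆) (cong₂ _∧_ (nonneg?-complete p₇) (nonneg?-complete p₈)))))))

  listed : ℤ → ℤ → ℤ → Bool
  listed a b c = any (λ m → does (m ≟ₒ ⟨ a , b , c ⟩)) smallElements

  listed-sound : ∀ a b c → listed a b c ≡ true → Small ⟨ a , b , c ⟩
  listed-sound a b c e with any-sound (λ m → does (m ≟ₒ ⟨ a , b , c ⟩)) smallElements-small e
  ... | m , small , eq = subst Small (does-sound (m ≟ₒ ⟨ a , b , c ⟩) eq) small

  no-sum-δ : ∀ a b c d e f → listed a b c ≡ true → listed d e f ≡ true → ⟨ a , b , c ⟩ +ₒ ⟨ d , e , f ⟩ ≢ δ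
  no-sum-δ a b c d e f = apart smallElements (refl ∷ refl ∷ refl ∷ refl ∷ refl ∷ refl ∷ refl ∷ refl ∷ refl ∷ refl ∷ refl ∷ []) ⟨ a , b , c ⟩ ⟨ d , e , f ⟩

  feasible⇒listed : ℤ → ℤ → ℤ → Bool
  feasible⇒listed a b c = not (feasible (a - + 6) (b - + 5) (c - + 5)) ∨ listed (a - + 6) (b - + 5) (c - + 5)

  feasible⇒listed-sound : ∀ a b c → feasible⇒listed a b c ≡ true → feasible (a - + 6) (b - + 5) (c - + 5) ≡ true → listed (a - + 6) (b - + 5) (c - + 5) ≡ true
  feasible⇒listed-sound a b c = modus-ponens

  -- The coordinates range over -6 ... 9, -5 ... 5 and -5 ... 5, shifted here to start at 0.
  box : below 16 (λ a → below 11 λ b → below 11 (feasible⇒listed a b)) ≡ true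
  box = refl

in-range : ∀ {a} k n → + 0 ≤ a + k → + 0 ≤ + n - (a + k) → ∃ λ i → i ℕ.< suc n × a ≡ + i - k
in-range {a} k n p q = i , s≤s (drop (subst (_≤ + n) (sym i≡) (0≤-⇒≤ q))) , trans (lemma a k) (cong (_- k) (sym i≡))
  where
  i = ∣ a + k ∣
  i≡ : + i ≡ a + k
  i≡ = ℤ.0≤i⇒+∣i∣≡i p
  drop : ∀ {m n} → + m ≤ + n → m ℕ.≤ n
  drop (+≤+ p) = p
  lemma : ∀ a k → a ≡ a + k - k
  lemma = solve-∀

isListed : O → Set
isListed ⟨ a , b , c ⟩ = listed a b c ≡ true

isListed-small : ∀ m → isListed m → Small m
isListed-small ⟨ a , b , c ⟩ = listed-sound a b c

small-listed : ∀ {m} → + 0 < Tr m → Tr m ≤ + 7 → (∀ y → + 0 ≤ Tr (m *ₒ (y *ₒ y))) → isListed m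
small-listed {m@(⟨ a , b , c ⟩)} 0<T T≤7 nonneg with trace-functionals a b c
... | T≡ , e₁ , e₂ , e₃ , e₄ , e₅ , e₆ = locate (in-range (+ 6) 15 a≥ a≤) (in-range (+ 5) 10 b≥ b≤) (in-range (+ 5) 10 c≥ c≤)
  where
  at : ∀ {y t} → Tr (m *ₒ (y *ₒ y)) ≡ t → + 0 ≤ t
  at {y} e = subst (+ 0 ≤_) e (nonneg y)
  p₁ : + 0 ≤ + 3 * a - b + + 5 * c - + 1
  p₁ = subst (λ T → + 0 ≤ T - + 1) T≡ (≤⇒0≤- (ℤ.i<j⇒suc[i]≤j 0<T))
  p₂ : + 0 ≤ + 7 - (+ 3 * a - b + + 5 * c)
  p₂ = subst (λ T → + 0 ≤ + 7 - T) T≡ (≤⇒0≤- T≤7)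
  p₃ = at e₁
  p₄ = at e₂
  p₅ = at e₃
  scaled : ∀ {x} n s → .{{_ : ℕ.NonZero n}} → + 0 ≤ s → s ≡ + n * x → + 0 ≤ x
  scaled (suc n) s p e = 0≤*-cancel {+ suc n} (+<+ (s≤s z≤n)) (subst (+ 0 ≤_) e p)
  -- Each of the six bounds is 1/7 of a nonnegative combination of 7 - Tr m and the values of the
  -- form at the three conjugates of θ.
  c≥ : + 0 ≤ c + + 5
  c≥ = scaled 7 _ (0≤+ (0≤+ p₃ (0≤* {+ 5} (+≤+ z≤n) p₂)) (0≤+ p₃ p₅)) (lemma a b c)
    where
    lemma : ∀ a b c → (+ 5 * a - + 4 * b + + 13 * c) + + 5 * (+ 7 - (+ 3 * a - b + + 5 * c)) + ((+ 5 * a - + 4 * b + + 13 * c) + (+ 5 * a + + 3 * b + + 6 * c)) ≡ + 7 * (c + + 5)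
    lemma = solve-∀
  c≤ : + 0 ≤ + 10 - (c + + 5)
  c≤ = scaled 7 _ (0≤+ (0≤+ p₄ (0≤* {+ 5} (+≤+ z≤n) p₂)) (0≤+ p₄ p₅)) (lemma a b c)
    where
    lemma : ∀ a b c → (+ 5 * a - + 4 * b + + 6 * c) + + 5 * (+ 7 - (+ 3 * a - b + + 5 * c)) + ((+ 5 * a - + 4 * b + + 6 * c) + (+ 5 * a + + 3 * b + + 6 * c)) ≡ + 7 * (+ 10 - (c + + 5))
    lemma = solve-∀
  b≥ : + 0 ≤ b + + 5
  b≥ = scaled 7 _ (0≤+ (0≤+ p₃ (0≤* {+ 5} (+≤+ z≤n) p₂)) (0≤+ p₅ p₅)) (lemma a b c)
    where
    lemma : ∀ a b c → (+ 5 * a - + 4 * b + + 13 * c) + + 5 * (+ 7 - (+ 3 * a - b + + 5 * c)) + ((+ 5 * a + + 3 * b + + 6 * c) + (+ 5 * a + + 3 * b + + 6 * c)) ≡ + 7 * (b + + 5)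
    lemma = solve-∀
  b≤ : + 0 ≤ + 10 - (b + + 5)
  b≤ = scaled 7 _ (0≤+ (0≤+ p₃ (0≤* {+ 5} (+≤+ z≤n) p₂)) (0≤+ p₄ p₄)) (lemma a b c)
    where
    lemma : ∀ a b c → (+ 5 * a - + 4 * b + + 13 * c) + + 5 * (+ 7 - (+ 3 * a - b + + 5 * c)) + ((+ 5 * a - + 4 * b + + 6 * c) + (+ 5 * a - + 4 * b + + 6 * c)) ≡ + 7 * (+ 10 - (b + + 5))
    lemma = solve-∀
  a≥ : + 0 ≤ a + + 6
  a≥ = scaled 7 _ (0≤+ (0≤+ (0≤* {+ 6} (+≤+ z≤n) p₂) (0≤* {+ 3} (+≤+ z≤n) p₄)) (0≤+ p₅ p₅)) (lemma a b c)
    where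
    lemma : ∀ a b c → + 6 * (+ 7 - (+ 3 * a - b + + 5 * c)) + + 3 * (+ 5 * a - + 4 * b + + 6 * c) + ((+ 5 * a + + 3 * b + + 6 * c) + (+ 5 * a + + 3 * b + + 6 * c)) ≡ + 7 * (a + + 6)
    lemma = solve-∀
  a≤ : + 0 ≤ + 15 - (a + + 6)
  a≤ = scaled 7 _ (0≤+ (0≤+ (0≤* {+ 9} (+≤+ z≤n) p₂) (0≤* {+ 3} (+≤+ z≤n) p₃)) p₅) (lemma a b c)
    where
    lemma : ∀ a b c → + 9 * (+ 7 - (+ 3 * a - b + + 5 * c)) + + 3 * (+ 5 * a - + 4 * b + + 13 * c) + (+ 5 * a + + 3 * b + + 6 * c) ≡ + 7 * (+ 15 - (a + + 6))
    lemma = solve-∀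
  locate : (∃ λ i → i ℕ.< 16 × a ≡ + i - + 6) → (∃ λ i → i ℕ.< 11 × b ≡ + i - + 5) → (∃ λ i → i ℕ.< 11 × c ≡ + i - + 5) → isListed ⟨ a , b , c ⟩
  locate (i , i< , refl) (j , j< , refl) (k , k< , refl) = feasible⇒listed-sound (+ i) (+ j) (+ k)
    (below-sound (feasible⇒listed (+ i) (+ j)) (below-sound (λ b → below 11 (feasible⇒listed (+ i) b)) (below-sound (λ a → below 11 λ b → below 11 (feasible⇒listed a b)) box i<) j<) k<)
    (feasible-complete a b c p₁ p₂ p₃ p₄ p₅ (at e₄) (at e₅) (at e₆))

-- From a small multiple of α to an element of norm α.

record NormFrom (α : O) : Set where
  field
    h z : ℍ
    a b : ℤ
    norm≡ : norm h ≡ α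
    -- 14 = 2 · 7 is divisible by every m that can be split off. The equation makes h a right
    -- divisor of 14 s, whose coefficient at j is 14.
    z⋆h≡ : z ⋆ h ≡ int (+ 14) • ι (quat a b (+ 1) (+ 0))

module _ {α : O} (α≢0 : α ≢ 0ₒ) where

  -- Multiplying s v̄ = α x by v on the right and cancelling α gives m s = x w h; the factor m′
  -- completes m to 14.
  cofactor : ∀ {w h v m m′ s x} → v ≡ w ⋆ h → norm w ≡ m → norm v ≡ α *ₒ m → m *ₒ m′ ≡ int (+ 14) → s ⋆ conj v ≡ α • x →
    norm h ≡ α × (m′ • (x ⋆ w)) ⋆ h ≡ int (+ 14) • s
  cofactor {w} {h} {v} {m} {m′} {s} {x} refl refl v-norm mm′ sv̄ = norm-h , (begin
    (m′ • (x ⋆ w)) ⋆ h            ≡⟨ •-⋆ m′ (x ⋆ w) h ⟩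
    m′ • (x ⋆ w ⋆ h)              ≡⟨ cong (m′ •_) (sym ms≡) ⟩
    m′ • (m • s)                  ≡⟨ trans (•-• m′ m s) (cong (_• s) (trans (*ₒ-comm m′ m) mm′)) ⟩
    int (+ 14) • s                ∎)
    where
    open ≡-Reasoning
    m≢0 : m ≢ 0ₒ
    m≢0 e = int≢0 {+ 14} (λ ()) (trans (sym mm′) (trans (cong (_*ₒ m′) e) (trans (*ₒ-comm 0ₒ m′) (*ₒ-zeroʳ m′))))
    norm-h : norm h ≡ α
    norm-h = *ₒ-cancelˡ m≢0 (trans (sym (norm-⋆ w h)) (trans v-norm (*ₒ-comm α m)))
    ms≡ : m • s ≡ x ⋆ w ⋆ h
    ms≡ = •-cancel α≢0 (begin
      α • (m • s)                               ≡⟨ trans (•-• α m s) (sym (⋆-embed (α *ₒ m) s)) ⟩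
      s ⋆ embed (α *ₒ m)                        ≡⟨ cong (s ⋆_) (trans (cong embed (sym v-norm)) (sym (conj-⋆-self (w ⋆ h)))) ⟩
      s ⋆ (conj (w ⋆ h) ⋆ (w ⋆ h))              ≡⟨ sym (⋆-assoc s (conj (w ⋆ h)) (w ⋆ h)) ⟩
      s ⋆ conj (w ⋆ h) ⋆ (w ⋆ h)                ≡⟨ trans (cong (_⋆ (w ⋆ h)) sv̄) (•-⋆ α x (w ⋆ h)) ⟩
      α • (x ⋆ (w ⋆ h))                         ≡⟨ cong (α •_) (sym (⋆-assoc x w h)) ⟩
      α • (x ⋆ w ⋆ h)                           ∎)

norm-embed : ∀ s → norm (embed s) ≡ s *ₒ s
norm-embed = SO.solve 1 (λ s → QP.norm (quat s (SO.Κ (+ 0)) (SO.Κ (+ 0)) (SO.Κ (+ 0))) SO.⊜ s SO.⊠ s) refl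

unit-cancel : ∀ {ε η} → ε *ₒ η ≡ 1ₒ → ∀ v → ε • (η • v) ≡ v
unit-cancel {ε} {η} e v = trans (•-• ε η v) (trans (cong (_• v) e) (1-• v))

norm-from : ∀ {α} → Pos α → (∃ λ k → Nm α ≡ + 1 + + 2 * k) → NormFrom α
norm-from {α} pos odd = convert (small-multiple pos odd)
  where
  convert : SmallMultiple α → NormFrom α
  convert sm = build (isListed-small m (small-listed 0<Tr Tr≤7 nonneg))
    where
    open SmallMultiple sm
    from : ∀ {u h m′} → v ≡ u ⋆ h → norm u ≡ m → m *ₒ m′ ≡ int (+ 14) → NormFrom α
    from {u} {h} {m′} v≡ u-norm mm′ with cofactor (Pos⇒≢0 pos) v≡ u-norm norm≡ mm′ s-conj≡
    ... | h-norm , z≡ = record { h = h ; z = m′ • (w ⋆ u) ; a = a ; b = b ; norm≡ = h-norm ; z⋆h≡ = z≡ }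
    units-cancel : ∀ {ε η} t → ε *ₒ η ≡ 1ₒ → t *ₒ (ε *ₒ ε) *ₒ (η *ₒ η) ≡ t
    units-cancel {ε} {η} t e = trans (lemma t ε η) (trans (cong (λ u → t *ₒ (u *ₒ u)) e) (lemma′ t))
      where
      lemma : ∀ t x y → t *ₒ (x *ₒ x) *ₒ (y *ₒ y) ≡ t *ₒ (x *ₒ y *ₒ (x *ₒ y))
      lemma = SO.solve 3 (λ t x y → t SO.⊠ (x SO.⊠ x) SO.⊠ (y SO.⊠ y) SO.⊜ t SO.⊠ (x SO.⊠ y SO.⊠ (x SO.⊠ y))) refl
      lemma′ : ∀ t → t *ₒ (1ₒ *ₒ 1ₒ) ≡ t
      lemma′ = SO.solve 1 (λ t → t SO.⊠ (SO.Κ (+ 1) SO.⊠ SO.Κ (+ 1)) SO.⊜ t) refl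
    build : Small m → NormFrom α
    build (square ε η εη m≡) = from {embed ε} {η • v} {η *ₒ η *ₒ int (+ 14)}
      (sym (trans (embed-⋆ ε (η • v)) (unit-cancel εη v))) (trans (norm-embed ε) (sym m≡))
      (trans (cong (_*ₒ (η *ₒ η *ₒ int (+ 14))) m≡) (trans (lemma ε η (int (+ 14))) (units-cancel (int (+ 14)) εη)))
      where
      lemma : ∀ x y t → x *ₒ x *ₒ (y *ₒ y *ₒ t) ≡ t *ₒ (x *ₒ x) *ₒ (y *ₒ y)
      lemma = SO.solve 3 (λ x y t → x SO.⊠ x SO.⊠ (y SO.⊠ y SO.⊠ t) SO.⊜ t SO.⊠ (x SO.⊠ x) SO.⊠ (y SO.⊠ y)) refl
    build (two m≡) with even-norm-divisible {α} v (trans norm≡ (trans (cong (α *ₒ_) m≡) (*ₒ-comm α 2ₒ)))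
    ... | h , v≡ = from {1+i} {h} {int (+ 7)} v≡ (trans norm-1+i (sym m≡)) (trans (cong (_*ₒ int (+ 7)) m≡) (sym (int-* (+ 2) (+ 7))))
    -- Dividing v by the unit ε first makes the norm exactly δ α, so that a left factor of norm δ
    -- can be split off.
    build (δ-times ε η εη m≡) with δ-divisible {η • v} (α , trans (norm-• η v) (trans (cong (η *ₒ η *ₒ_) (trans norm≡ (cong (α *ₒ_) m≡)))
        (trans (lemma α δ ε η) (units-cancel (δ *ₒ α) εη))))
      where
      lemma : ∀ α d x y → y *ₒ y *ₒ (α *ₒ (d *ₒ (x *ₒ x))) ≡ d *ₒ α *ₒ (x *ₒ x) *ₒ (y *ₒ y)
      lemma = SO.solve 4 (λ α d x y → y SO.⊠ y SO.⊠ (α SO.⊠ (d SO.⊠ (x SO.⊠ x))) SO.⊜ d SO.⊠ α SO.⊠ (x SO.⊠ x) SO.⊠ (y SO.⊠ y)) refl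
    ... | g , h , g-norm , ηv≡ = from {ε • g} {h} {η *ₒ η *ₒ adj δ *ₒ 2ₒ}
      (trans (sym (unit-cancel εη v)) (trans (cong (ε •_) ηv≡) (sym (•-⋆ ε g h))))
      (trans (norm-• ε g) (trans (cong (ε *ₒ ε *ₒ_) g-norm) (trans (*ₒ-comm (ε *ₒ ε) δ) (sym m≡))))
      (trans (cong (_*ₒ (η *ₒ η *ₒ adj δ *ₒ 2ₒ)) m≡) (trans (lemma δ ε η (adj δ) 2ₒ) (trans (units-cancel (δ *ₒ adj δ *ₒ 2ₒ) εη)
        (trans (cong (_*ₒ 2ₒ) (trans (*ₒ-adj δ) (cong int Nm-δ))) (sym (int-* (+ 7) (+ 2)))))))
      where
      lemma : ∀ d x y d′ t → d *ₒ (x *ₒ x) *ₒ (y *ₒ y *ₒ d′ *ₒ t) ≡ d *ₒ d′ *ₒ t *ₒ (x *ₒ x) *ₒ (y *ₒ y)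
      lemma = SO.solve 5 (λ d x y d′ t → d SO.⊠ (x SO.⊠ x) SO.⊠ (y SO.⊠ y SO.⊠ d′ SO.⊠ t) SO.⊜ d SO.⊠ d′ SO.⊠ t SO.⊠ (x SO.⊠ x) SO.⊠ (y SO.⊠ y)) refl

-- 7 is totally ramified: the three conjugates of x are congruent modulo δ, so the norm is the cube
-- of the residue modulo 7.
Nm-residue : ∀ x → ∃ λ k → Nm x ≡ residue x * (residue x * residue x) + + 7 * k
Nm-residue x = q x , identity x
  where
  opaque
    unfolding Nm

    q : O → ℤ
    q ⟨ a , b , c ⟩ = - (a * a * b + a * a * c + + 7 * (a * b * c) + + 6 * (a * c * c) + + 2 * (a * b * b) + + 14 * (b * c * c) + + 9 * (c * c * c) + + 7 * (b * b * c) + b * b * b)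

    identity : ∀ x → Nm x ≡ residue x * (residue x * residue x) + + 7 * q x
    identity ⟨ a , b , c ⟩ = S.solve 3 (λ a b c →
      let K = S.Κ ; r = a S.⊞ K (+ 2) S.⊠ b S.⊞ K (+ 4) S.⊠ c in
      P.cubicNorm (triple a b c) S.⊜ r S.⊠ (r S.⊠ r) S.⊞ K (+ 7) S.⊠ (S.⊝ (a S.⊠ a S.⊠ b S.⊞ a S.⊠ a S.⊠ c S.⊞ K (+ 7) S.⊠ (a S.⊠ b S.⊠ c) S.⊞
        K (+ 6) S.⊠ (a S.⊠ c S.⊠ c) S.⊞ K (+ 2) S.⊠ (a S.⊠ b S.⊠ b) S.⊞ K (+ 14) S.⊠ (b S.⊠ c S.⊠ c) S.⊞ K (+ 9) S.⊠ (c S.⊠ c S.⊠ c) S.⊞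
        K (+ 7) S.⊠ (b S.⊠ b S.⊠ c) S.⊞ b S.⊠ b S.⊠ b))) refl a b c

prime-7 : Prime 7
prime-7 = from-yes (prime? 7)

7∣⇒ : ∀ {n} → 7 ℕ.∣ ∣ n ∣ → ∃ λ k → n ≡ + 7 * k
7∣⇒ {n} d = zero₇-sound n (cong (ℕ._≡ᵇ 0) (ℕ.n∣m⇒m%n≡0 ∣ n ∣ 7 d))

δ∣-from-norm : ∀ x → 7 ℕ.∣ ∣ Nm x ∣ → δ ∣ₒ x
δ∣-from-norm x d = divides (7∣⇒ {Nm x} d) (Nm-residue x)
  where
  r = residue x
  divides : (∃ λ k → Nm x ≡ + 7 * k) → (∃ λ k → Nm x ≡ r * (r * r) + + 7 * k) → δ ∣ₒ x
  divides (k , e) (l , e′) = from-residue (split (euclidsLemma ∣ r ∣ (∣ r ∣ ℕ.* ∣ r ∣) prime-7 cube))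
    where
    r³≡ : r * (r * r) ≡ + 7 * (k - l)
    r³≡ = trans (lemma (r * (r * r)) (+ 7 * l)) (trans (cong (_- + 7 * l) (trans (sym e′) e)) (lemma′ k l))
      where
      lemma : ∀ c s → c ≡ c + s - s
      lemma = solve-∀
      lemma′ : ∀ k l → + 7 * k - + 7 * l ≡ + 7 * (k - l)
      lemma′ = solve-∀
    cube : 7 ℕ.∣ ∣ r ∣ ℕ.* (∣ r ∣ ℕ.* ∣ r ∣)
    cube = ℕ.divides ∣ k - l ∣ (trans (sym (trans (ℤ.abs-* r (r * r)) (cong (∣ r ∣ ℕ.*_) (ℤ.abs-* r r))))
      (trans (cong ∣_∣ r³≡) (trans (ℤ.abs-* (+ 7) (k - l)) (ℕ.*-comm 7 ∣ k - l ∣))))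
    split : 7 ℕ.∣ ∣ r ∣ ⊎ 7 ℕ.∣ ∣ r ∣ ℕ.* ∣ r ∣ → 7 ℕ.∣ ∣ r ∣
    split (inj₁ d) = d
    split (inj₂ d) with euclidsLemma ∣ r ∣ ∣ r ∣ prime-7 d
    ... | inj₁ d = d
    ... | inj₂ d = d
    from-residue : 7 ℕ.∣ ∣ r ∣ → δ ∣ₒ x
    from-residue d = coordinate-sound (decompose x) (zero₇-complete′ {r} (7∣⇒ {r} d))
      where
      decompose : ∀ x → x ≡ int (residue x) +ₒ δ *ₒ ⟨ - O.c₁ x - + 2 * O.c₂ x , - O.c₂ x , + 0 ⟩
      decompose ⟨ a , b , c ⟩ = residue-identity a b c

coprime-prime : ∀ {n p} → Prime p → ¬ p ℕ.∣ n → Coprimality.Coprime n p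
coprime-prime pr p∤n (d∣n , d∣p) with prime⇒irreducible pr d∣p
... | inj₁ d≡1 = d≡1
... | inj₂ refl = ⊥-elim (p∤n d∣n)

-- 2744 = 2³ · 7³ is the norm of 14; the six primes are stripped off one at a time.
odd-coprime-unit : ∀ {n} → ¬ 2 ℕ.∣ n → ¬ 7 ℕ.∣ n → n ℕ.∣ 2744 → n ≡ 1
odd-coprime-unit {n} 2∤ 7∤ d = ℕ.∣1⇒≡1 (c₇ 1 (c₇ 7 (c₇ 49 (c₂′ 343 (c₂′ 686 (c₂′ 1372 d))))))
  where
  c₂′ : ∀ o → n ℕ.∣ 2 ℕ.* o → n ℕ.∣ o
  c₂′ o = Coprimality.coprime-divisor (coprime-prime prime[2] 2∤)
  c₇ : ∀ o → n ℕ.∣ 7 ℕ.* o → n ℕ.∣ o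
  c₇ o = Coprimality.coprime-divisor (coprime-prime prime-7 7∤)

unit-inverse : ∀ l → ∣ Nm l ∣ ≡ 1 → ∃ λ η → l *ₒ η ≡ 1ₒ
unit-inverse l e = int (Nm l) *ₒ adj l , trans (lemma l (int (Nm l)) (adj l)) (trans (cong (_*ₒ int (Nm l)) (*ₒ-adj l)) (trans (sym (int-* (Nm l) (Nm l))) (cong int (sq (Nm l) e))))
  where
  lemma : ∀ l n a → l *ₒ (n *ₒ a) ≡ l *ₒ a *ₒ n
  lemma = SO.solve 3 (λ l n a → l SO.⊠ (n SO.⊠ a) SO.⊜ l SO.⊠ a SO.⊠ n) refl
  sq : ∀ n → ∣ n ∣ ≡ 1 → n * n ≡ + 1
  sq (+ 1) refl = refl
  sq -[1+ 0 ] refl = refl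

OddNorm : O → Set
OddNorm α = ∃ λ k → Nm α ≡ + 1 + + 2 * k

odd-not-even : ∀ {α} → OddNorm α → ¬ (2ₒ ∣ₒ α)
odd-not-even (k , e) (β , refl) = odd≢even {k} {+ 4 * Nm β} (trans (sym e) (trans (Nm-* 2ₒ β) (trans (cong (_* Nm β) (Nm-int (+ 2))) (ℤ.*-assoc (+ 2) (+ 4) (Nm β)))))

odd-factor : ∀ {x y} → OddNorm (x *ₒ y) → OddNorm y
odd-factor {x} {y} odd with even-or-odd-norm y
... | inj₂ o = o
... | inj₁ (z , refl) = ⊥-elim (odd-not-even odd (x *ₒ z , lemma x z))
  where
  lemma : ∀ x z → x *ₒ (2ₒ *ₒ z) ≡ 2ₒ *ₒ (x *ₒ z)
  lemma = SO.solve 2 (λ x z → x SO.⊠ (SO.Κ (+ 2) SO.⊠ z) SO.⊜ SO.Κ (+ 2) SO.⊠ (x SO.⊠ z)) refl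

odd-colour : ∀ {α} h → OddNorm α → norm h ≡ α → colour h ≢ none
odd-colour h odd refl e = odd-not-even odd (colour-none⇒even-norm h e)

four-squares-scale : ∀ {α} s → FourSquares α → FourSquares (α *ₒ (s *ₒ s))
four-squares-scale s (x , y , z , w , refl) = s *ₒ x , s *ₒ y , s *ₒ z , s *ₒ w , lemma s x y z w
  where
  open SO using (_⊞_; _⊠_; _⊜_)
  lemma : ∀ s x y z w → (x *ₒ x +ₒ y *ₒ y +ₒ z *ₒ z +ₒ w *ₒ w) *ₒ (s *ₒ s) ≡ s *ₒ x *ₒ (s *ₒ x) +ₒ s *ₒ y *ₒ (s *ₒ y) +ₒ s *ₒ z *ₒ (s *ₒ z) +ₒ s *ₒ w *ₒ (s *ₒ w)
  lemma = SO.solve 5 (λ s x y z w → (x ⊠ x ⊞ y ⊠ y ⊞ z ⊠ z ⊞ w ⊠ w) ⊠ (s ⊠ s) ⊜ s ⊠ x ⊠ (s ⊠ x) ⊞ s ⊠ y ⊠ (s ⊠ y) ⊞ s ⊠ z ⊠ (s ⊠ z) ⊞ s ⊠ w ⊠ (s ⊠ w)) refl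

four-squares-square : ∀ s → FourSquares (s *ₒ s)
four-squares-square s = s , 0ₒ , 0ₒ , 0ₒ , lemma s
  where
  open SO using (_⊞_; _⊠_; _⊜_; Κ)
  lemma : ∀ s → s *ₒ s ≡ s *ₒ s +ₒ 0ₒ *ₒ 0ₒ +ₒ 0ₒ *ₒ 0ₒ +ₒ 0ₒ *ₒ 0ₒ
  lemma = SO.solve 1 (λ s → s ⊠ s ⊜ s ⊠ s ⊞ Κ (+ 0) ⊠ Κ (+ 0) ⊞ Κ (+ 0) ⊠ Κ (+ 0) ⊞ Κ (+ 0) ⊠ Κ (+ 0)) refl

norm-scalar-unit : ∀ {h l u} → normᶻ u ≡ + 1 → h ≡ embed l ⋆ ι u → norm h ≡ l *ₒ l
norm-scalar-unit {l = l} {u} u-norm refl = trans (norm-⋆ (embed l) (ι u)) (trans (cong₂ _*ₒ_ (norm-embed l) (trans (norm-ι u) (cong int u-norm))) (*ₒ-identityʳ (l *ₒ l)))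

-- Totally positive elements as sums of four squares.

Exceptional : O → Set
Exceptional α = ∃₂ λ l η → l *ₒ η ≡ 1ₒ × α ≡ δ *ₒ (l *ₒ l)

δ∤⇒four-squares : ∀ {α} → Pos α → OddNorm α → ¬ (δ ∣ₒ α) → FourSquares α
δ∤⇒four-squares {α} pos odd δ∤α = from (norm-from pos odd)
  where
  from : NormFrom α → FourSquares α
  from nf = cases (recolour h (odd-colour h odd norm≡) (λ d → δ∤α (subst (δ ∣ₒ_) norm≡ d)))
    where
    open NormFrom nf
    coloured : (∃ λ h′ → norm h′ ≡ norm h × colour h′ ≡ c₀) → FourSquares α
    coloured (h′ , h′-norm , h′-colour) = subst FourSquares (trans h′-norm norm≡) (colour-trivial⇒four-squares h′ h′-colour)
    cases : ScalarTimesUnit h ⊎ AllColours (norm h) → FourSquares α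
    cases (inj₁ (l , u , u-norm , h≡)) = subst FourSquares (trans (sym (norm-scalar-unit u-norm h≡)) norm≡) (four-squares-square l)
    cases (inj₂ all) = coloured (all c₀ (λ ()))

γ : ℍ
γ = quat ⟨ + 0 , + 0 , + 0 ⟩ ⟨ + 0 , + 0 , + 0 ⟩ ⟨ + 1 , + 0 , - + 1 ⟩ ⟨ + 1 , + 0 , + 0 ⟩

γ-data : norm γ ≡ δ × colour γ ≡ c₁
γ-data with G₁-data
... | p ∷ _ = p

-- c₁ · c₂ is trivial, so multiplying by γ, of colour c₁, makes the colour trivial and the norm a
-- sum of four squares.
δ-four-squares : ∀ {α h} → norm h ≡ α → colour h ≡ c₂ → FourSquares (δ *ₒ α)
δ-four-squares {h = h} refl h-colour = subst FourSquares (trans (norm-⋆ γ h) (cong (_*ₒ norm h) (proj₁ γ-data)))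
  (colour-trivial⇒four-squares (γ ⋆ h) (trans (colour-⋆ γ h) (cong₂ _·_ (proj₂ γ-data) h-colour)))

-- The cube of c₁ is trivial, so γ³ has trivial colour although γ has not.
δ³-four-squares : FourSquares (δ *ₒ (δ *ₒ δ))
δ³-four-squares = δ-four-squares {h = γ ⋆ γ} (trans (norm-⋆ γ γ) (cong₂ _*ₒ_ (proj₁ γ-data) (proj₁ γ-data))) (trans (colour-⋆ γ γ) (cong₂ _·_ (proj₂ γ-data) (proj₂ γ-data)))

7∤norm : ∀ {l} → ¬ (δ ∣ₒ l *ₒ l) → ¬ 7 ℕ.∣ ∣ Nm l ∣
7∤norm {l} δ∤ d = δ∤ (square-divisible (δ∣-from-norm l d))
  where
  square-divisible : δ ∣ₒ l → δ ∣ₒ l *ₒ l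
  square-divisible (y , e) = y *ₒ l , trans (cong (_*ₒ l) e) (*ₒ-assoc δ y l)

2∤norm : ∀ {l} → OddNorm l → ¬ 2 ℕ.∣ ∣ Nm l ∣
2∤norm {l} (k , o) (ℕ.divides q e) = contradict (signed (Nm l) e)
  where
  signed : ∀ n → ∣ n ∣ ≡ q ℕ.* 2 → ∃ λ j → n ≡ + 2 * j
  signed (+ n) e = + q , trans (cong +_ e) (trans (ℤ.pos-* q 2) (ℤ.*-comm (+ q) (+ 2)))
  signed -[1+ n ] e = - + q , trans (cong (λ m → - + m) e) (trans (cong -_ (trans (ℤ.pos-* q 2) (ℤ.*-comm (+ q) (+ 2)))) (ℤ.neg-distribʳ-* (+ 2) (+ q)))
  contradict : (∃ λ j → Nm l ≡ + 2 * j) → ⊥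
  contradict (j , n≡) = odd≢even {k} {j} (trans (sym o) n≡)

-- As h = l u, comparing the coefficients of j in z h = 14 s shows that l divides 14, so Nm l
-- divides 14³. Since α = l² is odd and prime to δ, only units l are left.
primitive-scalar⇒unit : ∀ {α} → OddNorm α → ¬ (δ ∣ₒ α) → (nf : NormFrom α) → ∀ {l u} → NormFrom.h nf ≡ embed l ⋆ ι u → normᶻ u ≡ + 1 → ∃ λ η → l *ₒ η ≡ 1ₒ
primitive-scalar⇒unit {α} odd δ∤α nf {l} {u} h≡ u-norm = unit-inverse l (odd-coprime-unit (2∤norm (odd-factor {l} (subst OddNorm α≡ odd))) (7∤norm (subst (λ t → ¬ (δ ∣ₒ t)) α≡ δ∤α)) divides-2744)
  where
  open NormFrom nf
  α≡ : α ≡ l *ₒ l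
  α≡ = trans (sym norm≡) (norm-scalar-unit u-norm h≡)
  coordinate : ∀ s x → Quaternion.jm (s • x) ≡ s *ₒ Quaternion.jm x
  coordinate s (quat _ _ _ _) = refl
  y = z ⋆ ι u
  l∣14 : l *ₒ Quaternion.jm y ≡ int (+ 14)
  l∣14 = trans (sym (coordinate l y)) (trans (cong Quaternion.jm (begin
    l • (z ⋆ ι u)                                  ≡⟨ sym (•-⋆ l z (ι u)) ⟩
    (l • z) ⋆ ι u                                  ≡⟨ cong (_⋆ ι u) (sym (⋆-embed l z)) ⟩
    z ⋆ embed l ⋆ ι u                              ≡⟨ ⋆-assoc z (embed l) (ι u) ⟩
    z ⋆ (embed l ⋆ ι u)                            ≡⟨ trans (cong (z ⋆_) (sym h≡)) z⋆h≡ ⟩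
    int (+ 14) • ι (quat a b (+ 1) (+ 0))          ∎)) (*ₒ-identityʳ (int (+ 14))))
    where open ≡-Reasoning
  divides-2744 : ∣ Nm l ∣ ℕ.∣ 2744
  divides-2744 = ℕ.divides ∣ Nm (Quaternion.jm y) ∣ (trans (cong ∣_∣ (trans (sym (Nm-int (+ 14))) (trans (cong Nm (sym l∣14)) (Nm-* l (Quaternion.jm y)))))
    (trans (ℤ.abs-* (Nm l) (Nm (Quaternion.jm y))) (ℕ.*-comm ∣ Nm l ∣ ∣ Nm (Quaternion.jm y) ∣)))

δ-divides? : ∀ x → Dec (δ ∣ₒ x)
δ-divides? x = decide (residues-≡δ (embed x))
  where
  decide : embed x ≡δ residues (embed x) → Dec (δ ∣ₒ x)
  decide (quat q _ _ _ ,δ e) with zero₇ (residue x) in eq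
  ... | true = yes (coordinate-sound (cong Quaternion.re e) eq)
  ... | false = no λ d → contradiction (trans (sym eq) (coordinate-complete (cong Quaternion.re e) d)) λ ()

-- 4 δ is a sum of squares, so multiplication by δ preserves total positivity.
Pos-δ* : ∀ {α} → Pos α → Pos (δ *ₒ α)
Pos-δ* {α} pos y y≢0 = 0≤∧≢0⇒0< (subst (+ 0 ≤_) len≡ (len-nonneg pos (y • γ)))
    λ e → δ≢0 (trans (sym (proj₁ γ-data)) (trans (cong norm (γ≡0 e)) (trans (norm-embed 0ₒ) (*ₒ-zeroʳ 0ₒ))))
  where
  len≡ : Tr (α *ₒ norm (y • γ)) ≡ Tr (δ *ₒ α *ₒ (y *ₒ y))
  len≡ = cong Tr (trans (cong (α *ₒ_) (trans (norm-• y γ) (cong (y *ₒ y *ₒ_) (proj₁ γ-data)))) (lemma α y δ))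
    where
    lemma : ∀ α y d → α *ₒ (y *ₒ y *ₒ d) ≡ d *ₒ α *ₒ (y *ₒ y)
    lemma = SO.solve 3 (λ α y d → α SO.⊠ (y SO.⊠ y SO.⊠ d) SO.⊜ d SO.⊠ α SO.⊠ (y SO.⊠ y)) refl
  γ≡0 : Tr (δ *ₒ α *ₒ (y *ₒ y)) ≡ + 0 → γ ≡ 0ℍ
  γ≡0 e = •-cancel y≢0 (trans (len≡0 pos (y • γ) (trans len≡ e)) (sym (•-0 y)))

-- Multiplying once more by δ makes the factor a square, and squares can be cancelled.
Pos-δ⁻¹ : ∀ {α} → Pos (δ *ₒ α) → Pos α
Pos-δ⁻¹ {α} pos = Pos-*⁻¹ δ≢0 (subst Pos (lemma δ α) (Pos-δ* pos))
  where
  lemma : ∀ d α → d *ₒ (d *ₒ α) ≡ α *ₒ (d *ₒ d)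
  lemma = SO.solve 2 (λ d α → d SO.⊠ (d SO.⊠ α) SO.⊜ α SO.⊠ (d SO.⊠ d)) refl

-- By the power of δ in α. Without δ, an element of trivial colour is used. With exactly one δ, the
-- cofactor gets colour c₂ unless it is the square of a unit. Otherwise δ² is removed and restored
-- by scaling, and an exceptional quotient is rescued by `δ³-four-squares`.
odd-four-squares : ∀ {α} → Acc ℕ._<_ ∣ Nm α ∣ → Pos α → OddNorm α → Exceptional α ⊎ FourSquares α
odd-four-squares {α} (acc rec) pos odd with δ-divides? α
... | no δ∤α = inj₂ (δ∤⇒four-squares pos odd δ∤α)
... | yes (α′ , refl) = by-quotient (δ-divides? α′)
  where
  pos′ : Pos α′
  pos′ = Pos-δ⁻¹ pos
  odd′ : OddNorm α′
  odd′ = odd-factor {δ} odd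
  from : ¬ (δ ∣ₒ α′) → NormFrom α′ → Exceptional (δ *ₒ α′) ⊎ FourSquares (δ *ₒ α′)
  from δ∤α′ nf = cases (recolour h (odd-colour h odd′ norm≡) (subst (λ n → ¬ (δ ∣ₒ n)) (sym norm≡) δ∤α′))
    where
    open NormFrom nf
    cases : ScalarTimesUnit h ⊎ AllColours (norm h) → Exceptional (δ *ₒ α′) ⊎ FourSquares (δ *ₒ α′)
    exceptional : ∀ {l u} → normᶻ u ≡ + 1 → h ≡ embed l ⋆ ι u → (∃ λ η → l *ₒ η ≡ 1ₒ) → Exceptional (δ *ₒ α′)
    exceptional {l} u-norm h≡ (η , lη) = l , η , lη , cong (δ *ₒ_) (trans (sym norm≡) (norm-scalar-unit u-norm h≡))
    coloured : (∃ λ h′ → norm h′ ≡ norm h × colour h′ ≡ c₂) → FourSquares (δ *ₒ α′)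
    coloured (h′ , h′-norm , h′-colour) = δ-four-squares {h = h′} (trans h′-norm norm≡) h′-colour
    cases (inj₁ (l , u , u-norm , h≡)) = inj₁ (exceptional u-norm h≡ (primitive-scalar⇒unit odd′ δ∤α′ nf h≡ u-norm))
    cases (inj₂ all) = inj₂ (coloured (all c₂ (λ ())))
  by-quotient : Dec (δ ∣ₒ α′) → Exceptional (δ *ₒ α′) ⊎ FourSquares (δ *ₒ α′)
  by-quotient (no δ∤α′) = from δ∤α′ (norm-from pos′ odd′)
  by-quotient (yes (α″ , refl)) = lift (odd-four-squares (rec smaller) pos″ (odd-factor {δ} odd′))
    where
    pos″ : Pos α″
    pos″ = Pos-δ⁻¹ pos′
    n = ∣ Nm α″ ∣
    n>0 : 0 ℕ.< n
    n>0 = ℕ.n≢0⇒n>0 λ e → 0<⇒≢0 (Pos⇒0<Nm pos″) (ℤ.∣i∣≡0⇒i≡0 e)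
    smaller : n ℕ.< ∣ Nm (δ *ₒ (δ *ₒ α″)) ∣
    smaller = subst (n ℕ.<_) (sym (trans (seven (δ *ₒ α″)) (cong (7 ℕ.*_) (seven α″))))
      (ℕ.<-≤-trans (ℕ.m<m+n n (ℕ.<-≤-trans n>0 (ℕ.m≤m+n n (5 ℕ.* n)))) (ℕ.m≤m+n (7 ℕ.* n) (6 ℕ.* (7 ℕ.* n))))
      where
      seven : ∀ x → ∣ Nm (δ *ₒ x) ∣ ≡ 7 ℕ.* ∣ Nm x ∣
      seven x = trans (cong ∣_∣ (trans (Nm-* δ x) (cong (_* Nm x) Nm-δ))) (ℤ.abs-* (+ 7) (Nm x))
    lift : Exceptional α″ ⊎ FourSquares α″ → Exceptional (δ *ₒ (δ *ₒ α″)) ⊎ FourSquares (δ *ₒ (δ *ₒ α″))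
    lift (inj₂ fs) = inj₂ (subst FourSquares (lemma α″ δ) (four-squares-scale δ fs))
      where
      lemma : ∀ α d → α *ₒ (d *ₒ d) ≡ d *ₒ (d *ₒ α)
      lemma = SO.solve 2 (λ α d → α SO.⊠ (d SO.⊠ d) SO.⊜ d SO.⊠ (d SO.⊠ α)) refl
    lift (inj₁ (l , _ , _ , α″≡)) = inj₂ (subst FourSquares (trans (lemma δ l) (cong (λ t → δ *ₒ (δ *ₒ t)) (sym α″≡))) (four-squares-scale l δ³-four-squares))
      where
      lemma : ∀ d l → d *ₒ (d *ₒ d) *ₒ (l *ₒ l) ≡ d *ₒ (d *ₒ (d *ₒ (l *ₒ l)))
      lemma = SO.solve 2 (λ d l → d SO.⊠ (d SO.⊠ d) SO.⊠ (l SO.⊠ l) SO.⊜ d SO.⊠ (d SO.⊠ (d SO.⊠ (l SO.⊠ l)))) refl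

Pos-halve : ∀ {β} → Pos (2ₒ *ₒ β) → Pos β
Pos-halve {β} pos y y≢0 = 0<*-cancel {+ 2} (+<+ (s≤s z≤n)) (subst (+ 0 <_) (trans (cong Tr (*ₒ-assoc 2ₒ β (y *ₒ y))) (Tr-int (+ 2) (β *ₒ (y *ₒ y)))) (pos y y≢0))

-- Factors 2 = N(1 + i) are removed until the norm is odd.
every-Pos-is-norm : ∀ {α} → Acc ℕ._<_ ∣ Nm α ∣ → Pos α → ∃ λ h → norm h ≡ α
every-Pos-is-norm {α} (acc rec) pos with even-or-odd-norm α
... | inj₂ odd = forget (norm-from pos odd)
  where
  forget : NormFrom α → ∃ λ h → norm h ≡ α
  forget nf = NormFrom.h nf , NormFrom.norm≡ nf
... | inj₁ (β , refl) = double (every-Pos-is-norm (rec smaller) pos-β)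
  where
  pos-β : Pos β
  pos-β = Pos-halve pos
  n = ∣ Nm β ∣
  smaller : n ℕ.< ∣ Nm (2ₒ *ₒ β) ∣
  smaller = subst (n ℕ.<_) (sym (trans (cong ∣_∣ (trans (Nm-* 2ₒ β) (cong (_* Nm β) (Nm-int (+ 2))))) (ℤ.abs-* (+ 8) (Nm β))))
    (ℕ.m<m+n n (ℕ.<-≤-trans (ℕ.n≢0⇒n>0 λ e → 0<⇒≢0 (Pos⇒0<Nm pos-β) (ℤ.∣i∣≡0⇒i≡0 e)) (ℕ.m≤m+n n (6 ℕ.* n))))
  double : (∃ λ h → norm h ≡ β) → ∃ λ h → norm h ≡ 2ₒ *ₒ β
  double (h , h-norm) = 1+i ⋆ h , trans (norm-⋆ 1+i h) (cong₂ _*ₒ_ norm-1+i h-norm)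

-- For even α the residue of h in F₆₄ is zero, so h already has integral coordinates in 1, i, j, k.
Pos⇒four-squares : ∀ {α} → Pos α → Exceptional α ⊎ FourSquares α
Pos⇒four-squares {α} pos with even-or-odd-norm α
... | inj₂ odd = odd-four-squares (<-wellFounded ∣ Nm α ∣) pos odd
... | inj₁ (β , refl) = inj₂ (even (every-Pos-is-norm (<-wellFounded ∣ Nm (2ₒ *ₒ β) ∣) pos))
  where
  even : (∃ λ h → norm h ≡ 2ₒ *ₒ β) → FourSquares (2ₒ *ₒ β)
  even (h , h-norm) = subst FourSquares h-norm (lipschitz-reduced h (proj₂ (even-norm-reduced {h} {β} h-norm)))

-- Sums of squares as lists: positivity, and the elements that are excluded.

sumSq-∷ : ∀ x xs → sumSq (x ∷ xs) ≡ x *ₒ x +ₒ sumSq xs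
sumSq-∷ x xs = sym (trans (+ₒ-def (x *ₒ x) (sumSq xs)) (cong (_⊕ sumSq xs) (*ₒ-def x x)))

sumSq-[] : sumSq [] ≡ 0ₒ
sumSq-[] = sym (int-def (+ 0))

Pos-+ : ∀ {α β} → Pos α → Pos β → Pos (α +ₒ β)
Pos-+ {α} {β} p q y y≢0 = subst (+ 0 <_) (sym (trans (cong Tr (*ₒ-distribʳ (y *ₒ y) α β)) (Tr-+ (α *ₒ (y *ₒ y)) (β *ₒ (y *ₒ y)))))
  (ℤ.+-mono-< (p y y≢0) (q y y≢0))

Pos-square : ∀ {x} → x ≢ 0ₒ → Pos (x *ₒ x)
Pos-square {x} x≢0 y y≢0 = subst (λ t → + 0 < Tr t) (lemma x y) (0<Tr-square (x *ₒ y) (*ₒ-≢0 x≢0 y≢0))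
  where
  lemma : ∀ x y → x *ₒ y *ₒ (x *ₒ y) ≡ x *ₒ x *ₒ (y *ₒ y)
  lemma = SO.solve 2 (λ x y → x SO.⊠ y SO.⊠ (x SO.⊠ y) SO.⊜ x SO.⊠ x SO.⊠ (y SO.⊠ y)) refl

+ₒ-identityʳ : ∀ x → x +ₒ 0ₒ ≡ x
+ₒ-identityʳ x = trans (+ₒ-comm x 0ₒ) (+ₒ-identityˡ x)

sumSq-Pos : ∀ xs → sumSq xs ≡ 0ₒ ⊎ Pos (sumSq xs)
sumSq-Pos [] = inj₁ sumSq-[]
sumSq-Pos (x ∷ xs) with x ≟ₒ 0ₒ | sumSq-Pos xs
... | yes refl | inj₁ e = inj₁ (trans (sumSq-∷ 0ₒ xs) (trans (cong₂ _+ₒ_ (*ₒ-zeroʳ 0ₒ) e) (+ₒ-identityˡ 0ₒ)))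
... | yes refl | inj₂ p = inj₂ (subst Pos (sym (trans (sumSq-∷ 0ₒ xs) (trans (cong (_+ₒ sumSq xs) (*ₒ-zeroʳ 0ₒ)) (+ₒ-identityˡ (sumSq xs))))) p)
... | no x≢0 | inj₁ e = inj₂ (subst Pos (sym (trans (sumSq-∷ x xs) (trans (cong (x *ₒ x +ₒ_) e) (+ₒ-identityʳ (x *ₒ x))))) (Pos-square x≢0))
... | no x≢0 | inj₂ p = inj₂ (subst Pos (sym (sumSq-∷ x xs)) (Pos-+ (Pos-square x≢0) p))

Pos⇒nonneg : ∀ {α} → Pos α → ∀ y → + 0 ≤ Tr (α *ₒ (y *ₒ y))
Pos⇒nonneg pos y = 0≤lin-square pos y

isListed-apart : ∀ m m′ → isListed m → isListed m′ → m +ₒ m′ ≢ δ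
isListed-apart ⟨ a , b , c ⟩ ⟨ d , e , f ⟩ = no-sum-δ a b c d e f

Pos-listed : ∀ {α} → Pos α → Tr α ≤ + 7 → isListed α
Pos-listed pos T≤7 = small-listed (Pos⇒0<Tr pos) T≤7 (Pos⇒nonneg pos)

opaque
  unfolding Tr

  Tr-δ : Tr δ ≡ + 7
  Tr-δ = refl

≤-sumˡ : ∀ {a b c} → + 0 < b → a + b ≡ c → a ≤ c
≤-sumˡ {a} {b} 0<b refl = 0≤-⇒≤ (subst (+ 0 ≤_) (lemma a b) (ℤ.<⇒≤ 0<b))
  where
  lemma : ∀ a b → b ≡ a + b - a
  lemma = solve-∀

-- Both summands of δ = y² + S would be totally positive of trace less than 7.
δ-not-sum-of-squares : ∀ ys → sumSq ys ≢ δ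
δ-not-sum-of-squares [] e = δ≢0 (trans (sym e) sumSq-[])
δ-not-sum-of-squares (y ∷ ys) e with y ≟ₒ 0ₒ
... | yes refl = δ-not-sum-of-squares ys (trans (sym (trans (sumSq-∷ 0ₒ ys) (trans (cong (_+ₒ sumSq ys) (*ₒ-zeroʳ 0ₒ)) (+ₒ-identityˡ (sumSq ys))))) e)
... | no y≢0 = cases (sumSq-Pos ys)
  where
  sum≡ : y *ₒ y +ₒ sumSq ys ≡ δ
  sum≡ = trans (sym (sumSq-∷ y ys)) e
  not-square : ∀ n → n ℕ.* n ≢ 7
  not-square 0 ()
  not-square 1 ()
  not-square 2 ()
  not-square (suc (suc (suc n))) e = contradiction (ℕ.*-mono-≤ {3} {3 ℕ.+ n} {3} {3 ℕ.+ n} (ℕ.m≤m+n 3 n) (ℕ.m≤m+n 3 n)) (ℕ.<⇒≱ (subst (ℕ._< 9) (sym e) (ℕ.m<m+n 7 {2} (s≤s z≤n))))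
  traces : Tr (y *ₒ y) + Tr (sumSq ys) ≡ + 7
  traces = trans (sym (Tr-+ (y *ₒ y) (sumSq ys))) (trans (cong Tr sum≡) Tr-δ)
  cases : sumSq ys ≡ 0ₒ ⊎ Pos (sumSq ys) → ⊥
  -- Here δ = y² would make Nm δ = 7 a square.
  cases (inj₁ S≡0) = not-square ∣ Nm y ∣ (trans (sym (ℤ.abs-* (Nm y) (Nm y))) (cong ∣_∣ (trans (sym (Nm-* y y))
    (trans (cong Nm (trans (sym (+ₒ-identityʳ (y *ₒ y))) (trans (cong (y *ₒ y +ₒ_) (sym S≡0)) sum≡))) Nm-δ))))
  -- `smallElements` contains both summands, and no two of its members add up to δ.
  cases (inj₂ pos) = isListed-apart (y *ₒ y) (sumSq ys)
    (Pos-listed (Pos-square y≢0) (≤-sumˡ (Pos⇒0<Tr pos) traces))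
    (Pos-listed pos (≤-sumˡ (Pos⇒0<Tr (Pos-square y≢0)) (trans (ℤ.+-comm (Tr (sumSq ys)) (Tr (y *ₒ y))) traces))) sum≡

sumSq-scale : ∀ s xs → sumSq (map (s *ₒ_) xs) ≡ sumSq xs *ₒ (s *ₒ s)
sumSq-scale s [] = trans sumSq-[] (trans (lemma s) (cong (_*ₒ (s *ₒ s)) (sym sumSq-[])))
  where
  lemma : ∀ s → 0ₒ ≡ 0ₒ *ₒ (s *ₒ s)
  lemma = SO.solve 1 (λ s → SO.Κ (+ 0) SO.⊜ SO.Κ (+ 0) SO.⊠ (s SO.⊠ s)) refl
sumSq-scale s (x ∷ xs) = trans (sumSq-∷ (s *ₒ x) (map (s *ₒ_) xs)) (trans (cong (s *ₒ x *ₒ (s *ₒ x) +ₒ_) (sumSq-scale s xs))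
  (trans (lemma s x (sumSq xs)) (cong (_*ₒ (s *ₒ s)) (sym (sumSq-∷ x xs)))))
  where
  lemma : ∀ s x S → s *ₒ x *ₒ (s *ₒ x) +ₒ S *ₒ (s *ₒ s) ≡ (x *ₒ x +ₒ S) *ₒ (s *ₒ s)
  lemma = SO.solve 3 (λ s x S → s SO.⊠ x SO.⊠ (s SO.⊠ x) SO.⊞ S SO.⊠ (s SO.⊠ s) SO.⊜ (x SO.⊠ x SO.⊞ S) SO.⊠ (s SO.⊠ s)) refl

-- Multiplying a representation by the inverse square η² would represent δ itself.
exceptional-not-sum-of-squares : ∀ {α} → Exceptional α → ¬ IsSumOfSquares α
exceptional-not-sum-of-squares (l , η , lη , refl) (xs , e) = δ-not-sum-of-squares (map (η *ₒ_) xs)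
  (trans (sumSq-scale η xs) (trans (cong (_*ₒ (η *ₒ η)) (sym e)) (trans (lemma δ l η) (trans (cong (λ t → δ *ₒ (t *ₒ t)) lη) (lemma′ δ)))))
  where
  lemma : ∀ d l η → d *ₒ (l *ₒ l) *ₒ (η *ₒ η) ≡ d *ₒ (l *ₒ η *ₒ (l *ₒ η))
  lemma = SO.solve 3 (λ d l η → d SO.⊠ (l SO.⊠ l) SO.⊠ (η SO.⊠ η) SO.⊜ d SO.⊠ (l SO.⊠ η SO.⊠ (l SO.⊠ η))) refl
  lemma′ : ∀ d → d *ₒ (1ₒ *ₒ 1ₒ) ≡ d
  lemma′ = SO.solve 1 (λ d → d SO.⊠ (SO.Κ (+ 1) SO.⊠ SO.Κ (+ 1)) SO.⊜ d) refl

four-squares⇒sum : ∀ {α} → FourSquares α → IsSumOfAtMost 4 α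
four-squares⇒sum (x , y , z , w , refl) = x ∷ y ∷ z ∷ w ∷ [] , ℕ.≤-refl , sym (begin
  sumSq (x ∷ y ∷ z ∷ w ∷ [])                                     ≡⟨ trans (sumSq-∷ x (y ∷ z ∷ w ∷ [])) (cong (x *ₒ x +ₒ_) (trans (sumSq-∷ y (z ∷ w ∷ []))
                                                                     (cong (y *ₒ y +ₒ_) (trans (sumSq-∷ z (w ∷ [])) (cong (z *ₒ z +ₒ_) (trans (sumSq-∷ w []) (cong (w *ₒ w +ₒ_) sumSq-[]))))))) ⟩
  x *ₒ x +ₒ (y *ₒ y +ₒ (z *ₒ z +ₒ (w *ₒ w +ₒ 0ₒ)))               ≡⟨ lemma x y z w ⟩
  x *ₒ x +ₒ y *ₒ y +ₒ z *ₒ z +ₒ w *ₒ w                           ∎)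
  where
  open ≡-Reasoning
  lemma : ∀ x y z w → x *ₒ x +ₒ (y *ₒ y +ₒ (z *ₒ z +ₒ (w *ₒ w +ₒ 0ₒ))) ≡ x *ₒ x +ₒ y *ₒ y +ₒ z *ₒ z +ₒ w *ₒ w
  lemma = SO.solve 4 (λ x y z w → x SO.⊠ x SO.⊞ (y SO.⊠ y SO.⊞ (z SO.⊠ z SO.⊞ (w SO.⊠ w SO.⊞ SO.Κ (+ 0)))) SO.⊜ x SO.⊠ x SO.⊞ y SO.⊠ y SO.⊞ z SO.⊠ z SO.⊞ w SO.⊠ w) refl

four-squares-suffice : ∀ α → IsSumOfSquares α → IsSumOfAtMost 4 α
four-squares-suffice _ (xs , refl) = cases (sumSq-Pos xs)
  where
  exclude : Exceptional (sumSq xs) ⊎ FourSquares (sumSq xs) → IsSumOfAtMost 4 (sumSq xs)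
  exclude (inj₁ ex) = ⊥-elim (exceptional-not-sum-of-squares ex (xs , refl))
  exclude (inj₂ fs) = four-squares⇒sum fs
  cases : sumSq xs ≡ 0ₒ ⊎ Pos (sumSq xs) → IsSumOfAtMost 4 (sumSq xs)
  cases (inj₁ e) = [] , z≤n , trans e (sym sumSq-[])
  cases (inj₂ pos) = exclude (Pos⇒four-squares pos)

-- If x² + y² + z² = 7, then 1 + xi + yj + zk has norm 8 and is therefore divisible by
-- (1 + i)³ = 2i(1 + i), which makes all its Lipschitz coordinates even.
1+i-cube : ∀ a b c d → 1+i ⋆ (1+i ⋆ quat a b c d) ≡ 2ₒ • quat (-ₒ (b +ₒ c +ₒ d)) (a +ₒ -ₒ c) (-ₒ (c +ₒ d)) (2ₒ *ₒ c +ₒ d)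
1+i-cube a b c d = quat-≡
  (SO.solve 4 (λ a b c d → Quaternion.re (L a b c d) SO.⊜ Quaternion.re (R a b c d)) refl a b c d)
  (SO.solve 4 (λ a b c d → Quaternion.im (L a b c d) SO.⊜ Quaternion.im (R a b c d)) refl a b c d)
  (SO.solve 4 (λ a b c d → Quaternion.jm (L a b c d) SO.⊜ Quaternion.jm (R a b c d)) refl a b c d)
  (SO.solve 4 (λ a b c d → Quaternion.om (L a b c d) SO.⊜ Quaternion.om (R a b c d)) refl a b c d)
  where
  L R : ∀ {n} (a b c d : SO.Expr ℤ n) → Quaternion (SO.Expr ℤ n)
  L a b c d = let 1+i = quat (SO.Κ (+ 1)) (SO.Κ (+ 1)) (SO.Κ (+ 0)) (SO.Κ (+ 0)) in 1+i QP.⋆ (1+i QP.⋆ quat a b c d)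
  R a b c d = SO.Κ (+ 2) QP.• quat (SO.⊝ (b SO.⊞ c SO.⊞ d)) (a SO.⊟ c) (SO.⊝ (c SO.⊞ d)) (SO.Κ (+ 2) SO.⊠ c SO.⊞ d)

-- The quaternion is 1 + xi + yj + zk, rewritten in the basis 1, i, j, ω.
lipschitz-norm : ∀ x y z → norm (quat (1ₒ +ₒ -ₒ z) (x +ₒ -ₒ z) (y +ₒ -ₒ z) (2ₒ *ₒ z)) ≡ 1ₒ +ₒ (x *ₒ x +ₒ y *ₒ y +ₒ z *ₒ z)
lipschitz-norm = SO.solve 3 (λ x y z → QP.norm (quat (SO.Κ (+ 1) SO.⊟ z) (x SO.⊟ z) (y SO.⊟ z) (SO.Κ (+ 2) SO.⊠ z)) SO.⊜
  SO.Κ (+ 1) SO.⊞ (x SO.⊠ x SO.⊞ y SO.⊠ y SO.⊞ z SO.⊠ z)) refl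

divide-by-1+i : ∀ {α} x → norm x ≡ 2ₒ *ₒ α → ∃ λ y → x ≡ 1+i ⋆ y × norm y ≡ α
divide-by-1+i {α} x e = quotient (even-norm-divisible {α} x e)
  where
  quotient : (∃ λ y → x ≡ 1+i ⋆ y) → ∃ λ y → x ≡ 1+i ⋆ y × norm y ≡ α
  quotient (y , x≡) = y , x≡ , *ₒ-cancelˡ {2ₒ} (int≢0 (λ ())) (trans (cong (_*ₒ norm y) (sym norm-1+i)) (trans (sym (norm-⋆ 1+i y)) (trans (cong norm (sym x≡)) e)))

seven-not-three-squares : ∀ x y z → x *ₒ x +ₒ y *ₒ y +ₒ z *ₒ z ≢ int (+ 7)
seven-not-three-squares x y z e = first (divide-by-1+i q norm-q)
  where
  q = quat (1ₒ +ₒ -ₒ z) (x +ₒ -ₒ z) (y +ₒ -ₒ z) (2ₒ *ₒ z)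
  norm-q : norm q ≡ 2ₒ *ₒ int (+ 4)
  norm-q = trans (lipschitz-norm x y z) (trans (cong (1ₒ +ₒ_) e) (trans (sym (int-+ (+ 1) (+ 7))) (int-* (+ 2) (+ 4))))
  -- The third factor 1 + i enters through the evenness of d, the ω coordinate of q₂, whose norm is
  -- 2.
  third : ∀ {q₁ q₂} → q ≡ 1+i ⋆ q₁ → q₁ ≡ 1+i ⋆ q₂ → norm q₂ ≡ 2ₒ *ₒ 1ₒ → ⊥
  third {_} {quat a b c d} q≡ q₁≡ q₂-norm = absurd (reduce₈≡0 d (proj₂ (even-norm-reduced {quat a b c d} {1ₒ} q₂-norm)))
    where
    q≡₂ : q ≡ 2ₒ • quat (-ₒ (b +ₒ c +ₒ d)) (a +ₒ -ₒ c) (-ₒ (c +ₒ d)) (2ₒ *ₒ c +ₒ d)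
    q≡₂ = trans q≡ (trans (cong (1+i ⋆_) q₁≡) (1+i-cube a b c d))
    z≡ : z ≡ 2ₒ *ₒ c +ₒ d
    z≡ = *ₒ-cancelˡ {2ₒ} (int≢0 (λ ())) (cong Quaternion.om q≡₂)
    -- 1 = (1 - z) + z would be even: 1 - z is a coordinate of a multiple of 2, and z = 2c + d.
    absurd : 2ₒ ∣ₒ d → ⊥
    absurd (d′ , refl) = odd-not-even {1ₒ} (+ 0 , Nm-int (+ 1)) (-ₒ (b +ₒ c +ₒ 2ₒ *ₒ d′) +ₒ (c +ₒ d′) ,
      trans (restore 1ₒ z) (trans (cong₂ _+ₒ_ (cong Quaternion.re q≡₂) z≡) (lemma b c d′)))
      where
      restore : ∀ o z → o ≡ o +ₒ -ₒ z +ₒ z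
      restore = SO.solve 2 (λ o z → o SO.⊜ o SO.⊟ z SO.⊞ z) refl
      lemma : ∀ b c d → 2ₒ *ₒ (-ₒ (b +ₒ c +ₒ 2ₒ *ₒ d)) +ₒ (2ₒ *ₒ c +ₒ 2ₒ *ₒ d) ≡ 2ₒ *ₒ (-ₒ (b +ₒ c +ₒ 2ₒ *ₒ d) +ₒ (c +ₒ d))
      lemma = SO.solve 3 (λ b c d → let two = SO.Κ (+ 2) in two SO.⊠ (SO.⊝ (b SO.⊞ c SO.⊞ two SO.⊠ d)) SO.⊞ (two SO.⊠ c SO.⊞ two SO.⊠ d) SO.⊜ two SO.⊠ (SO.⊝ (b SO.⊞ c SO.⊞ two SO.⊠ d) SO.⊞ (c SO.⊞ d))) refl
  second : ∀ {q₁} → q ≡ 1+i ⋆ q₁ → (∃ λ q₂ → q₁ ≡ 1+i ⋆ q₂ × norm q₂ ≡ 2ₒ *ₒ 1ₒ) → ⊥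
  second q≡ (q₂ , q₁≡ , q₂-norm) = third q≡ q₁≡ q₂-norm
  first : (∃ λ q₁ → q ≡ 1+i ⋆ q₁ × norm q₁ ≡ int (+ 4)) → ⊥
  first (q₁ , q≡ , q₁-norm) = second q≡ (divide-by-1+i q₁ (trans q₁-norm (trans (int-* (+ 2) (+ 2)) (cong (2ₒ *ₒ_) (sym (*ₒ-identityʳ 2ₒ))))))

seven-not-sum : ¬ IsSumOfAtMost 3 ⟨ + 7 , + 0 , + 0 ⟩
seven-not-sum (xs , len , e) = go xs len (trans (int-def (+ 7)) e)
  where
  three : ∀ x y z → int (+ 7) ≡ x *ₒ x +ₒ (y *ₒ y +ₒ (z *ₒ z +ₒ 0ₒ)) → ⊥
  three x y z e = seven-not-three-squares x y z (trans (lemma x y z) (sym e))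
    where
    lemma : ∀ x y z → x *ₒ x +ₒ y *ₒ y +ₒ z *ₒ z ≡ x *ₒ x +ₒ (y *ₒ y +ₒ (z *ₒ z +ₒ 0ₒ))
    lemma = SO.solve 3 (λ x y z → x SO.⊠ x SO.⊞ y SO.⊠ y SO.⊞ z SO.⊠ z SO.⊜ x SO.⊠ x SO.⊞ (y SO.⊠ y SO.⊞ (z SO.⊠ z SO.⊞ SO.Κ (+ 0)))) refl
  zeros : ∀ {S} → S ≡ 0ₒ → S ≡ 0ₒ *ₒ 0ₒ +ₒ 0ₒ
  zeros refl = sym (trans (+ₒ-identityʳ (0ₒ *ₒ 0ₒ)) (*ₒ-zeroʳ 0ₒ))
  go : ∀ xs → length xs ℕ.≤ 3 → int (+ 7) ≡ sumSq xs → ⊥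
  go [] _ e = contradiction (int-injective (trans e sumSq-[])) λ ()
  go (x ∷ []) _ e = three x 0ₒ 0ₒ (trans e (trans (sumSq-∷ x []) (cong (x *ₒ x +ₒ_) (trans (zeros sumSq-[]) (cong (0ₒ *ₒ 0ₒ +ₒ_) (zeros refl))))))
  go (x ∷ y ∷ []) _ e = three x y 0ₒ (trans e (trans (sumSq-∷ x (y ∷ [])) (cong (x *ₒ x +ₒ_) (trans (sumSq-∷ y []) (cong (y *ₒ y +ₒ_) (zeros sumSq-[]))))))
  go (x ∷ y ∷ z ∷ []) _ e = three x y z (trans e (trans (sumSq-∷ x (y ∷ z ∷ [])) (cong (x *ₒ x +ₒ_) (trans (sumSq-∷ y (z ∷ [])) (cong (y *ₒ y +ₒ_) (trans (sumSq-∷ z []) (cong (z *ₒ z +ₒ_) sumSq-[])))))))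
  go (_ ∷ _ ∷ _ ∷ _ ∷ _) (s≤s (s≤s (s≤s ()))) _

theorem2p2 : ((α : O) → IsSumOfSquares α → IsSumOfAtMost 4 α)
    × (∃ λ (α : O) → IsSumOfSquares α × ¬ IsSumOfAtMost 3 α)
theorem2p2 = four-squares-suffice , ⟨ + 7 , + 0 , + 0 ⟩ , (⟨ + 2 , + 0 , + 0 ⟩ ∷ one ∷ one ∷ one ∷ [] , refl) , seven-not-sum
  where
  one : O
  one = ⟨ + 1 , + 0 , + 0 ⟩
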